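{- There is a distribution-free tester that, given black-box access to an arbitrary $f:\{0,1\}^n\to\{0,1\}$ and random examples $(x,f(x))$, $x\sim{\cal D}$ for an arbitrary unknown ${\cal D}$, makes $\tilde O(s^2/\epsilon)$ queries, runs in time $s^{O(d)}/\epsilon+n\cdot\tilde O(s^2/\epsilon)$, accepts with probability at least $2/3$ if $f\in\mathbb{DT}_d^s$, and rejects with probability at least $2/3$ if $f$ is $\epsilon$-far w.r.t. ${\cal D}$ from every function in $\mathbb{DT}_d^s$.
   Context: A decision tree over $x_1,\dots,x_n$ is a rooted binary tree whose internal nodes are labeled by variables, each having a 0-child and a 1-child, leaves labeled $0$ or $1$; it computes a Boolean function by following from the root the $x_i$-child at a node labeled $x_i$. Size = number of leaves; depth = maximum number of edges on a root-to-leaf path. $\mathbb{DT}_d^s$ = functions computed by decision trees of depth at most $d$ and size at most $s$. $f$ is $\epsilon$-far from $g$ w.r.t. ${\cal D}$ if $\Pr_{x\sim{\cal D}}[f(x)\ne g(x)]>\epsilon$. -}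

module Defs where

open import Algebra.Bundles using (CommutativeMonoid)
import Algebra.Properties.CommutativeSemigroup as CommutativeSemigroupProperties
open import Data.Bool using (Bool; true; false; if_then_else_; _xor_)
open import Data.Fin using (Fin; toℕ)
import Data.Integer as ℤ
open import Data.List using (List; head; drop)
open import Data.Maybe using (just; nothing)
open import Data.Nat as ℕ using (ℕ; zero; suc)
open import Data.Nat.DivMod using (_/_)
open import Data.Nat.Logarithm using (⌈log₂_⌉)
import Data.Nat.Properties as ℕₚ
open import Data.Product using (Σ; ∃; _×_; _,_; proj₁; proj₂)
open import Data.Rational as ℚ using (ℚ; 0ℚ; 1ℚ; ½; Positive)
import Data.Rational.Properties as ℚₚ
open import Data.Vec using (Vec; []; _∷_; lookup; tabulate)
open import Relation.Binary.PropositionalEquality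
  using (_≡_; refl; sym; trans; cong; cong₂; subst)
open import Relation.Nullary using (does)

------------------------------------------------------------------------
-- Real numbers, as Cauchy sequences of rationals with a modulus

Cauchy : (ℕ → ℚ) → Set
Cauchy x = ∀ δ → 0ℚ ℚ.< δ →
  ∃ λ N → ∀ j k → N ℕ.≤ j → N ℕ.≤ k → ℚ.∣ x j ℚ.- x k ∣ ℚ.≤ δ

record ℝ : Set where
  constructor mkℝ
  field
    seq    : ℕ → ℚ
    cauchy : Cauchy seq

open ℝ public

infix 4 _≤ℝ_ _<ℝ_ _≈ℝ_

_≤ℝ_ : ℝ → ℝ → Set
x ≤ℝ y = ∀ δ → 0ℚ ℚ.< δ →
  ∃ λ N → ∀ k → N ℕ.≤ k → seq x k ℚ.≤ seq y k ℚ.+ δ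

_<ℝ_ : ℝ → ℝ → Set
x <ℝ y = ∃ λ δ → 0ℚ ℚ.< δ ×
  (∃ λ N → ∀ k → N ℕ.≤ k → seq x k ℚ.+ δ ℚ.≤ seq y k)

_≈ℝ_ : ℝ → ℝ → Set
x ≈ℝ y = x ≤ℝ y × y ≤ℝ x

private
  open CommutativeSemigroupProperties
    (CommutativeMonoid.commutativeSemigroup ℚₚ.+-0-commutativeMonoid)
    using (interchange)

  -+-cancel : ∀ a b → (a ℚ.- b) ℚ.+ b ≡ a
  -+-cancel a b = trans (ℚₚ.+-assoc a (ℚ.- b) b)
    (trans (cong (a ℚ.+_) (ℚₚ.+-inverseˡ b)) (ℚₚ.+-identityʳ a))

  half-pos : ∀ {δ} → 0ℚ ℚ.< δ → 0ℚ ℚ.< δ ℚ.* ½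
  half-pos {δ} 0<δ = ℚₚ.positive⁻¹ (δ ℚ.* ½)
    {{ℚₚ.pos*pos⇒pos δ {{ℚ.positive 0<δ}} ½}}

  half+half : ∀ δ → δ ℚ.* ½ ℚ.+ δ ℚ.* ½ ≡ δ
  half+half δ = trans (sym (ℚₚ.*-distribˡ-+ δ ½ ½)) (ℚₚ.*-identityʳ δ)

  +-cauchy : ∀ x y → Cauchy x → Cauchy y → Cauchy (λ k → x k ℚ.+ y k)
  +-cauchy x y cx cy δ 0<δ
    with cx (δ ℚ.* ½) (half-pos 0<δ) | cy (δ ℚ.* ½) (half-pos 0<δ)
  ... | M , hx | N , hy = M ℕ.⊔ N , λ j k p q → begin
    ℚ.∣ (x j ℚ.+ y j) ℚ.- (x k ℚ.+ y k) ∣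
      ≡⟨ cong ℚ.∣_∣ (shuffle (x j) (y j) (x k) (y k)) ⟩
    ℚ.∣ (x j ℚ.- x k) ℚ.+ (y j ℚ.- y k) ∣
      ≤⟨ ℚₚ.∣p+q∣≤∣p∣+∣q∣ (x j ℚ.- x k) (y j ℚ.- y k) ⟩
    ℚ.∣ x j ℚ.- x k ∣ ℚ.+ ℚ.∣ y j ℚ.- y k ∣
      ≤⟨ ℚₚ.+-mono-≤
           (hx j k (ℕₚ.≤-trans (ℕₚ.m≤m⊔n M N) p) (ℕₚ.≤-trans (ℕₚ.m≤m⊔n M N) q))
           (hy j k (ℕₚ.≤-trans (ℕₚ.m≤n⊔m M N) p) (ℕₚ.≤-trans (ℕₚ.m≤n⊔m M N) q)) ⟩
    δ ℚ.* ½ ℚ.+ δ ℚ.* ½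
      ≡⟨ half+half δ ⟩
    δ ∎
    where
    open ℚₚ.≤-Reasoning
    shuffle : ∀ a b c d → (a ℚ.+ b) ℚ.- (c ℚ.+ d) ≡ (a ℚ.- c) ℚ.+ (b ℚ.- d)
    shuffle a b c d = trans (cong ((a ℚ.+ b) ℚ.+_) (ℚₚ.neg-distrib-+ c d))
                            (interchange a b (ℚ.- c) (ℚ.- d))

  bounded : ∀ x → Cauchy x → ∃ λ A → 0ℚ ℚ.< A ×
    (∃ λ N → ∀ k → N ℕ.≤ k → ℚ.∣ x k ∣ ℚ.≤ A)
  bounded x cx with cx 1ℚ (ℚₚ.positive⁻¹ 1ℚ)
  ... | N , h = 1ℚ ℚ.+ ℚ.∣ x N ∣ , A-pos , N , λ k p → begin
    ℚ.∣ x k ∣                         ≡⟨ cong ℚ.∣_∣ (sym (-+-cancel (x k) (x N))) ⟩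
    ℚ.∣ (x k ℚ.- x N) ℚ.+ x N ∣       ≤⟨ ℚₚ.∣p+q∣≤∣p∣+∣q∣ (x k ℚ.- x N) (x N) ⟩
    ℚ.∣ x k ℚ.- x N ∣ ℚ.+ ℚ.∣ x N ∣   ≤⟨ ℚₚ.+-monoˡ-≤ ℚ.∣ x N ∣ (h k N p ℕₚ.≤-refl) ⟩
    1ℚ ℚ.+ ℚ.∣ x N ∣                  ∎
    where
    open ℚₚ.≤-Reasoning
    A-pos : 0ℚ ℚ.< 1ℚ ℚ.+ ℚ.∣ x N ∣
    A-pos = ℚₚ.+-mono-<-≤ (ℚₚ.positive⁻¹ 1ℚ) (ℚₚ.0≤∣p∣ (x N))

  *-cauchy : ∀ x y → Cauchy x → Cauchy y → Cauchy (λ k → x k ℚ.* y k)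
  *-cauchy x y cx cy δ 0<δ with bounded x cx | bounded y cy
  ... | A , 0<A , Nx , bx | B , 0<B , Ny , by = N , bound
    where
    open ℚₚ.≤-Reasoning
    K : ℚ
    K = A ℚ.+ B
    instance
      K-pos : Positive K
      K-pos = ℚ.positive (ℚₚ.+-mono-< 0<A 0<B)
      K-nonZero : ℚ.NonZero K
      K-nonZero = ℚₚ.pos⇒nonZero K
      K⁻¹-pos : Positive (ℚ.1/ K)
      K⁻¹-pos = ℚₚ.1/pos⇒pos K
      A-nonNeg : ℚ.NonNegative A
      A-nonNeg = ℚ.nonNegative (ℚₚ.<⇒≤ 0<A)
      B-nonNeg : ℚ.NonNegative B
      B-nonNeg = ℚ.nonNegative (ℚₚ.<⇒≤ 0<B)
    γ : ℚ
    γ = δ ℚ.* ℚ.1/ K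
    0<γ : 0ℚ ℚ.< γ
    0<γ = ℚₚ.positive⁻¹ γ {{ℚₚ.pos*pos⇒pos δ {{ℚ.positive 0<δ}} (ℚ.1/ K)}}
    Mx My N : ℕ
    Mx = proj₁ (cx γ 0<γ)
    My = proj₁ (cy γ 0<γ)
    N = (Nx ℕ.⊔ Ny) ℕ.⊔ (Mx ℕ.⊔ My)
    Nx≤N : Nx ℕ.≤ N
    Nx≤N = ℕₚ.≤-trans (ℕₚ.m≤m⊔n Nx Ny) (ℕₚ.m≤m⊔n _ _)
    Ny≤N : Ny ℕ.≤ N
    Ny≤N = ℕₚ.≤-trans (ℕₚ.m≤n⊔m Nx Ny) (ℕₚ.m≤m⊔n _ _)
    Mx≤N : Mx ℕ.≤ N
    Mx≤N = ℕₚ.≤-trans (ℕₚ.m≤m⊔n Mx My) (ℕₚ.m≤n⊔m (Nx ℕ.⊔ Ny) _)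
    My≤N : My ℕ.≤ N
    My≤N = ℕₚ.≤-trans (ℕₚ.m≤n⊔m Mx My) (ℕₚ.m≤n⊔m (Nx ℕ.⊔ Ny) _)
    shuffle : ∀ a b c d → a ℚ.* b ℚ.- c ℚ.* d ≡ a ℚ.* (b ℚ.- d) ℚ.+ d ℚ.* (a ℚ.- c)
    shuffle a b c d = sym (begin-equality
      a ℚ.* (b ℚ.- d) ℚ.+ d ℚ.* (a ℚ.- c)
        ≡⟨ cong (a ℚ.* (b ℚ.- d) ℚ.+_) (ℚₚ.*-distribˡ-+ d a (ℚ.- c)) ⟩
      a ℚ.* (b ℚ.- d) ℚ.+ (d ℚ.* a ℚ.+ d ℚ.* (ℚ.- c))
        ≡⟨ cong₂ (λ u v → a ℚ.* (b ℚ.- d) ℚ.+ (u ℚ.+ v)) (ℚₚ.*-comm d a)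
             (trans (sym (ℚₚ.neg-distribʳ-* d c)) (cong ℚ.-_ (ℚₚ.*-comm d c))) ⟩
      a ℚ.* (b ℚ.- d) ℚ.+ (a ℚ.* d ℚ.- c ℚ.* d)
        ≡⟨ sym (ℚₚ.+-assoc (a ℚ.* (b ℚ.- d)) (a ℚ.* d) (ℚ.- (c ℚ.* d))) ⟩
      (a ℚ.* (b ℚ.- d) ℚ.+ a ℚ.* d) ℚ.- c ℚ.* d
        ≡⟨ cong (ℚ._- c ℚ.* d) (sym (ℚₚ.*-distribˡ-+ a (b ℚ.- d) d)) ⟩
      a ℚ.* ((b ℚ.- d) ℚ.+ d) ℚ.- c ℚ.* d
        ≡⟨ cong (λ u → a ℚ.* u ℚ.- c ℚ.* d) (-+-cancel b d) ⟩
      a ℚ.* b ℚ.- c ℚ.* d ∎)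
    scale : ∀ a b → ℚ.∣ a ∣ ℚ.≤ b → .{{ℚ.NonNegative b}} →
            ∀ c → ℚ.∣ c ∣ ℚ.≤ γ → ℚ.∣ a ℚ.* c ∣ ℚ.≤ b ℚ.* γ
    scale a b p c q = begin
      ℚ.∣ a ℚ.* c ∣           ≡⟨ ℚₚ.∣p*q∣≡∣p∣*∣q∣ a c ⟩
      ℚ.∣ a ∣ ℚ.* ℚ.∣ c ∣     ≤⟨ ℚₚ.*-monoʳ-≤-nonNeg ℚ.∣ c ∣ {{ℚₚ.∣-∣-nonNeg c}} p ⟩
      b ℚ.* ℚ.∣ c ∣           ≤⟨ ℚₚ.*-monoˡ-≤-nonNeg b q ⟩
      b ℚ.* γ                 ∎
    total : A ℚ.* γ ℚ.+ B ℚ.* γ ≡ δ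
    total = begin-equality
      A ℚ.* γ ℚ.+ B ℚ.* γ     ≡⟨ sym (ℚₚ.*-distribʳ-+ γ A B) ⟩
      K ℚ.* (δ ℚ.* ℚ.1/ K)    ≡⟨ ℚₚ.*-comm K γ ⟩
      (δ ℚ.* ℚ.1/ K) ℚ.* K    ≡⟨ ℚₚ.*-assoc δ (ℚ.1/ K) K ⟩
      δ ℚ.* (ℚ.1/ K ℚ.* K)    ≡⟨ cong (δ ℚ.*_) (ℚₚ.*-inverseˡ K) ⟩
      δ ℚ.* 1ℚ                ≡⟨ ℚₚ.*-identityʳ δ ⟩
      δ                       ∎
    bound : ∀ j k → N ℕ.≤ j → N ℕ.≤ k → ℚ.∣ x j ℚ.* y j ℚ.- x k ℚ.* y k ∣ ℚ.≤ δ
    bound j k p q = begin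
      ℚ.∣ x j ℚ.* y j ℚ.- x k ℚ.* y k ∣
        ≡⟨ cong ℚ.∣_∣ (shuffle (x j) (y j) (x k) (y k)) ⟩
      ℚ.∣ x j ℚ.* (y j ℚ.- y k) ℚ.+ y k ℚ.* (x j ℚ.- x k) ∣
        ≤⟨ ℚₚ.∣p+q∣≤∣p∣+∣q∣ (x j ℚ.* (y j ℚ.- y k)) (y k ℚ.* (x j ℚ.- x k)) ⟩
      ℚ.∣ x j ℚ.* (y j ℚ.- y k) ∣ ℚ.+ ℚ.∣ y k ℚ.* (x j ℚ.- x k) ∣
        ≤⟨ ℚₚ.+-mono-≤
             (scale (x j) A (bx j (ℕₚ.≤-trans Nx≤N p)) (y j ℚ.- y k)
               (proj₂ (cy γ 0<γ) j k (ℕₚ.≤-trans My≤N p) (ℕₚ.≤-trans My≤N q)))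
             (scale (y k) B (by k (ℕₚ.≤-trans Ny≤N q)) (x j ℚ.- x k)
               (proj₂ (cx γ 0<γ) j k (ℕₚ.≤-trans Mx≤N p) (ℕₚ.≤-trans Mx≤N q))) ⟩
      A ℚ.* γ ℚ.+ B ℚ.* γ
        ≡⟨ total ⟩
      δ ∎

fromℚ : ℚ → ℝ
fromℚ q = mkℝ (λ _ → q) λ δ 0<δ → 0 , λ _ _ _ _ →
  subst (λ r → ℚ.∣ r ∣ ℚ.≤ δ) (sym (ℚₚ.+-inverseʳ q)) (ℚₚ.<⇒≤ 0<δ)

infixl 6 _+ℝ_
infixl 7 _*ℝ_

_+ℝ_ : ℝ → ℝ → ℝ
x +ℝ y = mkℝ (λ k → seq x k ℚ.+ seq y k) (+-cauchy (seq x) (seq y) (cauchy x) (cauchy y))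

_*ℝ_ : ℝ → ℝ → ℝ
x *ℝ y = mkℝ (λ k → seq x k ℚ.* seq y k) (*-cauchy (seq x) (seq y) (cauchy x) (cauchy y))

0ℝ 1ℝ : ℝ
0ℝ = fromℚ 0ℚ
1ℝ = fromℚ 1ℚ

------------------------------------------------------------------------
-- Boolean functions and decision trees

BoolFun : ℕ → Set
BoolFun n = Vec Bool n → Bool

data Tree (n : ℕ) : Set where
  leaf : Bool → Tree n
  node : Fin n → (child₀ child₁ : Tree n) → Tree n

eval : ∀ {n} → Tree n → BoolFun n
eval (leaf b)       x = b
eval (node i t₀ t₁) x = if lookup x i then eval t₁ x else eval t₀ x

size : ∀ {n} → Tree n → ℕ
size (leaf _)       = 1
size (node _ t₀ t₁) = size t₀ ℕ.+ size t₁

depth : ∀ {n} → Tree n → ℕ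
depth (leaf _)       = 0
depth (node _ t₀ t₁) = suc (depth t₀ ℕ.⊔ depth t₁)

DT : ∀ {n} (d s : ℕ) → BoolFun n → Set
DT {n} d s f = Σ (Tree n) λ t →
  depth t ℕ.≤ d × size t ℕ.≤ s × (∀ x → eval t x ≡ f x)

------------------------------------------------------------------------
-- Probability distributions on {0,1}ⁿ and distance

∑ : ∀ n → (Vec Bool n → ℝ) → ℝ
∑ zero    g = g []
∑ (suc n) g = ∑ n (λ x → g (false ∷ x)) +ℝ ∑ n (λ x → g (true ∷ x))

record Distribution (n : ℕ) : Set where
  field
    weight : Vec Bool n → ℝ
    nonNeg : ∀ x → 0ℝ ≤ℝ weight x
    total  : ∑ n weight ≈ℝ 1ℝ

open Distribution public

Pr[_≠_] : ∀ {n} → BoolFun n → BoolFun n → Distribution n → ℝ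
Pr[_≠_] {n} f g D = ∑ n (λ x → if f x xor g x then weight D x else 0ℝ)

Far : ∀ {n} → ℚ → Distribution n → BoolFun n → BoolFun n → Set
Far ε D f g = fromℚ ε <ℝ Pr[ f ≠ g ] D

------------------------------------------------------------------------
-- Randomised oracle random access machines
--
-- Algorithms are finite programs, independent of all parameters and of the
-- oracles, for a unit-cost RAM with memory cells M[0], M[1], ….  The bound on
-- the contents of the cells (the word size) is part of `Runs` below.
-- In the instructions a, b, c are literal cell addresses and ℓ is a program
-- address; execution falls through to the next instruction unless it jumps.

Addr : Set
Addr = ℕ

data Instr : Set where
  const  : (a : Addr) (k : ℕ) → Instr  -- M[a] := k
  add    : (a b c : Addr) → Instr      -- M[a] := M[b] + M[c]
  sub    : (a b c : Addr) → Instr      -- M[a] := max (M[b] - M[c]) 0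
  mul    : (a b c : Addr) → Instr      -- M[a] := M[b] · M[c]
  div    : (a b c : Addr) → Instr      -- M[a] := ⌊M[b] / M[c]⌋, or 0 if M[c] = 0
  load   : (a b : Addr) → Instr        -- M[a] := M[M[b]]
  store  : (a b : Addr) → Instr        -- M[M[a]] := M[b]
  jump0  : (a : Addr) (ℓ : ℕ) → Instr  -- if M[a] = 0 then go to ℓ
  coin   : (a : Addr) → Instr          -- M[a] := a uniformly random bit
  query  : (a b : Addr) → Instr        -- M[a] := f(x), xᵢ the bit in M[M[b] + i], i < n
  sample : (a b : Addr) → Instr        -- draw x ∼ D; M[M[b] + i] := xᵢ for i < n,
                                       -- then M[a] := f(x)
  halt   : Bool → Instr                -- stop; true = accept, false = reject

Program : Set
Program = List Instr

Memory : Set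
Memory = ℕ → ℕ

record Config : Set where
  constructor ⟨_,_⟩
  field
    pc  : ℕ
    mem : Memory

open Config public

_[_≔_] : Memory → ℕ → ℕ → Memory
(M [ a ≔ v ]) b = if does (b ℕ.≟ a) then v else M b

quotient : ℕ → ℕ → ℕ
quotient m zero    = 0
quotient m (suc k) = m / suc k

fromBit : Bool → ℕ
fromBit false = 0
fromBit true  = 1

toBit : ℕ → Bool
toBit zero    = false
toBit (suc _) = true

readVec : ∀ n → Memory → ℕ → Vec Bool n
readVec n M a = tabulate (λ i → toBit (M (a ℕ.+ toℕ i)))

writeVec : ∀ {n} → Memory → ℕ → Vec Bool n → Memory
writeVec M a []      = M
writeVec M a (b ∷ x) = writeVec (M [ a ≔ fromBit b ]) (suc a) x

data Step (n : ℕ) : Set where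
  halted   : Bool → Step n
  internal : Config → Step n
  flip     : (Bool → Config) → Step n
  ask      : Vec Bool n → (Bool → Config) → Step n
  draw     : (Vec Bool n → Bool → Config) → Step n

exec : ∀ {n} → Instr → Config → Step n
exec {n} ins ⟨ pc , M ⟩ = go ins
  where
  next : Memory → Config
  next M′ = ⟨ suc pc , M′ ⟩
  go : Instr → Step n
  go (const a k)  = internal (next (M [ a ≔ k ]))
  go (add a b c)  = internal (next (M [ a ≔ M b ℕ.+ M c ]))
  go (sub a b c)  = internal (next (M [ a ≔ M b ℕ.∸ M c ]))
  go (mul a b c)  = internal (next (M [ a ≔ M b ℕ.* M c ]))
  go (div a b c)  = internal (next (M [ a ≔ quotient (M b) (M c) ]))
  go (load a b)   = internal (next (M [ a ≔ M (M b) ]))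
  go (store a b)  = internal (next (M [ M a ≔ M b ]))
  go (jump0 a ℓ)  = internal (if toBit (M a) then next M else ⟨ ℓ , M ⟩)
  go (coin a)     = flip (λ r → next (M [ a ≔ fromBit r ]))
  go (query a b)  = ask (readVec n M (M b)) (λ y → next (M [ a ≔ fromBit y ]))
  go (sample a b) = draw (λ x y → next (writeVec M (M b) x [ a ≔ fromBit y ]))
  go (halt r)     = halted r

-- A program counter outside the program rejects.
step : ∀ {n} → Program → Config → Step n
step P c with head (drop (pc c) P)
... | just ins = exec ins c
... | nothing  = halted false

-- Runs P f W t q c: whatever the coin flips and the examples drawn, the run
-- from c halts within time t, makes at most q queries (calls to either of the
-- two oracles), and only ever holds numbers < W in its memory.
-- Instructions take unit time, except that an oracle call takes time n + 1,
-- since an n-bit string is written or read.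
mutual
  data Runs {n} (P : Program) (f : BoolFun n) (W : ℕ) (t q : ℕ) (c : Config) : Set where
    run : (∀ a → mem c a ℕ.< W) → RunsStep P f W t q (step P c) → Runs P f W t q c

  data RunsStep {n} (P : Program) (f : BoolFun n) (W : ℕ) : ℕ → ℕ → Step n → Set where
    halted   : ∀ {t q r} → RunsStep P f W (suc t) q (halted r)
    internal : ∀ {t q c} → Runs P f W t q c → RunsStep P f W (suc t) q (internal c)
    flip     : ∀ {t q κ} → (∀ r → Runs P f W t q (κ r)) →
               RunsStep P f W (suc t) q (flip κ)
    ask      : ∀ {t q x κ} → Runs P f W t q (κ (f x)) →
               RunsStep P f W (suc (n ℕ.+ t)) (suc q) (ask x κ)
    draw     : ∀ {t q κ} → (∀ x → Runs P f W t q (κ x (f x))) →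
               RunsStep P f W (suc (n ℕ.+ t)) (suc q) (draw κ)

-- The probability that P, started in c, halts with output r within t steps;
-- coin flips and examples are independent.
mutual
  Pr-output : ∀ {n} → Program → BoolFun n → Distribution n → Bool → ℕ → Config → ℝ
  Pr-output P f D r zero    c = 0ℝ
  Pr-output P f D r (suc t) c = Pr-output-step P f D r t (step P c)

  Pr-output-step : ∀ {n} → Program → BoolFun n → Distribution n → Bool → ℕ → Step n → ℝ
  Pr-output-step     P f D r t (halted r′)  = if r xor r′ then 0ℝ else 1ℝ
  Pr-output-step     P f D r t (internal c) = Pr-output P f D r t c
  Pr-output-step     P f D r t (flip κ)     =
    fromℚ ½ *ℝ (Pr-output P f D r t (κ false) +ℝ Pr-output P f D r t (κ true))
  Pr-output-step     P f D r t (ask x κ)    = Pr-output P f D r t (κ (f x))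
  Pr-output-step {n} P f D r t (draw κ)     =
    ∑ n (λ x → weight D x *ℝ Pr-output P f D r t (κ x (f x)))

-- The inputs are n, s, d and the numerator and denominator of ε.
initial : (n s d : ℕ) (ε : ℚ) → Config
initial n s d ε = ⟨ 0 , M ⟩
  where
  M : Memory
  M 0 = n
  M 1 = s
  M 2 = d
  M 3 = ℤ.∣ ℚ.↥ ε ∣
  M 4 = ℚ.↧ₙ ε
  M _ = 0

------------------------------------------------------------------------
-- Asymptotic bounds
--
-- C stands for all the constants hidden by the O-notation; every bound is
-- monotone in C (for s ≥ 1), so a single constant is as general as several.

⌈_÷_⌉ : ℕ → (ε : ℚ) .{{_ : Positive ε}} → ℕ
⌈ a ÷ ε ⌉ = ℤ.∣ ℚ.ceiling ((ℤ.+ a ℚ./ 1) ℚ.* (ℚ.1/ ε) {{ℚₚ.pos⇒nonZero ε}}) ∣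

-- Õ(g) = O(g · polylog g)
softO : (C g : ℕ) → ℕ
softO C g = C ℕ.* (g ℕ.* suc ⌈log₂ g ⌉ ℕ.^ C)

queryBound : (C s : ℕ) (ε : ℚ) .{{_ : Positive ε}} → ℕ
queryBound C s ε = softO C ⌈ s ℕ.^ 2 ÷ ε ⌉

-- s^O(d)/ε + n·Õ(s²/ε)
timeBound : (C n s d : ℕ) (ε : ℚ) .{{_ : Positive ε}} → ℕ
timeBound C n s d ε =
  C ℕ.* ⌈ s ℕ.^ (C ℕ.* d) ÷ ε ⌉ ℕ.+ n ℕ.* softO C ⌈ s ℕ.^ 2 ÷ ε ⌉

-- Words have O(log(n + s + d + q)) bits, q the denominator of ε: up to the
-- constant, just enough to hold the inputs.
wordBound : (C n s d : ℕ) (ε : ℚ) → ℕ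
wordBound C n s d ε = (2 ℕ.+ n ℕ.+ s ℕ.+ d ℕ.+ ℚ.↧ₙ ε) ℕ.^ C

{-# OPTIONS --safe #-}
module Submission where

open import Defs
open import Data.Bool using (Bool; true; false; if_then_else_; _xor_; _∧_; T; not)
open import Data.Empty using (⊥; ⊥-elim)
open import Data.List using (List; []; _∷_; length)
open import Data.List.Membership.Propositional using (_∈_)
open import Data.List.Relation.Unary.Any using (here; there)
open import Data.Maybe using (just; Maybe; nothing)
open import Data.Product using (_×_; _,_; proj₁; proj₂; Σ; ∃)
open import Data.Sum using (_⊎_; inj₁; inj₂)
open import Data.Unit using (⊤; tt)
open import Data.Vec using (Vec; []; _∷_)
open import Function using (case_of_)
open import Relation.Binary.PropositionalEquality
open import Relation.Nullary using (yes; no; does; ¬_)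

-- The tester finds the variables of a hidden tree only implicitly. It keeps blocks: a point u
-- together with a set δ of coordinates, disjoint from the union B (`mask`) of the earlier sets,
-- such that f(u) and f(u ⊕ δ) differ. Each of at most s rounds draws a fresh batch of m labelled
-- examples. If some x in the batch has f(x) ≠ f(x ⊗ B), then R steps of random bisection of the set
-- where x and x ⊗ B differ give a new block, and R repetitions of a constant-query test check that
-- z ↦ f(u ⊕ z ⊗ δ) looks like a single variable, up to complement. If there is no such x, the bit
-- of every block is read on every example, and an exhaustive search decides whether a tree of depth
-- at most d and size at most s over these bits fits the labels.
--
-- Completeness. Consider the pairs of distinct tree variables inside δ. One bisection step keeps a
-- pair only if the random set treats both variables alike, so the expected number of pairs halves,
-- and after R steps a pair is left with probability at most s²/2^R. Without pairs, f(u ⊕ z ⊗ δ) is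
-- f(u) plus the coordinate of z at a single tree variable; then every test passes with certainty
-- and every bit is read correctly. Each block uses up a tree variable, and a tree of size at most s
-- has at most s - 1 internal nodes, so some round finds no witness. The tree with the undiscovered
-- variables set to 0 then fits the batch.
--
-- Soundness. A block on which at least 1/32 of the test triples fail is almost surely rejected.
-- Otherwise linearity testing with self-correction makes the majority vote h over z of f(u ⊕ z ⊗ δ)
-- + f(u ⊕ (z ⊕ x) ⊗ δ) an additive function. Its defect of multiplicativity is a bilinear form,
-- hence zero or nonzero on at least a quarter of all pairs, and the test excludes the latter. So h
-- respects sums and products and is a coordinate or zero. Bits are read once and rechecked R times,
-- so that a wrong reading rarely goes unnoticed. Acceptance therefore means that a small tree over
-- the blocks, with these coordinates substituted, agrees with f on the whole batch. There are at
-- most (2 + s)^(2s) such functions. They all lie in the class, hence are far from f, and they are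
-- determined before the batch is drawn. Each of them survives the batch with probability at most (1
-- - ε)^m.
--
-- Parameters. Let N = 1 + ⌊1/ε⌋ and let λ₀ be the binary length of s²N. Then R = 96 λ₀ and m = 7 λ₀
-- s N make all errors small. Reading m·s bits with R rechecks costs O(λ₀² s² N) queries, and the
-- search visits s^O(d) nodes with a scan of the m examples at each.
--
-- Machine. The tester is written in a small structured language that is compiled to the RAM. The
-- randomness of a run is described by a finite tree `Comp`, and each statement satisfies a triple
-- in continuation-passing style that gives time, queries, word size and the induced transformation
-- of `Comp` together. The probabilistic analysis takes place on `Comp` alone, through integer
-- bounds of the form Q · Pr ≤ A.

module Compilation where

  -- Randomised computations as finite trees

  open import Data.List using (_++_; head; drop)
  open import Data.List.Properties using (++-assoc)
  open import Data.Nat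
  open import Data.Nat.Properties
  import Data.Rational as ℚ
  open import Relation.Nullary.Decidable using (dec-true; dec-false)

  -- There is no constructor for queries: f is fixed, so the answer is known and only coins and
  -- examples branch. Queries are counted by the simulation relation instead.
  data Comp (n : ℕ) : Set where
    ret  : Bool → Comp n
    flip : (Bool → Comp n) → Comp n
    draw : (Vec Bool n → Comp n) → Comp n

  E : ∀ {n} → Distribution n → Bool → Comp n → ℝ
  E D r (ret r′)     = if r xor r′ then 0ℝ else 1ℝ
  E D r (flip κ)     = fromℚ ℚ.½ *ℝ (E D r (κ false) +ℝ E D r (κ true))
  E {n} D r (draw κ) = ∑ n (λ x → weight D x *ℝ E D r (κ x))

  -- The body receives the number of iterations still to come, matching machine loops whose counter
  -- runs down to zero.
  iter : ∀ {n} {X : Set} → (ℕ → X → (X → Comp n) → Comp n) → ℕ → X → (X → Comp n) → Comp n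
  iter G zero    x k = k x
  iter G (suc i) x k = G i x (λ y → iter G i y k)

  infix 4 _≋_
  -- Termwise equality of the approximating sequences. The output probability of a run and the value
  -- of its tree arise by the same arithmetic, so no limits are needed to compare them.
  _≋_ : ℝ → ℝ → Set
  x ≋ y = ∀ k → seq x k ≡ seq y k

  ∑-cong : ∀ n {g h : Vec Bool n → ℝ} → (∀ x → g x ≋ h x) → ∑ n g ≋ ∑ n h
  ∑-cong zero    e = e []
  ∑-cong (suc n) e k = cong₂ ℚ._+_ (∑-cong n (λ x → e (false ∷ x)) k) (∑-cong n (λ x → e (true ∷ x)) k)

  -- A structured language and its compiler

  data Stmt : Set where
    ins   : Instr → Stmt
    skip  : Stmt
    _⨟_   : Stmt → Stmt → Stmt
    ifz   : Addr → Stmt → Stmt → Stmt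
    while : Addr → Stmt → Stmt

  infixr 5 _⨟_

  -- Cell 63 is reserved for the constant zero of unconditional jumps.
  len : Stmt → ℕ
  len (ins _)     = 1
  len skip        = 0
  len (S ⨟ T)     = len S + len T
  len (ifz _ S T) = 3 + (len T + len S)
  len (while _ S) = 3 + len S

  compile : Stmt → ℕ → Program
  compile (ins i)     p = i ∷ []
  compile skip        p = []
  compile (S ⨟ T)     p = compile S p ++ compile T (len S + p)
  compile (ifz a S T) p =
    jump0 a (3 + (len T + p)) ∷ (compile T (1 + p) ++
    (const 63 0 ∷ jump0 63 (3 + (len T + len S) + p) ∷ compile S (3 + (len T + p))))
  compile (while a S) p =
    jump0 a (3 + (len S + p)) ∷ (compile S (1 + p) ++ (const 63 0 ∷ jump0 63 p ∷ []))

  length-compile : ∀ S p → length (compile S p) ≡ len S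
  length-compile (ins _)     p = refl
  length-compile skip        p = refl
  length-compile (S ⨟ T)     p = trans (length-++′ (compile S p)) (cong₂ _+_ (length-compile S p) (length-compile T _))
    where
    length-++′ : ∀ (xs : Program) {ys} → length (xs ++ ys) ≡ length xs + length ys
    length-++′ []       = refl
    length-++′ (_ ∷ xs) = cong suc (length-++′ xs)
  length-compile (ifz a S T) p = cong suc (begin
    length (compile T (1 + p) ++ _)                   ≡⟨ length-++ (compile T (1 + p)) ⟩
    length (compile T (1 + p)) + suc (suc (length (compile S _)))
      ≡⟨ cong₂ (λ u v → u + suc (suc v)) (length-compile T _) (length-compile S _) ⟩
    len T + suc (suc (len S))                         ≡⟨ trans (+-suc _ _) (cong suc (+-suc _ _)) ⟩
    suc (suc (len T + len S))                         ∎)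
    where open ≡-Reasoning
          open import Data.List.Properties using (length-++)
  length-compile (while a S) p = cong suc (begin
    length (compile S (1 + p) ++ _)  ≡⟨ length-++ (compile S (1 + p)) ⟩
    length (compile S (1 + p)) + 2   ≡⟨ cong (_+ 2) (length-compile S _) ⟩
    len S + 2                        ≡⟨ +-comm (len S) 2 ⟩
    suc (suc (len S))                ∎)
    where open ≡-Reasoning
          open import Data.List.Properties using (length-++)

  -- Jump targets are absolute, so correctness of a fragment is stated for any program that contains
  -- its code at the position it was compiled for.
  CodeAt : Program → ℕ → Program → Set
  CodeAt P p []       = ⊤
  CodeAt P p (i ∷ is) = head (drop p P) ≡ just i × CodeAt P (suc p) is

  codeAt-split : ∀ {P} p xs {ys} → CodeAt P p (xs ++ ys) → CodeAt P p xs × CodeAt P (length xs + p) ys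
  codeAt-split p []       c       = tt , c
  codeAt-split {P} p (x ∷ xs) {ys} (h , c) with codeAt-split (suc p) xs c
  ... | c₁ , c₂ = (h , c₁) , subst (λ q → CodeAt P q ys) (+-suc (length xs) p) c₂

  codeAt-refl : ∀ pre P → CodeAt (pre ++ P) (length pre) P
  codeAt-refl pre []      = tt
  codeAt-refl pre (i ∷ P) = lookup-pre pre , subst₂ (λ Q q → CodeAt Q q P)
    (++-assoc pre (i ∷ []) P) (length-snoc pre) (codeAt-refl (pre ++ i ∷ []) P)
    where
    lookup-pre : ∀ pre → head (drop (length pre) (pre ++ i ∷ P)) ≡ just i
    lookup-pre []        = refl
    lookup-pre (_ ∷ pre) = lookup-pre pre
    length-snoc : ∀ (pre : Program) → length (pre ++ i ∷ []) ≡ suc (length pre)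
    length-snoc []        = refl
    length-snoc (_ ∷ pre) = cong suc (length-snoc pre)

  line : List Instr → Stmt
  line []       = skip
  line (i ∷ is) = ins i ⨟ line is

  -- Triples for compiled code: time, queries, words and distribution

  module Simulation {n : ℕ} (f : BoolFun n) (W : ℕ) where

    Bnd : Memory → Set
    Bnd M = ∀ a → M a < W

    -- The output probability is fixed for every budget from t on, so that branches of different
    -- lengths can share one bound and budgets can be weakened.
    record Sim (P : Program) (t q : ℕ) (c : Config) (m : Comp n) : Set where
      field
        runs : Runs P f W t q c
        out  : ∀ D r {t′} → t ≤ t′ → Pr-output P f D r t′ c ≋ E D r m
    open Sim public

    mutual
      runs-weaken : ∀ {P t q t′ q′ c} → t ≤ t′ → q ≤ q′ → Runs P f W t q c → Runs P f W t′ q′ c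
      runs-weaken l r (run b s) = run b (step-weaken l r s)

      step-weaken : ∀ {P t q t′ q′ c} → t ≤ t′ → q ≤ q′ → RunsStep P f W t q c → RunsStep P f W t′ q′ c
      step-weaken (s≤s l) r halted       = halted
      step-weaken (s≤s l) r (internal s) = internal (runs-weaken l r s)
      step-weaken (s≤s l) r (flip s)     = flip (λ b → runs-weaken l r (s b))
      -- Oracle calls index their budget as n plus a remainder, so the larger budget is first
      -- rewritten into this shape.
      step-weaken {t′ = suc t″} (s≤s l) (s≤s r) (ask {t} s) =
        subst (λ u → RunsStep _ f W (suc u) _ _) (m+[n∸m]≡n (≤-trans (m≤m+n n t) l))
          (ask (runs-weaken (m+n≤o⇒m≤o∸n t (subst (_≤ t″) (+-comm n t) l)) r s))
      step-weaken {t′ = suc t″} (s≤s l) (s≤s r) (draw {t} s) =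
        subst (λ u → RunsStep _ f W (suc u) _ _) (m+[n∸m]≡n (≤-trans (m≤m+n n t) l))
          (draw (λ x → runs-weaken (m+n≤o⇒m≤o∸n t (subst (_≤ t″) (+-comm n t) l)) r (s x)))

    sim-weaken : ∀ {P t q t′ q′ c m} → t ≤ t′ → q ≤ q′ → Sim P t q c m → Sim P t′ q′ c m
    sim-weaken l r s .runs = runs-weaken l r (runs s)
    sim-weaken l r s .out D b l′ = out s D b (≤-trans l l′)

    step-at : ∀ {P p i} M → head (drop p P) ≡ just i → step {n} P ⟨ p , M ⟩ ≡ exec i ⟨ p , M ⟩
    step-at {P} {p} M e with head (drop p P) | e
    ... | just _ | refl = refl

    module _ {P : Program} {p : ℕ} {i : Instr} {M : Memory}
             (at : head (drop p P) ≡ just i) (b : Bnd M) where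

      private
        from-exec : ∀ {t q s} → exec i ⟨ p , M ⟩ ≡ s → RunsStep P f W t q s → Runs P f W t q ⟨ p , M ⟩
        from-exec e s = run b (subst (RunsStep P f W _ _) (sym (trans (step-at M at) e)) s)

        out-exec : ∀ {s D r t} v → exec i ⟨ p , M ⟩ ≡ s → Pr-output-step P f D r t s ≋ v →
                   Pr-output P f D r (suc t) ⟨ p , M ⟩ ≋ v
        out-exec v e h = subst (λ s → Pr-output-step P f _ _ _ s ≋ v) (sym (trans (step-at M at) e)) h

      sim-halt : ∀ {t q r} → exec i ⟨ p , M ⟩ ≡ halted r → Sim P (suc t) q ⟨ p , M ⟩ (ret r)
      sim-halt e .runs = from-exec e halted
      sim-halt {r = r′} e .out D r (s≤s l) = out-exec (E D r (ret r′)) e (λ _ → refl)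

      sim-internal : ∀ {t q m c} → exec i ⟨ p , M ⟩ ≡ internal c → Sim P t q c m → Sim P (suc t) q ⟨ p , M ⟩ m
      sim-internal e s .runs = from-exec e (internal (runs s))
      sim-internal {m = m} e s .out D r (s≤s l) = out-exec (E D r m) e (out s D r l)

      sim-flip : ∀ {t q m κ} → exec i ⟨ p , M ⟩ ≡ flip κ → (∀ r → Sim P t q (κ r) (m r)) →
                 Sim P (suc t) q ⟨ p , M ⟩ (flip m)
      sim-flip e s .runs = from-exec e (flip (λ r → runs (s r)))
      sim-flip {m = m} e s .out D r (s≤s l) = out-exec (E D r (flip m)) e
        (λ k → cong (ℚ.½ ℚ.*_) (cong₂ ℚ._+_ (out (s false) D r l k) (out (s true) D r l k)))

      sim-ask : ∀ {t q m x κ} → exec i ⟨ p , M ⟩ ≡ ask x κ → Sim P t q (κ (f x)) m →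
                Sim P (suc (n + t)) (suc q) ⟨ p , M ⟩ m
      sim-ask e s .runs = from-exec e (ask (runs s))
      sim-ask {m = m} e s .out D r (s≤s l) = out-exec (E D r m) e (out s D r (≤-trans (m≤n+m _ n) l))

      sim-draw : ∀ {t q m κ} → exec i ⟨ p , M ⟩ ≡ draw κ → (∀ x → Sim P t q (κ x (f x)) (m x)) →
                 Sim P (suc (n + t)) (suc q) ⟨ p , M ⟩ (draw m)
      sim-draw e s .runs = from-exec e (draw (λ x → runs (s x)))
      sim-draw {m = m} e s .out D r (s≤s l) = out-exec (E D r (draw m)) e
        (∑-cong n (λ x k → cong (seq (weight D x) k ℚ.*_) (out (s x) D r (≤-trans (m≤n+m _ n) l) k)))

    -- The triple: run from M, the statement S takes time t and q queries,
    -- realises the functional F, and leaves a memory satisfying Post.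
    record MFrag {X : Set} (S : Stmt) (t q : ℕ) (M : Memory) (F : (X → Comp n) → Comp n) (Post : X → Memory → Set) : Set where
      constructor frag
      field
        apply : ∀ {P p t′ q′} (k : X → Comp n) → CodeAt P p (compile S p) → Bnd M →
          (∀ x M′ → Bnd M′ → Post x M′ → Sim P t′ q′ ⟨ len S + p , M′ ⟩ (k x)) →
          Sim P (t + t′) (q + q′) ⟨ p , M ⟩ (F k)
    open MFrag public

    -- The empty postcondition says that control never reaches the end of the code: the run halts
    -- inside it, and the continuation supplied here is only a dummy.
    sim-program : ∀ S {t q M F} → Bnd M → MFrag {⊤} S t q M F (λ _ _ → ⊥) → Sim (compile S 0) t q ⟨ 0 , M ⟩ (F (λ _ → ret false))
    sim-program S {t} {q} {M} {F} b fr = subst₂ (λ u v → Sim (compile S 0) u v ⟨ 0 , M ⟩ (F (λ _ → ret false))) (+-identityʳ t) (+-identityʳ q)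
      (apply fr {compile S 0} {0} (λ _ → ret false) (codeAt-refl [] (compile S 0)) b (λ _ _ _ ()))

    return : {X : Set} → X → (X → Comp n) → Comp n
    return x k = k x

    m-weaken : ∀ {X S t q t′ q′ M F} {Post : X → Memory → Set} → t ≤ t′ → q ≤ q′ →
               MFrag S t q M F Post → MFrag S t′ q′ M F Post
    m-weaken l r fr .apply k c b κ = sim-weaken (+-monoˡ-≤ _ l) (+-monoˡ-≤ _ r) (apply fr k c b κ)

    m-post : ∀ {X S t q M F} {Post Post′ : X → Memory → Set} → (∀ x M′ → Post x M′ → Post′ x M′) →
             MFrag S t q M F Post → MFrag S t q M F Post′
    m-post h fr .apply k c b κ = apply fr k c b (λ x M′ b′ p → κ x M′ b′ (h x M′ p))

    m-bnd : ∀ {X S t q M F} {Post : X → Memory → Set} → (Bnd M → MFrag S t q M F Post) → MFrag S t q M F Post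
    m-bnd h .apply k c b κ = apply (h b) k c b κ

    m-skip : ∀ {X M} {x : X} {Post : X → Memory → Set} → Post x M → MFrag skip 0 0 M (return x) Post
    m-skip p .apply k c b κ = κ _ _ b p

    m-seq : ∀ {X Y S T t q t₁ q₁ M F} {G : X → (Y → Comp n) → Comp n} {Mid : X → Memory → Set} {Post : Y → Memory → Set} →
            MFrag S t q M F Mid → (∀ x M′ → Mid x M′ → MFrag T t₁ q₁ M′ (G x) Post) →
            MFrag (S ⨟ T) (t + t₁) (q + q₁) M (λ k → F (λ x → G x k)) Post
    m-seq {S = S} {T} {t} {q} {t₁} {q₁} {M} {F} {G} fr gr .apply {P} {p} {t′} {q′} k c b κ
      with codeAt-split p (compile S p) c
    ... | c₁ , c₂ = subst₂ (λ u v → Sim P u v ⟨ p , M ⟩ (F (λ x → G x k)))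
          (sym (+-assoc t t₁ t′)) (sym (+-assoc q q₁ q′))
          (apply fr _ c₁ b λ x M′ b′ m → apply (gr x M′ m) k
            (subst (λ l → CodeAt P (l + p) (compile T (len S + p))) (length-compile S p) c₂) b′
            (λ y M″ b″ m′ → subst (λ u → Sim P t′ q′ ⟨ u , M″ ⟩ (k y)) (shift p) (κ y M″ b″ m′)))
      where
      shift : ∀ p → len S + len T + p ≡ len T + (len S + p)
      shift p = trans (cong (_+ p) (+-comm (len S) (len T))) (+-assoc (len T) (len S) p)

    -- For deterministic code after a random statement: the outcome x passes through unchanged, and
    -- the final postcondition may still mention it.
    m-then : ∀ {X S T t q t₁ q₁ M F} {Mid Post : X → Memory → Set} →
             MFrag S t q M F Mid → (∀ x M′ → Mid x M′ → MFrag T t₁ q₁ M′ (return tt) (λ _ → Post x)) →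
             MFrag (S ⨟ T) (t + t₁) (q + q₁) M F Post
    m-then {X} {S} {T} {t₁ = t₁} {q₁} {Post = Post} fr gr = m-seq {G = return} fr (λ x M′ m → carry x M′ (gr x M′ m))
      where
      carry : ∀ x M′ → MFrag T t₁ q₁ M′ (return tt) (λ _ → Post x) → MFrag T t₁ q₁ M′ (return x) Post
      carry x M′ g .apply k c b κ = apply g (λ _ → k x) c b (λ _ → κ x)

    upd-same : ∀ (M : Memory) a v → (M [ a ≔ v ]) a ≡ v
    upd-same M a v = cong (λ z → if z then v else M a) (dec-true (a ≟ a) refl)

    upd-other : ∀ (M : Memory) {a b} v → a ≢ b → (M [ b ≔ v ]) a ≡ M a
    upd-other M {a} {b} v ne = cong (λ z → if z then v else M a) (dec-false (a ≟ b) ne)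

    bnd-upd : ∀ {M} a {v} → Bnd M → v < W → Bnd (M [ a ≔ v ])
    bnd-upd {M} a {v} b l c with does (c ≟ a)
    ... | true  = l
    ... | false = b c

    0<W : ∀ {M} → Bnd M → 0 < W
    0<W b = ≤-trans (s≤s z≤n) (b 0)

    private
      goto : ∀ {P p ℓ t q M m} → CodeAt P p (const 63 0 ∷ jump0 63 ℓ ∷ []) → Bnd M →
             (Bnd (M [ 63 ≔ 0 ]) → Sim P t q ⟨ ℓ , M [ 63 ≔ 0 ] ⟩ m) → Sim P (2 + t) q ⟨ p , M ⟩ m
      goto {M = M} (c₁ , c₂ , _) b s = sim-internal c₁ b refl (sim-internal c₂ b′ refl (s b′))
        where b′ = bnd-upd {M} 63 b (0<W b)

    -- An unconditional jump clears cell 63 after the postcondition of a branch has been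
    -- established, so the postcondition must survive this write.
    Keeps63 : {X : Set} → (X → Memory → Set) → Set
    Keeps63 Post = ∀ x M → Post x M → Post x (M [ 63 ≔ 0 ])

    toBit-zero : ∀ {m} → m ≡ 0 → toBit m ≡ false
    toBit-zero refl = refl

    toBit-suc : ∀ {m} → m ≢ 0 → toBit m ≡ true
    toBit-suc {zero}  h = ⊥-elim (h refl)
    toBit-suc {suc _} h = refl

    m-ifz : ∀ {X a S T t q M F} {Post : X → Memory → Set} → Keeps63 Post →
            (M a ≡ 0 → MFrag S t q M F Post) → (M a ≢ 0 → MFrag T t q M F Post) →
            MFrag (ifz a S T) (3 + t) q M F Post
    m-ifz {a = a} {S} {T} {t} {q} {M} {F} keep fz fn .apply {P} {p} {t′} {q′} k (c₀ , c) b κ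
      with codeAt-split (suc p) (compile T (suc p)) c | M a ≟ 0
    -- The zero branch lies last and falls through to the end; it saves the two instructions of the
    -- unconditional jump, and the bound is padded accordingly.
    ... | cT , cR | yes e = sim-weaken (s≤s (m≤n+m _ 2)) ≤-refl
          (sim-internal c₀ b (cong (λ v → internal (if v then _ else _)) (toBit-zero e))
            (apply (fz e) k (subst (λ l → CodeAt P l (compile S (3 + (len T + p)))) posS (proj₂ (proj₂ cR))) b
              (λ x M′ b′ m → subst (λ l → Sim P t′ q′ ⟨ l , M′ ⟩ (k x)) endS (κ x M′ b′ m))))
      where
      posS : suc (suc (length (compile T (suc p)) + suc p)) ≡ 3 + (len T + p)
      posS = cong (2 +_) (trans (cong (_+ suc p) (length-compile T (suc p))) (+-suc (len T) p))
      endS : 3 + (len T + len S) + p ≡ len S + (3 + (len T + p))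
      endS = trans (cong (3 +_) (trans (cong (_+ p) (+-comm (len T) (len S))) (+-assoc (len S) (len T) p)))
               (sym (trans (+-suc _ _) (cong suc (trans (+-suc _ _) (cong suc (+-suc _ _))))))
    ... | cT , cR | no ne = subst (λ u → Sim P u (q + q′) ⟨ p , M ⟩ (F k)) (cong suc arith)
          (sim-internal c₀ b (cong (λ v → internal (if v then _ else _)) (toBit-suc ne))
            (apply (fn ne) k cT b
              (λ x M′ b′ m → subst (λ l → Sim P (2 + t′) q′ ⟨ l , M′ ⟩ (k x))
                 (cong (_+ suc p) (length-compile T (suc p)))
                 (goto (proj₁ cR , proj₁ (proj₂ cR) , tt) b′ (λ b″ → κ x _ b″ (keep x M′ m))))))
      where
      arith : t + (2 + t′) ≡ 2 + (t + t′)
      arith = trans (+-suc t _) (cong suc (+-suc t t′))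

    m-exit : ∀ {X a S M} {x : X} {Post : X → Memory → Set} → M a ≡ 0 → Post x M →
             MFrag (while a S) 1 0 M (return x) Post
    m-exit e post .apply k c b κ =
      sim-internal (proj₁ c) b (cong (λ v → internal (if v then _ else _)) (toBit-zero e)) (κ _ _ b post)

    m-unroll : ∀ {X Y a S t q t₁ q₁ M F} {G : X → (Y → Comp n) → Comp n} {Mid : X → Memory → Set} {Post : Y → Memory → Set} →
               Keeps63 Mid → M a ≢ 0 → MFrag S t q M F Mid →
               (∀ x M′ → Mid x M′ → MFrag (while a S) t₁ q₁ M′ (G x) Post) →
               MFrag (while a S) (3 + t + t₁) (q + q₁) M (λ k → F (λ x → G x k)) Post
    m-unroll {a = a} {S} {t} {q} {t₁} {q₁} {M} {F} {G} keep ne fr rest .apply {P} {p} {t′} {q′} k c b κ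
      with codeAt-split (suc p) (compile S (suc p)) (proj₂ c)
    ... | cS , cR = subst₂ (λ u v → Sim P u v ⟨ p , M ⟩ (F (λ x → G x k))) (cong suc arith) (sym (+-assoc q q₁ q′))
          (sim-internal (proj₁ c) b (cong (λ v → internal (if v then _ else _)) (toBit-suc ne))
            (apply fr (λ x → G x k) cS b (λ x M′ b′ m → subst (λ l → Sim P (2 + (t₁ + t′)) (q₁ + q′) ⟨ l , M′ ⟩ (G x k))
               (cong (_+ suc p) (length-compile S (suc p)))
               (goto cR b′ (λ b″ → apply (rest x _ (keep x M′ m)) k c b″ κ)))))
      where
      arith : t + (2 + (t₁ + t′)) ≡ 2 + (t + t₁ + t′)
      arith = trans (+-suc t _) (cong suc (trans (+-suc t _) (cong suc (sym (+-assoc t t₁ t′)))))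

    -- Straight-line code.
    effect : Instr → Memory → Memory
    effect (const a k) M = M [ a ≔ k ]
    effect (add a b c) M = M [ a ≔ M b + M c ]
    effect (sub a b c) M = M [ a ≔ M b ∸ M c ]
    effect (mul a b c) M = M [ a ≔ M b * M c ]
    effect (div a b c) M = M [ a ≔ quotient (M b) (M c) ]
    effect (load a b)  M = M [ a ≔ M (M b) ]
    effect (store a b) M = M [ M a ≔ M b ]
    effect _           M = M

    -- Only constants, sums and products can exceed the word bound; the other data instructions
    -- store at most a value already in memory. The absurd default restricts straight-line code to
    -- data instructions.
    Safe : Instr → Memory → Set
    Safe (const a k) M = k < W
    Safe (add a b c) M = M b + M c < W
    Safe (sub a b c) M = ⊤
    Safe (mul a b c) M = M b * M c < W
    Safe (div a b c) M = ⊤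
    Safe (load a b)  M = ⊤
    Safe (store a b) M = ⊤
    Safe _           M = 1 < 0

    quotient-≤ : ∀ m k → quotient m k ≤ m
    quotient-≤ m zero    = z≤n
    quotient-≤ m (suc k) = m/n≤m m (suc k)
      where open import Data.Nat.DivMod using (m/n≤m)

    m-ins : ∀ {i M} → Safe i M → MFrag (ins i) 1 0 M (return tt) (λ _ M′ → M′ ≡ effect i M)
    m-ins {const a k} {M} s .apply κ (c , _) b h = sim-internal c b refl (h tt _ (bnd-upd {M} a b s) refl)
    m-ins {add a _ _} {M} s .apply κ (c , _) b h = sim-internal c b refl (h tt _ (bnd-upd {M} a b s) refl)
    m-ins {sub a x y} {M} s .apply κ (c , _) b h =
      sim-internal c b refl (h tt _ (bnd-upd {M} a b (≤-<-trans (m∸n≤m (M x) (M y)) (b x))) refl)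
    m-ins {mul a _ _} {M} s .apply κ (c , _) b h = sim-internal c b refl (h tt _ (bnd-upd {M} a b s) refl)
    m-ins {div a x y} {M} s .apply κ (c , _) b h =
      sim-internal c b refl (h tt _ (bnd-upd {M} a b (≤-<-trans (quotient-≤ (M x) (M y)) (b x))) refl)
    m-ins {load a x}  {M} s .apply κ (c , _) b h = sim-internal c b refl (h tt _ (bnd-upd {M} a b (b (M x))) refl)
    m-ins {store x y} {M} s .apply κ (c , _) b h = sim-internal c b refl (h tt _ (bnd-upd {M} (M x) b (b y)) refl)

    effects : List Instr → Memory → Memory
    effects []       M = M
    effects (i ∷ is) M = effects is (effect i M)

    Safes : List Instr → Memory → Set
    Safes []       M = ⊤
    Safes (i ∷ is) M = Safe i M × Safes is (effect i M)

    m-line : ∀ is {M} → Safes is M → MFrag (line is) (length is) 0 M (return tt) (λ _ M′ → M′ ≡ effects is M)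
    m-line []       s        = m-skip refl
    m-line (i ∷ is) (s , s′) = m-seq {G = λ _ → return tt} (m-ins s) λ { _ _ refl → m-line is s′ }

    -- The continuation is discarded, so every postcondition holds vacuously.
    m-halt : ∀ {X r M t q} {Post : X → Memory → Set} → MFrag (ins (halt r)) (suc t) q M (λ _ → ret r) Post
    m-halt .apply k (c , _) b κ = sim-halt c b refl

    m-coin : ∀ {a M} → 1 < W → MFrag (ins (coin a)) 1 0 M flip (λ r M′ → M′ ≡ M [ a ≔ fromBit r ])
    m-coin {a} {M} l .apply k (c , _) b κ = sim-flip c b refl (λ r → κ r _ (bnd-upd {M} a b (bit r)) refl)
      where bit : ∀ r → fromBit r < W
            bit false = ≤-trans (s≤s z≤n) l
            bit true  = l

    fromBit-<W : 1 < W → ∀ r → fromBit r < W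
    fromBit-<W l false = ≤-trans (s≤s z≤n) l
    fromBit-<W l true  = l

    m-query : ∀ {a b M} → 1 < W →
              MFrag (ins (query a b)) (suc n) 1 M (return tt) (λ _ M′ → M′ ≡ M [ a ≔ fromBit (f (readVec n M (M b))) ])
    m-query {a} {M = M} l .apply k (c , _) b κ = sim-ask c b refl (κ tt _ (bnd-upd {M} a b (fromBit-<W l _)) refl)

    bnd-write : ∀ {k M} a (x : Vec Bool k) → 1 < W → Bnd M → Bnd (writeVec M a x)
    bnd-write a []      l b = b
    bnd-write {M = M} a (r ∷ x) l b = bnd-write (suc a) x l (bnd-upd {M} a b (fromBit-<W l r))

    m-draw : ∀ {a b M} → 1 < W →
             MFrag (ins (sample a b)) (suc n) 1 M draw (λ x M′ → M′ ≡ writeVec M (M b) x [ a ≔ fromBit (f x) ])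
    m-draw {a} {M = M} l .apply k (c , _) b κ = sim-draw c b refl
      (λ x → κ x _ (bnd-upd a (bnd-write _ x l b) (fromBit-<W l _)) refl)

-- Vector and number operations on an abstract state

module Operations where

  open Compilation
  open import Data.Fin as F using (Fin; toℕ)
  import Data.Fin.Properties as Fₚ
  open import Data.Nat
  open import Data.Nat.Properties
  open import Data.Nat.DivMod using (_%_; [m+kn]%n≡m%n; m<n⇒m%n≡m)
  open import Data.Vec using (lookup)
  open import Data.Vec.Properties using (tabulate∘lookup; tabulate-cong)
  open import Relation.Nullary.Decidable using (dec-true; dec-false)
  open import Data.Vec using (lookup; zipWith)

  -- The view of memory that the tester reasons about: registers, rows holding n-bit vectors and
  -- rows of numbers, each row addressed by a kind and an index.
  record State (n : ℕ) : Set where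
    constructor st
    field
      reg : ℕ → ℕ
      vec : ℕ → ℕ → Vec Bool n
      num : ℕ → ℕ → ℕ → ℕ
  open State public

  module _ {n : ℕ} where
    setReg : ℕ → ℕ → State n → State n
    setReg a v σ = record σ { reg = reg σ [ a ≔ v ] }

    setVec : ℕ → ℕ → Vec Bool n → State n → State n
    setVec K i x σ = record σ { vec = λ K′ i′ → if (K′ ≡ᵇ K) ∧ (i′ ≡ᵇ i) then x else vec σ K′ i′ }

    setNum : ℕ → ℕ → ℕ → ℕ → State n → State n
    setNum K i c v σ = record σ { num = λ K′ i′ c′ → if (K′ ≡ᵇ K) ∧ ((i′ ≡ᵇ i) ∧ (c′ ≡ᵇ c)) then v else num σ K′ i′ c′ }

    idx : State n → Maybe ℕ → ℕ
    idx σ nothing  = 0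
    idx σ (just r) = reg σ r

  ≡ᵇ-refl : ∀ m → (m ≡ᵇ m) ≡ true
  ≡ᵇ-refl m = dec-true (m ≟ m) refl

  ≡ᵇ-≢ : ∀ {m k} → m ≢ k → (m ≡ᵇ k) ≡ false
  ≡ᵇ-≢ {m} {k} = dec-false (m ≟ k)

  ≡ᵇ-true : ∀ {m k} → (m ≡ᵇ k) ≡ true → m ≡ k
  ≡ᵇ-true {m} {k} e = ≡ᵇ⇒≡ m k (subst T (sym e) tt)

  ∧-true : ∀ {a b} → a ∧ b ≡ true → a ≡ true × b ≡ true
  ∧-true {true} {true} e = refl , refl

  T⇒< : ∀ {a b} → T (a <ᵇ b) → a < b
  T⇒< {a} {b} t = <ᵇ⇒< a b t

  private
    radix : ∀ b .{{_ : NonZero b}} {r r′ c c′} → c < b → c′ < b → r * b + c ≡ r′ * b + c′ → r ≡ r′ × c ≡ c′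
    radix b {r} {r′} {c} {c′} l l′ e = *-cancelʳ-≡ r r′ b (+-cancelʳ-≡ c (r * b) (r′ * b) (trans e (cong (r′ * b +_) (sym c≡)))) , c≡
      where
      rem : ∀ r {c} → c < b → (r * b + c) % b ≡ c
      rem r {c} l = trans (cong (_% b) (+-comm (r * b) c)) (trans ([m+kn]%n≡m%n c r b) (m<n⇒m%n≡m l))
      c≡ : c ≡ c′
      c≡ = trans (sym (rem r l)) (trans (cong (_% b) e) (rem r′ l′))

    -- Two nested positional expansions: after cancelling the offset, the column is the digit below
    -- w, and the kind is the digit below B of the row number.
    row-injective : ∀ B w S .{{_ : NonZero B}} .{{_ : NonZero w}} {K K′ i i′ c c′} → K < B → K′ < B → c < w → c′ < w →
      (B * i + K) * w + S + c ≡ (B * i′ + K′) * w + S + c′ → K ≡ K′ × i ≡ i′ × c ≡ c′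
    row-injective B w S {K} {K′} {i} {i′} {c} {c′} lK lK′ lc lc′ e
      with radix w {B * i + K} {B * i′ + K′} lc lc′
             (+-cancelˡ-≡ S _ _ (trans (move (B * i + K) c) (trans e (sym (move (B * i′ + K′) c′)))))
      where
      move : ∀ a c → S + (a * w + c) ≡ a * w + S + c
      move a c = trans (sym (+-assoc S (a * w) c)) (cong (_+ c) (+-comm S (a * w)))
    ... | e₁ , e₂ with radix B {i} {i′} lK lK′ (trans (cong (_+ K) (*-comm i B)) (trans e₁ (cong (_+ K′) (*-comm B i′))))
    ... | e₃ , e₄ = e₄ , e₃ , e₂

  randVec : ∀ {n} k → (Vec Bool k → Comp n) → Comp n
  randVec zero    κ = κ []
  randVec (suc k) κ = flip (λ b → randVec k (λ x → κ (b ∷ x)))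

  IsReg : ℕ → Set
  IsReg a = T (a <ᵇ 40)

  data VOp : Set where
    vxor vand : VOp

  bitOp : VOp → Bool → Bool → Bool
  bitOp vxor = _xor_
  bitOp vand = _∧_

  vop : ∀ {k} → VOp → Vec Bool k → Vec Bool k → Vec Bool k
  vop o = zipWith (bitOp o)

  data Op : Set where
    lit             : (a k : ℕ) → Op
    add sub mul div : (a b c : ℕ) → Op
    diff            : (a b c : ℕ) → Op
    inc dec         : (a b : ℕ) → Op
    get             : (a K : ℕ) (i c : Maybe ℕ) → Op
    put             : (K : ℕ) (i c : Maybe ℕ) (a : ℕ) → Op
    vector          : VOp → (K : ℕ) (i : Maybe ℕ) (K₁ : ℕ) (i₁ : Maybe ℕ) (K₂ : ℕ) (i₂ : Maybe ℕ) → Op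
    query           : (a K : ℕ) (i : Maybe ℕ) → Op

  -- The machine has no move instruction, so a copy is an addition to a freshly cleared scratch
  -- cell.
  addrCode : ℕ → Maybe ℕ → List Instr
  addrCode K nothing  = const 60 K ∷ mul 60 60 40 ∷ const 61 64 ∷ add 60 60 61 ∷ []
  addrCode K (just r) = const 61 0 ∷ add 60 61 r ∷ const 61 18 ∷ mul 60 61 60 ∷ const 61 K ∷ add 60 60 61 ∷
                        mul 60 60 40 ∷ const 61 64 ∷ add 60 60 61 ∷ []

  -- Exclusive or of bits is the sum of the two truncated differences, conjunction is the product.
  bitCode : VOp → List Instr
  bitCode vxor = load 48 46 ∷ load 49 47 ∷ sub 50 48 49 ∷ sub 51 49 48 ∷ add 48 50 51 ∷ []
  bitCode vand = load 48 46 ∷ load 49 47 ∷ mul 48 48 49 ∷ []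

  advance : List Instr
  advance = const 61 1 ∷ add 45 61 45 ∷ add 46 61 46 ∷ add 47 61 47 ∷ sub 44 44 61 ∷ []

  vecBody : VOp → Stmt
  vecBody o = line (bitCode o) ⨟ (ins (store 45 48) ⨟ line advance)

  vecCode : VOp → ℕ → Maybe ℕ → ℕ → Maybe ℕ → ℕ → Maybe ℕ → Stmt
  vecCode o K i K₁ i₁ K₂ i₂ =
    line (addrCode K i)   ⨟ line (const 61 0 ∷ add 45 61 60 ∷ []) ⨟
    line (addrCode K₁ i₁) ⨟ line (const 61 0 ∷ add 46 61 60 ∷ []) ⨟
    line (addrCode K₂ i₂) ⨟ line (const 61 0 ∷ add 47 61 60 ∷ []) ⨟
    line (const 61 0 ∷ add 44 61 41 ∷ []) ⨟ while 44 (vecBody o)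

  randAdvance : List Instr
  randAdvance = const 61 1 ∷ add 45 61 45 ∷ sub 44 44 61 ∷ []

  randBody : Stmt
  randBody = ins (coin 48) ⨟ (ins (store 45 48) ⨟ line randAdvance)

  randCode : ℕ → Maybe ℕ → Stmt
  randCode K i = line (addrCode K i) ⨟ line (const 61 0 ∷ add 45 61 60 ∷ const 61 0 ∷ add 44 61 41 ∷ []) ⨟ while 44 randBody

  drawCode : ℕ → ℕ → Maybe ℕ → Stmt
  drawCode a K i = line (addrCode K i) ⨟ ins (sample a 60)

  colCode : Maybe ℕ → List Instr
  colCode nothing  = const 61 0 ∷ []
  colCode (just r) = add 60 60 r ∷ []

  stmt : Op → Stmt
  stmt (lit a k)               = ins (const a k)
  stmt (add a b c)             = ins (add a b c)
  stmt (sub a b c)             = ins (sub a b c)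
  stmt (mul a b c)             = ins (mul a b c)
  stmt (div a b c)             = ins (div a b c)
  stmt (diff a b c)            = ins (sub 61 b c) ⨟ (ins (sub 62 c b) ⨟ ins (add a 61 62))
  stmt (inc a b)               = ins (const 61 1) ⨟ ins (add a 61 b)
  stmt (dec a b)               = ins (const 61 1) ⨟ ins (sub a b 61)
  stmt (get a K i c)           = line (addrCode (12 + K) i) ⨟ (line (colCode c) ⨟ ins (load a 60))
  stmt (put K i c a)           = line (addrCode (12 + K) i) ⨟ (line (colCode c) ⨟ ins (store 60 a))
  stmt (vector o K i K₁ i₁ K₂ i₂) = vecCode o K i K₁ i₁ K₂ i₂
  stmt (query a K i)           = line (addrCode K i) ⨟ ins (query a 60)

  ops : List Op → Stmt
  ops []       = skip
  ops (o ∷ os) = stmt o ⨟ ops os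

  guard : ℕ → Stmt
  guard a = ifz a skip (ins (halt false))

  -- Memory layout: registers below 40, the row width w in cell 40, n in cell 41,
  -- scratch cells up to 63, then rows of width w; row i of kind K has number 18 i + K, vectors
  -- using the kinds below 12 and numbers the kinds 12 + K.
  module OpSemantics {n : ℕ} (f : BoolFun n) (W w I : ℕ) (n<w : n < w) (0<I : 0 < I)
                     (64<W : 64 < W) (space : 64 + 18 * I * w ≤ W) where

    open Simulation f W public

    n≤w : n ≤ w
    n≤w = <⇒≤ n<w

    0<w : 0 < w
    0<w = ≤-trans (s≤s z≤n) n<w

    abstract
      -- Sealed, since only its range and injectivity matter later and unfolding it would blow up
      -- every state.
      addr : ℕ → ℕ → ℕ → ℕ
      addr K i c = (18 * i + K) * w + 64 + c

      64≤addr : ∀ K i c → 64 ≤ addr K i c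
      64≤addr K i c = ≤-trans (m≤n+m 64 _) (m≤m+n _ c)

      addr-bound : ∀ {K i c} → K < 18 → i < I → c < w → addr K i c < W
      addr-bound {K} {i} {c} K< i< c< = begin-strict
        (18 * i + K) * w + 64 + c       <⟨ +-monoʳ-< _ c< ⟩
        (18 * i + K) * w + 64 + w       ≡⟨ trans (cong (_+ w) (+-comm _ 64)) (+-assoc 64 ((18 * i + K) * w) w) ⟩
        64 + ((18 * i + K) * w + w)     ≡⟨ cong (64 +_) (+-comm _ w) ⟩
        64 + suc (18 * i + K) * w       ≤⟨ +-monoʳ-≤ 64 (*-monoˡ-≤ w below) ⟩
        64 + 18 * I * w                 ≤⟨ space ⟩
        W                               ∎
        where
        open ≤-Reasoning
        below : suc (18 * i + K) ≤ 18 * I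
        below = begin
          suc (18 * i + K) ≡⟨ sym (+-suc (18 * i) K) ⟩
          18 * i + suc K   ≤⟨ +-monoʳ-≤ (18 * i) K< ⟩
          18 * i + 18      ≡⟨ trans (+-comm (18 * i) 18) (sym (*-suc 18 i)) ⟩
          18 * suc i       ≤⟨ *-monoʳ-≤ 18 i< ⟩
          18 * I           ∎

      addr-injective : ∀ {K K′ i i′ c c′} → K < 18 → K′ < 18 → c < w → c′ < w →
                       addr K i c ≡ addr K′ i′ c′ → K ≡ K′ × i ≡ i′ × c ≡ c′
      addr-injective = row-injective 18 w 64 {{_}} {{>-nonZero 0<w}}

      addr-def : ∀ K i c → addr K i c ≡ (18 * i + K) * w + 64 + c
      addr-def K i c = refl

      addr-+ : ∀ K i c → addr K i 0 + c ≡ addr K i c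
      addr-+ K i c = cong (_+ c) (+-identityʳ _)

    -- Cells 42 to 63 are left unconstrained; this is what lets address computations and inner loops
    -- run without changing the abstract state.
    record Rep (M : Memory) (σ : State n) : Set where
      field
        regs  : ∀ {a} → a < 40 → M a ≡ reg σ a
        width : M 40 ≡ w
        count : M 41 ≡ n
        vecs  : ∀ {K} → K < 12 → ∀ i (c : Fin n) → M (addr K i (toℕ c)) ≡ fromBit (lookup (vec σ K i) c)
        nums  : ∀ {K} → K < 6 → ∀ i {c} → c < w → M (addr (12 + K) i c) ≡ num σ K i c
    open Rep public

    Scratch : ℕ → Set
    Scratch t = 42 ≤ t × t < 64

    col : (c : Fin n) → toℕ c < w
    col c = ≤-trans (Fₚ.toℕ<n c) n≤w

    vkind : ∀ {K} → K < 12 → K < 18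
    vkind l = ≤-trans l (m≤m+n 12 6)

    nkind : ∀ {K} → K < 6 → 12 + K < 18
    nkind l = +-monoʳ-< 12 l

    -- Agreement outside the scratch cells.
    rep-agree : ∀ {M M′ σ} → (∀ a → ¬ Scratch a → M′ a ≡ M a) → Rep M σ → Rep M′ σ
    rep-agree h r .regs l = trans (h _ (λ s → <⇒≱ l (≤-trans (m≤m+n 40 2) (proj₁ s)))) (regs r l)
    rep-agree h r .width = trans (h 40 (λ s → <⇒≱ (proj₁ s) (n≤1+n 40))) (width r)
    rep-agree h r .count = trans (h 41 (λ s → <⇒≱ (proj₁ s) ≤-refl)) (count r)
    rep-agree h r .vecs l i c = trans (h _ (λ s → <⇒≱ (proj₂ s) (64≤addr _ i _))) (vecs r l i c)
    rep-agree h r .nums l i c = trans (h _ (λ s → <⇒≱ (proj₂ s) (64≤addr _ i _))) (nums r l i c)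

    agree-upd : ∀ (M : Memory) t v → Scratch t → ∀ a → ¬ Scratch a → (M [ t ≔ v ]) a ≡ M a
    agree-upd M t v s a ns = upd-other M v (λ e → ns (subst Scratch (sym e) s))

    rep-scratch : ∀ {M σ} t v → Scratch t → Rep M σ → Rep (M [ t ≔ v ]) σ
    rep-scratch {M} t v s = rep-agree (agree-upd M t v s)

    rep-reg : ∀ {M σ a v} → a < 40 → Rep M σ → Rep (M [ a ≔ v ]) (setReg a v σ)
    rep-reg {M} {σ} {a} {v} l r .regs {b} l′ = cong (λ m → if does (b ≟ a) then v else m) (regs r l′)
    rep-reg {M} {a = a} {v} l r .width = trans (upd-other M v (λ e → <⇒≢ l (sym e))) (width r)
    rep-reg {M} {a = a} {v} l r .count = trans (upd-other M v (λ e → <⇒≢ (≤-trans l (n≤1+n 40)) (sym e))) (count r)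
    rep-reg {M} {a = a} {v} l r .vecs k i c = trans (upd-other M v (λ e → <⇒≱ (subst (_< 40) (sym e) l) (≤-trans (m≤m+n 40 24) (64≤addr _ i _)))) (vecs r k i c)
    rep-reg {M} {a = a} {v} l r .nums k i c = trans (upd-other M v (λ e → <⇒≱ (subst (_< 40) (sym e) l) (≤-trans (m≤m+n 40 24) (64≤addr _ i _)))) (nums r k i c)

    rep-norm : ∀ {M σ} a {v} → reg σ a ≡ v → Rep M σ → Rep M (setReg a v σ)
    rep-norm {σ = σ} a {v} e r .regs {b} l with b ≟ a
    ... | yes refl = trans (regs r l) (trans e (cong (λ z → if z then v else reg σ b) (sym (≡ᵇ-refl b))))
    ... | no ne    = trans (regs r l) (cong (λ z → if z then v else reg σ b) (sym (≡ᵇ-≢ ne)))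
    rep-norm a e r .width = width r
    rep-norm a e r .count = count r
    rep-norm a e r .vecs = vecs r
    rep-norm a e r .nums = nums r

    rep-num : ∀ {M σ K i c v} → K < 6 → c < w → Rep M σ → Rep (M [ addr (12 + K) i c ≔ v ]) (setNum K i c v σ)
    rep-num {M} {K = K} {i} {c} {v} lK lc r .regs l = trans (upd-other M v (λ e → <⇒≱ l (≤-trans (m≤m+n 40 24) (subst (64 ≤_) (sym e) (64≤addr (12 + K) i c))))) (regs r l)
    rep-num {M} {K = K} {i} {c} {v} lK lc r .width = trans (upd-other M v (λ e → <⇒≱ (n<1+n 40) (≤-trans (m≤m+n 41 23) (subst (64 ≤_) (sym e) (64≤addr (12 + K) i c))))) (width r)
    rep-num {M} {K = K} {i} {c} {v} lK lc r .count = trans (upd-other M v (λ e → <⇒≱ (n<1+n 41) (≤-trans (m≤m+n 42 22) (subst (64 ≤_) (sym e) (64≤addr (12 + K) i c))))) (count r)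
    rep-num {M} {K = K} {i} {c} {v} lK lc r .vecs {K′} l i′ c′ = trans (upd-other M v
      (λ e → <⇒≱ l (≤-trans (m≤m+n 12 K) (≤-reflexive (sym (proj₁ (addr-injective (vkind l) (nkind lK) (col c′) lc e))))))) (vecs r l i′ c′)
    rep-num {M} {σ} {K} {i} {c} {v} lK lc r .nums {K′} l i′ {c′} l′ with (K′ ≡ᵇ K) ∧ ((i′ ≡ᵇ i) ∧ (c′ ≡ᵇ c)) in eq
    ... | true with ∧-true {K′ ≡ᵇ K} eq
    ...   | e₁ , e₂₃ with ∧-true {i′ ≡ᵇ i} e₂₃
    ...     | e₂ , e₃ rewrite ≡ᵇ-true {K′} e₁ | ≡ᵇ-true {i′} e₂ | ≡ᵇ-true {c′} e₃ = upd-same M _ v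
    rep-num {M} {σ} {K} {i} {c} {v} lK lc r .nums {K′} l i′ {c′} l′ | false =
      trans (upd-other M v (λ e → differ (addr-injective (nkind l) (nkind lK) l′ lc e))) (nums r l i′ l′)
      where
      differ : ¬ (12 + K′ ≡ 12 + K × i′ ≡ i × c′ ≡ c)
      differ (e₁ , refl , refl) with +-cancelˡ-≡ 12 K′ K e₁
      ... | refl rewrite ≡ᵇ-refl K | ≡ᵇ-refl i | ≡ᵇ-refl c = case eq of λ ()

    -- M′ is M with x written from address a on, up to scratch cells.
    record Written {k} (a : ℕ) (x : Vec Bool k) (M M′ : Memory) : Set where
      field
        inside  : ∀ c → M′ (a + toℕ c) ≡ fromBit (lookup x c)
        outside : ∀ b → ¬ Scratch b → (b < a ⊎ a + k ≤ b) → M′ b ≡ M b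
    open Written public

    ¬scratch : ∀ {a} → 64 ≤ a → ¬ Scratch a
    ¬scratch l s = <⇒≱ (proj₂ s) l

    written-[] : ∀ {a M} → Written a [] M M
    written-[] .inside ()
    written-[] .outside _ _ _ = refl

    written-∷ : ∀ {k a b M M₁ M′} {x : Vec Bool k} → 64 ≤ a → M₁ a ≡ fromBit b →
                (∀ c → ¬ Scratch c → c ≢ a → M₁ c ≡ M c) → Written (suc a) x M₁ M′ → Written a (b ∷ x) M M′
    written-∷ {a = a} la e h wr .inside F.zero rewrite +-identityʳ a = trans (outside wr a (¬scratch la) (inj₁ ≤-refl)) e
    written-∷ {a = a} la e h wr .inside (F.suc c) rewrite +-suc a (toℕ c) = inside wr c
    written-∷ {a = a} la e h wr .outside b ns (inj₁ l) = trans (outside wr b ns (inj₁ (≤-trans l (n≤1+n a)))) (h b ns (<⇒≢ l))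
    written-∷ {k} {a} la e h wr .outside b ns (inj₂ l) = trans (outside wr b ns (inj₂ (subst (_≤ b) (+-suc a k) l)))
      (h b ns (λ e → <⇒≢ (≤-trans (s≤s (m≤m+n a k)) (subst (_≤ b) (+-suc a k) l)) (sym e)))

    written-write : ∀ {k} a (x : Vec Bool k) M → 64 ≤ a → Written a x M (writeVec M a x)
    written-write a []      M l = written-[]
    written-write a (b ∷ x) M l = written-∷ l (upd-same M a _) (λ c _ ne → upd-other M _ ne)
      (written-write (suc a) x (M [ a ≔ fromBit b ]) (≤-trans l (n≤1+n a)))

    -- A cell of another row that was neither before nor after the written interval would, by
    -- injectivity of addresses, belong to the row being written.
    rep-written : ∀ {M M′ σ K i x} → K < 12 → Written (addr K i 0) x M M′ → Rep M σ → Rep M′ (setVec K i x σ)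
    rep-written {M} {M′} {σ} {K} {i} {x} lK wr r = rep
      where
      low : ∀ {b} → b < 64 → b < addr K i 0
      low l = ≤-trans l (64≤addr K i 0)
      away : ∀ {K′ i′ c′} → K′ < 18 → c′ < w → ¬ (K′ ≡ K × i′ ≡ i) → M′ (addr K′ i′ c′) ≡ M (addr K′ i′ c′)
      away {K′} {i′} {c′} l lc ne with addr K′ i′ c′ <? addr K i 0
      ... | yes lt = outside wr _ (¬scratch (64≤addr K′ i′ c′)) (inj₁ lt)
      ... | no ge with addr K i 0 + n ≤? addr K′ i′ c′
      ...   | yes le = outside wr _ (¬scratch (64≤addr K′ i′ c′)) (inj₂ le)
      ...   | no nle = ⊥-elim (ne (proj₁ hit , proj₁ (proj₂ hit)))
        where
        j = addr K′ i′ c′ ∸ addr K i 0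
        j< : j < n
        j< = +-cancelˡ-< (addr K i 0) j n (subst (_< addr K i 0 + n) (sym (m+[n∸m]≡n (≮⇒≥ ge))) (≰⇒> nle))
        hit : K′ ≡ K × i′ ≡ i × c′ ≡ j
        hit = addr-injective l (vkind lK) lc (≤-trans j< n≤w)
          (trans (sym (m+[n∸m]≡n (≮⇒≥ ge))) (addr-+ K i j))
      rep : Rep M′ (setVec K i x σ)
      rep .regs {a} l = trans (outside wr a (λ s → <⇒≱ l (≤-trans (m≤m+n 40 2) (proj₁ s))) (inj₁ (low (≤-trans l (m≤m+n 40 24))))) (regs r l)
      rep .width = trans (outside wr 40 (λ s → <⇒≱ (proj₁ s) (n≤1+n 40)) (inj₁ (low (m≤m+n 41 23)))) (width r)
      rep .count = trans (outside wr 41 (λ s → <⇒≱ (proj₁ s) ≤-refl) (inj₁ (low (m≤m+n 42 22)))) (count r)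
      rep .nums {K′} l i′ l′ = trans (away (nkind l) l′ (λ h → <⇒≱ lK (≤-trans (m≤m+n 12 K′) (≤-reflexive (proj₁ h))))) (nums r l i′ l′)
      rep .vecs {K′} l i′ c with (K′ ≡ᵇ K) ∧ (i′ ≡ᵇ i) in eq
      ... | true with ∧-true {K′ ≡ᵇ K} eq
      ...   | e₁ , e₂ rewrite ≡ᵇ-true {K′} e₁ | ≡ᵇ-true {i′} e₂ = trans (cong M′ (sym (addr-+ K i (toℕ c)))) (inside wr c)
      rep .vecs {K′} l i′ c | false = trans (away (vkind l) (col c) clash) (vecs r l i′ c)
        where
        clash : ¬ (K′ ≡ K × i′ ≡ i)
        clash (refl , refl) rewrite ≡ᵇ-refl K | ≡ᵇ-refl i = case eq of λ ()

    rep-read : ∀ {M σ K i} → K < 12 → Rep M σ → readVec n M (addr K i 0) ≡ vec σ K i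
    rep-read {M} {σ} {K} {i} l r = trans (tabulate-cong (λ c → trans (cong toBit (trans (cong M (addr-+ K i (toℕ c))) (vecs r l i c))) (bit (lookup (vec σ K i) c)))) (tabulate∘lookup (vec σ K i))
      where
      bit : ∀ b → toBit (fromBit b) ≡ b
      bit false = refl
      bit true  = refl

    1<W : 1 < W
    1<W = ≤-trans (s≤s (s≤s z≤n)) 64<W

    -- The triple lifted to abstract states. The resulting state is existential because memory
    -- determines it only on the cells in use.
    record Frag {X : Set} (S : Stmt) (t q : ℕ) (σ : State n) (F : (X → Comp n) → Comp n) (Post : X → State n → Set) : Set where
      constructor sfrag
      field
        runF : ∀ {M} → Rep M σ → MFrag S t q M F (λ x M′ → Σ (State n) λ σ′ → Post x σ′ × Rep M′ σ′)
    open Frag public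

    rep63 : {X : Set} {Post : X → State n → Set} → Keeps63 (λ x M′ → Σ (State n) λ σ′ → Post x σ′ × Rep M′ σ′)
    rep63 x M (σ , p , r) = σ , p , rep-scratch {M} 63 0 (m≤m+n 42 21 , ≤-refl) r

    f-weaken : ∀ {X S t q t′ q′ σ F} {Post : X → State n → Set} → t ≤ t′ → q ≤ q′ → Frag S t q σ F Post → Frag S t′ q′ σ F Post
    f-weaken l r fr .runF rep = m-weaken l r (runF fr rep)

    f-post : ∀ {X S t q σ F} {Post Post′ : X → State n → Set} → (∀ x σ′ → Post x σ′ → Post′ x σ′) →
             Frag S t q σ F Post → Frag S t q σ F Post′
    f-post h fr .runF rep = m-post (λ { x M (σ′ , p , r) → σ′ , h x σ′ p , r }) (runF fr rep)

    f-skip : ∀ {X σ} {x : X} {Post : X → State n → Set} → Post x σ → Frag skip 0 0 σ (return x) Post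
    f-skip p .runF rep = m-skip (_ , p , rep)

    -- Overwriting a register by the value it is known to hold has no effect, but makes that value
    -- available by computation, so that later operations on the state evaluate and postconditions
    -- can close by `refl`.
    f-norm : ∀ {X S t q σ F} {Post : X → State n → Set} a {v} → reg σ a ≡ v → Frag S t q (setReg a v σ) F Post → Frag S t q σ F Post
    f-norm a e fr .runF rep = runF fr (rep-norm a e rep)

    f-seq : ∀ {X Y S T t q t₁ q₁ σ F} {G : X → (Y → Comp n) → Comp n} {Mid : X → State n → Set} {Post : Y → State n → Set} →
            Frag S t q σ F Mid → (∀ x σ′ → Mid x σ′ → Frag T t₁ q₁ σ′ (G x) Post) →
            Frag (S ⨟ T) (t + t₁) (q + q₁) σ (λ k → F (λ x → G x k)) Post
    f-seq fr gr .runF rep = m-seq (runF fr rep) λ { x M (σ′ , p , r) → runF (gr x σ′ p) r }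

    f-det : ∀ {Y S T t q t₁ q₁ σ} {F : (Y → Comp n) → Comp n} {Mid : ⊤ → State n → Set} {Post : Y → State n → Set} →
            Frag S t q σ (return tt) Mid → (∀ x σ′ → Mid x σ′ → Frag T t₁ q₁ σ′ F Post) →
            Frag (S ⨟ T) (t + t₁) (q + q₁) σ F Post
    f-det {F = F} = f-seq {G = λ _ → F}

    f-then : ∀ {X S T t q t₁ q₁ σ F} {Mid Post : X → State n → Set} →
             Frag S t q σ F Mid → (∀ x σ′ → Mid x σ′ → Frag T t₁ q₁ σ′ (return tt) (λ _ → Post x)) →
             Frag (S ⨟ T) (t + t₁) (q + q₁) σ F Post
    f-then fr gr .runF rep = m-then (runF fr rep) λ { x M (σ′ , p , r) → runF (gr x σ′ p) r }

    f-ifz : ∀ {X a S T t q σ F} {Post : X → State n → Set} → IsReg a →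
            (reg σ a ≡ 0 → Frag S t q σ F Post) → (reg σ a ≢ 0 → Frag T t q σ F Post) →
            Frag (ifz a S T) (3 + t) q σ F Post
    f-ifz l fz fn .runF rep = m-ifz rep63 (λ e → runF (fz (trans (sym (regs rep (T⇒< l))) e)) rep)
                                         (λ e → runF (fn (λ e′ → e (trans (regs rep (T⇒< l)) e′))) rep)

    f-exit : ∀ {X a S σ} {x : X} {Post : X → State n → Set} → IsReg a → reg σ a ≡ 0 → Post x σ →
             Frag (while a S) 1 0 σ (return x) Post
    f-exit l e p .runF rep = m-exit (trans (regs rep (T⇒< l)) e) (_ , p , rep)

    f-unroll : ∀ {X Y a S t q t₁ q₁ σ F} {G : X → (Y → Comp n) → Comp n} {Mid : X → State n → Set} {Post : Y → State n → Set} →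
               IsReg a → reg σ a ≢ 0 → Frag S t q σ F Mid →
               (∀ x σ′ → Mid x σ′ → Frag (while a S) t₁ q₁ σ′ (G x) Post) →
               Frag (while a S) (3 + t + t₁) (q + q₁) σ (λ k → F (λ x → G x k)) Post
    f-unroll l ne fr rest .runF rep = m-unroll rep63 (λ e → ne (trans (sym (regs rep (T⇒< l))) e)) (runF fr rep)
      λ { x M (σ′ , p , r) → runF (rest x σ′ p) r }

    -- The body itself decrements the counter. Each iteration costs three extra steps for the test
    -- and the backward jump, and the final failing test costs one.
    f-for : ∀ {X : Set} {a S t q} (G : ℕ → X → (X → Comp n) → Comp n) (Inv : ℕ → X → State n → Set) → IsReg a →
            (∀ i x σ → Inv (suc i) x σ → reg σ a ≡ suc i → Frag S t q σ (G i x) (λ y σ′ → Inv i y σ′ × reg σ′ a ≡ i)) →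
            ∀ i x σ → Inv i x σ → reg σ a ≡ i →
            Frag (while a S) (1 + i * (3 + t)) (i * q) σ (iter G i x) (λ y σ′ → Inv 0 y σ′ × reg σ′ a ≡ 0)
    f-for G Inv l body zero    x σ v e = f-exit l e (v , e)
    f-for {a = a} {S} {t} {q} G Inv l body (suc i) x σ v e = f-weaken (≤-reflexive (+-suc (3 + t) _)) ≤-refl
      (f-unroll l (λ e′ → case trans (sym e) e′ of λ ()) (body i x σ v e)
        (λ y σ′ p → f-for {t = t} {q} G Inv l body i y σ′ (proj₁ p) (proj₂ p)))

    f-halt : ∀ {X r t q σ} {Post : X → State n → Set} → Frag (ins (halt r)) (suc t) q σ (λ _ → ret r) Post
    f-halt .runF rep = m-halt

    -- Address computation: leaves addr K (idx σ i) 0 in cell 60.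
    inRange : ℕ → ℕ → ℕ → Bool
    inRange lo hi a = (lo ≤ᵇ a) ∧ (a <ᵇ hi)

    target-in : ℕ → ℕ → Instr → Bool
    target-in lo hi (const a _) = inRange lo hi a
    target-in lo hi (add a _ _) = inRange lo hi a
    target-in lo hi (sub a _ _) = inRange lo hi a
    target-in lo hi (mul a _ _) = inRange lo hi a
    target-in lo hi (load a _)  = inRange lo hi a
    target-in lo hi _           = false

    targets-in : ℕ → ℕ → List Instr → Bool
    targets-in lo hi []       = true
    targets-in lo hi (i ∷ is) = target-in lo hi i ∧ targets-in lo hi is

    private
      ∧-T : ∀ {a b} → T (a ∧ b) → T a × T b
      ∧-T {true} {true} _ = tt , tt

      in-range : ∀ {lo hi a} → T (inRange lo hi a) → lo ≤ a × a < hi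
      in-range {lo} {hi} {a} t = ≤ᵇ⇒≤ lo a (proj₁ (∧-T t)) , <ᵇ⇒< a hi (proj₂ (∧-T {lo ≤ᵇ a} t))

      kept : ∀ {lo hi} i → T (target-in lo hi i) → ∀ M b → ¬ (lo ≤ b × b < hi) → effect i M b ≡ M b
      kept (const a _) t M b nb = upd-other M _ (λ { refl → nb (in-range t) })
      kept (add a _ _) t M b nb = upd-other M _ (λ { refl → nb (in-range t) })
      kept (sub a _ _) t M b nb = upd-other M _ (λ { refl → nb (in-range t) })
      kept (mul a _ _) t M b nb = upd-other M _ (λ { refl → nb (in-range t) })
      kept (load a _)  t M b nb = upd-other M _ (λ { refl → nb (in-range t) })

    untouched : ∀ lo hi is → T (targets-in lo hi is) → ∀ M b → ¬ (lo ≤ b × b < hi) → effects is M b ≡ M b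
    untouched lo hi []       t M b nb = refl
    untouched lo hi (i ∷ is) t M b nb = trans (untouched lo hi is (proj₂ (∧-T {target-in lo hi i} t)) _ b nb)
                                              (kept i (proj₁ (∧-T t)) M b nb)

    rep-effects : ∀ is {M σ} → T (targets-in 42 64 is) → Rep M σ → Rep (effects is M) σ
    rep-effects is {M} s = rep-agree (λ a ns → untouched 42 64 is s M a ns)

    IdxOK : State n → ℕ → Maybe ℕ → Set
    IdxOK σ b nothing  = ⊤
    IdxOK σ b (just r) = reg σ r < b

    validIdx : Maybe ℕ → Bool
    validIdx nothing  = true
    validIdx (just r) = r <ᵇ 40

    private
      abstract
        addr-chain : ∀ {K i} → K < 18 → i < I → 18 * i + K ≤ (18 * i + K) * w × (18 * i + K) * w < W × (18 * i + K) * w + 64 < W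
        addr-chain {K} {i} lK li = m≤m*n _ w {{>-nonZero 0<w}} , ≤-<-trans (m≤m+n _ 64) l , l
          where l : (18 * i + K) * w + 64 < W
                l = ≤-<-trans (≤-reflexive (trans (sym (+-identityʳ _)) (sym (addr-def K i 0)))) (addr-bound lK li 0<w)

    AddrPost : ℕ → ℕ → Memory → Memory → Set
    AddrPost K i M M′ = M′ 60 ≡ addr K i 0 × (∀ b → ¬ (60 ≤ b × b < 62) → M′ b ≡ M b)

    rep-addr : ∀ {K i M M′ σ} → AddrPost K i M M′ → Rep M σ → Rep M′ σ
    rep-addr (_ , h) = rep-agree (λ a ns → h a (λ { (l , l′) → ns (≤-trans (m≤m+n 42 18) l , ≤-trans l′ (m≤m+n 62 2)) }))

    m-addr : ∀ {M σ} K i → K < 18 → T (validIdx i) → IdxOK σ I i → Rep M σ →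
             MFrag (line (addrCode K i)) 9 0 M (return tt) (λ _ M′ → AddrPost K (idx σ i) M M′)
    m-addr {M} {σ} K nothing lK v l r = m-weaken (m≤m+n 4 5) z≤n (m-post post (m-line (addrCode K nothing) safe))
      where
      K<W : K < W
      K<W = ≤-trans (m<n⇒m<1+n (≤-trans lK (m≤m+n 18 46))) 64<W
      chain = addr-chain {K} {0} lK 0<I
      safe : Safes (addrCode K nothing) M
      safe = K<W , subst (λ u → K * u < W) (sym (width r)) (proj₁ (proj₂ chain)) , 64<W ,
             subst (λ u → K * u + 64 < W) (sym (width r)) (proj₂ (proj₂ chain)) , tt
      post : ∀ _ M′ → M′ ≡ effects (addrCode K nothing) M → AddrPost K 0 M M′
      post _ _ refl = trans (cong (λ u → K * u + 64) (width r)) (trans (sym (+-identityʳ _)) (sym (addr-def K 0 0))) ,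
        untouched 60 62 (addrCode K nothing) _ M
    m-addr {M} {σ} K (just j) lK v l r = m-post post (m-line (addrCode K (just j)) safe)
      where
      Mj : (M [ 61 ≔ 0 ]) j ≡ reg σ j
      Mj = trans (upd-other M 0 (λ e → <⇒≱ (subst (_< 40) e (T⇒< v)) (m≤m+n 40 21))) (regs r (T⇒< v))
      chain = addr-chain {K} lK l
      a₁ : 18 * reg σ j + K < W
      a₁ = ≤-<-trans (proj₁ chain) (proj₁ (proj₂ chain))
      a₀ : 18 * reg σ j < W
      a₀ = ≤-<-trans (m≤m+n _ K) a₁
      safe : Safes (addrCode K (just j)) M
      safe = ≤-trans (s≤s z≤n) 64<W , subst (_< W) (sym Mj) (≤-<-trans (m≤n*m (reg σ j) 18) a₀) , ≤-trans (m≤m+n 19 46) 64<W ,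
        subst (λ u → 18 * u < W) (sym Mj) a₀ , ≤-trans (m<n⇒m<1+n (≤-trans lK (m≤m+n 18 46))) 64<W ,
        subst (λ u → 18 * u + K < W) (sym Mj) a₁ , subst₂ (λ u v → (18 * u + K) * v < W) (sym Mj) (sym (width r)) (proj₁ (proj₂ chain)) , 64<W ,
        subst₂ (λ u v → (18 * u + K) * v + 64 < W) (sym Mj) (sym (width r)) (proj₂ (proj₂ chain)) , tt
      post : ∀ _ M′ → M′ ≡ effects (addrCode K (just j)) M → AddrPost K (reg σ j) M M′
      post _ _ refl = trans (cong₂ (λ u v → (18 * u + K) * v + 64) Mj (width r)) (trans (sym (+-identityʳ _)) (sym (addr-def K (reg σ j) 0))) ,
        untouched 60 62 (addrCode K (just j)) _ M

    xor-arith : ∀ u v → (fromBit u ∸ fromBit v) + (fromBit v ∸ fromBit u) ≡ fromBit (u xor v)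
    xor-arith false false = refl
    xor-arith false true  = refl
    xor-arith true  false = refl
    xor-arith true  true  = refl

    and-arith : ∀ u v → fromBit u * fromBit v ≡ fromBit (u ∧ v)
    and-arith false v     = refl
    and-arith true  false = refl
    and-arith true  true  = refl

    record Pointers (i d a b : ℕ) (M : Memory) : Set where
      field
        counter : M 44 ≡ i
        dst     : M 45 ≡ d
        src₁    : M 46 ≡ a
        src₂    : M 47 ≡ b
    open Pointers public

    private
      scratch : ∀ t → T (inRange 42 64 t) → Scratch t
      scratch t = in-range

      outside-scratch : ∀ {a t} → 64 ≤ a → t < 64 → a ≢ t
      outside-scratch l l′ refl = <⇒≱ l′ l

      m-bit : ∀ o {i d a b u v M} → Pointers i d a b M → 64 ≤ b → M a ≡ fromBit u → M b ≡ fromBit v →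
              MFrag (line (bitCode o)) 5 0 M (return tt)
                (λ _ M′ → M′ 48 ≡ fromBit (bitOp o u v) × (∀ c → ¬ (48 ≤ c × c < 52) → M′ c ≡ M c))
      m-bit o {b = b} {u} {v} {M} ptr lb ea eb = go o
        where
        x : M (M 46) ≡ fromBit u
        x = trans (cong M (src₁ ptr)) ea
        y : (M [ 48 ≔ M (M 46) ]) (M 47) ≡ fromBit v
        y = trans (upd-other M _ (λ e → outside-scratch (subst (64 ≤_) (sym (src₂ ptr)) lb) (m≤m+n 49 15) e)) (trans (cong M (src₂ ptr)) eb)
        go : ∀ o → MFrag (line (bitCode o)) 5 0 M (return tt)
                (λ _ M′ → M′ 48 ≡ fromBit (bitOp o u v) × (∀ c → ¬ (48 ≤ c × c < 52) → M′ c ≡ M c))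
        go vxor = m-post (λ { _ _ refl → res , untouched 48 52 (bitCode vxor) _ M })
                    (m-line (bitCode vxor) (_ , _ , _ , _ , subst (_< W) (sym res) (fromBit-<W 1<W _) , tt))
          where res = trans (cong₂ (λ p q → (p ∸ q) + (q ∸ p)) x y) (xor-arith u v)
        go vand = m-weaken (m≤m+n 3 2) z≤n (m-post (λ { _ _ refl → res , (λ c nc → untouched 48 52 (bitCode vand) _ M c nc) })
                    (m-line (bitCode vand) (_ , _ , subst (_< W) (sym res) (fromBit-<W 1<W _) , tt)))
          where res = trans (cong₂ _*_ x y) (and-arith u v)

      record BodyPost (k d a b : ℕ) (z : Bool) (M M′ : Memory) : Set where
        field
          ptrs  : Pointers k (suc d) (suc a) (suc b) M′
          wrote : M′ d ≡ fromBit z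
          rest  : ∀ c → ¬ Scratch c → c ≢ d → M′ c ≡ M c
      open BodyPost

      m-body : ∀ o {k d a b u v M} → Pointers (suc k) d a b M → 64 ≤ d → 64 ≤ b → suc d < W → suc a < W → suc b < W →
               M a ≡ fromBit u → M b ≡ fromBit v →
               MFrag (vecBody o) 11 0 M (return tt) (λ _ M′ → BodyPost k d a b (bitOp o u v) M M′)
      m-body o {k} {d} {a} {b} {u} {v} {M} ptr ld lb bd ba bb ea eb =
        m-seq (m-bit o ptr lb ea eb) λ { _ M₁ (e , h) → m-seq (m-ins tt) λ { _ M₂ refl → finish M₁ e h } }
        where
        finish : ∀ M₁ → M₁ 48 ≡ fromBit (bitOp o u v) → (∀ c → ¬ (48 ≤ c × c < 52) → M₁ c ≡ M c) →
               MFrag (line advance) 5 0 (M₁ [ M₁ 45 ≔ M₁ 48 ]) (return tt) (λ _ M′ → BodyPost k d a b (bitOp o u v) M M′)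
        finish M₁ e h = m-post post (m-line advance (1<W , subst (λ z → suc z < W) (sym e45) bd , subst (λ z → suc z < W) (sym e46) ba ,
                                     subst (λ z → suc z < W) (sym e47) bb , tt , tt))
          where
          M₂ = M₁ [ M₁ 45 ≔ M₁ 48 ]
          at45 : M₁ 45 ≡ d
          at45 = trans (h 45 (λ { (l , _) → <⇒≱ (m≤m+n 46 2) l })) (dst ptr)
          low : ∀ t {z} → t < 48 → M t ≡ z → M₂ t ≡ z
          low t l ez = trans (upd-other M₁ _ (λ et → outside-scratch (subst (64 ≤_) (sym at45) ld) (≤-trans l (m≤m+n 48 16)) (sym et)))
                         (trans (h t (λ { (l′ , _) → <⇒≱ l l′ })) ez)
          e44 = low 44 (m≤m+n 45 3) (counter ptr)
          e45 = low 45 (m≤m+n 46 2) (dst ptr)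
          e46 = low 46 (m≤m+n 47 1) (src₁ ptr)
          e47 = low 47 ≤-refl (src₂ ptr)
          post : ∀ _ M′ → M′ ≡ effects advance M₂ → BodyPost k d a b (bitOp o u v) M M′
          post _ _ refl .ptrs .counter = cong (_∸ 1) e44
          post _ _ refl .ptrs .dst     = cong suc e45
          post _ _ refl .ptrs .src₁    = cong suc e46
          post _ _ refl .ptrs .src₂    = cong suc e47
          post _ _ refl .wrote = trans (untouched 42 64 advance _ M₂ d (¬scratch ld))
            (trans (cong M₂ (sym at45)) (trans (upd-same M₁ (M₁ 45) _) e))
          post _ _ refl .rest c nc ne = trans (untouched 42 64 advance _ M₂ c nc)
            (trans (upd-other M₁ _ (λ e → ne (trans e at45))) (h c (λ { (l , l′) → nc (≤-trans (m≤m+n 42 6) l , ≤-trans l′ (m≤m+n 52 12)) })))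

      Contents : ∀ {k} → ℕ → Vec Bool k → Memory → Set
      Contents a x M = ∀ c → M (a + toℕ c) ≡ fromBit (lookup x c)

      -- Writing upwards from d never destroys what is still to be read from a.
      Ahead : ℕ → ℕ → ℕ → Set
      Ahead k d a = ∀ {c c′} → c′ < c → c < k → d + c′ ≢ a + c

      m-vloop : ∀ o {k d a b} (x y : Vec Bool k) M → Pointers k d a b M → Contents a x M → Contents b y M →
                64 ≤ d → 64 ≤ a → 64 ≤ b → d + k < W → a + k < W → b + k < W → Ahead k d a → Ahead k d b →
                MFrag (while 44 (vecBody o)) (1 + k * 14) 0 M (return tt) (λ _ M′ → Written d (vop o x y) M M′)
      m-vloop o [] [] M ptr cx cy ld la lb bd ba bb ha hb = m-exit (counter ptr) written-[]
      m-vloop o {suc k} {d} {a} {b} (u ∷ x) (v ∷ y) M ptr cx cy ld la lb bd ba bb ha hb =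
        m-weaken (≤-reflexive (+-suc 14 (k * 14))) ≤-refl
          (m-unroll {Mid = λ _ M′ → BodyPost k d a b (bitOp o u v) M M′} keep (λ e → case trans (sym (counter ptr)) e of λ ())
            (m-body o ptr ld lb (bump bd) (bump ba) (bump bb)
              (trans (cong M (sym (+-identityʳ a))) (cx F.zero)) (trans (cong M (sym (+-identityʳ b))) (cy F.zero)))
            (λ { _ M₁ bp → m-post (λ _ M′ wr → written-∷ ld (wrote bp) (rest bp) wr)
              (m-vloop o x y M₁ (ptrs bp) (tail-contents M₁ bp la cx ha) (tail-contents M₁ bp lb cy hb)
                (≤-trans ld (n≤1+n d)) (≤-trans la (n≤1+n a)) (≤-trans lb (n≤1+n b))
                (subst (_< W) (+-suc d k) bd) (subst (_< W) (+-suc a k) ba) (subst (_< W) (+-suc b k) bb)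
                (ahead ha) (ahead hb)) }))
        where
        bump : ∀ {e} → e + suc k < W → suc e < W
        bump {e} l = ≤-<-trans (≤-trans (s≤s (m≤m+n e k)) (≤-reflexive (sym (+-suc e k)))) l
        keep : Keeps63 {X = ⊤} (λ _ M′ → BodyPost k d a b (bitOp o u v) M M′)
        keep _ M′ bp .ptrs .counter = counter (ptrs bp)
        keep _ M′ bp .ptrs .dst     = dst (ptrs bp)
        keep _ M′ bp .ptrs .src₁    = src₁ (ptrs bp)
        keep _ M′ bp .ptrs .src₂    = src₂ (ptrs bp)
        keep _ M′ bp .wrote = trans (upd-other M′ 0 (outside-scratch ld ≤-refl)) (wrote bp)
        keep _ M′ bp .rest c nc ne = trans (upd-other M′ 0 (λ e → nc (subst Scratch (sym e) (scratch 63 _)))) (rest bp c nc ne)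
        tail-contents : ∀ M₁ {e w} {z : Vec Bool k} → BodyPost k d a b (bitOp o u v) M M₁ → 64 ≤ e → Contents e (w ∷ z) M →
                        Ahead (suc k) d e → Contents (suc e) z M₁
        tail-contents M₁ {e} bp le ce he c = trans (cong M₁ (sym (+-suc e (toℕ c))))
          (trans (rest bp _ (¬scratch (≤-trans le (m≤m+n e _))) (λ eq → he {suc (toℕ c)} {0} (s≤s z≤n) (s≤s (Fₚ.toℕ<n c)) (trans (+-identityʳ d) (sym eq)))) (ce (F.suc c)))
        ahead : ∀ {e} → Ahead (suc k) d e → Ahead k (suc d) (suc e)
        ahead {e} h l l′ eq = h (s≤s l) (s≤s l′) (trans (+-suc d _) (trans eq (sym (+-suc e _))))

    private
      contents : ∀ {M σ K i} → K < 12 → Rep M σ → Contents (addr K i 0) (vec σ K i) M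
      contents {M} {σ} {K} {i} l r c = trans (cong M (addr-+ K i (toℕ c))) (vecs r l i c)

      -- Two rows coincide or are disjoint, so a cell already written is never one still to be read.
      -- Hence a vector operation may overwrite its own operands.
      apart : ∀ {K i K′ i′} → K < 12 → K′ < 12 → Ahead n (addr K i 0) (addr K′ i′ 0)
      apart {K} {i} {K′} {i′} l l′ c′<c c<n e =
        <⇒≢ c′<c (proj₂ (proj₂ (addr-injective (vkind l) (vkind l′) (≤-trans (<-trans c′<c c<n) n≤w) (≤-trans c<n n≤w)
          (trans (sym (addr-+ K i _)) (trans e (addr-+ K′ i′ _))))))

      row-end : ∀ {K i} → K < 12 → i < I → addr K i 0 + n < W
      row-end {K} {i} l li = subst (_< W) (sym (addr-+ K i n)) (addr-bound (vkind l) li n<w)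

      idx< : ∀ {σ} i → IdxOK σ I i → idx σ i < I
      idx< nothing  _ = 0<I
      idx< (just r) l = l

    cost-vec : ℕ
    cost-vec = 40 + n * 14

    m-vec : ∀ {M σ} o K i K₁ i₁ K₂ i₂ → K < 12 → K₁ < 12 → K₂ < 12 → T (validIdx i) → T (validIdx i₁) → T (validIdx i₂) →
            IdxOK σ I i → IdxOK σ I i₁ → IdxOK σ I i₂ → Rep M σ →
            MFrag (vecCode o K i K₁ i₁ K₂ i₂) cost-vec 0 M (return tt)
              (λ _ M′ → Rep M′ (setVec K (idx σ i) (vop o (vec σ K₁ (idx σ i₁)) (vec σ K₂ (idx σ i₂))) σ))
    m-vec {M} {σ} o K i K₁ i₁ K₂ i₂ l l₁ l₂ v v₁ v₂ h h₁ h₂ r =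
      m-weaken (≤-trans (≤-reflexive (cong (35 +_) (+-suc 0 (n * 14)))) (+-monoˡ-≤ (n * 14) (m≤m+n 36 4))) z≤n
      (m-seq (m-addr K i (vkind l) v h r) λ { _ M₁ p₁ →
       m-seq (m-line (const 61 0 ∷ add 45 61 60 ∷ []) (0<W′ , bound (proj₁ p₁) l (idx< i h) , tt)) λ { _ M₂ refl → let r₂ = rep-effects (const 61 0 ∷ add 45 61 60 ∷ []) _ (rep-addr p₁ r) in
       m-seq (m-addr K₁ i₁ (vkind l₁) v₁ h₁ r₂) λ { _ M₃ p₃ →
       m-seq (m-line (const 61 0 ∷ add 46 61 60 ∷ []) (0<W′ , bound (proj₁ p₃) l₁ (idx< i₁ h₁) , tt)) λ { _ M₄ refl → let r₄ = rep-effects (const 61 0 ∷ add 46 61 60 ∷ []) _ (rep-addr p₃ r₂) in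
       m-seq (m-addr K₂ i₂ (vkind l₂) v₂ h₂ r₄) λ { _ M₅ p₅ → let r₅ = rep-addr p₅ r₄ in
       m-seq (m-line (const 61 0 ∷ add 47 61 60 ∷ []) (0<W′ , bound (proj₁ p₅) l₂ (idx< i₂ h₂) , tt)) λ { _ M₆ refl → let r₆ = rep-effects (const 61 0 ∷ add 47 61 60 ∷ []) _ r₅ in
       m-seq (m-line (const 61 0 ∷ add 44 61 41 ∷ []) (0<W′ , subst (_< W) (sym (count r₅)) n<W , tt)) λ { _ M₇ refl → let r₇ = rep-effects (const 61 0 ∷ add 44 61 41 ∷ []) _ r₆ in
       m-post (λ _ M′ wr → rep-written l wr r₇)
         (m-vloop o (vec σ K₁ (idx σ i₁)) (vec σ K₂ (idx σ i₂)) _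
           (ptr (count r₅) (trans (below p₅ 45 (m≤m+n 46 14)) (trans (below p₃ 45 (m≤m+n 46 14)) (proj₁ p₁))) (trans (below p₅ 46 (m≤m+n 47 13)) (proj₁ p₃)) (proj₁ p₅))
           (contents l₁ r₇) (contents l₂ r₇) (64≤addr K _ 0) (64≤addr K₁ _ 0) (64≤addr K₂ _ 0)
           (row-end l (idx< i h)) (row-end l₁ (idx< i₁ h₁)) (row-end l₂ (idx< i₂ h₂)) (apart l l₁) (apart l l₂))
       } } } } } } })
      where
      0<W′ : 0 < W
      0<W′ = ≤-trans (s≤s z≤n) 64<W
      n<W : n < W
      n<W = ≤-<-trans (m≤n+m n (addr 0 0 0)) (row-end (s≤s z≤n) 0<I)
      bound : ∀ {m K i} → m ≡ addr K i 0 → K < 12 → i < I → m < W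
      bound refl l li = addr-bound (vkind l) li 0<w
      below : ∀ {K i M M′} → AddrPost K i M M′ → ∀ t → t < 60 → M′ t ≡ M t
      below p t l = proj₂ p t (λ { (l′ , _) → <⇒≱ l l′ })
      ptr : ∀ {i d a b M} → M 44 ≡ i → M 45 ≡ d → M 46 ≡ a → M 47 ≡ b → Pointers i d a b M
      ptr e₁ e₂ e₃ e₄ = record { counter = e₁ ; dst = e₂ ; src₁ = e₃ ; src₂ = e₄ }

    -- A random vector.
    private
      record RandPost (k d : ℕ) (z : Bool) (M M′ : Memory) : Set where
        field
          counter′ : M′ 44 ≡ k
          dst′     : M′ 45 ≡ suc d
          wrote    : M′ d ≡ fromBit z
          rest     : ∀ c → ¬ Scratch c → c ≢ d → M′ c ≡ M c
      open RandPost

      m-randBody : ∀ {k d M} → M 44 ≡ suc k → M 45 ≡ d → 64 ≤ d → suc d < W →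
                   MFrag randBody 5 0 M flip (λ z M′ → RandPost k d z M M′)
      m-randBody {k} {d} {M} e₁ e₂ ld bd =
        m-then (m-coin 1<W) λ { z M₁ refl → m-seq (m-ins tt) λ { _ M₂ refl →
          m-post (post z) (m-line randAdvance (1<W , subst (λ u → suc u < W) (sym (low z 45 (m≤m+n 46 2) e₂)) bd , tt , tt)) } }
        where
        M₂ : Bool → Memory
        M₂ z = M [ 48 ≔ fromBit z ] [ M 45 ≔ fromBit z ]
        low : ∀ z t {v} → t < 48 → M t ≡ v → M₂ z t ≡ v
        low z t l e = trans (upd-other (M [ 48 ≔ fromBit z ]) _ (λ e′ → <⇒≱ l (≤-trans (≤-trans (m≤m+n 48 16) ld) (≤-reflexive (trans (sym e₂) (sym e′))))))
                            (trans (upd-other M _ (<⇒≢ l)) e)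
        post : ∀ z (_ : ⊤) M′ → M′ ≡ effects randAdvance (M₂ z) → RandPost k d z M M′
        post z _ _ refl .counter′ = cong (_∸ 1) (low z 44 (m≤m+n 45 3) e₁)
        post z _ _ refl .dst′     = cong suc (low z 45 (m≤m+n 46 2) e₂)
        post z _ _ refl .wrote = trans (untouched 42 64 randAdvance _ (M₂ z) d (¬scratch ld))
          (trans (cong (M₂ z) (sym e₂)) (upd-same (M [ 48 ≔ fromBit z ]) (M 45) _))
        post z _ _ refl .rest c nc ne = trans (untouched 42 64 randAdvance _ (M₂ z) c nc)
          (trans (upd-other (M [ 48 ≔ fromBit z ]) _ (λ e → ne (trans e e₂))) (upd-other M _ (λ { refl → nc (m≤m+n 42 6 , m≤m+n 49 15) })))

      m-randLoop : ∀ k {d M} → M 44 ≡ k → M 45 ≡ d → 64 ≤ d → d + k < W →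
                   MFrag (while 44 randBody) (1 + k * 8) 0 M (randVec k) (λ x M′ → Written d x M M′)
      m-randLoop zero e₁ e₂ ld bd = m-exit e₁ written-[]
      m-randLoop (suc k) {d} {M} e₁ e₂ ld bd = m-weaken (≤-reflexive (+-suc 8 (k * 8))) ≤-refl
        (m-unroll {Mid = λ z M′ → RandPost k d z M M′} keep (λ e → case trans (sym e₁) e of λ ())
          (m-randBody e₁ e₂ ld (≤-<-trans (≤-trans (s≤s (m≤m+n d k)) (≤-reflexive (sym (+-suc d k)))) bd))
          (λ z M₁ p → rec z M₁ p))
        where
        keep : Keeps63 (λ z M′ → RandPost k d z M M′)
        keep z M′ p .counter′ = counter′ p
        keep z M′ p .dst′ = dst′ p
        keep z M′ p .wrote = trans (upd-other M′ 0 (λ e → <⇒≱ (n<1+n 63) (≤-trans ld (≤-reflexive e)))) (wrote p)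
        keep z M′ p .rest c nc ne = trans (upd-other M′ 0 (λ { refl → nc (m≤m+n 42 21 , ≤-refl) })) (rest p c nc ne)
        cons : Bool → (Vec Bool (suc k) → Comp n) → Vec Bool k → Comp n
        cons z κ x = κ (z ∷ x)
        rec : ∀ z M₁ → RandPost k d z M M₁ →
              MFrag (while 44 randBody) (1 + k * 8) 0 M₁ (λ κ → randVec k (cons z κ)) (λ x M′ → Written d x M M′)
        rec z M₁ p .apply κ c b h = apply (m-randLoop k (counter′ p) (dst′ p) (≤-trans ld (n≤1+n d)) (subst (_< W) (+-suc d k) bd))
          (cons z κ) c b (λ x M′ b′ wr → h (z ∷ x) M′ b′ (written-∷ ld (wrote p) (rest p) wr))

    cost-rand : ℕ
    cost-rand = 40 + n * 8

    private
      0<W′ : 0 < W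
      0<W′ = ≤-trans (s≤s z≤n) 64<W
      idx<′ : ∀ {σ} i → IdxOK σ I i → idx σ i < I
      idx<′ nothing  _ = 0<I
      idx<′ (just r) l = l
      end : ∀ {K i} → K < 12 → i < I → addr K i 0 + n < W
      end {K} {i} l li = subst (_< W) (sym (addr-+ K i n)) (addr-bound (vkind l) li n<w)

    -- The functional of an operation followed by a deterministic return is
    -- written out, so that posts can mention the random outcome.
    f-rand : ∀ {σ} K i → T (K <ᵇ 12) → T (validIdx i) → IdxOK σ I i →
             Frag (randCode K i) cost-rand 0 σ (randVec n) (λ x σ′ → σ′ ≡ setVec K (idx σ i) x σ)
    f-rand {σ} K i l v h .runF {M} r = m-weaken (≤-trans (≤-reflexive (cong (13 +_) (+-suc 0 (n * 8)))) (+-monoˡ-≤ (n * 8) (m≤m+n 14 26))) z≤n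
      (m-seq (m-addr K i (vkind (T⇒< l)) v h r) λ { _ M₁ p₁ →
       let r₁ = rep-addr p₁ r in
       m-seq (m-line setup (0<W′ , subst (_< W) (sym (proj₁ p₁)) (addr-bound (vkind (T⇒< l)) (idx<′ i h) 0<w) , 0<W′ , subst (_< W) (sym (count r₁)) n<W , tt))
         λ { _ M₂ refl → let r₂ = rep-effects setup _ r₁ in
       m-post (λ x M′ wr → _ , refl , rep-written (T⇒< l) wr r₂)
         (m-randLoop n (count r₁) (proj₁ p₁) (64≤addr K _ 0) (end (T⇒< l) (idx<′ i h))) } })
      where
      setup : List Instr
      setup = const 61 0 ∷ add 45 61 60 ∷ const 61 0 ∷ add 44 61 41 ∷ []
      n<W : n < W
      n<W = ≤-<-trans (m≤n+m n (addr 0 0 0)) (end (s≤s z≤n) 0<I)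

    f-draw : ∀ {σ} a K i → IsReg a → T (K <ᵇ 12) → T (validIdx i) → IdxOK σ I i →
             Frag (drawCode a K i) (10 + n) 1 σ draw (λ x σ′ → σ′ ≡ setReg a (fromBit (f x)) (setVec K (idx σ i) x σ))
    f-draw a K i la l v h .runF {M} r =
      m-weaken (≤-reflexive (+-suc 9 n)) ≤-refl (m-seq (m-addr K i (vkind (T⇒< l)) v h r) λ { _ M₁ p₁ →
        m-post (λ { x M′ refl → _ , refl , rep-reg (T⇒< la)
            (rep-written (T⇒< l) (subst (λ u → Written u x M₁ (writeVec M₁ (M₁ 60) x)) (proj₁ p₁)
               (written-write (M₁ 60) x M₁ (subst (64 ≤_) (sym (proj₁ p₁)) (64≤addr K _ 0)))) (rep-addr p₁ r)) })
          (m-draw 1<W) })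

    -- Deterministic operations.
    exec-op : Op → State n → State n
    exec-op (lit a k)     σ = setReg a k σ
    exec-op (add a b c)   σ = setReg a (reg σ b + reg σ c) σ
    exec-op (sub a b c)   σ = setReg a (reg σ b ∸ reg σ c) σ
    exec-op (mul a b c)   σ = setReg a (reg σ b * reg σ c) σ
    exec-op (div a b c)   σ = setReg a (quotient (reg σ b) (reg σ c)) σ
    exec-op (diff a b c)  σ = setReg a ((reg σ b ∸ reg σ c) + (reg σ c ∸ reg σ b)) σ
    exec-op (inc a b)     σ = setReg a (suc (reg σ b)) σ
    exec-op (dec a b)     σ = setReg a (reg σ b ∸ 1) σ
    exec-op (get a K i c) σ = setReg a (num σ K (idx σ i) (idx σ c)) σ
    exec-op (put K i c a) σ = setNum K (idx σ i) (idx σ c) (reg σ a) σ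
    exec-op (vector o K i K₁ i₁ K₂ i₂) σ = setVec K (idx σ i) (vop o (vec σ K₁ (idx σ i₁)) (vec σ K₂ (idx σ i₂))) σ
    exec-op (query a K i) σ = setReg a (fromBit (f (vec σ K (idx σ i)))) σ

    Obl : Op → State n → Set
    Obl (add a b c)   σ = reg σ b + reg σ c < W
    Obl (mul a b c)   σ = reg σ b * reg σ c < W
    Obl (inc a b)     σ = suc (reg σ b) < W
    Obl (get a K i c) σ = IdxOK σ I i × IdxOK σ w c
    Obl (put K i c a) σ = IdxOK σ I i × IdxOK σ w c
    Obl (vector o K i K₁ i₁ K₂ i₂) σ = IdxOK σ I i × IdxOK σ I i₁ × IdxOK σ I i₂
    Obl (query a K i) σ = IdxOK σ I i
    Obl _             σ = ⊤

    -- Boolean, so that for concrete code this check is settled by evaluation; only conditions on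
    -- run-time values remain in `Obl`. The limit 65 on literals comes from 64 < W.
    valid : Op → Bool
    valid (lit a k)     = (a <ᵇ 40) ∧ (k <ᵇ 65)
    valid (add a b c)   = (a <ᵇ 40) ∧ ((b <ᵇ 40) ∧ (c <ᵇ 40))
    valid (sub a b c)   = (a <ᵇ 40) ∧ ((b <ᵇ 40) ∧ (c <ᵇ 40))
    valid (mul a b c)   = (a <ᵇ 40) ∧ ((b <ᵇ 40) ∧ (c <ᵇ 40))
    valid (div a b c)   = (a <ᵇ 40) ∧ ((b <ᵇ 40) ∧ (c <ᵇ 40))
    valid (diff a b c)  = (a <ᵇ 40) ∧ ((b <ᵇ 40) ∧ (c <ᵇ 40))
    valid (inc a b)     = (a <ᵇ 40) ∧ (b <ᵇ 40)
    valid (dec a b)     = (a <ᵇ 40) ∧ (b <ᵇ 40)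
    valid (get a K i c) = (a <ᵇ 40) ∧ ((K <ᵇ 6) ∧ (validIdx i ∧ validIdx c))
    valid (put K i c a) = (a <ᵇ 40) ∧ ((K <ᵇ 6) ∧ (validIdx i ∧ validIdx c))
    valid (vector o K i K₁ i₁ K₂ i₂) = ((K <ᵇ 12) ∧ ((K₁ <ᵇ 12) ∧ (K₂ <ᵇ 12))) ∧ (validIdx i ∧ (validIdx i₁ ∧ validIdx i₂))
    valid (query a K i) = (a <ᵇ 40) ∧ ((K <ᵇ 12) ∧ validIdx i)

    queries : Op → ℕ
    queries (query _ _ _) = 1
    queries _             = 0

    -- Scalar operations take constant time, the others time O(n).
    abstract
      cost-vector : ℕ
      cost-vector = 40 + n * 14

      cost-vector-def : cost-vector ≡ 40 + n * 14
      cost-vector-def = refl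

    private
      ≤cost-vector : ∀ {t} → t ≤ 40 + n * 14 → t ≤ cost-vector
      ≤cost-vector {t} = subst (t ≤_) (sym cost-vector-def)

    cost : Op → ℕ
    cost (vector _ _ _ _ _ _ _) = cost-vector
    cost (query _ _ _)          = cost-vector
    cost _                      = 12

    private
      ∧T : ∀ {a b} → T (a ∧ b) → T a × T b
      ∧T {true} {true} _ = tt , tt

      ∧T³ : ∀ {a b c} → T (a ∧ (b ∧ c)) → T a × T b × T c
      ∧T³ {true} {true} {true} _ = tt , tt , tt

      ∧T⁴ : ∀ {a b c d} → T (a ∧ (b ∧ (c ∧ d))) → T a × T b × T c × T d
      ∧T⁴ {true} {true} {true} {true} _ = tt , tt , tt , tt

      same : ∀ {M σ a} → Rep M σ → T (a <ᵇ 40) → M a ≡ reg σ a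
      same r t = regs r (T⇒< t)

      hi≢ : ∀ {a t} → T (a <ᵇ 40) → 40 ≤ t → a ≢ t
      hi≢ l h refl = <⇒≱ (T⇒< l) h

      ColPost : ℕ → ℕ → ℕ → Memory → Memory → Set
      ColPost K i c M M′ = M′ 60 ≡ addr K i c × (∀ b → ¬ (60 ≤ b × b < 62) → M′ b ≡ M b)

      m-cell : ∀ {M σ} K i c → K < 18 → T (validIdx i) → T (validIdx c) → IdxOK σ I i → IdxOK σ w c → Rep M σ → ∀ {S F} →
               (∀ M′ → ColPost K (idx σ i) (idx σ c) M M′ → Rep M′ σ → MFrag {⊤} S 1 0 M′ (return tt) F) →
               MFrag (line (addrCode K i) ⨟ (line (colCode c) ⨟ S)) 12 0 M (return tt) F
      m-cell {M} {σ} K i nothing lK vi vc hi hc r k = m-weaken (m≤m+n 11 1) z≤n (m-seq (m-addr K i lK vi hi r) λ { _ M₁ p →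
        m-seq (m-line (const 61 0 ∷ []) (0<W′ , tt)) λ { _ M₂ refl →
          k _ (proj₁ p , λ b nb → trans (untouched 60 62 (const 61 0 ∷ []) _ M₁ b nb) (proj₂ p b nb)) (rep-effects (const 61 0 ∷ []) _ (rep-addr p r)) } })
      m-cell {M} {σ} K i (just j) lK vi vc hi hc r k = m-weaken (m≤m+n 11 1) z≤n (m-seq (m-addr K i lK vi hi r) λ { _ M₁ p →
        let e = trans (cong₂ _+_ (proj₁ p) (same (rep-addr p r) vc)) (addr-+ K (idx σ i) (reg σ j)) in
        m-seq (m-line (add 60 60 j ∷ []) (subst (_< W) (sym e) (addr-bound lK (idx<′ i hi) hc) , tt)) λ { _ M₂ refl →
          k _ (e , λ b nb → trans (untouched 60 62 (add 60 60 j ∷ []) _ M₁ b nb) (proj₂ p b nb)) (rep-effects (add 60 60 j ∷ []) _ (rep-addr p r)) } })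

      col< : ∀ {σ} c → IdxOK σ w c → idx σ c < w
      col< nothing  _ = 0<w
      col< (just r) l = l

      wk1 : ∀ {S t M} {Post : ⊤ → Memory → Set} → t ≤ 12 → MFrag S t 0 M (return tt) Post → MFrag S 12 0 M (return tt) Post
      wk1 l = m-weaken l ≤-refl

    f-op : ∀ o {σ} → T (valid o) → Obl o σ → Frag (stmt o) (cost o) (queries o) σ (return tt) (λ _ σ′ → σ′ ≡ exec-op o σ)
    f-op (lit a k) {σ} v h .runF r with ∧T {a <ᵇ 40} v
    ... | va , vk = wk1 (s≤s z≤n) (m-post (λ { _ _ refl → _ , refl , rep-reg (T⇒< va) r })
          (m-ins (≤-trans (T⇒< vk) 64<W)))
    f-op (add a b c) {σ} v h .runF {M} r with ∧T³ {a <ᵇ 40} v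
    ... | va , vb , vc = wk1 (s≤s z≤n) (m-post (λ { _ _ refl → _ , refl , subst (λ u → Rep (M [ a ≔ M b + M c ]) (setReg a u σ)) e (rep-reg (T⇒< va) r) })
          (m-ins (subst (_< W) (sym e) h)))
      where e = cong₂ _+_ (same r vb) (same r vc)
    f-op (mul a b c) {σ} v h .runF {M} r with ∧T³ {a <ᵇ 40} v
    ... | va , vb , vc = wk1 (s≤s z≤n) (m-post (λ { _ _ refl → _ , refl , subst (λ u → Rep (M [ a ≔ M b * M c ]) (setReg a u σ)) e (rep-reg (T⇒< va) r) })
          (m-ins (subst (_< W) (sym e) h)))
      where e = cong₂ _*_ (same r vb) (same r vc)
    f-op (sub a b c) {σ} v h .runF {M} r with ∧T³ {a <ᵇ 40} v
    ... | va , vb , vc = wk1 (s≤s z≤n) (m-post (λ { _ _ refl → _ , refl , subst (λ u → Rep (M [ a ≔ M b ∸ M c ]) (setReg a u σ)) e (rep-reg (T⇒< va) r) })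
          (m-ins tt))
      where e = cong₂ _∸_ (same r vb) (same r vc)
    f-op (div a b c) {σ} v h .runF {M} r with ∧T³ {a <ᵇ 40} v
    ... | va , vb , vc = wk1 (s≤s z≤n) (m-post (λ { _ _ refl → _ , refl , subst (λ u → Rep (M [ a ≔ quotient (M b) (M c) ]) (setReg a u σ)) e (rep-reg (T⇒< va) r) })
          (m-ins tt))
      where e = cong₂ quotient (same r vb) (same r vc)
    f-op (inc a b) {σ} v h .runF {M} r with ∧T {a <ᵇ 40} v
    ... | va , vb = wk1 (s≤s (s≤s z≤n)) (m-seq (m-ins 1<W) λ { _ M₁ refl → m-post (λ { _ _ refl → _ , refl ,
              subst (λ u → Rep (M [ 61 ≔ 1 ] [ a ≔ suc ((M [ 61 ≔ 1 ]) b) ]) (setReg a (suc u) σ)) e (rep-reg (T⇒< va) (rep-scratch {M} 61 1 (m≤m+n 42 19 , m≤m+n 62 2) r)) })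
          (m-ins (subst (λ u → suc u < W) (sym e) h)) })
      where e = trans (upd-other M 1 (hi≢ vb (m≤m+n 40 21))) (same r vb)
    f-op (dec a b) {σ} v h .runF {M} r with ∧T {a <ᵇ 40} v
    ... | va , vb = wk1 (s≤s (s≤s z≤n)) (m-seq (m-ins 1<W) λ { _ M₁ refl → m-post (λ { _ _ refl → _ , refl ,
              subst (λ u → Rep (M [ 61 ≔ 1 ] [ a ≔ (M [ 61 ≔ 1 ]) b ∸ 1 ]) (setReg a (u ∸ 1) σ)) e (rep-reg (T⇒< va) (rep-scratch {M} 61 1 (m≤m+n 42 19 , m≤m+n 62 2) r)) })
          (m-ins tt) })
      where e = trans (upd-other M 1 (hi≢ vb (m≤m+n 40 21))) (same r vb)
    f-op (diff a b c) {σ} v h .runF {M} r with ∧T³ {a <ᵇ 40} v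
    ... | va , vb , vc = m-bnd λ bM → wk1 (s≤s (s≤s (s≤s z≤n))) (m-seq (m-ins tt) λ { _ M₁ refl → m-seq (m-ins tt) λ { _ M₂ refl →
            m-post (λ { _ _ refl → _ , refl , subst (λ u → Rep (M₂′ [ a ≔ M₂′ 61 + M₂′ 62 ]) (setReg a u σ)) e (rep-reg (T⇒< va) r₂) })
              (m-ins (subst (_< W) (sym e) (≤-<-trans (small (reg σ b) (reg σ c)) (⊔-pres-<m (subst (_< W) (same r vb) (bM b)) (subst (_< W) (same r vc) (bM c)))))) } })
      where
      M₁′ = M [ 61 ≔ M b ∸ M c ]
      M₂′ = M₁′ [ 62 ≔ M₁′ c ∸ M₁′ b ]
      r₂ : Rep M₂′ σ
      r₂ = rep-scratch {M₁′} 62 _ (m≤m+n 42 20 , m≤m+n 63 1) (rep-scratch {M} 61 _ (m≤m+n 42 19 , m≤m+n 62 2) r)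
      e : M₂′ 61 + M₂′ 62 ≡ (reg σ b ∸ reg σ c) + (reg σ c ∸ reg σ b)
      e = cong₂ _+_ (cong₂ _∸_ (same r vb) (same r vc))
            (cong₂ _∸_ (trans (upd-other M _ (hi≢ vc (m≤m+n 40 21))) (same r vc)) (trans (upd-other M _ (hi≢ vb (m≤m+n 40 21))) (same r vb)))
      small : ∀ x y → (x ∸ y) + (y ∸ x) ≤ x ⊔ y
      small x y with ≤-total x y
      ... | inj₁ l rewrite m≤n⇒m∸n≡0 l = ≤-trans (m∸n≤m y x) (m≤n⊔m x y)
      ... | inj₂ l rewrite m≤n⇒m∸n≡0 l | +-identityʳ (x ∸ y) = ≤-trans (m∸n≤m x y) (m≤m⊔n x y)
    f-op (get a K i c) {σ} v h .runF r with ∧T⁴ {a <ᵇ 40} v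
    ... | va , vK , vi , vc = m-cell (12 + K) i c (nkind (T⇒< vK)) vi vc (proj₁ h) (proj₂ h) r
      λ { M′ (e , _) r′ → m-post (λ { _ _ refl → _ , refl , subst (λ u → Rep (M′ [ a ≔ M′ (M′ 60) ]) (setReg a u σ))
            (trans (cong M′ e) (nums r′ (T⇒< vK) _ (col< c (proj₂ h)))) (rep-reg (T⇒< va) r′) }) (m-ins tt) }
    f-op (put K i c a) {σ} v h .runF r with ∧T⁴ {a <ᵇ 40} v
    ... | va , vK , vi , vc = m-cell (12 + K) i c (nkind (T⇒< vK)) vi vc (proj₁ h) (proj₂ h) r
      λ { M′ (e , _) r′ → m-post (λ { _ _ refl → _ , refl , subst₂ (λ u z → Rep (M′ [ u ≔ M′ a ]) (setNum K _ _ z σ)) (sym e) (same r′ va)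
            (rep-num (T⇒< vK) (col< c (proj₂ h)) r′) }) (m-ins tt) }
    f-op (vector o K i K₁ i₁ K₂ i₂) v (h , h₁ , h₂) .runF r with ∧T {(K <ᵇ 12) ∧ ((K₁ <ᵇ 12) ∧ (K₂ <ᵇ 12))} v
    ... | vK , vi with ∧T³ {K <ᵇ 12} vK | ∧T³ {validIdx i} vi
    ... | k₀ , k₁ , k₂ | j₀ , j₁ , j₂ = m-weaken (≤cost-vector ≤-refl) ≤-refl (m-post (λ _ _ r′ → _ , refl , r′) (m-vec o K i K₁ i₁ K₂ i₂ (T⇒< k₀) (T⇒< k₁) (T⇒< k₂) j₀ j₁ j₂ h h₁ h₂ r))
    f-op (query a K i) {σ} v h .runF r with ∧T³ {a <ᵇ 40} v
    ... | va , vK , vi = m-weaken (≤cost-vector (≤-trans (≤-reflexive (+-suc 9 n)) (≤-trans (+-monoʳ-≤ 10 (m≤m*n n 14)) (+-monoˡ-≤ (n * 14) (m≤m+n 10 30))))) ≤-refl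
      (m-seq (m-addr K i (vkind (T⇒< vK)) vi h r) λ { _ M₁ p → let r₁ = rep-addr p r in
        m-post (λ { _ _ refl → _ , refl , subst (λ u → Rep (M₁ [ a ≔ fromBit (f (readVec n M₁ (M₁ 60))) ]) (setReg a (fromBit (f u)) σ))
            (trans (cong (readVec n M₁) (proj₁ p)) (rep-read (T⇒< vK) r₁)) (rep-reg (T⇒< va) r₁) })
          (m-query 1<W) })

    exec-ops : List Op → State n → State n
    exec-ops []       σ = σ
    exec-ops (o ∷ os) σ = exec-ops os (exec-op o σ)

    Obls : List Op → State n → Set
    Obls []       σ = ⊤
    Obls (o ∷ os) σ = Obl o σ × Obls os (exec-op o σ)

    valids : List Op → Bool
    valids []       = true
    valids (o ∷ os) = valid o ∧ valids os

    costs : List Op → ℕ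
    costs []       = 0
    costs (o ∷ os) = cost o + costs os

    queriess : List Op → ℕ
    queriess []       = 0
    queriess (o ∷ os) = queries o + queriess os

    f-ops : ∀ os {σ} → T (valids os) → Obls os σ →
            Frag (ops os) (costs os) (queriess os) σ (return tt) (λ _ σ′ → σ′ ≡ exec-ops os σ)
    f-ops []       v h = f-skip refl
    f-ops (o ∷ os) v (h , hs) = f-seq {G = λ _ → return tt} (f-op o (proj₁ (∧T v)) h)
      λ { _ _ refl → f-ops os (proj₂ (∧T {valid o} v)) hs }

    12≤cost-vector : 12 ≤ cost-vector
    12≤cost-vector = ≤cost-vector (m≤m+n 12 _)

    cost≤ : ∀ o → cost o ≤ cost-vector
    cost≤ (vector _ _ _ _ _ _ _) = ≤-refl
    cost≤ (query _ _ _)          = ≤-refl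
    cost≤ (lit _ _)              = 12≤cost-vector
    cost≤ (add _ _ _)            = 12≤cost-vector
    cost≤ (sub _ _ _)            = 12≤cost-vector
    cost≤ (mul _ _ _)            = 12≤cost-vector
    cost≤ (div _ _ _)            = 12≤cost-vector
    cost≤ (diff _ _ _)           = 12≤cost-vector
    cost≤ (inc _ _)              = 12≤cost-vector
    cost≤ (dec _ _)              = 12≤cost-vector
    cost≤ (get _ _ _ _)          = 12≤cost-vector
    cost≤ (put _ _ _ _)          = 12≤cost-vector

    costs≤ : ∀ os → costs os ≤ length os * cost-vector
    costs≤ []       = z≤n
    costs≤ (o ∷ os) = +-mono-≤ (cost≤ o) (costs≤ os)

    -- As f-ops and f-rand, with all costs in units of cost-vector.
    f-ops′ : ∀ os {σ} → T (valids os) → Obls os σ →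
             Frag (ops os) (length os * cost-vector) (queriess os) σ (return tt) (λ _ σ′ → σ′ ≡ exec-ops os σ)
    f-ops′ os v h = f-weaken (costs≤ os) ≤-refl (f-ops os v h)

    f-rand′ : ∀ {σ} K i → T (K <ᵇ 12) → T (validIdx i) → IdxOK σ I i →
              Frag (randCode K i) cost-vector 0 σ (randVec n) (λ x σ′ → σ′ ≡ setVec K (idx σ i) x σ)
    f-rand′ K i l v h = f-weaken (≤cost-vector (+-monoʳ-≤ 40 (*-monoʳ-≤ n (m≤m+n 8 6)))) ≤-refl (f-rand K i l v h)

    f-draw′ : ∀ {σ} a K i → IsReg a → T (K <ᵇ 12) → T (validIdx i) → IdxOK σ I i →
              Frag (drawCode a K i) cost-vector 1 σ draw (λ x σ′ → σ′ ≡ setReg a (fromBit (f x)) (setVec K (idx σ i) x σ))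
    f-draw′ a K i la l v h = f-weaken (≤cost-vector (+-mono-≤ (m≤m+n 10 30) (m≤m*n n 14))) ≤-refl (f-draw a K i la l v h)

    -- The test of a bit, rejecting at once if it is set.
    f-guard : ∀ {a σ} t → IsReg a → reg σ a ≡ fromBit t →
              Frag (guard a) cost-vector 0 σ (λ (k : ⊤ → Comp n) → if t then ret false else k tt) (λ _ σ′ → σ′ ≡ σ)
    f-guard false l e = f-weaken (≤-trans (m≤m+n 4 8) 12≤cost-vector) ≤-refl
      (f-ifz l (λ _ → f-weaken z≤n ≤-refl (f-skip refl)) (λ ne → ⊥-elim (ne e)))
    f-guard true l e = f-weaken (≤-trans (m≤m+n 4 8) 12≤cost-vector) ≤-refl
      (f-ifz l (λ e′ → case trans (sym e) e′ of λ ()) (λ _ → f-halt {t = 0}))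

    f-cond : ∀ {X a S T t q σ} {F G : (X → Comp n) → Comp n} {Post : X → State n → Set} b → IsReg a → reg σ a ≡ fromBit b →
             (b ≡ false → Frag S t q σ F Post) → (b ≡ true → Frag T t q σ G Post) →
             Frag (ifz a S T) (3 + t) q σ (λ k → if b then G k else F k) Post
    f-cond false l e fs ft = f-ifz l (λ _ → fs refl) (λ ne → ⊥-elim (ne e))
    f-cond true  l e fs ft = f-ifz l (λ e′ → case trans (sym e) e′ of λ ()) (λ _ → ft refl)

-- The tester as a randomised computation

module TesterAlgorithm where

  open Compilation
  open Operations
  open import Data.Nat
  open import Data.Vec using (replicate)

  infixr 6 _⊕_
  infixr 7 _⊗_

  _⊕_ _⊗_ : ∀ {n} → Vec Bool n → Vec Bool n → Vec Bool n
  _⊕_ = vop vxor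
  _⊗_ = vop vand

  zeros : ∀ {n} → Vec Bool n
  zeros = replicate _ false

  -- Trees of minimal size consistent with the samples.
  module MinSize (Y : ℕ → ℕ → Bool) (lab : ℕ → Bool) (m κ s : ℕ) where

    Path : Set
    Path = List (ℕ × Bool)

    alive : Bool → Path → ℕ → Bool
    alive a []            t = a
    alive a ((j , b) ∷ p) t = alive (a ∧ not (Y t j xor b)) p t

    tally : Bool → Path → ℕ → ℕ
    tally b p zero    = 0
    tally b p (suc t) = fromBit (alive true p t ∧ not (lab t xor b)) + tally b p t

    -- The minimum, in the form in which the machine computes it by truncated subtraction.
    minOf : ℕ → ℕ → ℕ
    minOf x y = x ∸ (x ∸ y)

    pure : Path → Bool
    pure p = minOf (tally false p m) (tally true p m) ≡ᵇ 0

    mutual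
      -- The value s + 1 stands for every size that is too large: the result is only compared with
      -- s, and the cap keeps all sums within 2s + 2.
      minSize : ℕ → Path → ℕ
      minSize r p = if pure p then 1 else split r p

      split : ℕ → Path → ℕ
      split zero    p = suc s
      split (suc r) p = scan r p κ (suc s)

      scan : ℕ → Path → ℕ → ℕ → ℕ
      scan r p zero    best = best
      scan r p (suc j) best = scan r p j (minOf best (minSize r ((j , false) ∷ p) + minSize r ((j , true) ∷ p)))

  Matrix : Set
  Matrix = ℕ → ℕ → Bool

  update : ℕ → ℕ → Bool → Matrix → Matrix
  update t j v Y t′ j′ = if (t′ ≡ᵇ t) ∧ (j′ ≡ᵇ j) then v else Y t′ j′

  module Tester {n : ℕ} (f : BoolFun n) (s d m R : ℕ) where

    -- In the block δ of the restriction of f around u, the value of x at z.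
    A : Vec Bool n → Vec Bool n → Vec Bool n → Vec Bool n → Bool
    A u δ z x = f (u ⊕ z ⊗ δ) xor f (u ⊕ (z ⊕ x) ⊗ δ)

    record Blocks : Set where
      constructor blocks
      field
        κ     : ℕ
        bu bd : ℕ → Vec Bool n
        mask  : Vec Bool n
    open Blocks public

    append : Vec Bool n → Vec Bool n → Blocks → Blocks
    append u δ (blocks κ bu bd B) =
      blocks (suc κ) (λ j → if j ≡ᵇ κ then u else bu j) (λ j → if j ≡ᵇ κ then δ else bd j) (B ⊕ δ)

    Batch : Set
    Batch = List (Vec Bool n) × Maybe (Vec Bool n)

    -- One batch has two uses: a point on which the mask changes f shows that variables are missing,
    -- and if there is none the batch is the labelled sample for the final search.
    batchStep : Vec Bool n → ℕ → Batch → (Batch → Comp n) → Comp n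
    batchStep B t (xs , bad) k = draw λ x → if f x xor f (x ⊗ B) then k (x ∷ xs , just x) else k (x ∷ xs , bad)

    -- Random bisection. The path from u to u ⊕ δ is cut at u ⊕ c ⊗ δ; since f differs at its ends,
    -- it differs across one of the two halves, and that half is kept.
    searchStep : ℕ → Vec Bool n × Vec Bool n → (Vec Bool n × Vec Bool n → Comp n) → Comp n
    searchStep i (u , δ) k = randVec n λ c →
      if f (u ⊕ c ⊗ δ) xor f u then k (u , c ⊗ δ) else k (u ⊕ c ⊗ δ , δ ⊕ c ⊗ δ)

    -- The first check is the linearity test for z ↦ f(u ⊕ z ⊗ δ), the second compares its
    -- self-corrected values at x, y and x ⊗ y, all three read with the same shift z.
    literalStep : Vec Bool n → Vec Bool n → ℕ → ⊤ → (⊤ → Comp n) → Comp n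
    literalStep u δ i _ k = randVec n λ x → randVec n λ y → randVec n λ z →
      if A u δ x y xor A u δ zeros y then ret false else
      if A u δ z (x ⊗ y) xor (A u δ z x ∧ A u δ z y) then ret false else k tt

    recheck : Vec Bool n → Vec Bool n → Vec Bool n → Bool → ℕ → ⊤ → (⊤ → Comp n) → Comp n
    recheck u δ x y i _ k = randVec n λ z → if A u δ z x xor y then ret false else k tt

    -- Disagreement with any of the R rereadings rejects instead of being put to a vote: a true
    -- literal never disagrees with itself, and a wrong first reading is exposed by almost every
    -- reread.
    evalBit : Vec Bool n → Vec Bool n → Vec Bool n → (Bool → Comp n) → Comp n
    evalBit u δ x k = randVec n λ z → iter (recheck u δ x (A u δ z x)) R tt λ _ → k (A u δ z x)

    nth : List (Vec Bool n) → ℕ → Vec Bool n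
    nth []       i       = zeros
    nth (x ∷ xs) zero    = x
    nth (x ∷ xs) (suc i) = nth xs i

    evalRow : Blocks → List (Vec Bool n) → ℕ → ℕ → Matrix → (Matrix → Comp n) → Comp n
    evalRow b xs t j Y k = evalBit (bu b j) (bd b j) (nth xs t) (λ v → k (update t j v Y))

    evalAll : Blocks → List (Vec Bool n) → ℕ → Matrix → (Matrix → Comp n) → Comp n
    evalAll b xs t = iter (evalRow b xs t) (κ b)

    decide : Blocks → List (Vec Bool n) → Matrix → Comp n
    decide b xs Y = ret (MinSize.minSize Y (λ t → f (nth xs t)) m (κ b) s d [] ≤ᵇ s)

    final : Blocks → List (Vec Bool n) → Comp n
    final b xs = iter (evalAll b xs) m (λ _ _ → false) (decide b xs)

    testBlock : Blocks → Vec Bool n × Vec Bool n → (Blocks → Comp n) → Comp n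
    testBlock b (u , δ) k = iter (literalStep u δ) R tt λ _ → k (append u δ b)

    -- With this δ the point u ⊕ δ is x ⊗ `mask`, so the witness x provides the sensitivity that the
    -- search starts from, and δ avoids the mask.
    newBlock : Blocks → Vec Bool n → (Blocks → Comp n) → Comp n
    newBlock b x k = iter searchStep R (x , x ⊕ x ⊗ mask b) λ y → testBlock b y k

    afterBatch : Blocks → Batch → (Blocks ⊎ List (Vec Bool n) → Comp n) → Comp n
    afterBatch b (xs , nothing) k = k (inj₂ xs)
    afterBatch b (xs , just x)  k = newBlock b x (λ b′ → k (inj₁ b′))

    Outcome : Set
    Outcome = Maybe (Blocks × List (Vec Bool n))

    rounds : ℕ → Blocks → (Outcome → Comp n) → Comp n
    continue : ℕ → Blocks → Blocks ⊎ List (Vec Bool n) → (Outcome → Comp n) → Comp n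

    rounds zero    b k = k nothing
    rounds (suc r) b k = iter (batchStep (mask b)) m ([] , nothing) λ y → afterBatch b y λ o → continue r b o k

    continue r b (inj₁ b′) k = rounds r b′ k
    continue r b (inj₂ xs) k = k (just (b , xs))

    finish : Outcome → Comp n
    finish nothing         = ret false
    finish (just (b , xs)) = final b xs

    noBlocks : Blocks
    noBlocks = blocks 0 (λ _ → zeros) (λ _ → zeros) zeros

    tester : Comp n
    tester = rounds s noBlocks finish

-- Code of the subroutines

module Subroutines where

  open Compilation
  open Operations
  open TesterAlgorithm
  open import Data.Nat
  open import Data.Nat.Properties
  open import Data.Nat.Tactic.RingSolver using (solve-∀)

  zeroth : Maybe ℕ
  zeroth = nothing

  aliveOps : List Op
  aliveOps = dec 27 26 ∷ get 16 2 (just 27) zeroth ∷ get 17 1 (just 12) (just 16) ∷ get 18 3 (just 27) zeroth ∷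
             diff 17 17 18 ∷ lit 31 1 ∷ sub 17 31 17 ∷ mul 28 28 17 ∷ dec 26 26 ∷ []

  -- Stack rows store the branching variable shifted by one, so that 0 means exhausted. `pushOps`
  -- makes a new row look like the return of a fictitious second child, with nothing gained, so that
  -- one piece of code both starts and continues the scan over the variables.
  countOps₁ countOps₂ pushOps advanceOps bit0Ops bit1Ops : List Op
  countOps₁  = dec 12 11 ∷ lit 28 1 ∷ lit 31 0 ∷ sub 26 22 31 ∷ []
  countOps₂  = get 16 0 (just 12) zeroth ∷ mul 17 28 16 ∷ add 25 17 25 ∷ lit 31 1 ∷ sub 16 31 16 ∷ mul 17 28 16 ∷ add 24 17 24 ∷ dec 11 11 ∷ []
  pushOps    = inc 16 9 ∷ put 2 (just 22) zeroth 16 ∷ lit 16 1 ∷ put 3 (just 22) zeroth 16 ∷ put 4 (just 22) zeroth 8 ∷ put 5 (just 22) zeroth 8 ∷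
               lit 23 0 ∷ lit 21 1 ∷ inc 22 22 ∷ []
  bit0Ops    = put 5 (just 22) zeroth 23 ∷ lit 16 1 ∷ put 3 (just 22) zeroth 16 ∷ inc 22 22 ∷ lit 21 0 ∷ []
  bit1Ops    = get 16 5 (just 22) zeroth ∷ add 16 16 23 ∷ get 17 4 (just 22) zeroth ∷ sub 18 17 16 ∷ sub 17 17 18 ∷ put 4 (just 22) zeroth 17 ∷
               get 16 2 (just 22) zeroth ∷ dec 16 16 ∷ []
  advanceOps = put 2 (just 22) zeroth 16 ∷ lit 18 0 ∷ put 3 (just 22) zeroth 18 ∷ inc 22 22 ∷ lit 21 0 ∷ []

  -- The recursion of `minSize` as one flat loop with an explicit stack: register 20 says whether to
  -- go on, 21 whether a node is entered or returned to, 22 is the level and 23 the returned size.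
  aliveLoop countBody countLoop enterCode retCode dfsBody dfsCode : Stmt
  aliveLoop = while 26 (ops aliveOps)
  countBody = ops countOps₁ ⨟ (aliveLoop ⨟ ops countOps₂)
  countLoop = while 11 countBody
  enterCode = ops (lit 24 0 ∷ lit 25 0 ∷ lit 31 0 ∷ sub 11 7 31 ∷ []) ⨟ (countLoop ⨟ (ops (sub 16 24 25 ∷ sub 16 24 16 ∷ []) ⨟
              ifz 16 (ops (lit 23 1 ∷ lit 21 1 ∷ []))
                     (ops (sub 17 2 22 ∷ []) ⨟ ifz 17 (ops (lit 31 0 ∷ sub 23 8 31 ∷ lit 21 1 ∷ [])) (ops pushOps))))
  retCode   = ifz 22 (ops (lit 20 0 ∷ []))
                     (ops (dec 22 22 ∷ get 16 3 (just 22) zeroth ∷ []) ⨟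
                      ifz 16 (ops bit0Ops)
                             (ops bit1Ops ⨟ ifz 16 (ops (lit 31 0 ∷ sub 23 17 31 ∷ [])) (ops advanceOps)))
  dfsBody   = ifz 21 enterCode retCode
  dfsCode   = while 20 dfsBody

  -- Rows are copied by taking the conjunction of a vector with itself.
  ⊗-idem : ∀ {n} (x : Vec Bool n) → x ⊗ x ≡ x
  ⊗-idem []          = refl
  ⊗-idem (false ∷ x) = cong (false ∷_) (⊗-idem x)
  ⊗-idem (true ∷ x)  = cong (true ∷_) (⊗-idem x)

  -- The bit A of the block whose index is in register j, with z in row (K , zeroth)
  -- and x in row (K₁ , i₁).
  evalPre : ℕ → ℕ → ℕ → Maybe ℕ → List Op
  evalPre j K K₁ i₁ =
    vector vand 3 zeroth K zeroth 10 (just j) ∷ vector vxor 3 zeroth 9 (just j) 3 zeroth ∷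
    vector vxor 4 zeroth K zeroth K₁ i₁ ∷ vector vand 4 zeroth 4 zeroth 10 (just j) ∷ vector vxor 4 zeroth 9 (just j) 4 zeroth ∷
    query 31 3 zeroth ∷ query 32 4 zeroth ∷ []

  batchOps searchOps₁ moveOps narrowOps newOps startOps : List Op
  batchOps   = put 0 (just 12) zeroth 16 ∷ vector vand 3 zeroth 11 (just 12) 0 zeroth ∷ query 17 3 zeroth ∷ diff 18 16 17 ∷ []
  searchOps₁ = vector vand 3 zeroth 5 zeroth 2 zeroth ∷ vector vxor 4 zeroth 1 zeroth 3 zeroth ∷ query 16 4 zeroth ∷ query 17 1 zeroth ∷ diff 18 16 17 ∷ []
  moveOps    = vector vand 1 zeroth 4 zeroth 4 zeroth ∷ vector vxor 2 zeroth 2 zeroth 3 zeroth ∷ []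
  narrowOps  = vector vand 2 zeroth 3 zeroth 3 zeroth ∷ []
  newOps     = vector vand 3 zeroth 1 zeroth 0 zeroth ∷ vector vxor 2 zeroth 1 zeroth 3 zeroth ∷ lit 31 0 ∷ sub 15 6 31 ∷ []
  startOps   = vector vand 9 (just 9) 1 zeroth 1 zeroth ∷ vector vand 10 (just 9) 2 zeroth 2 zeroth ∷ vector vxor 0 zeroth 0 zeroth 2 zeroth ∷ lit 31 0 ∷ sub 15 6 31 ∷ []

  evalCode : ℕ → ℕ → ℕ → ℕ → Maybe ℕ → Stmt
  evalCode a j K K₁ i₁ = ops (evalPre j K K₁ i₁) ⨟ ops (diff a 31 32 ∷ [])

  batchBody : Stmt
  batchBody = ops (dec 12 11 ∷ []) ⨟ (drawCode 16 11 (just 12) ⨟ (ops batchOps ⨟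
              (ifz 18 skip (ops (vector vand 1 zeroth 11 (just 12) 11 (just 12) ∷ lit 19 1 ∷ [])) ⨟ ops (dec 11 11 ∷ []))))

  searchBody : Stmt
  searchBody = randCode 5 zeroth ⨟ (ops searchOps₁ ⨟ (ifz 18 (ops moveOps) (ops narrowOps) ⨟ ops (dec 15 15 ∷ [])))

  literalBody : Stmt
  literalBody = randCode 5 zeroth ⨟ (randCode 6 zeroth ⨟ (randCode 7 zeroth ⨟
    (evalCode 16 9 5 6 zeroth ⨟ (evalCode 17 9 8 6 zeroth ⨟ (ops (diff 18 16 17 ∷ []) ⨟ (guard 18 ⨟
    (ops (vector vand 4 zeroth 5 zeroth 6 zeroth ∷ []) ⨟ (evalCode 16 9 7 4 zeroth ⨟ (evalCode 17 9 7 5 zeroth ⨟ (evalCode 18 9 7 6 zeroth ⨟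
    (ops (mul 17 17 18 ∷ diff 18 16 17 ∷ []) ⨟ (guard 18 ⨟ ops (dec 15 15 ∷ [])))))))))))))

  recheckBody evalBody evalRows : Stmt
  recheckBody = randCode 7 zeroth ⨟ (evalCode 17 14 7 11 (just 12) ⨟ (ops (diff 18 17 16 ∷ []) ⨟ (guard 18 ⨟ ops (dec 15 15 ∷ []))))
  evalBody    = ops (dec 14 13 ∷ []) ⨟ (randCode 7 zeroth ⨟ (evalCode 16 14 7 11 (just 12) ⨟
                (ops (put 1 (just 12) (just 13) 16 ∷ lit 31 0 ∷ sub 15 6 31 ∷ []) ⨟ (while 15 recheckBody ⨟ ops (dec 13 13 ∷ [])))))
  evalRows    = ops (dec 12 11 ∷ lit 31 0 ∷ sub 13 9 31 ∷ []) ⨟ (while 13 evalBody ⨟ ops (dec 11 11 ∷ []))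

  finalCode : Stmt
  finalCode = ops (lit 31 0 ∷ sub 11 7 31 ∷ []) ⨟ (while 11 evalRows ⨟ ((ops (lit 20 1 ∷ lit 21 0 ∷ lit 22 0 ∷ []) ⨟ dfsCode) ⨟
              (ops (sub 16 23 1 ∷ []) ⨟ ifz 16 (ins (halt true)) (ins (halt false)))))

  newCode roundBody : Stmt
  newCode   = ops newOps ⨟ (while 15 searchBody ⨟ (ops startOps ⨟ (while 15 literalBody ⨟ ops (inc 9 9 ∷ dec 10 10 ∷ lit 19 1 ∷ []))))
  roundBody = ops (lit 19 0 ∷ lit 31 0 ∷ sub 11 7 31 ∷ []) ⨟ (while 11 batchBody ⨟ ifz 19 (ops (lit 10 0 ∷ [])) newCode)

  module RoundProgram {n : ℕ} (f : BoolFun n) (W w I : ℕ) (n<w : n < w) (0<I : 0 < I) (64<W : 64 < W) (space : 64 + 18 * I * w ≤ W)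
                     (s d m R : ℕ) (s<w : s < w) (m<I : m < I) (d<I : d < I) (2s<I : suc s + suc s < I) where

    open OpSemantics f W w I n<w 0<I 64<W space public

    f-zero : ∀ {X a S T t q σ F} {Post : X → State n → Set} → IsReg a → reg σ a ≡ 0 → Frag S t q σ F Post → Frag (ifz a S T) (3 + t) q σ F Post
    f-zero l e fr = f-ifz l (λ _ → fr) (λ ne → ⊥-elim (ne e))

    f-suc : ∀ {X a S T t q σ F k} {Post : X → State n → Set} → IsReg a → reg σ a ≡ suc k → Frag T t q σ F Post → Frag (ifz a S T) (3 + t) q σ F Post
    f-suc l e fr = f-ifz l (λ e′ → case trans (sym e) e′ of λ ()) (λ _ → fr)

    I≤W : I ≤ W
    I≤W = ≤-trans (m≤n*m I 18) (≤-trans (m≤m*n (18 * I) w {{>-nonZero 0<w}}) (≤-trans (m≤n+m _ 64) space))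

    -- Correctness and cost of the depth-first search

    module Search (κ : ℕ) (κ≤s : κ ≤ s) (Y : ℕ → ℕ → Bool) (lab : ℕ → Bool) where

      open MinSize Y lab m κ s public

      Base : State n → Set
      Base σ = reg σ 1 ≡ s × reg σ 2 ≡ d × reg σ 7 ≡ m × reg σ 8 ≡ suc s × reg σ 9 ≡ κ × reg σ 20 ≡ 1 ×
               (∀ t → t < m → num σ 0 t 0 ≡ fromBit (lab t)) × (∀ t j → num σ 1 t (suc j) ≡ fromBit (Y t j))

      -- The head of the path is the deepest decision, so it sits in the stack row whose index is
      -- the length of the rest.
      StackOK : Path → (ℕ → ℕ → ℕ → ℕ) → Set
      StackOK []            g = ⊤
      StackOK ((j , b) ∷ p) g = j < κ × g 2 (length p) 0 ≡ suc j × g 3 (length p) 0 ≡ fromBit b × StackOK p g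

      -- Registers live during the scan of the samples.
      Ctx : ℕ → ℕ → ℕ → ℕ → State n → State n → Set
      Ctx l t c₀ c₁ σ₀ σ = reg σ 1 ≡ s × reg σ 2 ≡ d × reg σ 7 ≡ m × reg σ 8 ≡ suc s × reg σ 9 ≡ κ × reg σ 20 ≡ 1 ×
        reg σ 22 ≡ l × reg σ 11 ≡ t × reg σ 24 ≡ c₀ × reg σ 25 ≡ c₁ × num σ ≡ num σ₀

      fromBit-not : ∀ a → 1 ∸ fromBit a ≡ fromBit (not a)
      fromBit-not false = refl
      fromBit-not true  = refl

      alive-frag : ∀ p {l c₀ c₁ t σ₀} a {σ} → t < m → length p ≤ d → Ctx l (suc t) c₀ c₁ σ₀ σ → reg σ 12 ≡ t → reg σ 26 ≡ length p → reg σ 28 ≡ fromBit a →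
        (∀ t j → num σ 1 t (suc j) ≡ fromBit (Y t j)) → StackOK p (num σ) →
        Frag aliveLoop (1 + length p * 111) 0 σ (return tt) (λ _ σ′ → Ctx l (suc t) c₀ c₁ σ₀ σ′ × reg σ′ 12 ≡ t × reg σ′ 28 ≡ fromBit (alive a p t))
      alive-frag [] a t<m l≤ ctx e12 e26 e28 yok sok = f-exit _ e26 (ctx , e12 , e28)
      alive-frag ((j , b) ∷ p) {l} {c₀} {c₁} {t} {σ₀} a {σ} t<m l≤ ctx e12 e26 e28 yok (j<κ , ej , eb , sok) =
        f-weaken (≤-reflexive (+-suc 111 (length p * 111))) ≤-refl
        (f-norm 12 e12 (f-norm 26 e26 (f-norm 28 e28
          (f-unroll _ (λ ())
            (f-ops aliveOps _ (_ , (i<I , _) , (t<I , col<) , (i<I , _) , _ , _ , _ , mul< , _ , _))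
            λ { _ _ refl → alive-frag p {l} {c₀} {c₁} {t} {σ₀} (a ∧ not (Y t j xor b)) t<m (≤-trans (n≤1+n _) l≤) ctx refl refl bit yok sok }))))
        where
        i<I : length p < I
        i<I = ≤-trans l≤ (<⇒≤ d<I)
        t<I : t < I
        t<I = <-trans t<m m<I
        -- The shifted variable number taken from the stack is itself used as the column of the
        -- matrix row, so it must stay below the row width.
        col< : num σ 2 (length p) 0 < w
        col< = subst (_< w) (sym ej) (≤-<-trans (≤-trans j<κ κ≤s) s<w)
        value : num σ 1 t (num σ 2 (length p) 0) ≡ fromBit (Y t j)
        value = trans (cong (num σ 1 t) ej) (yok t j)
        bit : fromBit a * (1 ∸ ((num σ 1 t (num σ 2 (length p) 0) ∸ num σ 3 (length p) 0) + (num σ 3 (length p) 0 ∸ num σ 1 t (num σ 2 (length p) 0)))) ≡ fromBit (a ∧ not (Y t j xor b))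
        bit rewrite value | eb = trans (cong (λ u → fromBit a * (1 ∸ u)) (xor-arith (Y t j) b))
          (trans (cong (fromBit a *_) (fromBit-not (Y t j xor b))) (and-arith a _))
        mul< : fromBit a * (1 ∸ ((num σ 1 t (num σ 2 (length p) 0) ∸ num σ 3 (length p) 0) + (num σ 3 (length p) 0 ∸ num σ 1 t (num σ 2 (length p) 0)))) < W
        mul< = subst (_< W) (sym bit) (fromBit-<W 1<W _)

      ok : Path → Bool → ℕ → ℕ
      ok p b t = fromBit (alive true p t ∧ not (lab t xor b))

      count-frag : ∀ t p {c₀ c₁ σ₀ σ} → t ≤ m → c₀ + t ≤ m → c₁ + t ≤ m → length p ≤ d → Ctx (length p) t c₀ c₁ σ₀ σ →
        (∀ t → t < m → num σ 0 t 0 ≡ fromBit (lab t)) → (∀ t j → num σ 1 t (suc j) ≡ fromBit (Y t j)) → StackOK p (num σ) →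
        Frag countLoop (1 + t * (148 + length p * 111)) 0 σ (return tt)
          (λ _ σ′ → Ctx (length p) 0 (c₀ + tally false p t) (c₁ + tally true p t) σ₀ σ′)
      count-frag zero p {c₀} {c₁} t≤m b₀ b₁ l≤ ctx@(x1 , x2 , x7 , x8 , x9 , x20 , x22 , x11 , x24 , x25 , xn) lok yok sok =
        f-exit _ x11 (x1 , x2 , x7 , x8 , x9 , x20 , x22 , x11 , trans x24 (sym (+-identityʳ c₀)) , trans x25 (sym (+-identityʳ c₁)) , xn)
      count-frag (suc t) p {c₀} {c₁} {σ₀} {σ} t≤m b₀ b₁ l≤ ctx@(x1 , x2 , x7 , x8 , x9 , x20 , x22 , x11 , x24 , x25 , xn) lok yok sok =
        f-weaken (≤-reflexive cost-eq) ≤-refl (f-norm 11 x11 (f-norm 22 x22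
         (f-unroll {Mid = λ _ σ′ → Ctx (length p) t (c₀ + ok p false t) (c₁ + ok p true t) σ₀ σ′} _ (λ ()) body
           λ { _ σ′ ctx′@(_ , _ , _ , _ , _ , _ , _ , _ , _ , _ , yn) →
             f-post (λ { _ _ (y1 , y2 , y7 , y8 , y9 , y20 , y22 , y11 , y24 , y25 , yn′) →
               y1 , y2 , y7 , y8 , y9 , y20 , y22 , y11 , trans y24 (+-assoc c₀ _ _) , trans y25 (+-assoc c₁ _ _) , yn′ })
             (count-frag t p {c₀ + ok p false t} {c₁ + ok p true t} {σ₀} {σ′} (<⇒≤ t≤m)
               (step≤ c₀ (ok p false t) (bit≤1 (alive true p t ∧ not (lab t xor false))) b₀) (step≤ c₁ (ok p true t) (bit≤1 (alive true p t ∧ not (lab t xor true))) b₁) l≤ ctx′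
               (subst (λ g → ∀ t → t < m → g 0 t 0 ≡ fromBit (lab t)) (trans xn (sym yn)) lok)
               (subst (λ g → ∀ t j → g 1 t (suc j) ≡ fromBit (Y t j)) (trans xn (sym yn)) yok)
               (subst (StackOK p) (trans xn (sym yn)) sok)) })))
        where
        cost-eq : 3 + (48 + ((1 + length p * 111) + 96)) + (1 + t * (148 + length p * 111)) ≡ 1 + (148 + length p * 111 + t * (148 + length p * 111))
        cost-eq = cong (52 +_) (trans (cong (_+ (1 + t * (148 + length p * 111))) (+-comm (length p * 111) 96))
                    (trans (+-suc (96 + length p * 111) _) refl))
        bit≤1 : ∀ b → fromBit b ≤ 1
        bit≤1 false = z≤n
        bit≤1 true  = ≤-refl
        step≤ : ∀ c u → u ≤ 1 → c + suc t ≤ m → c + u + t ≤ m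
        step≤ c u l h = ≤-trans (≤-reflexive (+-assoc c u t)) (≤-trans (+-monoʳ-≤ c (+-monoˡ-≤ t l)) h)
        body : Frag countBody (48 + ((1 + length p * 111) + 96)) 0 (setReg 22 (length p) (setReg 11 (suc t) σ)) (return tt)
                 (λ _ σ′ → Ctx (length p) t (c₀ + ok p false t) (c₁ + ok p true t) σ₀ σ′)
        body = f-det (f-ops countOps₁ _ _) λ { _ _ refl →
          f-det (alive-frag p {length p} {c₀} {c₁} {t} {σ₀} true t≤m l≤ (x1 , x2 , x7 , x8 , x9 , x20 , refl , refl , x24 , x25 , xn) refl refl refl yok sok)
          λ { _ σ₁ ((y1 , y2 , y7 , y8 , y9 , y20 , y22 , y11 , y24 , y25 , yn) , y12 , y28) →
          f-norm 12 y12 (f-norm 28 y28 (f-norm 24 y24 (f-norm 25 y25 (f-norm 11 y11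
            (let v = trans (cong (λ g → g 0 t 0) (trans yn (sym xn))) (lok t t≤m) in
            f-post (λ { _ _ refl → y1 , y2 , y7 , y8 , y9 , y20 , y22 , refl , sum₀ σ₁ v , sum₁ σ₁ v , yn })
              (f-ops countOps₂ _ ((<-trans t≤m m<I , _) , small₁ σ₁ v , subst (_< W) (sym (trans (sum₁ σ₁ v) refl)) (final< c₁ (ok p true t) (bit≤1 (alive true p t ∧ not (lab t xor true))) b₁) , _ , _ ,
                 small₀ σ₁ v , subst (_< W) (sym (sum₀ σ₁ v)) (final< c₀ (ok p false t) (bit≤1 (alive true p t ∧ not (lab t xor false))) b₀) , _ , tt)))))))
          } }
          where
          al = alive true p t
          prod₁ : ∀ σ₁ → num σ₁ 0 t 0 ≡ fromBit (lab t) → fromBit al * num σ₁ 0 t 0 ≡ ok p true t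
          prod₁ σ₁ v = trans (cong (fromBit al *_) v) (trans (and-arith al (lab t)) (cong (λ u → fromBit (al ∧ u)) (flip-true (lab t))))
            where flip-true : ∀ b → b ≡ not (b xor true)
                  flip-true false = refl
                  flip-true true  = refl
          prod₀ : ∀ σ₁ → num σ₁ 0 t 0 ≡ fromBit (lab t) → fromBit al * (1 ∸ num σ₁ 0 t 0) ≡ ok p false t
          prod₀ σ₁ v = trans (cong (λ u → fromBit al * (1 ∸ u)) v) (trans (cong (fromBit al *_) (fromBit-not (lab t))) (trans (and-arith al (not (lab t))) (cong (λ u → fromBit (al ∧ not u)) (same-false (lab t)))))
            where same-false : ∀ b → b ≡ b xor false
                  same-false false = refl
                  same-false true  = refl
          sum₁ : ∀ σ₁ → num σ₁ 0 t 0 ≡ fromBit (lab t) → fromBit al * num σ₁ 0 t 0 + c₁ ≡ c₁ + ok p true t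
          sum₁ σ₁ v = trans (cong (_+ c₁) (prod₁ σ₁ v)) (+-comm _ c₁)
          sum₀ : ∀ σ₁ → num σ₁ 0 t 0 ≡ fromBit (lab t) → fromBit al * (1 ∸ num σ₁ 0 t 0) + c₀ ≡ c₀ + ok p false t
          sum₀ σ₁ v = trans (cong (_+ c₀) (prod₀ σ₁ v)) (+-comm _ c₀)
          small₁ : ∀ σ₁ → num σ₁ 0 t 0 ≡ fromBit (lab t) → fromBit al * num σ₁ 0 t 0 < W
          small₁ σ₁ v = subst (_< W) (sym (prod₁ σ₁ v)) (fromBit-<W 1<W _)
          small₀ : ∀ σ₁ → num σ₁ 0 t 0 ≡ fromBit (lab t) → fromBit al * (1 ∸ num σ₁ 0 t 0) < W
          small₀ σ₁ v = subst (_< W) (sym (prod₀ σ₁ v)) (fromBit-<W 1<W _)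
          final< : ∀ c u → u ≤ 1 → c + suc t ≤ m → c + u < W
          final< c u l h = ≤-<-trans (≤-trans (m≤m+n (c + u) t) (step≤ c u l h)) (<-≤-trans m<I I≤W)

      minOf≤ : ∀ x y → minOf x y ≤ x
      minOf≤ x y = m∸n≤m x (x ∸ y)

      scan≤ : ∀ r p j best → scan r p j best ≤ best
      scan≤ r p zero    best = ≤-refl
      scan≤ r p (suc j) best = ≤-trans (scan≤ r p j _) (minOf≤ best (minSize r ((j , false) ∷ p) + minSize r ((j , true) ∷ p)))

      minSize≤ : ∀ r p → minSize r p ≤ suc s
      minSize≤ r p with pure p
      ... | true = s≤s z≤n
      minSize≤ zero    p | false = ≤-refl
      minSize≤ (suc r) p | false = scan≤ r p κ (suc s)

      Grid : Set
      Grid = ℕ → ℕ → ℕ → ℕ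

      KeepRow : ℕ → Grid → Grid → Set
      KeepRow i g g′ = g′ 2 i 0 ≡ g 2 i 0 × g′ 3 i 0 ≡ g 3 i 0 × g′ 4 i 0 ≡ g 4 i 0 × g′ 5 i 0 ≡ g 5 i 0

      -- The frame condition of a recursive call at level l: it may use the stack from row l
      -- upwards, but leaves its callers' rows alone.
      record Keep (l : ℕ) (g g′ : Grid) : Set where
        constructor keep
        field below : ∀ i → i < l → KeepRow i g g′
      open Keep

      keep-trans : ∀ {l l′ g g′ g″} → l ≤ l′ → Keep l g g′ → Keep l′ g′ g″ → Keep l g g″
      keep-trans h k k′ .below i l with below k i l | below k′ i (≤-trans l h)
      ... | a , b , c , d | a′ , b′ , c′ , d′ = trans a′ a , trans b′ b , trans c′ c , trans d′ d

      keep-weak : ∀ {l g g′} → Keep (suc l) g g′ → Keep l g g′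
      keep-weak k .below i l = below k i (m<n⇒m<1+n l)

      keep-≡ : ∀ {l g g′} → g′ ≡ g → Keep l g g′
      keep-≡ refl .below i _ = refl , refl , refl , refl

      stack-keep : ∀ p {g g′} → Keep (length p) g g′ → StackOK p g → StackOK p g′
      stack-keep []      k so = tt
      stack-keep (_ ∷ p) k (a , b , c , so) with below k (length p) ≤-refl
      ... | e₂ , e₃ , _ = a , trans e₂ b , trans e₃ c , stack-keep p (keep-weak k) so

      EnterAt : ℕ → State n → Set
      EnterAt l σ = reg σ 21 ≡ 0 × reg σ 22 ≡ l

      RetAt : ℕ → ℕ → State n → Set
      RetAt l v σ = reg σ 21 ≡ 1 × reg σ 22 ≡ l × reg σ 23 ≡ v

      -- Row l of the stack: the branching variable, the side under
      -- examination, the best size so far and the size of the other side.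
      Row : ℕ → ℕ → ℕ → ℕ → ℕ → Grid → Set
      Row l v b best acc g = g 2 l 0 ≡ v × g 3 l 0 ≡ b × g 4 l 0 ≡ best × g 5 l 0 ≡ acc

      private
        hit : ∀ l {v u : ℕ} → (if (l ≡ᵇ l) ∧ true then v else u) ≡ v
        hit l {v} {u} = cong (λ z → if z ∧ true then v else u) (≡ᵇ-refl l)

        miss : ∀ {i l} {v u : ℕ} → i < l → (if (i ≡ᵇ l) ∧ true then v else u) ≡ u
        miss {v = v} {u} h = cong (λ z → if z ∧ true then v else u) (≡ᵇ-≢ (<⇒≢ h))

        f-step : ∀ {c t σ} {Mid : ⊤ → State n → Set} {Post : ⊤ → State n → Set} → reg σ 20 ≡ 1 →
                 Frag dfsBody c 0 σ (return tt) Mid → (∀ x σ′ → Mid x σ′ → Frag dfsCode t 0 σ′ (return tt) Post) →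
                 Frag dfsCode (3 + c + t) 0 σ (return tt) Post
        f-step e fr k = f-unroll {G = λ _ → return tt} _ (λ e′ → case trans (sym e) e′ of λ ()) fr k

      scanCost : ℕ → ℕ
      scanCost l = 1 + m * (148 + l * 111)

      enterCost : ℕ → ℕ
      enterCost l = 51 + (scanCost l + 150)

      -- The part common to the three outcomes of entering a node: scan the examples, count the
      -- labels along the path, and leave the smaller count for the purity test.
      prefix : ∀ p {σ} {Post : ⊤ → State n → Set} → length p ≤ d → Base σ → StackOK p (num σ) → EnterAt (length p) σ →
               (∀ σ′ → Base σ′ → num σ′ ≡ num σ → reg σ′ 22 ≡ length p → reg σ′ 16 ≡ minOf (tally false p m) (tally true p m) →
                  Frag (ifz 16 (ops (lit 23 1 ∷ lit 21 1 ∷ []))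
                       (ops (sub 17 2 22 ∷ []) ⨟ ifz 17 (ops (lit 31 0 ∷ sub 23 8 31 ∷ lit 21 1 ∷ [])) (ops pushOps))) 126 0 σ′ (return tt) Post) →
               Frag dfsBody (enterCost (length p)) 0 σ (return tt) Post
      prefix p {σ} l≤ (b1 , b2 , b7 , b8 , b9 , b20 , lok , yok) sok (e21 , e22) k = f-zero _ e21
        (f-det (f-ops (lit 24 0 ∷ lit 25 0 ∷ lit 31 0 ∷ sub 11 7 31 ∷ []) _ _) λ { _ _ refl →
         f-det (count-frag m p {0} {0} {σ} ≤-refl ≤-refl ≤-refl l≤ (b1 , b2 , b7 , b8 , b9 , b20 , e22 , b7 , refl , refl , refl) lok yok sok)
         λ { _ σ₁ (y1 , y2 , y7 , y8 , y9 , y20 , y22 , y11 , y24 , y25 , yn) →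
         f-det (f-ops (sub 16 24 25 ∷ sub 16 24 16 ∷ []) _ _) λ { _ _ refl →
         k _ (y1 , y2 , y7 , y8 , y9 , y20 , subst (λ g → ∀ t → t < m → g 0 t 0 ≡ fromBit (lab t)) (sym yn) lok ,
              subst (λ g → ∀ t j → g 1 t (suc j) ≡ fromBit (Y t j)) (sym yn) yok) yn y22
           (cong₂ minOf y24 y25) } } })

      enter-pure : ∀ p {σ} → length p ≤ d → Base σ → StackOK p (num σ) → EnterAt (length p) σ → pure p ≡ true →
                   Frag dfsBody (enterCost (length p)) 0 σ (return tt) (λ _ σ′ → Base σ′ × Keep (length p) (num σ) (num σ′) × RetAt (length p) 1 σ′)
      enter-pure p {σ} l≤ bs sok en pu = prefix p l≤ bs sok en λ σ₁ bs₁ e e22 e16 →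
        f-weaken (m≤m+n 27 99) ≤-refl (f-zero _ (trans e16 (≡ᵇ-true pu))
          (f-post (λ { _ _ refl → bs₁ , keep-≡ e , refl , e22 , refl }) (f-ops (lit 23 1 ∷ lit 21 1 ∷ []) _ _)))

      private
        not-pure : ∀ {x} → (x ≡ᵇ 0) ≡ false → Σ ℕ λ k → x ≡ suc k
        not-pure {suc k} _ = k , refl

      enter-stop : ∀ p {σ} → length p ≡ d → Base σ → StackOK p (num σ) → EnterAt (length p) σ → pure p ≡ false →
                   Frag dfsBody (enterCost (length p)) 0 σ (return tt) (λ _ σ′ → Base σ′ × Keep (length p) (num σ) (num σ′) × RetAt (length p) (suc s) σ′)
      enter-stop p {σ} l≡ bs sok en pu = prefix p (≤-reflexive l≡) bs sok en λ { σ₁ bs₁@(b1 , b2 , b7 , b8 , b9 , b20 , lok , yok) e e22 e16 →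
        f-weaken (m≤m+n 54 72) ≤-refl (f-suc _ (trans e16 (proj₂ (not-pure pu)))
          (f-det (f-ops (sub 17 2 22 ∷ []) _ _) λ { _ _ refl →
           f-zero _ (trans (cong₂ _∸_ b2 (trans e22 l≡)) (n∸n≡0 d))
           (f-post (λ { _ _ refl → bs₁ , keep-≡ e , refl , e22 , b8 }) (f-ops (lit 31 0 ∷ sub 23 8 31 ∷ lit 21 1 ∷ []) _ _)) })) }

      enter-push : ∀ p r {σ} → length p + suc r ≡ d → Base σ → StackOK p (num σ) → EnterAt (length p) σ → pure p ≡ false →
                   Frag dfsBody (enterCost (length p)) 0 σ (return tt)
                     (λ _ σ′ → Base σ′ × Keep (length p) (num σ) (num σ′) × RetAt (suc (length p)) 0 σ′ × Row (length p) (suc κ) 1 (suc s) (suc s) (num σ′))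
      enter-push p r {σ} l+r bs sok en pu = prefix p (<⇒≤ l<d) bs sok en λ { σ₁ bs₁@(b1 , b2 , b7 , b8 , b9 , b20 , lok , yok) e e22 e16 →
        f-suc _ (trans e16 (proj₂ (not-pure pu)))
          (f-det (f-ops (sub 17 2 22 ∷ []) _ _) λ { _ σ₂ refl →
           f-suc {k = r} _ (trans (cong₂ _∸_ b2 e22) (trans (cong (_∸ length p) (sym l+r)) (m+n∸m≡n (length p) (suc r))))
           (f-norm 22 e22 (f-norm 9 b9 (f-norm 8 b8
           (f-post (λ { _ _ refl → (b1 , b2 , b7 , refl , refl , b20 , lok , yok) ,
                      keep (λ i l → trans (miss l) (at e 2 i) , trans (miss l) (at e 3 i) , trans (miss l) (at e 4 i) , trans (miss l) (at e 5 i)) ,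
                      (refl , refl , refl) , (hit (length p) , hit (length p) , hit (length p) , hit (length p)) })
             (f-ops pushOps _ (κ<W , (l<I , _) , _ , (l<I , _) , (l<I , _) , (l<I , _) , _ , _ , <-≤-trans (≤-<-trans l<d d<I) I≤W , tt)))))) }) }
        where
        l<d : length p < d
        l<d = subst (length p <_) (trans (sym (+-suc (length p) r)) l+r) (s≤s (m≤m+n (length p) r))
        l<I : length p < I
        l<I = <-trans l<d d<I
        κ<W : suc κ < W
        κ<W = <-≤-trans (≤-<-trans (≤-trans (s≤s κ≤s) (m≤m+n (suc s) _)) 2s<I) I≤W
        at : ∀ {g g′ : Grid} → g ≡ g′ → ∀ K i → g K i 0 ≡ g′ K i 0
        at refl K i = refl

      retCost : ℕ
      retCost = 300

      ret-first : ∀ l {v best acc y σ} → l < d → Base σ → RetAt (suc l) y σ → Row l v 0 best acc (num σ) →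
                  Frag dfsBody retCost 0 σ (return tt) (λ _ σ′ → Base σ′ × Keep l (num σ) (num σ′) × EnterAt (suc l) σ′ × Row l v 1 best y (num σ′))
      ret-first l l<d (b1 , b2 , b7 , b8 , b9 , b20 , lok , yok) (e21 , e22 , e23) (r2 , r3 , r4 , r5) =
        f-weaken (m≤m+n (3 + (3 + (24 + (3 + 60)))) 207) ≤-refl
        (f-suc _ e21 (f-suc _ e22 (f-norm 22 e22 (f-norm 23 e23
          (f-det (f-ops (dec 22 22 ∷ get 16 3 (just 22) zeroth ∷ []) _ (_ , (l<I , _) , _)) λ { _ _ refl →
           f-zero _ r3 (f-post (λ { _ _ refl → (b1 , b2 , b7 , b8 , b9 , b20 , lok , yok) ,
               keep (λ i h → refl , miss h , refl , miss h) , (refl , refl) , (r2 , hit l , r4 , hit l) })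
             (f-ops bit0Ops _ ((l<I , _) , _ , (l<I , _) , <-≤-trans (≤-<-trans l<d d<I) I≤W , _))) })))))
        where l<I = <-trans l<d d<I

      private
        second : ∀ l j {best acc y σ} {Post : ⊤ → State n → Set} → l < d → acc ≤ suc s → y ≤ suc s → Base σ → RetAt (suc l) y σ → Row l (suc j) 1 best acc (num σ) →
                 (∀ σ′ → Base σ′ → Keep l (num σ) (num σ′) → reg σ′ 22 ≡ l → reg σ′ 21 ≡ 1 → reg σ′ 16 ≡ j → reg σ′ 17 ≡ minOf best (acc + y) →
                    num σ′ 4 l 0 ≡ minOf best (acc + y) →
                    Frag (ifz 16 (ops (lit 31 0 ∷ sub 23 17 31 ∷ [])) (ops advanceOps)) 63 0 σ′ (return tt) Post) →
                 Frag dfsBody retCost 0 σ (return tt) Post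
        second l j {best} {acc} {y} {σ} l<d acc≤ y≤ (b1 , b2 , b7 , b8 , b9 , b20 , lok , yok) (e21 , e22 , e23) (r2 , r3 , r4 , r5) k =
          f-weaken (m≤m+n (3 + (3 + (24 + (3 + (96 + 63))))) 108) ≤-refl
          (f-suc _ e21 (f-suc _ e22 (f-norm 22 e22 (f-norm 23 e23
            (f-det (f-ops (dec 22 22 ∷ get 16 3 (just 22) zeroth ∷ []) _ (_ , (l<I , _) , _)) λ { _ _ refl →
             f-suc _ r3 (f-det (f-ops bit1Ops _ ((l<I , _) , sum< , (l<I , _) , _ , _ , (l<I , _) , (l<I , _) , _)) λ { _ _ refl →
             k _ (b1 , b2 , b7 , b8 , b9 , b20 , lok , yok) (keep (λ i h → refl , refl , miss h , refl)) refl e21 (cong (_∸ 1) r2)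
               (cong₂ (λ u v → minOf u (v + y)) r4 r5) (trans (hit l) (cong₂ (λ u v → minOf u (v + y)) r4 r5)) }) })))))
          where
          l<I = <-trans l<d d<I
          sum< : num σ 5 l 0 + y < W
          sum< = subst (λ u → u + y < W) (sym r5) (<-≤-trans (≤-<-trans (+-mono-≤ acc≤ y≤) 2s<I) I≤W)

      ret-last : ∀ l {best acc y σ} → l < d → acc ≤ suc s → y ≤ suc s → Base σ → RetAt (suc l) y σ → Row l 1 1 best acc (num σ) →
                 Frag dfsBody retCost 0 σ (return tt) (λ _ σ′ → Base σ′ × Keep l (num σ) (num σ′) × RetAt l (minOf best (acc + y)) σ′)
      ret-last l l<d acc≤ y≤ bs rt rw = second l 0 l<d acc≤ y≤ bs rt rw λ σ₁ bs₁ kp e22 e21 e16 e17 e4 →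
        f-weaken (m≤m+n 27 36) ≤-refl (f-zero _ e16 (f-post (λ { _ _ refl → bs₁ , kp , e21 , e22 , e17 })
          (f-ops (lit 31 0 ∷ sub 23 17 31 ∷ []) _ _)))

      ret-next : ∀ l j {best acc y σ} → l < d → acc ≤ suc s → y ≤ suc s → Base σ → RetAt (suc l) y σ → Row l (suc (suc j)) 1 best acc (num σ) →
                 Frag dfsBody retCost 0 σ (return tt)
                   (λ _ σ′ → Base σ′ × Keep l (num σ) (num σ′) × EnterAt (suc l) σ′ × Σ ℕ λ acc′ → Row l (suc j) 0 (minOf best (acc + y)) acc′ (num σ′))
      ret-next l j l<d acc≤ y≤ bs rt rw = second l (suc j) l<d acc≤ y≤ bs rt rw
        λ { σ₁ bs₁@(b1 , b2 , b7 , b8 , b9 , b20 , lok , yok) kp e22 e21 e16 e17 e4 →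
        f-suc _ e16 (f-norm 16 e16 (f-norm 22 e22 (f-post (λ { _ _ refl → bs₁ ,
              keep (λ i h → trans (miss h) (proj₁ (below kp i h)) , trans (miss h) (proj₁ (proj₂ (below kp i h))) , proj₁ (proj₂ (proj₂ (below kp i h))) , proj₂ (proj₂ (proj₂ (below kp i h)))) ,
              (refl , refl) , _ , hit l , hit l , e4 , refl })
          (f-ops advanceOps _ ((l<I , _) , _ , (l<I , _) , <-≤-trans (≤-<-trans l<d d<I) I≤W , _))))) }
        where l<I = <-trans l<d d<I

      -- Running time of the search from level l with r levels to go.
      callCost : ℕ → ℕ → ℕ
      callCost zero    l = 3 + enterCost l
      callCost (suc r) l = 3 + enterCost l + (suc κ * 303 + κ * (callCost r (suc l) + (303 + callCost r (suc l))))

      Cont : ℕ → ℕ → State n → ℕ → (⊤ → State n → Set) → Set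
      Cont l v σ t Post = ∀ σ′ → Base σ′ → Keep l (num σ) (num σ′) → RetAt l v σ′ → Frag dfsCode t 0 σ′ (return tt) Post

      mutual
        -- The code is one loop without calls, so a recursive call is not a statement of its own.
        -- Instead, what the loop does after the node has returned is taken as a continuation, whose
        -- time is added to that of the node.
        call : ∀ r p {σ t Post} → length p + r ≡ d → Base σ → StackOK p (num σ) → EnterAt (length p) σ →
               Cont (length p) (minSize r p) σ t Post → Frag dfsCode (callCost r (length p) + t) 0 σ (return tt) Post
        call r p {σ} {t} e bs sok en k with pure p in pu
        ... | true = f-weaken (+-monoˡ-≤ t (enter≤ r)) ≤-refl (f-step (proj₁ (proj₂ (proj₂ (proj₂ (proj₂ (proj₂ bs))))))
                (enter-pure p (≤-trans (m≤m+n _ r) (≤-reflexive e)) bs sok en pu) (λ { _ σ′ (b′ , kp , rt) → k σ′ b′ kp rt }))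
          where enter≤ : ∀ r → 3 + enterCost (length p) ≤ callCost r (length p)
                enter≤ zero    = ≤-refl
                enter≤ (suc r) = m≤m+n _ _
        call zero p {σ} {t} e bs sok en k | false = f-step (proj₁ (proj₂ (proj₂ (proj₂ (proj₂ (proj₂ bs))))))
                (enter-stop p (trans (sym (+-identityʳ _)) e) bs sok en pu) (λ { _ σ′ (b′ , kp , rt) → k σ′ b′ kp rt })
        call (suc r) p {σ} {t} e bs sok en k | false = f-weaken (≤-reflexive (sym (+-assoc (3 + enterCost (length p)) _ t))) ≤-refl
          (f-step (proj₁ (proj₂ (proj₂ (proj₂ (proj₂ (proj₂ bs)))))) (enter-push p r e bs sok en pu)
            (λ { _ σ′ (b′ , kp , rt , rw) → branch r p κ {σ = σ′} e ≤-refl ≤-refl z≤n b′ (stack-keep p kp sok) rt rw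
              (λ σ″ b″ kp′ rt′ → k σ″ b″ (keep-trans ≤-refl kp kp′)
                 (subst (λ v → RetAt (length p) (scan r p κ v) σ″) start rt′)) }))
          -- The fictitious first return contributes the sum s + 1, which leaves the initial best
          -- value s + 1 unchanged.
          where start : minOf (suc s) (suc s + 0) ≡ suc s
                start = trans (cong (suc s ∸_) (trans (cong (suc s ∸_) (+-identityʳ (suc s))) (n∸n≡0 (suc s)))) refl

        -- Starts at the moment the second child of a variable has returned y, with the first
        -- child's size in `acc`, and handles the j variables not yet tried. Each of them takes two
        -- calls and two returns of 303 steps.
        branch : ∀ r p j {best acc y σ t Post} → length p + suc r ≡ d → j ≤ κ → acc ≤ suc s → y ≤ suc s → Base σ → StackOK p (num σ) →
                 RetAt (suc (length p)) y σ → Row (length p) (suc j) 1 best acc (num σ) →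
                 Cont (length p) (scan r p j (minOf best (acc + y))) σ t Post →
                 Frag dfsCode (suc j * 303 + j * (callCost r (suc (length p)) + (303 + callCost r (suc (length p)))) + t) 0 σ (return tt) Post
        branch r p zero {t = t} e j≤ acc≤ y≤ bs sok rt rw k = f-weaken (≤-reflexive refl) ≤-refl
          (f-step (proj₁ (proj₂ (proj₂ (proj₂ (proj₂ (proj₂ bs)))))) (ret-last (length p) (l<d r p e) acc≤ y≤ bs rt rw) (λ { _ σ′ (b′ , kp , rt′) → k σ′ b′ kp rt′ }))
        branch r p (suc j) {best} {acc} {y} {t = t} e j≤ acc≤ y≤ bs sok rt rw k = f-weaken (≤-reflexive (arith j (callCost r (suc (length p))) t)) ≤-refl
          (f-step (proj₁ (proj₂ (proj₂ (proj₂ (proj₂ (proj₂ bs)))))) (ret-next (length p) j (l<d r p e) acc≤ y≤ bs rt rw)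
           λ { _ σ₁ (b₁ , kp₁ , en₁ , acc′ , rw₁) →
           call r ((j , false) ∷ p) {σ₁} (trans (sym (+-suc (length p) r)) e) b₁
             (j≤ , proj₁ rw₁ , proj₁ (proj₂ rw₁) , stack-keep p kp₁ sok) en₁
           λ σ₂ b₂ kp₂ rt₂ →
           f-step (proj₁ (proj₂ (proj₂ (proj₂ (proj₂ (proj₂ b₂)))))) (ret-first (length p) (l<d r p e) b₂ rt₂ (row-keep kp₂ rw₁))
           λ { _ σ₃ (b₃ , kp₃ , en₃ , rw₃) →
           let keep₁₃ = keep-trans ≤-refl kp₁ (keep-trans ≤-refl (keep-weak kp₂) kp₃) in
           call r ((j , true) ∷ p) {σ₃} (trans (sym (+-suc (length p) r)) e) b₃
             (j≤ , proj₁ rw₃ , proj₁ (proj₂ rw₃) , stack-keep p keep₁₃ sok) en₃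
           λ σ₄ b₄ kp₄ rt₄ →
           let keep₁₄ = keep-trans ≤-refl keep₁₃ (keep-weak kp₄) in
           branch r p j {σ = σ₄} e (<⇒≤ j≤) (minSize≤ r ((j , false) ∷ p)) (minSize≤ r ((j , true) ∷ p)) b₄ (stack-keep p keep₁₄ sok) rt₄ (row-keep kp₄ rw₃)
           λ σ₅ b₅ kp₅ rt₅ → k σ₅ b₅ (keep-trans ≤-refl keep₁₄ kp₅) rt₅ } })
          where
          arith : ∀ j c t → 303 + (c + (303 + (c + (suc j * 303 + j * (c + (303 + c)) + t)))) ≡ suc (suc j) * 303 + suc j * (c + (303 + c)) + t
          arith = solve-∀

        l<d : ∀ r p → length p + suc r ≡ d → length p < d
        l<d r p e = subst (length p <_) (trans (sym (+-suc (length p) r)) e) (s≤s (m≤m+n (length p) r))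

        row-keep : ∀ {l v b best acc g g′} → Keep (suc l) g g′ → Row l v b best acc g → Row l v b best acc g′
        row-keep {l} kp (a , b , c , d) with below kp l ≤-refl
        ... | e₂ , e₃ , e₄ , e₅ = trans e₂ a , trans e₃ b , trans e₄ c , trans e₅ d

      initOps : List Op
      initOps = lit 20 1 ∷ lit 21 0 ∷ lit 22 0 ∷ []

      dfs-frag : ∀ {σ} → reg σ 1 ≡ s → reg σ 2 ≡ d → reg σ 7 ≡ m → reg σ 8 ≡ suc s → reg σ 9 ≡ κ →
                 (∀ t → t < m → num σ 0 t 0 ≡ fromBit (lab t)) → (∀ t j → num σ 1 t (suc j) ≡ fromBit (Y t j)) →
                 Frag (ops initOps ⨟ dfsCode) (36 + (callCost d 0 + 22)) 0 σ (return tt) (λ _ σ′ → reg σ′ 23 ≡ minSize d [] × reg σ′ 1 ≡ s)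
      dfs-frag b1 b2 b7 b8 b9 lok yok = f-det (f-ops initOps _ _) λ { _ σ₁ refl →
        -- The 22 steps are the last iteration, which returns at level 0 and clears register 20, and
        -- the failing loop test after it.
        call d [] {σ₁} {t = 22} refl (b1 , b2 , b7 , b8 , b9 , refl , lok , yok) tt (refl , refl)
        λ { σ₂ (c1 , c2 , c7 , c8 , c9 , c20 , _) kp (e21 , e22 , e23) →
          f-step {Mid = λ _ σ′ → reg σ′ 20 ≡ 0 × reg σ′ 23 ≡ minSize d [] × reg σ′ 1 ≡ s} c20
            (f-suc {k = 0} _ e21 (f-zero _ e22 (f-post (λ { _ _ refl → refl , e23 , c1 }) (f-ops (lit 20 0 ∷ []) _ _))))
            (λ { _ σ₃ (e , e23′ , e1′) → f-exit _ e (e23′ , e1′) }) } }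

    -- The rounds of the tester on the machine

    open Tester f s d m R public

    V : ℕ
    V = cost-vector

    -- Time in multiples of the cost V of one vector operation, which is linear in n; the
    -- bookkeeping then counts operations and never mentions n.
    record FragV {X : Set} (S : Stmt) (a q : ℕ) (σ : State n) (F : (X → Comp n) → Comp n) (Post : X → State n → Set) : Set where
      constructor units
      field frag-of : Frag S (a * V) q σ F Post
    open FragV public

    v-seq : ∀ {X Y S T a q b q₁ σ F} {G : X → (Y → Comp n) → Comp n} {Mid : X → State n → Set} {Post : Y → State n → Set} →
            FragV S a q σ F Mid → (∀ x σ′ → Mid x σ′ → FragV T b q₁ σ′ (G x) Post) →
            FragV (S ⨟ T) (a + b) (q + q₁) σ (λ k → F (λ x → G x k)) Post
    v-seq {a = a} {b = b} (units fr) gr = units (f-weaken (≤-reflexive (sym (*-distribʳ-+ V a b))) ≤-refl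
      (f-seq fr (λ x σ′ p → frag-of (gr x σ′ p))))

    v-det : ∀ {Y S T a q b q₁ σ} {F : (Y → Comp n) → Comp n} {Mid : ⊤ → State n → Set} {Post : Y → State n → Set} →
            FragV S a q σ (return tt) Mid → (∀ x σ′ → Mid x σ′ → FragV T b q₁ σ′ F Post) →
            FragV (S ⨟ T) (a + b) (q + q₁) σ F Post
    v-det {F = F} = v-seq {G = λ _ → F}

    v-then : ∀ {X S T a q b q₁ σ F} {Mid Post : X → State n → Set} →
             FragV S a q σ F Mid → (∀ x σ′ → Mid x σ′ → FragV T b q₁ σ′ (return tt) (λ _ → Post x)) →
             FragV (S ⨟ T) (a + b) (q + q₁) σ F Post
    v-then {a = a} {b = b} (units fr) gr = units (f-weaken (≤-reflexive (sym (*-distribʳ-+ V a b))) ≤-refl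
      (f-then fr (λ x σ′ p → frag-of (gr x σ′ p))))

    v-ops : ∀ os {σ} → T (valids os) → Obls os σ → FragV (ops os) (length os) (queriess os) σ (return tt) (λ _ σ′ → σ′ ≡ exec-ops os σ)
    v-ops os v h = units (f-ops′ os v h)

    v-post : ∀ {X S a q σ F} {Post Post′ : X → State n → Set} → (∀ x σ′ → Post x σ′ → Post′ x σ′) → FragV S a q σ F Post → FragV S a q σ F Post′
    v-post h (units fr) = units (f-post h fr)

    v-norm : ∀ {X S a q σ F} {Post : X → State n → Set} r {v} → reg σ r ≡ v → FragV S a q (setReg r v σ) F Post → FragV S a q σ F Post
    v-norm r e (units fr) = units (f-norm r e fr)

    private
      unit : ∀ {t} → t ≤ V → t ≤ 1 * V
      unit l = ≤-trans l (≤-reflexive (sym (+-identityʳ V)))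

    v-rand : ∀ {σ} K i → T (K <ᵇ 12) → T (validIdx i) → IdxOK σ I i →
             FragV (randCode K i) 1 0 σ (randVec n) (λ x σ′ → σ′ ≡ setVec K (idx σ i) x σ)
    v-rand K i l v h = units (f-weaken (unit ≤-refl) ≤-refl (f-rand′ K i l v h))

    v-draw : ∀ {σ} a K i → IsReg a → T (K <ᵇ 12) → T (validIdx i) → IdxOK σ I i →
             FragV (drawCode a K i) 1 1 σ draw (λ x σ′ → σ′ ≡ setReg a (fromBit (f x)) (setVec K (idx σ i) x σ))
    v-draw a K i la l v h = units (f-weaken (unit ≤-refl) ≤-refl (f-draw′ a K i la l v h))

    v-guard : ∀ {a σ} t → IsReg a → reg σ a ≡ fromBit t →
              FragV (guard a) 1 0 σ (λ (k : ⊤ → Comp n) → if t then ret false else k tt) (λ _ σ′ → σ′ ≡ σ)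
    v-guard t l e = units (f-weaken (unit ≤-refl) ≤-refl (f-guard t l e))

    v-cond : ∀ {X a S T c c′ σ} {F G : (X → Comp n) → Comp n} {Post : X → State n → Set} b → IsReg a → reg σ a ≡ fromBit b →
             (b ≡ false → FragV S c 0 σ F Post) → (b ≡ true → FragV T c′ 0 σ G Post) →
             FragV (ifz a S T) (1 + (c + c′)) 0 σ (λ k → if b then G k else F k) Post
    v-cond {c = c} {c′} b l e fs ft = units (f-weaken (+-monoˡ-≤ _ (≤-trans (m≤m+n 3 9) 12≤cost-vector)) ≤-refl
      (f-cond b l e (λ h → f-weaken (*-monoˡ-≤ V (m≤m+n c c′)) ≤-refl (frag-of (fs h)))
                    (λ h → f-weaken (*-monoˡ-≤ V (m≤n+m c′ c)) ≤-refl (frag-of (ft h)))))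

    v-for : ∀ {X : Set} {a S c q} (G : ℕ → X → (X → Comp n) → Comp n) (Inv : ℕ → X → State n → Set) → IsReg a →
            (∀ i x σ → Inv (suc i) x σ → reg σ a ≡ suc i → FragV S c q σ (G i x) (λ y σ′ → Inv i y σ′ × reg σ′ a ≡ i)) →
            ∀ i x σ → Inv i x σ → reg σ a ≡ i →
            FragV (while a S) (1 + i * (1 + c)) (i * q) σ (iter G i x) (λ y σ′ → Inv 0 y σ′ × reg σ′ a ≡ 0)
    v-for {c = c} {q} G Inv l body i x σ v e = units (f-weaken bound ≤-refl
      (f-for {t = c * V} {q} G Inv l (λ i x σ v e → frag-of (body i x σ v e)) i x σ v e))
      where
      bound : 1 + i * (3 + c * V) ≤ (1 + i * (1 + c)) * V
      bound = +-mono-≤ (≤-trans (m≤m+n 1 11) 12≤cost-vector)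
        (≤-trans (*-monoʳ-≤ i (+-monoˡ-≤ (c * V) (≤-trans (m≤m+n 3 9) 12≤cost-vector))) (≤-reflexive (sym (*-assoc i (1 + c) V))))

    -- Row 3 is overwritten before the second argument is read and the first is read again, so
    -- neither may live there. Row 4 is allowed for the second argument, because vector operations
    -- work in place.
    v-eval : ∀ {σ} a j K K₁ i₁ {u δ z x} → T (valids (evalPre j K K₁ i₁)) → T (valids (diff a 31 32 ∷ [])) →
             (K ≡ᵇ 3) ≡ false → (K₁ ≡ᵇ 3) ≡ false → reg σ j < I → IdxOK σ I i₁ →
             vec σ 9 (reg σ j) ≡ u → vec σ 10 (reg σ j) ≡ δ → vec σ K 0 ≡ z → vec σ K₁ (idx σ i₁) ≡ x →
             FragV (evalCode a j K K₁ i₁) 8 2 σ (return tt) (λ _ σ′ → σ′ ≡ setReg a (fromBit (A u δ z x)) (exec-ops (evalPre j K K₁ i₁) σ))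
    v-eval {σ} a j K K₁ i₁ {u} {δ} {z} {x} v v′ e e₁ j<I ok eu ed ez ex =
      v-det (v-ops (evalPre j K K₁ i₁) v ((_ , _ , j<I) , (_ , j<I , _) , (_ , _ , ok′ i₁ ok) , (_ , _ , j<I) , (_ , j<I , _) , _ , _ , tt))
        λ { _ _ refl → v-post (λ { _ _ refl → cong (λ u → setReg a u _) value }) (v-ops (diff a 31 32 ∷ []) v′ _) }
      where
      ok′ : ∀ i {g} → IdxOK σ I i → IdxOK (record σ { vec = g }) I i
      ok′ nothing  h = h
      ok′ (just r) h = h
      σ₂ : State n
      σ₂ = exec-ops (vector vand 3 zeroth K zeroth 10 (just j) ∷ vector vxor 3 zeroth 9 (just j) 3 zeroth ∷ []) σ
      idx-vec : ∀ i {g} → idx (record σ { vec = g }) i ≡ idx σ i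
      idx-vec nothing  = refl
      idx-vec (just r) = refl
      z′ : vec σ₂ K 0 ≡ z
      z′ rewrite e = ez
      x′ : vec σ₂ K₁ (idx σ₂ i₁) ≡ x
      x′ rewrite e₁ = trans (cong (vec σ K₁) (idx-vec i₁)) ex
      value : (fromBit (f (vec σ 9 (reg σ j) ⊕ vec σ K 0 ⊗ vec σ 10 (reg σ j))) ∸ fromBit (f (vec σ 9 (reg σ j) ⊕ (vec σ₂ K 0 ⊕ vec σ₂ K₁ (idx σ₂ i₁)) ⊗ vec σ 10 (reg σ j))))
            + (fromBit (f (vec σ 9 (reg σ j) ⊕ (vec σ₂ K 0 ⊕ vec σ₂ K₁ (idx σ₂ i₁)) ⊗ vec σ 10 (reg σ j))) ∸ fromBit (f (vec σ 9 (reg σ j) ⊕ vec σ K 0 ⊗ vec σ 10 (reg σ j))))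
            ≡ fromBit (A u δ z x)
      value rewrite z′ | x′ | eu | ed | ez = xor-arith (f (u ⊕ z ⊗ δ)) (f (u ⊕ (z ⊕ x) ⊗ δ))

    -- Examples fill the rows from m - 1 downwards while the list grows at its head. When the batch
    -- is complete, list position and row index therefore agree.
    Rows : ℕ → List (Vec Bool n) → (ℕ → Vec Bool n) → (ℕ → ℕ → ℕ) → Set
    Rows t []       g h = ⊤
    Rows t (x ∷ xs) g h = g t ≡ x × h t 0 ≡ fromBit (f x) × Rows (suc t) xs g h

    -- The registers and rows that stay fixed, with κ blocks counted so far,
    -- the blocks of b stored and r rounds left.
    Env : ℕ → Blocks → ℕ → State n → Set
    Env c b r σ = reg σ 1 ≡ s × reg σ 2 ≡ d × reg σ 6 ≡ R × reg σ 7 ≡ m × reg σ 8 ≡ suc s × reg σ 9 ≡ c × reg σ 10 ≡ r ×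
      vec σ 8 0 ≡ zeros × vec σ 0 0 ≡ mask b × (∀ j → vec σ 9 j ≡ bu b j) × (∀ j → vec σ 10 j ≡ bd b j) × (∀ t j → num σ 1 t (suc j) ≡ 0)

    BadOK : Maybe (Vec Bool n) → State n → Set
    BadOK nothing  σ = reg σ 19 ≡ 0
    BadOK (just x) σ = reg σ 19 ≡ 1 × vec σ 1 0 ≡ x

    BatchInv : Blocks → ℕ → ℕ → Batch → State n → Set
    BatchInv b r t (xs , bad) σ = Env (κ b) b r σ × t + length xs ≡ m × Rows t xs (vec σ 11) (num σ 0) × BadOK bad σ

    private
      hit : ∀ {A : Set} t {v u : A} → (if t ≡ᵇ t then v else u) ≡ v
      hit t {v} {u} = cong (λ z → if z then v else u) (≡ᵇ-refl t)

      miss : ∀ {A : Set} {i t} {v u : A} → i ≢ t → (if i ≡ᵇ t then v else u) ≡ u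
      miss {v = v} {u} h = cong (λ z → if z then v else u) (≡ᵇ-≢ h)

      hit∧ : ∀ t {v u : ℕ} → (if (t ≡ᵇ t) ∧ true then v else u) ≡ v
      hit∧ t {v} {u} = cong (λ z → if z ∧ true then v else u) (≡ᵇ-refl t)

      miss∧ : ∀ {i t} {v u : ℕ} → i ≢ t → (if (i ≡ᵇ t) ∧ true then v else u) ≡ u
      miss∧ {v = v} {u} h = cong (λ z → if z ∧ true then v else u) (≡ᵇ-≢ h)

      rows-ext : ∀ t xs {g g′ h h′} → (∀ i → t ≤ i → g′ i ≡ g i) → (∀ i → t ≤ i → h′ i 0 ≡ h i 0) → Rows t xs g h → Rows t xs g′ h′
      rows-ext t []       eg eh r = tt
      rows-ext t (x ∷ xs) eg eh (a , b , r) = trans (eg t ≤-refl) a , trans (eh t ≤-refl) b ,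
        rows-ext (suc t) xs (λ i l → eg i (<⇒≤ l)) (λ i l → eh i (<⇒≤ l)) r

    v-skip : ∀ {X σ} {x : X} {Post : X → State n → Set} → Post x σ → FragV skip 0 0 σ (return x) Post
    v-skip p = units (f-skip p)

    v-carry : ∀ {X S a q σ} {x : X} {Post : X → State n → Set} → FragV S a q σ (return tt) (λ _ → Post x) → FragV S a q σ (return x) Post
    v-carry {X} {S} {a} {q} {σ} {x} {Post} (units fr) = units (sfrag go)
      where
      go : ∀ {M} → Rep M σ → MFrag S (a * V) q M (return x) (λ y M′ → Σ (State n) λ σ′ → Post y σ′ × Rep M′ σ′)
      go rep .apply k c b h = apply (runF fr rep) (λ _ → k x) c b (λ _ → h x)

    batch-body : ∀ b r t y σ → BatchInv b r (suc t) y σ → reg σ 11 ≡ suc t →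
                 FragV batchBody 10 2 σ (batchStep (mask b) t y) (λ y′ σ′ → BatchInv b r t y′ σ′ × reg σ′ 11 ≡ t)
    batch-body b r t (xs , bad) σ ((e1 , e2 , e6 , e7 , e8 , e9 , e10 , z8 , z0 , rows9 , rows10 , y0) , len≡ , rws , bok) e11 =
      v-norm 11 e11 (v-det (v-ops (dec 12 11 ∷ []) _ _) λ { _ _ refl →
      v-seq {G = λ x k → if f x xor f (x ⊗ mask b) then k (x ∷ xs , just x) else k (x ∷ xs , bad)}
        (v-draw 16 11 (just 12) _ _ _ t<I) λ { x σ₁ refl →
      v-det (v-ops batchOps _ ((t<I , _) , (_ , t<I , _) , _ , _ , tt)) λ { _ σ₂ refl →
      v-then {Mid = λ y′ σ′ → BatchInv b r t y′ σ′ × reg σ′ 11 ≡ suc t}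
        (v-cond (f x xor f (x ⊗ mask b)) _
          (trans (cong₂ (λ u v → (fromBit (f x) ∸ fromBit (f (u ⊗ v))) + (fromBit (f (u ⊗ v)) ∸ fromBit (f x))) (hit t) z0) (xor-arith (f x) (f (x ⊗ mask b))))
          (λ _ → v-skip (((e1 , e2 , e6 , e7 , e8 , e9 , e10 , z8 , z0 , rows9 , rows10 , y0) , len′ , new x , bad-ok bad bok) , refl))
          (λ _ → v-carry (v-post (λ { _ _ refl → ((e1 , e2 , e6 , e7 , e8 , e9 , e10 , z8 , z0 , rows9 , rows10 , y0) , len′ , new x , refl ,
                     trans (cong₂ _⊗_ (hit t) (hit t)) (⊗-idem x)) , refl })
                   (v-ops (vector vand 1 zeroth 11 (just 12) 11 (just 12) ∷ lit 19 1 ∷ []) _ ((_ , t<I , t<I) , _)))))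
        λ { y′@(ys , bad′) σ₃ ((env , l , rw , bk) , e) → v-post (λ { _ _ refl → (env , l , rw , keep-bad bad′ bk) , cong (_∸ 1) e }) (v-ops (dec 11 11 ∷ []) _ _) } } } })
      where
      t<m : t < m
      t<m = subst (t <_) len≡ (s≤s (m≤m+n t (length xs)))
      t<I = <-trans t<m m<I
      len′ : t + suc (length xs) ≡ m
      len′ = trans (+-suc t (length xs)) len≡
      new : ∀ x → Rows t (x ∷ xs) (λ i → if i ≡ᵇ t then x else vec σ 11 i) (λ i c → if (i ≡ᵇ t) ∧ (c ≡ᵇ 0) then fromBit (f x) else num σ 0 i c)
      new x = hit t , hit∧ t , rows-ext (suc t) xs (λ i l → miss (>⇒≢ l)) (λ i l → miss∧ (>⇒≢ l)) rws
      bad-ok : ∀ bad {σ′} → BadOK bad σ → {{reg σ′ 19 ≡ reg σ 19}} → {{vec σ′ 1 0 ≡ vec σ 1 0}} → BadOK bad σ′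
      bad-ok nothing  h       {{e}} {{e′}} = trans e h
      bad-ok (just x) (h , k) {{e}} {{e′}} = trans e h , trans e′ k
      keep-bad : ∀ bad {σ₃} → BadOK bad σ₃ → BadOK bad (exec-ops (dec 11 11 ∷ []) σ₃)
      keep-bad nothing  h = h
      keep-bad (just x) h = h

    SearchInv : Blocks → ℕ → Vec Bool n × Vec Bool n → State n → Set
    SearchInv b r (u , δ) σ = Env (κ b) b r σ × vec σ 1 0 ≡ u × vec σ 2 0 ≡ δ

    search-body : ∀ b r i y σ → SearchInv b r y σ → reg σ 15 ≡ suc i →
                  FragV searchBody 11 2 σ (searchStep i y) (λ y′ σ′ → SearchInv b r y′ σ′ × reg σ′ 15 ≡ i)
    search-body b r i (u , δ) σ ((e1 , e2 , e6 , e7 , e8 , e9 , e10 , z8 , z0 , rows9 , rows10 , y0) , eu , ed) e15 =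
      v-seq {G = λ c k → if f (u ⊕ c ⊗ δ) xor f u then k (u , c ⊗ δ) else k (u ⊕ c ⊗ δ , δ ⊕ c ⊗ δ)}
        (v-rand 5 zeroth _ _ _) λ { c _ refl →
      v-det (v-ops searchOps₁ _ _) λ { _ σ₂ refl →
      v-then {Mid = λ y′ σ′ → SearchInv b r y′ σ′ × reg σ′ 15 ≡ suc i}
        (v-cond (f (u ⊕ c ⊗ δ) xor f u) _
          (trans (cong₂ (λ u δ → (fromBit (f (u ⊕ c ⊗ δ)) ∸ fromBit (f u)) + (fromBit (f u) ∸ fromBit (f (u ⊕ c ⊗ δ)))) eu ed) (xor-arith (f (u ⊕ c ⊗ δ)) (f u)))
          (λ _ → v-carry (v-post (λ { _ _ refl → ((e1 , e2 , e6 , e7 , e8 , e9 , e10 , z8 , z0 , rows9 , rows10 , y0) ,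
                    trans (⊗-idem _) (cong₂ (λ u δ → u ⊕ c ⊗ δ) eu ed) , cong (λ δ → δ ⊕ c ⊗ δ) ed) , e15 }) (v-ops moveOps _ _)))
          (λ _ → v-carry (v-post (λ { _ _ refl → ((e1 , e2 , e6 , e7 , e8 , e9 , e10 , z8 , z0 , rows9 , rows10 , y0) ,
                    eu , trans (⊗-idem _) (cong (c ⊗_) ed)) , e15 }) (v-ops narrowOps _ _))))
        λ { y′ σ₃ (inv , e) → v-post (λ { _ _ refl → inv , cong (_∸ 1) e }) (v-ops (dec 15 15 ∷ []) _ _) } } }

    LiteralInv : ℕ → Blocks → ℕ → Vec Bool n → Vec Bool n → State n → Set
    LiteralInv c b r u δ σ = Env c b r σ × vec σ 9 c ≡ u × vec σ 10 c ≡ δ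

    -- The state in the middle of a literal test, with a and b in registers 16 and 17.
    LiteralMid : ℕ → Blocks → ℕ → (u δ x y z : Vec Bool n) → (i a b : ℕ) → State n → Set
    LiteralMid c bl r u δ x y z i a b σ = LiteralInv c bl r u δ σ × reg σ 15 ≡ suc i ×
      vec σ 5 0 ≡ x × vec σ 6 0 ≡ y × vec σ 7 0 ≡ z × reg σ 16 ≡ a × reg σ 17 ≡ b

    module _ {c : ℕ} {bl : Blocks} {r : ℕ} {u δ x y z : Vec Bool n} {i : ℕ} (c<s : c < s) where
      private
        c<I : c < I
        c<I = <-trans c<s (≤-<-trans (≤-trans (n≤1+n s) (m≤m+n (suc s) _)) 2s<I)

        Mid : ℕ → ℕ → State n → Set
        Mid = LiteralMid c bl r u δ x y z i

        b₁ b₂ b₃ b₄ b₅ : Bool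
        b₁ = A u δ x y
        b₂ = A u δ zeros y
        b₃ = A u δ z (x ⊗ y)
        b₄ = A u δ z x
        b₅ = A u δ z y

        index : ∀ σ {a b} → Mid a b σ → reg σ 9 < I
        index σ ((( _ , _ , _ , _ , _ , e9 , _) , _) , _) = subst (_< I) (sym e9) c<I

        row9 : ∀ σ {a b} → Mid a b σ → vec σ 9 (reg σ 9) ≡ u
        row9 σ ((( _ , _ , _ , _ , _ , e9 , _) , eu , _) , _) = trans (cong (vec σ 9) e9) eu

        row10 : ∀ σ {a b} → Mid a b σ → vec σ 10 (reg σ 9) ≡ δ
        row10 σ ((( _ , _ , _ , _ , _ , e9 , _) , _ , ed) , _) = trans (cong (vec σ 10) e9) ed

      step₁ : ∀ σ {a b} → Mid a b σ → FragV (evalCode 16 9 5 6 zeroth) 8 2 σ (return tt) (λ _ → Mid (fromBit b₁) b)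
      step₁ σ h@(inv , e15 , ex , ey , ez , ea , eb) = v-post (λ { _ _ refl → inv , e15 , ex , ey , ez , refl , eb })
        (v-eval 16 9 5 6 zeroth _ _ refl refl (index σ h) _ (row9 σ h) (row10 σ h) ex ey)

      step₂ : ∀ σ {a b} → Mid a b σ → FragV (evalCode 17 9 8 6 zeroth) 8 2 σ (return tt) (λ _ → Mid a (fromBit b₂))
      step₂ σ h@(inv@((_ , _ , _ , _ , _ , _ , _ , z8 , _) , _) , e15 , ex , ey , ez , ea , eb) = v-post (λ { _ _ refl → inv , e15 , ex , ey , ez , ea , refl })
        (v-eval 17 9 8 6 zeroth _ _ refl refl (index σ h) _ (row9 σ h) (row10 σ h) z8 ey)

      step₃ : ∀ σ → Mid (fromBit b₁) (fromBit b₂) σ →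
              FragV (ops (diff 18 16 17 ∷ [])) 1 0 σ (return tt) (λ _ σ′ → Mid (fromBit b₁) (fromBit b₂) σ′ × reg σ′ 18 ≡ fromBit (b₁ xor b₂))
      step₃ σ (inv , e15 , ex , ey , ez , ea , eb) = v-post (λ { _ _ refl → (inv , e15 , ex , ey , ez , ea , eb) ,
        trans (cong₂ (λ u v → (u ∸ v) + (v ∸ u)) ea eb) (xor-arith b₁ b₂) }) (v-ops (diff 18 16 17 ∷ []) _ _)

      step₄ : ∀ σ {a b} → Mid a b σ → FragV (ops (vector vand 4 zeroth 5 zeroth 6 zeroth ∷ [])) 1 0 σ (return tt) (λ _ σ′ → Mid a b σ′ × vec σ′ 4 0 ≡ x ⊗ y)
      step₄ σ (inv , e15 , ex , ey , ez , ea , eb) = v-post (λ { _ _ refl → (inv , e15 , ex , ey , ez , ea , eb) , cong₂ _⊗_ ex ey })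
        (v-ops (vector vand 4 zeroth 5 zeroth 6 zeroth ∷ []) _ _)

      step₅ : ∀ σ {a b} → Mid a b σ × vec σ 4 0 ≡ x ⊗ y → FragV (evalCode 16 9 7 4 zeroth) 8 2 σ (return tt) (λ _ → Mid (fromBit b₃) b)
      step₅ σ (h@(inv , e15 , ex , ey , ez , ea , eb) , e4) = v-post (λ { _ _ refl → inv , e15 , ex , ey , ez , refl , eb })
        (v-eval 16 9 7 4 zeroth _ _ refl refl (index σ h) _ (row9 σ h) (row10 σ h) ez e4)

      step₆ : ∀ σ {a b} → Mid a b σ → FragV (evalCode 17 9 7 5 zeroth) 8 2 σ (return tt) (λ _ → Mid a (fromBit b₄))
      step₆ σ h@(inv , e15 , ex , ey , ez , ea , eb) = v-post (λ { _ _ refl → inv , e15 , ex , ey , ez , ea , refl })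
        (v-eval 17 9 7 5 zeroth _ _ refl refl (index σ h) _ (row9 σ h) (row10 σ h) ez ex)

      step₇ : ∀ σ {a b} → Mid a b σ → FragV (evalCode 18 9 7 6 zeroth) 8 2 σ (return tt) (λ _ σ′ → Mid a b σ′ × reg σ′ 18 ≡ fromBit b₅)
      step₇ σ h@(inv , e15 , ex , ey , ez , ea , eb) = v-post (λ { _ _ refl → (inv , e15 , ex , ey , ez , ea , eb) , refl })
        (v-eval 18 9 7 6 zeroth _ _ refl refl (index σ h) _ (row9 σ h) (row10 σ h) ez ey)

      step₈ : ∀ σ → Mid (fromBit b₃) (fromBit b₄) σ × reg σ 18 ≡ fromBit b₅ →
              FragV (ops (mul 17 17 18 ∷ diff 18 16 17 ∷ [])) 2 0 σ (return tt)
                (λ _ σ′ → Mid (fromBit b₃) (fromBit (b₄ ∧ b₅)) σ′ × reg σ′ 18 ≡ fromBit (b₃ xor (b₄ ∧ b₅)))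
      step₈ σ ((inv , e15 , ex , ey , ez , ea , eb) , ec) = v-post (λ { _ _ refl → (inv , e15 , ex , ey , ez , ea , prod) ,
          trans (cong₂ (λ u v → (u ∸ v) + (v ∸ u)) ea prod) (xor-arith b₃ (b₄ ∧ b₅)) })
        (v-ops (mul 17 17 18 ∷ diff 18 16 17 ∷ []) _ (subst (_< W) (sym prod) (fromBit-<W 1<W _) , _))
        where prod : reg σ 17 * reg σ 18 ≡ fromBit (b₄ ∧ b₅)
              prod = trans (cong₂ _*_ eb ec) (and-arith b₄ b₅)

      literal-test : ∀ σ {a b} → Mid a b σ →
        FragV (evalCode 16 9 5 6 zeroth ⨟ (evalCode 17 9 8 6 zeroth ⨟ (ops (diff 18 16 17 ∷ []) ⨟ (guard 18 ⨟
               (ops (vector vand 4 zeroth 5 zeroth 6 zeroth ∷ []) ⨟ (evalCode 16 9 7 4 zeroth ⨟ (evalCode 17 9 7 5 zeroth ⨟ (evalCode 18 9 7 6 zeroth ⨟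
               (ops (mul 17 17 18 ∷ diff 18 16 17 ∷ []) ⨟ (guard 18 ⨟ ops (dec 15 15 ∷ []))))))))))) 47 10 σ
          (λ k → if b₁ xor b₂ then ret false else (if b₃ xor (b₄ ∧ b₅) then ret false else k tt))
          (λ (_ : ⊤) σ′ → LiteralInv c bl r u δ σ′ × reg σ′ 15 ≡ i)
      literal-test σ h =
        v-det (step₁ σ h) λ { _ σ₁ h₁ → v-det (step₂ σ₁ h₁) λ { _ σ₂ h₂ → v-det (step₃ σ₂ h₂) λ { _ σ₃ (h₃ , e₃) →
        v-seq {G = λ _ k → if b₃ xor (b₄ ∧ b₅) then ret false else k tt} (v-guard (b₁ xor b₂) _ e₃) λ { _ _ refl →
        v-det (step₄ σ₃ h₃) λ { _ σ₄ h₄ → v-det (step₅ σ₄ h₄) λ { _ σ₅ h₅ → v-det (step₆ σ₅ h₅) λ { _ σ₆ h₆ →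
        v-det (step₇ σ₆ h₆) λ { _ σ₇ h₇ → v-det (step₈ σ₇ h₇) λ { _ σ₈ (h₈ , e₈) →
        v-seq {G = return} (v-guard (b₃ xor (b₄ ∧ b₅)) _ e₈) λ { _ _ refl →
        v-post (λ { _ _ refl → proj₁ h₈ , cong (_∸ 1) (proj₁ (proj₂ h₈)) }) (v-ops (dec 15 15 ∷ []) _ _) } } } } } } } } } }

    literal-body : ∀ c b r u δ → c < s → ∀ i y σ → LiteralInv c b r u δ σ → reg σ 15 ≡ suc i →
                   FragV literalBody 50 10 σ (literalStep u δ i y) (λ y′ σ′ → LiteralInv c b r u δ σ′ × reg σ′ 15 ≡ i)
    literal-body c b r u δ c<s i _ σ inv e15 =
      v-seq {G = λ x k → randVec n λ y → randVec n λ z → test x y z k} (v-rand 5 zeroth _ _ _) λ { x _ refl →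
      v-seq {G = λ y k → randVec n λ z → test x y z k} (v-rand 6 zeroth _ _ _) λ { y _ refl →
      v-seq {G = λ z k → test x y z k} (v-rand 7 zeroth _ _ _) λ { z _ refl →
      literal-test {c} {b} {r} {u} {δ} {x} {y} {z} {i} c<s _ (inv , e15 , refl , refl , refl , refl , refl) } } }
      where
      test : Vec Bool n → Vec Bool n → Vec Bool n → (⊤ → Comp n) → Comp n
      test x y z k = if A u δ x y xor A u δ zeros y then ret false else
        (if A u δ z (x ⊗ y) xor (A u δ z x ∧ A u δ z y) then ret false else k tt)

    private
      s<I : s < I
      s<I = ≤-<-trans (≤-trans (n≤1+n s) (m≤m+n (suc s) _)) 2s<I

    Fixed : Blocks → List (Vec Bool n) → State n → Set
    Fixed b xs σ = reg σ 1 ≡ s × reg σ 2 ≡ d × reg σ 6 ≡ R × reg σ 7 ≡ m × reg σ 8 ≡ suc s × reg σ 9 ≡ κ b ×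
      (∀ j → vec σ 9 j ≡ bu b j) × (∀ j → vec σ 10 j ≡ bd b j) ×
      (∀ t → t < m → vec σ 11 t ≡ nth xs t) × (∀ t → t < m → num σ 0 t 0 ≡ fromBit (f (nth xs t)))

    EvalInv : Blocks → List (Vec Bool n) → Matrix → State n → Set
    EvalInv b xs Y σ = Fixed b xs σ × (∀ t j → num σ 1 t (suc j) ≡ fromBit (Y t j))

    module _ (b : Blocks) (xs : List (Vec Bool n)) (κ≤s : κ b ≤ s) where

      RowInv : ℕ → Matrix → State n → Set
      RowInv t Y σ = EvalInv b xs Y σ × reg σ 11 ≡ suc t × reg σ 12 ≡ t

      CheckInv : ℕ → ℕ → Bool → Matrix → State n → Set
      CheckInv t j y Y σ = RowInv t Y σ × reg σ 13 ≡ suc j × reg σ 14 ≡ j × reg σ 16 ≡ fromBit y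

      eval-frag : ∀ a {t j Y z} σ → (T (valids (evalPre 14 7 11 (just 12)))) → T (valids (diff a 31 32 ∷ [])) → t < m → j < κ b →
                  RowInv t Y σ → reg σ 14 ≡ j → vec σ 7 0 ≡ z →
                  FragV (evalCode a 14 7 11 (just 12)) 8 2 σ (return tt)
                    (λ _ σ′ → σ′ ≡ setReg a (fromBit (A (bu b j) (bd b j) z (nth xs t))) (exec-ops (evalPre 14 7 11 (just 12)) σ))
      eval-frag a σ v v′ t<m j<κ (((_ , _ , _ , _ , _ , _ , r9 , r10 , smp , _) , _) , _ , e12) e14 ez =
        v-eval a 14 7 11 (just 12) v v′ refl refl (subst (_< I) (sym e14) (<-trans (≤-trans j<κ κ≤s) s<I)) (subst (_< I) (sym e12) (<-trans t<m m<I))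
          (trans (cong (vec σ 9) e14) (r9 _)) (trans (cong (vec σ 10) e14) (r10 _)) ez (trans (cong (vec σ 11) e12) (smp _ t<m))

      recheck-body : ∀ t j y Y → t < m → j < κ b → ∀ i x σ → CheckInv t j y Y σ → reg σ 15 ≡ suc i →
                     FragV recheckBody 12 2 σ (recheck (bu b j) (bd b j) (nth xs t) y i x) (λ _ σ′ → CheckInv t j y Y σ′ × reg σ′ 15 ≡ i)
      recheck-body t j y Y t<m j<κ i _ σ (rw , e13 , e14 , e16) e15 =
        v-seq {G = λ z k → if A (bu b j) (bd b j) z (nth xs t) xor y then ret false else k tt} (v-rand 7 zeroth _ _ _) λ { z _ refl →
        v-det {Mid = λ _ σ′ → CheckInv t j y Y σ′ × reg σ′ 15 ≡ suc i × reg σ′ 17 ≡ fromBit (A (bu b j) (bd b j) z (nth xs t))}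
          (v-post (λ { _ _ refl → (rw , e13 , e14 , e16) , e15 , refl }) (eval-frag 17 {t} {j} {Y} {z} _ _ _ t<m j<κ rw e14 refl))
          λ { _ σ₁ ((rw₁ , f13 , f14 , f16) , f15 , f17) →
        v-det (v-ops (diff 18 17 16 ∷ []) _ _) λ { _ _ refl →
        v-seq {G = return} (v-guard (A (bu b j) (bd b j) z (nth xs t) xor y) _ (trans (cong₂ (λ u v → (u ∸ v) + (v ∸ u)) f17 f16) (xor-arith _ y))) λ { _ _ refl →
        v-post (λ { _ _ refl → (rw₁ , f13 , f14 , f16) , cong (_∸ 1) f15 }) (v-ops (dec 15 15 ∷ []) _ _) } } } }

      -- The machine stores the bit before the rereadings, the algorithm afterwards. Both give the
      -- same computation, since a failed reread rejects and discards the matrix.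
      eval-body : ∀ t → t < m → ∀ j Y σ → j < κ b → RowInv t Y σ → reg σ 13 ≡ suc j →
                  FragV evalBody (15 + R * 13) (2 + R * 2) σ (evalRow b xs t j Y) (λ Y′ σ′ → RowInv t Y′ σ′ × reg σ′ 13 ≡ j)
      eval-body t t<m j Y σ j<κ rw e13 = conv (
        v-det {Mid = λ _ σ′ → RowInv t Y σ′ × reg σ′ 13 ≡ suc j × reg σ′ 14 ≡ j} (v-post (λ { _ _ refl → rw , e13 , cong (_∸ 1) e13 }) (v-ops (dec 14 13 ∷ []) _ _)) λ { _ σ₁ (rw₁ , f13 , f14) →
        v-seq {G = λ z k → iter (recheck (bu b j) (bd b j) (nth xs t) (A (bu b j) (bd b j) z (nth xs t))) R tt λ _ → k (update t j (A (bu b j) (bd b j) z (nth xs t)) Y)}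
          (v-rand 7 zeroth _ _ _) λ { z _ refl →
        v-det {Mid = λ _ σ′ → CheckInv t j (A (bu b j) (bd b j) z (nth xs t)) Y σ′}
          (v-post (λ { _ _ refl → rw₁ , f13 , f14 , refl }) (eval-frag 16 {t} {j} {Y} {z} _ _ _ t<m j<κ rw₁ f14 refl))
          λ { _ σ₂ c₂ →
        v-det {Mid = λ _ σ′ → CheckInv t j (A (bu b j) (bd b j) z (nth xs t)) (update t j (A (bu b j) (bd b j) z (nth xs t)) Y) σ′ × reg σ′ 15 ≡ R}
          (record-bit σ₂ c₂) λ { _ σ₃ (c₃ , e15) →
        v-seq {G = λ _ k → k (update t j (A (bu b j) (bd b j) z (nth xs t)) Y)}
          (v-for {c = 12} {2} (recheck (bu b j) (bd b j) (nth xs t) (A (bu b j) (bd b j) z (nth xs t))) (λ _ _ → CheckInv t j (A (bu b j) (bd b j) z (nth xs t)) (update t j (A (bu b j) (bd b j) z (nth xs t)) Y)) _ (recheck-body t j (A (bu b j) (bd b j) z (nth xs t)) (update t j (A (bu b j) (bd b j) z (nth xs t)) Y) t<m j<κ) R tt σ₃ c₃ e15)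
          λ { _ σ₄ ((rw₄ , g13 , _) , _) →
        v-carry (v-post (λ { _ _ refl → rw₄ , cong (_∸ 1) g13 }) (v-ops (dec 13 13 ∷ []) _ _)) } } } } })
        where
        conv : ∀ {F} {Post : Matrix → State n → Set} → FragV evalBody (1 + (1 + (8 + (3 + (1 + R * 13 + 1))))) (2 + (R * 2 + 0)) σ F Post → FragV evalBody (15 + R * 13) (2 + R * 2) σ F Post
        conv {F} {Post} = subst₂ (λ a q → FragV evalBody a q σ F Post) (cong (14 +_) (+-comm (R * 13) 1)) (cong (2 +_) (+-identityʳ (R * 2)))
        record-bit : ∀ σ₂ {v} → CheckInv t j v Y σ₂ →
                FragV (ops (put 1 (just 12) (just 13) 16 ∷ lit 31 0 ∷ sub 15 6 31 ∷ [])) 3 0 σ₂ (return tt) (λ _ σ′ → CheckInv t j v (update t j v Y) σ′ × reg σ′ 15 ≡ R)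
        record-bit σ₂ {v} (((fx@(e1 , e2 , e6 , e7 , e8 , e9 , r9 , r10 , smp , lb) , yok) , e11 , e12) , f13 , f14 , f16) =
          v-norm 12 e12 (v-norm 13 f13 (v-norm 16 f16 (v-post (λ { _ _ refl → ((((e1 , e2 , e6 , e7 , e8 , e9 , r9 , r10 , smp , lb) , yok′) , e11 , refl) , refl , f14 , refl) , e6 })
            (v-ops (put 1 (just 12) (just 13) 16 ∷ lit 31 0 ∷ sub 15 6 31 ∷ []) _ ((<-trans t<m m<I , ≤-<-trans (≤-trans j<κ κ≤s) s<w) , _)))))
          where
          yok′ : ∀ t′ j′ → (if (t′ ≡ᵇ t) ∧ (j′ ≡ᵇ j) then fromBit v else num σ₂ 1 t′ (suc j′)) ≡ fromBit (update t j v Y t′ j′)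
          yok′ t′ j′ with (t′ ≡ᵇ t) ∧ (j′ ≡ᵇ j)
          ... | true  = refl
          ... | false = yok t′ j′

      evalRows-cost : ℕ
      evalRows-cost = 3 + (1 + κ b * (16 + R * 13) + 1)

      evalRows-body : ∀ t Y σ → EvalInv b xs Y σ → reg σ 11 ≡ suc t → t < m →
                      FragV evalRows evalRows-cost (κ b * (2 + R * 2)) σ (evalAll b xs t Y) (λ Y′ σ′ → EvalInv b xs Y′ σ′ × reg σ′ 11 ≡ t)
      evalRows-body t Y σ inv e11 t<m = subst (λ q → FragV evalRows evalRows-cost q σ (evalAll b xs t Y) (λ Y′ σ′ → EvalInv b xs Y′ σ′ × reg σ′ 11 ≡ t)) (+-identityʳ (κ b * (2 + R * 2)))
        (v-det {Mid = λ _ σ′ → RowInv t Y σ′ × reg σ′ 13 ≡ κ b}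
          (v-post (λ { _ _ refl → (inv , e11 , cong (_∸ 1) e11) , proj₁ (proj₂ (proj₂ (proj₂ (proj₂ (proj₂ (proj₁ inv)))))) }) (v-ops (dec 12 11 ∷ lit 31 0 ∷ sub 13 9 31 ∷ []) _ _))
        λ { _ σ₁ (rw , e13) →
        v-then {Mid = λ Y′ σ′ → RowInv t Y′ σ′}
          (v-post (λ { _ _ ((rw′ , _) , _) → rw′ }) (v-for {c = 15 + R * 13} {2 + R * 2} (evalRow b xs t) (λ j Y σ → RowInv t Y σ × j ≤ κ b) _
             (λ { j Y σ (rw , j<) e → v-post (λ { Y′ σ′ (rw′ , e′) → (rw′ , <⇒≤ j<) , e′ }) (eval-body t t<m j Y σ j< rw e) })
             (κ b) Y σ₁ (rw , ≤-refl) e13))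
        λ { Y′ σ₂ (inv₂ , f11 , _) → v-post (λ { _ _ refl → inv₂ , cong (_∸ 1) f11 }) (v-ops (dec 11 11 ∷ []) _ _) } })

      evalTime : ℕ
      evalTime = 1 + m * (1 + evalRows-cost)

      dfsTime : ℕ
      dfsTime = Search.callCost (κ b) κ≤s (λ _ _ → false) (λ _ → false) d 0

      finalTime : ℕ
      finalTime = 2 * V + (evalTime * V + ((36 + (dfsTime + 22)) + (12 + 4)))

      final-frag : ∀ {X : Set} {Post : X → State n → Set} σ → EvalInv b xs (λ _ _ → false) σ →
                   Frag finalCode finalTime (0 + (m * (κ b * (2 + R * 2)) + (0 + (0 + 0)))) σ (λ _ → final b xs) Post
      final-frag {X} {Post} σ inv = f-det {Mid = λ _ σ′ → EvalInv b xs (λ _ _ → false) σ′ × reg σ′ 11 ≡ m}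
        (frag-of (v-post (λ { _ _ refl → inv , proj₁ (proj₂ (proj₂ (proj₂ (proj₁ inv)))) }) (v-ops (lit 31 0 ∷ sub 11 7 31 ∷ []) _ _)))
        λ { _ σ₁ (inv₁ , e11) →
        f-seq {G = λ Y _ → decide b xs Y}
          (frag-of (v-for {c = evalRows-cost} {κ b * (2 + R * 2)} (evalAll b xs) (λ t Y σ → EvalInv b xs Y σ × t ≤ m) _
            (λ { t Y σ (inv , t<) e → v-post (λ { Y′ σ′ (inv′ , e′) → (inv′ , <⇒≤ t<) , e′ }) (evalRows-body t Y σ inv e t<) })
            m (λ _ _ → false) σ₁ (inv₁ , ≤-refl) e11))
        λ { Y σ₂ (((( e1 , e2 , e6 , e7 , e8 , e9 , r9 , r10 , smp , lb) , yok) , _) , _) →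
        f-det (same-cost Y (Search.dfs-frag (κ b) κ≤s Y (λ t → f (nth xs t)) e1 e2 e7 e8 e9 lb yok)) λ { _ σ₃ (e23 , f1) →
        f-det (f-ops (sub 16 23 1 ∷ []) _ _) λ { _ _ refl →
        f-ifz _ (λ z → halts (≤ᵇ-true (found Y) s (subst₂ (λ u v → u ∸ v ≡ 0) e23 f1 z)))
                (λ nz → halts (≤ᵇ-false (found Y) s (λ z → nz (subst₂ (λ u v → u ∸ v ≡ 0) (sym e23) (sym f1) z)))) } } } }
        where
        found : Matrix → ℕ
        found Y = MinSize.minSize Y (λ t → f (nth xs t)) m (κ b) s d []
        halts : ∀ {r r′ σ} → r ≡ r′ → Frag (ins (halt r′)) 1 0 σ (λ _ → ret r) Post
        halts refl = f-halt
        ≤ᵇ-true : ∀ x y → x ∸ y ≡ 0 → (x ≤ᵇ y) ≡ true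
        ≤ᵇ-true x y e with x ≤ᵇ y in eq
        ... | true  = refl
        ... | false = ⊥-elim (subst T eq (≤⇒≤ᵇ (m∸n≡0⇒m≤n {x} {y} e)))
        ≤ᵇ-false : ∀ x y → ¬ (x ∸ y ≡ 0) → (x ≤ᵇ y) ≡ false
        ≤ᵇ-false x y ne with x ≤ᵇ y in eq
        ... | false = refl
        ... | true  = ⊥-elim (ne (m≤n⇒m∸n≡0 (≤ᵇ⇒≤ x y (subst T (sym eq) tt))))
        -- The cost of the search depends on neither the matrix nor the labels, so one closed bound
        -- serves all random outcomes.
        same-cost : ∀ Y {S σ Post} → Frag {⊤} S (36 + (Search.callCost (κ b) κ≤s Y (λ t → f (nth xs t)) d 0 + 22)) 0 σ (return tt) Post →
                    Frag S (36 + (dfsTime + 22)) 0 σ (return tt) Post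
        same-cost Y = f-weaken (≤-reflexive (cong (λ c → 36 + (c + 22)) (cost-eq d 0))) ≤-refl
          where
          cost-eq : ∀ r l → Search.callCost (κ b) κ≤s Y (λ t → f (nth xs t)) r l ≡ Search.callCost (κ b) κ≤s (λ _ _ → false) (λ _ → false) r l
          cost-eq zero    l = refl
          cost-eq (suc r) l rewrite cost-eq r (suc l) = refl

    newUnits newQueries roundUnits roundQueries : ℕ
    newUnits     = 4 + ((1 + R * 12) + (5 + ((1 + R * 51) + 3)))
    newQueries   = R * 2 + R * 10
    roundUnits   = 3 + ((1 + m * 11) + (1 + newUnits))
    roundQueries = m * 2 + newQueries

    v-weaken : ∀ {X S a a′ q q′ σ F} {Post : X → State n → Set} → a ≤ a′ → q ≤ q′ → FragV S a q σ F Post → FragV S a′ q′ σ F Post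
    v-weaken l r (units fr) = units (f-weaken (*-monoˡ-≤ V l) r fr)

    v-zero : ∀ {X a S T c q σ F} {Post : X → State n → Set} → IsReg a → reg σ a ≡ 0 → FragV S c q σ F Post → FragV (ifz a S T) (1 + c) q σ F Post
    v-zero l e (units fr) = units (f-weaken (+-monoˡ-≤ _ (≤-trans (m≤m+n 3 9) 12≤cost-vector)) ≤-refl (f-zero l e fr))

    v-suc : ∀ {X a S T c q σ F k} {Post : X → State n → Set} → IsReg a → reg σ a ≡ suc k → FragV T c q σ F Post → FragV (ifz a S T) (1 + c) q σ F Post
    v-suc l e (units fr) = units (f-weaken (+-monoˡ-≤ _ (≤-trans (m≤m+n 3 9) 12≤cost-vector)) ≤-refl (f-suc l e fr))

    Again : Blocks → ℕ → State n → Set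
    Again b r σ = Env (κ b) b r σ × κ b + r ≡ s × reg σ 19 ≡ 1

    Done : Blocks → List (Vec Bool n) → State n → Set
    Done b xs σ = reg σ 19 ≡ 0 × EvalInv b xs (λ _ _ → false) σ × κ b < s

    -- After the search the block is stored, but not yet counted.
    start-frag : ∀ b r u δ σ → κ b < s → SearchInv b (suc r) (u , δ) σ →
                 FragV (ops startOps) 5 0 σ (return tt) (λ _ σ′ → LiteralInv (κ b) (append u δ b) (suc r) u δ σ′ × reg σ′ 15 ≡ R)
    start-frag b r u δ σ κ<s ((e1 , e2 , e6 , e7 , e8 , e9 , e10 , z8 , z0 , rows9 , rows10 , y0) , eu , ed) =
      v-norm 9 e9 (v-post (λ { _ _ refl → ((e1 , e2 , e6 , e7 , e8 , refl , e10 , z8 , cong₂ _⊕_ z0 ed , row9′ , row10′ , y0) ,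
          trans (hit (κ b)) eu′ , trans (hit (κ b)) ed′) , e6 })
        (v-ops startOps _ ((κ<I , _ , _) , (κ<I , _ , _) , _)))
      where
      κ<I = <-trans κ<s s<I
      eu′ : vec σ 1 0 ⊗ vec σ 1 0 ≡ u
      eu′ = trans (⊗-idem _) eu
      ed′ : vec σ 2 0 ⊗ vec σ 2 0 ≡ δ
      ed′ = trans (⊗-idem _) ed
      row9′ : ∀ j → (if j ≡ᵇ κ b then vec σ 1 0 ⊗ vec σ 1 0 else vec σ 9 j) ≡ (if j ≡ᵇ κ b then u else bu b j)
      row9′ j with j ≡ᵇ κ b
      ... | true  = eu′
      ... | false = rows9 j
      row10′ : ∀ j → (if j ≡ᵇ κ b then vec σ 2 0 ⊗ vec σ 2 0 else vec σ 10 j) ≡ (if j ≡ᵇ κ b then δ else bd b j)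
      row10′ j with j ≡ᵇ κ b
      ... | true  = ed′
      ... | false = rows10 j

    new-frag : ∀ b r x σ → Env (κ b) b (suc r) σ → κ b + suc r ≡ s → vec σ 1 0 ≡ x →
               FragV newCode newUnits newQueries σ (newBlock b x) (λ b′ σ′ → Again b′ r σ′)
    new-frag b r x σ env@(e1 , e2 , e6 , e7 , e8 , e9 , e10 , z8 , z0 , rows9 , rows10 , y0) κr ex =
      v-det {Mid = λ _ σ′ → SearchInv b (suc r) (x , x ⊕ x ⊗ mask b) σ′ × reg σ′ 15 ≡ R}
        (v-post (λ { _ _ refl → (env , ex , cong₂ (λ x B → x ⊕ x ⊗ B) ex z0) , e6 }) (v-ops newOps _ _)) λ { _ σ₁ (inv₁ , e15) →
      v-seq {q₁ = R * 10} {G = λ y k → testBlock b y k}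
        (v-for {c = 11} {2} searchStep (λ _ y σ → SearchInv b (suc r) y σ) _ (search-body b (suc r)) R _ σ₁ inv₁ e15)
        λ { (u , δ) σ₂ (inv₂ , _) → v-weaken ≤-refl (≤-reflexive (+-identityʳ (R * 10)))
      (v-det (start-frag b r u δ σ₂ κ<s inv₂) λ { _ σ₃ (inv₃ , f15) →
      v-seq {G = λ _ k → k (append u δ b)}
        (v-for {c = 50} {10} (literalStep u δ) (λ _ _ σ → LiteralInv (κ b) (append u δ b) (suc r) u δ σ) _
          (literal-body (κ b) (append u δ b) (suc r) u δ κ<s) R tt σ₃ inv₃ f15)
        λ { _ σ₄ (((f1 , f2 , f6 , f7 , f8 , f9 , f10 , z8 , z0 , rows9 , rows10 , y0) , _ , _) , _) →
      v-carry (v-post (λ { _ _ refl → (f1 , f2 , f6 , f7 , f8 , cong suc f9 , cong (_∸ 1) f10 , z8 , z0 , rows9 , rows10 , y0) ,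
                          trans (sym (+-suc (κ b) r)) κr , refl })
        (v-ops (inc 9 9 ∷ dec 10 10 ∷ lit 19 1 ∷ []) _ (subst (λ u → suc u < W) (sym f9) (<-≤-trans (≤-<-trans κ<s s<I) I≤W) , _))) } }) } }
      where
      κ<s : κ b < s
      κ<s = subst (κ b <_) (trans (sym (+-suc (κ b) r)) κr) (s≤s (m≤m+n (κ b) r))

    v-map : ∀ {X Y S a q σ F} {Post : Y → State n → Set} (g : X → Y) → FragV S a q σ F (λ x → Post (g x)) → FragV S a q σ (λ k → F (λ x → k (g x))) Post
    v-map {X} {Y} {S} {a} {q} {σ} {F} {Post} g (units fr) = units (sfrag go)
      where
      go : ∀ {M} → Rep M σ → MFrag S (a * V) q M (λ k → F (λ x → k (g x))) (λ y M′ → Σ (State n) λ σ′ → Post y σ′ × Rep M′ σ′)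
      go rep .apply k c b h = apply (runF fr rep) (λ x → k (g x)) c b (λ x → h (g x))

    rows-nth : ∀ t xs {g h} → Rows t xs g h → ∀ i → i < length xs → g (t + i) ≡ nth xs i × h (t + i) 0 ≡ fromBit (f (nth xs i))
    rows-nth t (x ∷ xs) {g} {h} (a , b , rw) zero    l = trans (cong g (+-identityʳ t)) a , trans (cong (λ u → h u 0) (+-identityʳ t)) b
    rows-nth t (x ∷ xs) {g} {h} (a , b , rw) (suc i) (s≤s l) with rows-nth (suc t) xs rw i l
    ... | p , q = trans (cong g (+-suc t i)) p , trans (cong (λ u → h u 0) (+-suc t i)) q

    done : ∀ {b r xs σ} → BatchInv b r 0 (xs , nothing) σ → κ b < s → Done b xs σ
    done {xs = xs} ((e1 , e2 , e6 , e7 , e8 , e9 , e10 , z8 , z0 , rows9 , rows10 , y0) , len≡ , rw , e19) κ<s =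
      e19 , ((e1 , e2 , e6 , e7 , e8 , e9 , rows9 , rows10 ,
        (λ t l → proj₁ (rows-nth 0 xs rw t (subst (t <_) (sym len≡) l))) , (λ t l → proj₂ (rows-nth 0 xs rw t (subst (t <_) (sym len≡) l)))) , y0) , κ<s

    After : Blocks → ℕ → Blocks ⊎ List (Vec Bool n) → State n → Set
    After b r (inj₁ b′) σ = Again b′ r σ
    After b r (inj₂ xs) σ = Done b xs σ × reg σ 10 ≡ 0

    round-frag : ∀ b r σ → Again b (suc r) σ →
                 FragV roundBody roundUnits roundQueries σ (λ k → iter (batchStep (mask b)) m ([] , nothing) (λ y → afterBatch b y k)) (After b r)
    round-frag b r σ (env@(e1 , e2 , e6 , e7 , e8 , e9 , e10 , z8 , z0 , rows9 , rows10 , y0) , κr , e19) =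
      v-det {Mid = λ _ σ′ → BatchInv b (suc r) m ([] , nothing) σ′ × reg σ′ 11 ≡ m}
        (v-post (λ { _ _ refl → (env , +-identityʳ m , tt , refl) , e7 }) (v-ops (lit 19 0 ∷ lit 31 0 ∷ sub 11 7 31 ∷ []) _ _)) λ { _ σ₁ (inv₁ , e11) →
      v-seq {G = λ y k → afterBatch b y k}
        (v-for {c = 10} {2} (batchStep (mask b)) (BatchInv b (suc r)) _ (batch-body b (suc r)) m _ σ₁ inv₁ e11)
        λ { (xs , nothing) σ₂ (inv₂ , _) → v-weaken (+-monoʳ-≤ 1 (m≤m+n 1 (3 + ((1 + R * 12) + (5 + ((1 + R * 51) + 3)))))) z≤n
              (v-zero _ (proj₂ (proj₂ (proj₂ inv₂))) (v-carry (v-post (λ { _ _ refl → done {b} {suc r} {xs} {σ₂} inv₂ κ<s , refl }) (v-ops (lit 10 0 ∷ []) _ _))))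
          ; (xs , just x) σ₂ ((env₂ , _ , _ , f19 , fx) , _) → v-suc _ f19 (v-map inj₁ (new-frag b r x σ₂ env₂ κr fx)) } }
      where
      κ<s : κ b < s
      κ<s = subst (κ b <_) (trans (sym (+-suc (κ b) r)) κr) (s≤s (m≤m+n (κ b) r))

    -- Register 19 distinguishes the two ways out of the loop: all rounds used up by witnesses, or a
    -- batch without a witness.
    RoundsPost : Outcome → State n → Set
    RoundsPost nothing         σ = reg σ 19 ≡ 1
    RoundsPost (just (b , xs)) σ = Done b xs σ

    rounds-frag : ∀ r b σ → Again b r σ →
                  Frag (while 10 roundBody) (1 + r * (3 + roundUnits * V)) (r * roundQueries) σ (rounds r b) RoundsPost
    rounds-frag zero    b σ ag@(env , κr , e19) = f-exit _ (proj₁ (proj₂ (proj₂ (proj₂ (proj₂ (proj₂ (proj₂ env))))))) e19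
    rounds-frag (suc r) b σ ag@(env , κr , e19) = f-weaken (≤-reflexive (+-suc (3 + roundUnits * V) _)) ≤-refl
      (f-unroll {G = continue r b} _ (λ e → case trans (sym (proj₁ (proj₂ (proj₂ (proj₂ (proj₂ (proj₂ (proj₂ env)))))))) e of λ ())
        (frag-of (round-frag b r σ ag))
        λ { (inj₁ b′) σ′ ag′ → rounds-frag r b′ σ′ ag′
          ; (inj₂ xs) σ′ (dn , e10) → f-weaken (m≤m+n 1 _) z≤n (f-exit _ e10 dn) })

-- The whole program, with its parameters computed on the machine

module TesterCode where

  open Compilation
  open Operations
  open TesterAlgorithm
  open Subroutines
  open import Data.Nat
  open import Data.Nat.DivMod using (m/n<m)
  open import Data.Nat.Properties
  open import Data.Vec.Properties using (lookup-replicate)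

  -- The length of the binary expansion of x, provided the fuel g is at least x; it plays the role
  -- of a rounded logarithm.
  bits : ℕ → ℕ → ℕ
  bits zero    x       = 0
  bits (suc g) zero    = 0
  bits (suc g) (suc x) = suc (bits g (quotient (suc x) 2))

  -- Raw instructions, since the width and count cells lie outside the registers that abstract
  -- operations may write.
  setup : List Instr
  setup = add 40 0 1 ∷ const 61 4 ∷ add 40 40 61 ∷ const 61 0 ∷ add 41 61 0 ∷ []

  parameterOps₁ halveOps parameterOps₂ : List Op
  parameterOps₁ = lit 30 2 ∷ div 5 4 3 ∷ inc 5 5 ∷ mul 16 1 1 ∷ mul 16 16 5 ∷ lit 29 0 ∷ []
  halveOps      = div 16 16 30 ∷ inc 29 29 ∷ []
  parameterOps₂ = lit 31 48 ∷ mul 6 29 31 ∷ add 6 6 6 ∷ lit 31 7 ∷ mul 7 29 31 ∷ mul 7 7 1 ∷ mul 7 7 5 ∷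
                  inc 8 1 ∷ lit 31 0 ∷ sub 10 1 31 ∷ lit 19 1 ∷ []

  -- The case n = 0 is accepted at once: the time bound then lacks its second summand and would not
  -- pay for the tester, and f is constant anyway.
  mainLoop testerCode : Stmt
  mainLoop   = while 10 roundBody ⨟ ifz 19 finalCode (ins (halt false))
  testerCode = ifz 0 (ins (halt true)) (line setup ⨟ (ops parameterOps₁ ⨟ (while 16 (ops halveOps) ⨟ (ops parameterOps₂ ⨟ mainLoop))))

  -- The quantities computed from s and ε = a / b.
  module Parameters (s a b : ℕ) where
    N q λ₀ R m : ℕ
    N  = suc (quotient b a)
    q  = s * s * N
    λ₀ = bits q q
    R  = λ₀ * 48 + λ₀ * 48
    m  = λ₀ * 7 * s * N

  -- Running time of the search for a small tree.
  module SearchTime (m κ : ℕ) where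
    searchTime : ℕ → ℕ → ℕ
    searchTime zero    l = 3 + (51 + ((1 + m * (148 + l * 111)) + 150))
    searchTime (suc r) l = 3 + (51 + ((1 + m * (148 + l * 111)) + 150)) + (suc κ * 303 + κ * (searchTime r (suc l) + (303 + searchTime r (suc l))))

  open SearchTime public

  searchTime-mono : ∀ m {κ κ′} → κ ≤ κ′ → ∀ r l → searchTime m κ r l ≤ searchTime m κ′ r l
  searchTime-mono m l zero    i = ≤-refl
  searchTime-mono m l (suc r) i = +-monoʳ-≤ (3 + (51 + ((1 + m * (148 + i * 111)) + 150)))
    (+-mono-≤ (*-monoˡ-≤ 303 (s≤s l)) (*-mono-≤ l (+-mono-≤ (searchTime-mono m l r (suc i)) (+-monoʳ-≤ 303 (searchTime-mono m l r (suc i))))))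

  module WholeProgram {n : ℕ} (f : BoolFun n) (s d a b W I : ℕ)
                      (0<n : 0 < n) (1≤s : 1 ≤ s) (64<W : 64 < W) (space : 64 + 18 * I * (n + s + 4) ≤ W)
                      (n<I : n + s + 4 < I) (d<I : d < I) (2s<I : suc s + suc s < I) (a<I : a < I) (b<I : b < I)
                      (N<I : Parameters.N s a b < I) (s²<I : s * s < I) (q<I : Parameters.q s a b < I) (R<I : Parameters.R s a b < I) (m₁<I : Parameters.λ₀ s a b * 7 * s < I) (m<I : Parameters.m s a b < I) where

    open Parameters s a b

    w : ℕ
    w = n + s + 4

    private
      n<w : n < w
      n<w = ≤-<-trans (m≤m+n n s) (m<m+n (n + s) (s≤s z≤n))
      s<w : s < w
      s<w = ≤-<-trans (m≤n+m s n) (m<m+n (n + s) (s≤s z≤n))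
      0<I : 0 < I
      0<I = ≤-trans (s≤s z≤n) d<I

    open RoundProgram f W w I n<w 0<I 64<W space s d m R s<w m<I d<I 2s<I

    private
      up : ∀ {x} → x < I → x < W
      up l = <-≤-trans l I≤W

    halve-frag : ∀ g x c {σ} → x ≤ g → c + bits g x < I → reg σ 16 ≡ x → reg σ 30 ≡ 2 → reg σ 29 ≡ c →
                 Frag (while 16 (ops halveOps)) (1 + g * 27) 0 σ (return tt)
                   (λ _ σ′ → reg σ′ 29 ≡ c + bits g x × (reg σ′ 1 ≡ reg σ 1 × reg σ′ 2 ≡ reg σ 2 × reg σ′ 5 ≡ reg σ 5 × reg σ′ 9 ≡ reg σ 9) × vec σ′ ≡ vec σ × num σ′ ≡ num σ)
    halve-frag zero    zero    c l h e16 e30 e29 = f-exit _ e16 (trans e29 (sym (+-identityʳ c)) , (refl , refl , refl , refl) , refl , refl)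
    halve-frag (suc g) zero    c l h e16 e30 e29 = f-weaken (m≤m+n 1 _) ≤-refl (f-exit _ e16 (trans e29 (sym (+-identityʳ c)) , (refl , refl , refl , refl) , refl , refl))
    halve-frag (suc g) (suc x) c {σ} l h e16 e30 e29 = f-weaken (≤-reflexive (+-suc 27 (g * 27))) ≤-refl
      (f-norm 16 e16 (f-norm 30 e30 (f-norm 29 e29
        (f-unroll {G = λ _ → return tt} _ (λ ()) (f-ops halveOps _ (_ , up (≤-<-trans (≤-trans (s≤s (m≤m+n c _)) (≤-reflexive (sym (+-suc c _)))) h) , _))
          λ { _ _ refl → f-post (λ { _ _ (p , keep , ev , en) → trans p (sym (+-suc c _)) , keep , ev , en })
                (halve-frag g (quotient (suc x) 2) (suc c) (≤-pred (≤-trans (m/n<m (suc x) 2 ≤-refl) l)) (subst (_< I) (+-suc c _) h) refl refl refl) }))))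

    private
      m<n⇒m≤n∸1 : ∀ {x y} → x < y → x ≤ y ∸ 1
      m<n⇒m≤n∸1 (s≤s l) = l

    -- The search is charged for s - 1 blocks rather than s. This gives a factor s³ per level, which
    -- is 1 for s = 1, as the term s^O(d) demands.
    finalBound : ℕ
    finalBound = 2 * V + ((1 + m * (1 + (3 + (1 + s * (16 + R * 13) + 1)))) * V + ((36 + (searchTime m (s ∸ 1) d 0 + 22)) + (12 + 4)))

    final-time≤ : ∀ bl xs (h : κ bl < s) → finalTime bl xs (<⇒≤ h) ≤ finalBound
    final-time≤ bl xs h = +-monoʳ-≤ (2 * V) (+-mono-≤
      (*-monoˡ-≤ V (+-monoʳ-≤ 1 (*-monoʳ-≤ m (+-monoʳ-≤ 4 (+-monoʳ-≤ 1 (+-monoˡ-≤ 1 (*-monoˡ-≤ (16 + R * 13) (<⇒≤ h))))))))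
      (+-monoˡ-≤ 16 (+-monoʳ-≤ 36 (+-monoˡ-≤ 22 (≤-trans (≤-reflexive (same d 0)) (searchTime-mono m (m<n⇒m≤n∸1 h) d 0))))))
      where
      same : ∀ r l → Search.callCost (κ bl) (<⇒≤ h) (λ _ _ → false) (λ _ → false) r l ≡ searchTime m (κ bl) r l
      same zero    l = refl
      same (suc r) l rewrite same r (suc l) = refl

    mainTime mainQueries : ℕ
    mainTime    = (1 + s * (3 + roundUnits * V)) + (3 + finalBound)
    mainQueries = s * roundQueries + m * (s * (2 + R * 2))

    main-frag : ∀ {σ} → Again noBlocks s σ → Frag {⊤} mainLoop mainTime mainQueries σ (λ _ → tester) (λ _ _ → ⊥)
    main-frag {σ} ag = f-seq {G = λ o _ → finish o} (rounds-frag s noBlocks σ ag) λ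
      { nothing σ′ e → f-weaken (+-monoʳ-≤ 3 1≤final) z≤n (f-suc _ e (f-halt {t = 0}))
      ; (just (bl , xs)) σ′ (e , inv , h) → f-zero _ e (f-weaken (final-time≤ bl xs h) (≤-trans (≤-reflexive (+-identityʳ _)) (*-monoʳ-≤ m (*-monoˡ-≤ (2 + R * 2) (<⇒≤ h)))) (final-frag bl xs (<⇒≤ h) σ′ inv)) }
      where
      1≤final : 1 ≤ finalBound
      1≤final = ≤-trans (≤-trans (m≤m+n 1 _) (m≤n+m _ ((1 + m * (1 + (3 + (1 + s * (16 + R * 13) + 1)))) * V))) (m≤n+m _ (2 * V))

    V-def : V ≡ 40 + n * 14
    V-def = cost-vector-def

    wholeTime : ℕ
    wholeTime = 3 + (5 + (72 + ((1 + q * 27) + (132 + mainTime))))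

    params-frag : ∀ {σ} → reg σ 1 ≡ s → reg σ 2 ≡ d → reg σ 3 ≡ a → reg σ 4 ≡ b → reg σ 9 ≡ 0 →
                  (∀ K i → vec σ K i ≡ zeros) → (∀ K i c → num σ K i c ≡ 0) →
                  Frag {⊤} (ops parameterOps₁ ⨟ (while 16 (ops halveOps) ⨟ (ops parameterOps₂ ⨟ mainLoop))) (72 + ((1 + q * 27) + (132 + mainTime))) mainQueries σ (λ _ → tester) (λ _ _ → ⊥)
    params-frag {σ} e1 e2 e3 e4 e9 ev en = f-norm 1 e1 (f-norm 3 e3 (f-norm 4 e4
      (f-det (f-ops parameterOps₁ _ (_ , _ , up N<I , up s²<I , up q<I , _)) λ { _ _ refl →
       f-det (halve-frag q q 0 ≤-refl λ<I refl refl refl) λ { _ σ₂ (f29 , (f1 , f2 , f5 , f9) , fv , fn) →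
       f-norm 29 f29 (f-norm 1 f1 (f-norm 5 f5
       (f-det (f-ops parameterOps₂ _ (_ , up λ48<I , up R<I , _ , up λ7<I , up m₁<I , up m<I , up s<I′ , _)) λ { _ _ refl →
       main-frag ((refl , trans f2 e2 , refl , refl , refl , trans f9 e9 , refl , at fv 8 0 , at fv 0 0 , (λ j → at fv 9 j) , (λ j → at fv 10 j) , (λ t j → at′ fn 1 t (suc j))) , refl , refl) }))) } })))
      where
      λ48≤R : λ₀ * 48 ≤ R
      λ48≤R = m≤m+n _ _
      λ48<I = ≤-<-trans λ48≤R R<I
      λ<I : bits q q < I
      λ<I = ≤-<-trans (≤-trans (m≤m*n λ₀ 48) λ48≤R) R<I
      λ7<I : λ₀ * 7 < I
      λ7<I = ≤-<-trans (≤-trans (*-monoʳ-≤ λ₀ (m≤m+n 7 41)) λ48≤R) R<I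
      s<I′ : suc s < I
      s<I′ = ≤-<-trans (m≤m+n (suc s) _) 2s<I
      at : ∀ {v} → v ≡ vec σ → ∀ K i → v K i ≡ zeros
      at refl = ev
      at′ : ∀ {v} → v ≡ num σ → ∀ K i c → v K i c ≡ 0
      at′ refl = en

    whole-frag : ∀ {M} → M 0 ≡ n → M 1 ≡ s → M 2 ≡ d → M 3 ≡ a → M 4 ≡ b → (∀ c → 5 ≤ c → M c ≡ 0) →
                 MFrag {⊤} testerCode wholeTime mainQueries M (λ _ → tester) (λ _ _ → ⊥)
    whole-frag {M} i0 i1 i2 i3 i4 i5 = m-ifz (λ x M ()) (λ e → ⊥-elim (<⇒≢ 0<n (trans (sym e) i0))) λ _ →
      m-seq {G = λ _ _ → tester} (m-line setup (subst (_< W) (sym (cong₂ _+_ i0 i1)) (up (≤-<-trans (m≤m+n (n + s) 4) n<I)) , ≤-trans (m≤m+n 5 60) 64<W ,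
                          subst (_< W) (sym (cong (_+ 4) (cong₂ _+_ i0 i1))) (up n<I) , ≤-trans (s≤s z≤n) 64<W , subst (_< W) (sym i0) (up (≤-<-trans (≤-trans (m≤m+n n s) (m≤m+n (n + s) 4)) n<I)) , tt))
        λ { _ _ refl → m-post (λ { _ _ (_ , () , _) }) (runF (params-frag {σ = start′} i1 i2 i3 i4 (i5 9 (m≤m+n 5 4)) (λ _ _ → refl) (λ _ _ _ → refl)) rep) }
      where
      start′ : State n
      start′ = st M (λ _ _ → zeros) (λ _ _ _ → 0)
      untouched′ : ∀ c → 64 ≤ c → effects setup M c ≡ 0
      untouched′ c l = trans (untouched 40 64 setup _ M c (λ { (_ , h) → <⇒≱ h l })) (i5 c (≤-trans (m≤m+n 5 59) l))
      rep : Rep (effects setup M) start′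
      rep .regs {c} l = untouched 40 64 setup _ M c (λ { (h , _) → <⇒≱ l h })
      rep .width = cong (_+ 4) (cong₂ _+_ i0 i1)
      rep .count = i0
      rep .vecs {K} lK i c = trans (untouched′ _ (64≤addr K i _)) (sym (cong fromBit (lookup-replicate c false)))
      rep .nums {K} lK i {c} lc = untouched′ _ (64≤addr (12 + K) i c)

-- Order and arithmetic of Cauchy reals

module RealOrder where

  open Compilation using (_≋_)
  import Data.Integer as ℤ
  import Data.Integer.Properties as ℤₚ
  open import Data.Nat as ℕ using (ℕ; zero; suc)
  import Data.Nat.Properties as ℕₚ
  open import Data.Nat.Coprimality using (1-coprimeTo) renaming (sym to coprime-sym)
  open import Data.Rational as ℚ using (ℚ; 0ℚ; 1ℚ; ½; mkℚ; _+_; _*_; _≤_; _<_)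
  open import Data.Rational.Properties as ℚₚ hiding (+-mono-≤)
  import Data.Rational.Unnormalised as ℚᵘ
  import Data.Rational.Unnormalised.Properties as ℚᵘₚ
  open import Data.Rational.Solver using (module +-*-Solver)

  open +-*-Solver using (solve; _:+_; _:*_; _:-_; :-_; _:=_; con)

  -- Written directly in lowest terms, so that comparisons of numerals hold by computation.
  ι : ℕ → ℚ
  ι k = mkℚ (ℤ.+ k) 0 (coprime-sym (1-coprimeTo k))

  ι-+ : ∀ a b → ι (a ℕ.+ b) ≡ ι a + ι b
  ι-+ a b = toℚᵘ-injective (ℚᵘₚ.≃-trans (ℚᵘ.*≡* (cong (ℤ._* ℤ.1ℤ) (sym (cong₂ ℤ._+_ (ℤₚ.*-identityʳ (ℤ.+ a)) (ℤₚ.*-identityʳ (ℤ.+ b))))))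
    (ℚᵘₚ.≃-sym (toℚᵘ-homo-+ (ι a) (ι b))))

  ι-* : ∀ a b → ι (a ℕ.* b) ≡ ι a * ι b
  ι-* a b = toℚᵘ-injective (ℚᵘₚ.≃-trans (ℚᵘ.*≡* (cong (ℤ._* ℤ.1ℤ) (ℤₚ.pos-* a b))) (ℚᵘₚ.≃-sym (toℚᵘ-homo-* (ι a) (ι b))))

  ι-≤ : ∀ {a b} → a ℕ.≤ b → ι a ≤ ι b
  ι-≤ {a} {b} l = ℚ.*≤* (subst₂ ℤ._≤_ (sym (ℤₚ.*-identityʳ (ℤ.+ a))) (sym (ℤₚ.*-identityʳ (ℤ.+ b))) (ℤ.+≤+ l))

  instance
    ι-nonNeg : ∀ {a} → ℚ.NonNegative (ι a)
    ι-nonNeg {a} = ℚ.nonNegative (ι-≤ {0} {a} ℕ.z≤n)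

  ι-pos : ∀ {a} → 0 ℕ.< a → ℚ.Positive (ι a)
  ι-pos {suc a} l = _

  -- The order on the reals.
  ≤-pointwise : ∀ {x y} → (∀ k → seq x k ≤ seq y k) → x ≤ℝ y
  ≤-pointwise {x} {y} h δ 0<δ = 0 , λ k _ → ≤-trans (h k) (≤-trans (≤-reflexive (sym (+-identityʳ _))) (+-monoʳ-≤ (seq y k) (<⇒≤ 0<δ)))

  ≋⇒≤ : ∀ {x y} → x ≋ y → x ≤ℝ y
  ≋⇒≤ {x} {y} h = ≤-pointwise {x} {y} (λ k → ≤-reflexive (h k))

  private
    interchange : ∀ a b c d → (a + b) + (c + d) ≡ (a + c) + (b + d)
    interchange = solve 4 (λ a b c d → (a :+ b) :+ (c :+ d) := (a :+ c) :+ (b :+ d)) refl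

    half : ℚ → ℚ
    half δ = δ * ½

    0<half : ∀ {δ} → 0ℚ < δ → 0ℚ < half δ
    0<half {δ} h = positive⁻¹ (δ * ½) {{pos*pos⇒pos δ {{ℚ.positive h}} ½}}

    halves : ∀ δ → half δ + half δ ≡ δ
    halves δ = trans (sym (*-distribˡ-+ δ ½ ½)) (*-identityʳ δ)

  ≤ℝ-trans : ∀ {x y z} → x ≤ℝ y → y ≤ℝ z → x ≤ℝ z
  ≤ℝ-trans {x} {y} {z} p q δ 0<δ with p (half δ) (0<half 0<δ) | q (half δ) (0<half 0<δ)
  ... | M , hp | N , hq = M ℕ.⊔ N , λ k l → begin
    seq x k                         ≤⟨ hp k (ℕₚ.≤-trans (ℕₚ.m≤m⊔n M N) l) ⟩
    seq y k + half δ                ≤⟨ +-monoˡ-≤ (half δ) (hq k (ℕₚ.≤-trans (ℕₚ.m≤n⊔m M N) l)) ⟩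
    seq z k + half δ + half δ       ≡⟨ trans (+-assoc (seq z k) _ _) (cong (seq z k +_) (halves δ)) ⟩
    seq z k + δ                     ∎
    where open ≤-Reasoning

  +ℝ-mono : ∀ {x y u v} → x ≤ℝ y → u ≤ℝ v → (x +ℝ u) ≤ℝ (y +ℝ v)
  +ℝ-mono {x} {y} {u} {v} p q δ 0<δ with p (half δ) (0<half 0<δ) | q (half δ) (0<half 0<δ)
  ... | M , hp | N , hq = M ℕ.⊔ N , λ k l → begin
    seq x k + seq u k                         ≤⟨ ℚₚ.+-mono-≤ (hp k (ℕₚ.≤-trans (ℕₚ.m≤m⊔n M N) l)) (hq k (ℕₚ.≤-trans (ℕₚ.m≤n⊔m M N) l)) ⟩
    (seq y k + half δ) + (seq v k + half δ)   ≡⟨ interchange (seq y k) (half δ) (seq v k) (half δ) ⟩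
    (seq y k + seq v k) + (half δ + half δ)   ≡⟨ cong ((seq y k + seq v k) +_) (halves δ) ⟩
    seq y k + seq v k + δ                     ∎
    where open ≤-Reasoning

  -- Scaling by a natural number.
  infixl 7 _·_
  _·_ : ℕ → ℝ → ℝ
  c · x = fromℚ (ι c) *ℝ x

  cancel-scale : ∀ c {x y} → 0 ℕ.< c → (c · x) ≤ℝ (c · y) → x ≤ℝ y
  -- The scaled inequality is used with precision c · δ, from which the factor c is then divided
  -- out.
  cancel-scale c {x} {y} 0<c p δ 0<δ with p (ι c * δ) (positive⁻¹ (ι c * δ) {{pos*pos⇒pos (ι c) {{ι-pos 0<c}} δ {{ℚ.positive 0<δ}}}})
  ... | N , h = N , λ k l → *-cancelˡ-≤-pos (ι c) {{ι-pos 0<c}} (≤-trans (h k l) (≤-reflexive (sym (*-distribˡ-+ (ι c) (seq y k) δ))))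

  cancel-+ : ∀ {x y} q → (x +ℝ fromℚ q) ≤ℝ (y +ℝ fromℚ q) → x ≤ℝ y
  cancel-+ {x} {y} q p δ 0<δ with p δ 0<δ
  ... | N , h = N , λ k l → +-cancelʳ-≤ q (seq x k) (seq y k + δ)
        (≤-trans (h k l) (≤-reflexive (solve 3 (λ a b c → (a :+ b) :+ c := (a :+ c) :+ b) refl (seq y k) q δ)))
    where
    +-cancelʳ-≤ : ∀ r p q → p + r ≤ q + r → p ≤ q
    +-cancelʳ-≤ r p q h = subst₂ _≤_ (undo p) (undo q) (+-monoˡ-≤ (ℚ.- r) h)
      where undo : ∀ p → (p + r) + (ℚ.- r) ≡ p
            undo p = trans (+-assoc p r (ℚ.- r)) (trans (cong (p +_) (+-inverseʳ r)) (+-identityʳ p))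

  private
    bound : ∀ x → ∃ λ A → 0ℚ ≤ A × (∃ λ N → ∀ k → N ℕ.≤ k → ℚ.∣ seq x k ∣ ≤ A)
    bound x with cauchy x 1ℚ (positive⁻¹ 1ℚ)
    ... | N , h = 1ℚ + ℚ.∣ seq x N ∣ , ≤-trans (<⇒≤ (positive⁻¹ 1ℚ)) (≤-trans (≤-reflexive (sym (+-identityʳ 1ℚ))) (+-monoʳ-≤ 1ℚ (0≤∣p∣ (seq x N)))) , N , λ k l → begin
      ℚ.∣ seq x k ∣                              ≡⟨ cong ℚ.∣_∣ (sym (trans (+-assoc (seq x k) (ℚ.- seq x N) (seq x N)) (trans (cong (seq x k +_) (+-inverseˡ (seq x N))) (+-identityʳ _)))) ⟩
      ℚ.∣ (seq x k ℚ.- seq x N) + seq x N ∣      ≤⟨ ∣p+q∣≤∣p∣+∣q∣ (seq x k ℚ.- seq x N) (seq x N) ⟩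
      ℚ.∣ seq x k ℚ.- seq x N ∣ + ℚ.∣ seq x N ∣  ≤⟨ +-monoˡ-≤ ℚ.∣ seq x N ∣ (h k N l ℕₚ.≤-refl) ⟩
      1ℚ + ℚ.∣ seq x N ∣                         ∎
      where open ≤-Reasoning

    p≤∣p∣ : ∀ p → p ≤ ℚ.∣ p ∣
    p≤∣p∣ p with ℚₚ.≤-total 0ℚ p
    ... | inj₁ l = ≤-reflexive (sym (0≤p⇒∣p∣≡p l))
    ... | inj₂ l = ≤-trans l (0≤∣p∣ p)

    -p≤∣p∣ : ∀ p → ℚ.- p ≤ ℚ.∣ p ∣
    -p≤∣p∣ p = subst (ℚ.- p ≤_) (∣-p∣≡∣p∣ p) (p≤∣p∣ (ℚ.- p))

    0≤* : ∀ {p q} → 0ℚ ≤ p → 0ℚ ≤ q → 0ℚ ≤ p * q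
    0≤* {p} {q} l l′ = subst (_≤ p * q) (*-zeroʳ p) (*-monoˡ-≤-nonNeg p {{ℚ.nonNegative l}} l′)

    0≤+ : ∀ {p q} → 0ℚ ≤ p → 0ℚ ≤ q → 0ℚ ≤ p + q
    0≤+ = ℚₚ.+-mono-≤

    0≤- : ∀ {p q} → p ≤ q → 0ℚ ≤ q ℚ.- p
    0≤- {p} {q} l = subst (_≤ q ℚ.- p) (+-inverseʳ p) (+-monoˡ-≤ (ℚ.- p) l)

    ≤+ : ∀ {p r} → 0ℚ ≤ r → p ≤ p + r
    ≤+ {p} {r} l = subst (_≤ p + r) (+-identityʳ p) (+-monoʳ-≤ p l)

    expand : ∀ x y z γ K → z * y + γ * K ≡ z * x + ((z + γ) * (y + γ ℚ.- x) + (γ * γ + γ * (K ℚ.- ((z + γ) + (y + γ ℚ.- x)))))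
    expand = solve 5 (λ x y z γ K → z :* y :+ γ :* K := z :* x :+ ((z :+ γ) :* (y :+ γ :- x) :+ (γ :* γ :+ γ :* (K :- ((z :+ γ) :+ (y :+ γ :- x)))))) refl

  -- At a finite stage z and y - x are only at least -γ, so their product need not be nonnegative.
  -- The product of z + γ and y + γ - x is, and `expand` shows that the correction costs at most γ ·
  -- K = δ for bounded sequences.
  *ℝ-monoˡ : ∀ {z x y} → 0ℝ ≤ℝ z → x ≤ℝ y → (z *ℝ x) ≤ℝ (z *ℝ y)
  *ℝ-monoˡ {z} {x} {y} 0≤z x≤y δ 0<δ with bound z | bound x | bound y
  ... | A , 0≤A , Na , ha | B , 0≤B , Nb , hb | C , 0≤C , Nc , hc = N , main
    where
    open ≤-Reasoning
    -- K exceeds the bounds on the three sequences by 2, which covers the two corrections γ ≤ 1. The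
    -- summand δ is what makes γ = δ / K at most 1.
    K : ℚ
    K = (A + (B + C)) + (1ℚ + 1ℚ) + δ
    0≤S : 0ℚ ≤ (A + (B + C)) + (1ℚ + 1ℚ)
    0≤S = 0≤+ (0≤+ 0≤A (0≤+ 0≤B 0≤C)) (<⇒≤ (positive⁻¹ (1ℚ + 1ℚ)))
    instance
      K-pos : ℚ.Positive K
      K-pos = ℚ.positive (+-mono-≤-< 0≤S 0<δ)
      K-nonZero : ℚ.NonZero K
      K-nonZero = pos⇒nonZero K
      K⁻¹-pos : ℚ.Positive (ℚ.1/ K)
      K⁻¹-pos = 1/pos⇒pos K
    γ : ℚ
    γ = δ * ℚ.1/ K
    0<γ : 0ℚ < γ
    0<γ = positive⁻¹ γ {{pos*pos⇒pos δ {{ℚ.positive 0<δ}} (ℚ.1/ K)}}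
    0≤γ = <⇒≤ 0<γ
    γK : γ * K ≡ δ
    γK = trans (*-assoc δ (ℚ.1/ K) K) (trans (cong (δ *_) (*-inverseˡ K)) (*-identityʳ δ))
    γ≤1 : γ ≤ 1ℚ
    γ≤1 = *-cancelʳ-≤-pos K (begin
      γ * K    ≡⟨ γK ⟩
      δ        ≤⟨ subst (_≤ K) (+-identityˡ δ) (+-monoˡ-≤ δ 0≤S) ⟩
      K        ≡⟨ sym (*-identityˡ K) ⟩
      1ℚ * K   ∎)
    Mz = proj₁ (0≤z γ 0<γ)
    Mx = proj₁ (x≤y γ 0<γ)
    N : ℕ
    N = (Na ℕ.⊔ (Nb ℕ.⊔ Nc)) ℕ.⊔ (Mz ℕ.⊔ Mx)
    main : ∀ k → N ℕ.≤ k → seq z k * seq x k ≤ seq z k * seq y k + δ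
    main k l = begin
      u * v                                   ≤⟨ ≤+ (0≤+ (0≤* pz pξ) (0≤+ (0≤* 0≤γ 0≤γ) (0≤* 0≤γ (0≤- small)))) ⟩
      u * v + ((u + γ) * (t + γ ℚ.- v) + (γ * γ + γ * (K ℚ.- ((u + γ) + (t + γ ℚ.- v))))) ≡⟨ sym (expand v t u γ K) ⟩
      u * t + γ * K                           ≡⟨ cong (u * t +_) γK ⟩
      u * t + δ                               ∎
      where
      u = seq z k
      v = seq x k
      t = seq y k
      l₁ = ℕₚ.≤-trans (ℕₚ.m≤m⊔n (Na ℕ.⊔ (Nb ℕ.⊔ Nc)) _) l
      l₂ = ℕₚ.≤-trans (ℕₚ.m≤n⊔m (Na ℕ.⊔ (Nb ℕ.⊔ Nc)) _) l
      pz : 0ℚ ≤ u + γ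
      pz = proj₂ (0≤z γ 0<γ) k (ℕₚ.≤-trans (ℕₚ.m≤m⊔n Mz Mx) l₂)
      pξ : 0ℚ ≤ t + γ ℚ.- v
      pξ = 0≤- (proj₂ (x≤y γ 0<γ) k (ℕₚ.≤-trans (ℕₚ.m≤n⊔m Mz Mx) l₂))
      small : (u + γ) + (t + γ ℚ.- v) ≤ K
      small = begin
        (u + γ) + (t + γ ℚ.- v)           ≡⟨ solve 4 (λ u t v γ → (u :+ γ) :+ (t :+ γ :- v) := (u :+ (:- v :+ t)) :+ (γ :+ γ)) refl u t v γ ⟩
        (u + (ℚ.- v + t)) + (γ + γ)       ≤⟨ ℚₚ.+-mono-≤ (ℚₚ.+-mono-≤ (≤-trans (p≤∣p∣ u) (ha k (ℕₚ.≤-trans (ℕₚ.m≤m⊔n Na _) l₁)))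
                                                (ℚₚ.+-mono-≤ (≤-trans (-p≤∣p∣ v) (hb k (ℕₚ.≤-trans (ℕₚ.m≤m⊔n Nb Nc) (ℕₚ.≤-trans (ℕₚ.m≤n⊔m Na _) l₁))))
                                                             (≤-trans (p≤∣p∣ t) (hc k (ℕₚ.≤-trans (ℕₚ.m≤n⊔m Nb Nc) (ℕₚ.≤-trans (ℕₚ.m≤n⊔m Na _) l₁)))))) (ℚₚ.+-mono-≤ γ≤1 γ≤1) ⟩
        (A + (B + C)) + (1ℚ + 1ℚ)         ≤⟨ ≤+ (<⇒≤ 0<δ) ⟩
        K                                 ∎

  ∑-mono : ∀ n {g h : Vec Bool n → ℝ} → (∀ x → g x ≤ℝ h x) → ∑ n g ≤ℝ ∑ n h
  ∑-mono zero    e = e []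
  ∑-mono (suc n) {g} {h} e = +ℝ-mono {∑ n (λ x → g (false ∷ x))} {∑ n (λ x → h (false ∷ x))} {∑ n (λ x → g (true ∷ x))} {∑ n (λ x → h (true ∷ x))}
    (∑-mono n (λ x → e (false ∷ x))) (∑-mono n (λ x → e (true ∷ x)))

  ∑-+ : ∀ n (g h : Vec Bool n → ℝ) → ∑ n (λ x → g x +ℝ h x) ≋ (∑ n g +ℝ ∑ n h)
  ∑-+ zero    g h k = refl
  ∑-+ (suc n) g h k = trans
    (cong₂ _+_ (∑-+ n (λ x → g (false ∷ x)) (λ x → h (false ∷ x)) k) (∑-+ n (λ x → g (true ∷ x)) (λ x → h (true ∷ x)) k))
    (interchange (seq (∑ n (λ x → g (false ∷ x))) k) (seq (∑ n (λ x → h (false ∷ x))) k)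
                 (seq (∑ n (λ x → g (true ∷ x))) k) (seq (∑ n (λ x → h (true ∷ x))) k))

  ∑-scale : ∀ n c (g : Vec Bool n → ℝ) → ∑ n (λ x → c *ℝ g x) ≋ (c *ℝ ∑ n g)
  ∑-scale zero    c g k = refl
  ∑-scale (suc n) c g k = trans
    (cong₂ _+_ (∑-scale n c (λ x → g (false ∷ x)) k) (∑-scale n c (λ x → g (true ∷ x)) k))
    (sym (*-distribˡ-+ (seq c k) (seq (∑ n (λ x → g (false ∷ x))) k) (seq (∑ n (λ x → g (true ∷ x))) k)))

-- Sums over the Boolean cube

module CubeCounting where

  open TesterAlgorithm using (_⊕_; zeros)
  open import Data.Bool.Properties using (xor-assoc; xor-comm; xor-same)
  open import Data.Nat
  open import Data.Nat.Properties
  open import Data.Nat.Tactic.RingSolver using (solve-∀)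

  private
    interchange : ∀ a b c d → (a + b) + (c + d) ≡ (a + c) + (b + d)
    interchange = solve-∀

  sumV : ∀ k → (Vec Bool k → ℕ) → ℕ
  sumV zero    φ = φ []
  sumV (suc k) φ = sumV k (λ x → φ (false ∷ x)) + sumV k (λ x → φ (true ∷ x))

  sumV-cong : ∀ k {φ ψ : Vec Bool k → ℕ} → (∀ x → φ x ≡ ψ x) → sumV k φ ≡ sumV k ψ
  sumV-cong zero    h = h []
  sumV-cong (suc k) h = cong₂ _+_ (sumV-cong k (λ x → h (false ∷ x))) (sumV-cong k (λ x → h (true ∷ x)))

  sumV-mono : ∀ k {φ ψ : Vec Bool k → ℕ} → (∀ x → φ x ≤ ψ x) → sumV k φ ≤ sumV k ψ
  sumV-mono zero    h = h []
  sumV-mono (suc k) h = +-mono-≤ (sumV-mono k (λ x → h (false ∷ x))) (sumV-mono k (λ x → h (true ∷ x)))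

  sumV-+ : ∀ k (φ ψ : Vec Bool k → ℕ) → sumV k (λ x → φ x + ψ x) ≡ sumV k φ + sumV k ψ
  sumV-+ zero    φ ψ = refl
  sumV-+ (suc k) φ ψ = trans (cong₂ _+_ (sumV-+ k (λ x → φ (false ∷ x)) (λ x → ψ (false ∷ x))) (sumV-+ k (λ x → φ (true ∷ x)) (λ x → ψ (true ∷ x))))
    (interchange (sumV k (λ x → φ (false ∷ x))) (sumV k (λ x → ψ (false ∷ x))) _ _)

  sumV-* : ∀ k c (φ : Vec Bool k → ℕ) → sumV k (λ x → c * φ x) ≡ c * sumV k φ
  sumV-* zero    c φ = refl
  sumV-* (suc k) c φ = trans (cong₂ _+_ (sumV-* k c (λ x → φ (false ∷ x))) (sumV-* k c (λ x → φ (true ∷ x))))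
    (sym (*-distribˡ-+ c _ _))

  sumV-const : ∀ k c → sumV k (λ _ → c) ≡ 2 ^ k * c
  sumV-const zero    c = sym (+-identityʳ c)
  sumV-const (suc k) c = trans (cong₂ _+_ (sumV-const k c) (sumV-const k c))
    (trans (sym (*-distribʳ-+ c (2 ^ k) (2 ^ k))) (cong (λ u → (2 ^ k + u) * c) (sym (+-identityʳ (2 ^ k)))))

  sumV-swap : ∀ j k (φ : Vec Bool j → Vec Bool k → ℕ) → sumV j (λ x → sumV k (φ x)) ≡ sumV k (λ y → sumV j (λ x → φ x y))
  sumV-swap zero    k φ = refl
  sumV-swap (suc j) k φ = trans (cong₂ _+_ (sumV-swap j k (λ x → φ (false ∷ x))) (sumV-swap j k (λ x → φ (true ∷ x))))
    (sym (sumV-+ k (λ y → sumV j (λ x → φ (false ∷ x) y)) (λ y → sumV j (λ x → φ (true ∷ x) y))))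

  sumV-shift : ∀ k a (φ : Vec Bool k → ℕ) → sumV k (λ x → φ (x ⊕ a)) ≡ sumV k φ
  sumV-shift zero    []          φ = refl
  sumV-shift (suc k) (false ∷ a) φ = cong₂ _+_ (sumV-shift k a (λ x → φ (false ∷ x))) (sumV-shift k a (λ x → φ (true ∷ x)))
  sumV-shift (suc k) (true ∷ a)  φ = trans (cong₂ _+_ (sumV-shift k a (λ x → φ (true ∷ x))) (sumV-shift k a (λ x → φ (false ∷ x))))
    (+-comm (sumV k (λ x → φ (true ∷ x))) _)

  cnt : ∀ k → (Vec Bool k → Bool) → ℕ
  cnt k p = sumV k (λ x → fromBit (p x))

  cnt-≡ : ∀ k {p q : Vec Bool k → Bool} → (∀ x → p x ≡ q x) → cnt k p ≡ cnt k q
  cnt-≡ k h = sumV-cong k (λ x → cong fromBit (h x))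

  cnt-total : ∀ k (p : Vec Bool k → Bool) → cnt k p + cnt k (λ x → not (p x)) ≡ 2 ^ k
  cnt-total k p = trans (sym (sumV-+ k _ _)) (trans (sumV-cong k (λ x → one (p x))) (trans (sumV-const k 1) (*-identityʳ _)))
    where one : ∀ b → fromBit b + fromBit (not b) ≡ 1
          one false = refl
          one true  = refl

  ⊕-comm : ∀ {k} (x y : Vec Bool k) → x ⊕ y ≡ y ⊕ x
  ⊕-comm []      []      = refl
  ⊕-comm (a ∷ x) (b ∷ y) = cong₂ _∷_ (xor-comm a b) (⊕-comm x y)

  ⊕-assoc : ∀ {k} (x y z : Vec Bool k) → (x ⊕ y) ⊕ z ≡ x ⊕ (y ⊕ z)
  ⊕-assoc []      []      []      = refl
  ⊕-assoc (a ∷ x) (b ∷ y) (c ∷ z) = cong₂ _∷_ (xor-assoc a b c) (⊕-assoc x y z)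

  ⊕-zeros : ∀ {k} (x : Vec Bool k) → x ⊕ zeros ≡ x
  ⊕-zeros []          = refl
  ⊕-zeros (false ∷ x) = cong (false ∷_) (⊕-zeros x)
  ⊕-zeros (true ∷ x)  = cong (true ∷_) (⊕-zeros x)

  zeros-⊕ : ∀ {k} (x : Vec Bool k) → zeros ⊕ x ≡ x
  zeros-⊕ x = trans (⊕-comm zeros x) (⊕-zeros x)

  ⊕-self : ∀ {k} (x : Vec Bool k) → x ⊕ x ≡ zeros
  ⊕-self []      = refl
  ⊕-self (a ∷ x) = cong₂ _∷_ (xor-same a) (⊕-self x)

  ⊕-cancel : ∀ {k} (x y : Vec Bool k) → (x ⊕ y) ⊕ y ≡ x
  ⊕-cancel x y = trans (⊕-assoc x y y) (trans (cong (x ⊕_) (⊕-self y)) (⊕-zeros x))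

-- Bounds on output probabilities with integer numerators

module OutputBounds where

  open Compilation using (Comp; ret; flip; draw; E; _≋_; ∑-cong; iter)
  open Operations using (randVec)
  open CubeCounting
  open RealOrder
  open import Data.List.Relation.Unary.All using (All; []; _∷_)
  open import Data.Nat as ℕ using (ℕ; zero; suc)
  import Data.Nat.Properties as ℕₚ
  import Data.Integer as ℤ
  open import Data.Rational as ℚ using (ℚ; 0ℚ; 1ℚ; ½)
  import Data.Rational.Properties as ℚₚ

  -- ⌜ k ⌝ is the natural number k as a real.
  ⌜_⌝ : ℕ → ℝ
  ⌜ k ⌝ = fromℚ (ι k)

  private
    ≤ℝ-refl : ∀ {x} → x ≤ℝ x
    ≤ℝ-refl {x} = ≤-pointwise {x} {x} (λ _ → ℚₚ.≤-refl)

    ⌜⌝-mono : ∀ {a b} → a ℕ.≤ b → ⌜ a ⌝ ≤ℝ ⌜ b ⌝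
    ⌜⌝-mono {a} {b} l = ≤-pointwise {⌜ a ⌝} {⌜ b ⌝} (λ _ → ι-≤ l)

    0≤⌜_⌝ : ∀ c → 0ℝ ≤ℝ ⌜ c ⌝
    0≤⌜ c ⌝ = ⌜⌝-mono {0} {c} ℕ.z≤n

    scale-mono : ∀ c {x y} → x ≤ℝ y → (c · x) ≤ℝ (c · y)
    scale-mono c {x} {y} = *ℝ-monoˡ {⌜ c ⌝} {x} {y} 0≤⌜ c ⌝

  module Bounds {n : ℕ} (D : Distribution n) (r : Bool) where

    -- Q times the probability of output r is at most A.
    record Bd (Q : ℕ) (m : Comp n) (A : ℕ) : Set where
      constructor mkBd
      field le : (Q · E D r m) ≤ℝ ⌜ A ⌝
    open Bd public

    ∑weight≤ : ∀ c → ∑ n (λ x → weight D x *ℝ ⌜ c ⌝) ≤ℝ ⌜ c ⌝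
    ∑weight≤ c = ≤ℝ-trans {∑ n (λ x → weight D x *ℝ ⌜ c ⌝)} {c · ∑ n (weight D)} {⌜ c ⌝}
      (≋⇒≤ {∑ n (λ x → weight D x *ℝ ⌜ c ⌝)} {c · ∑ n (weight D)}
        (λ k → trans (∑-cong n {h = λ x → c · weight D x} (λ x k → ℚₚ.*-comm (seq (weight D x) k) (ι c)) k) (∑-scale n ⌜ c ⌝ (weight D) k)))
      (≤ℝ-trans {c · ∑ n (weight D)} {c · 1ℝ} {⌜ c ⌝} (scale-mono c {∑ n (weight D)} {1ℝ} (proj₁ (total D)))
        (≋⇒≤ {c · 1ℝ} {⌜ c ⌝} (λ _ → ℚₚ.*-identityʳ (ι c))))

    bd-mono : ∀ {Q m A A′} → A ℕ.≤ A′ → Bd Q m A → Bd Q m A′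
    bd-mono {Q} {m} {A} {A′} l (mkBd h) = mkBd (≤ℝ-trans {Q · E D r m} {⌜ A ⌝} {⌜ A′ ⌝} h (⌜⌝-mono l))

    bd-scale : ∀ c {Q m A} → Bd Q m A → Bd (c ℕ.* Q) m (c ℕ.* A)
    bd-scale c {Q} {m} {A} (mkBd h) = mkBd (≤ℝ-trans {(c ℕ.* Q) · E D r m} {c · (Q · E D r m)} {⌜ c ℕ.* A ⌝}
      (≋⇒≤ {(c ℕ.* Q) · E D r m} {c · (Q · E D r m)} (λ k → trans (cong (ℚ._* seq (E D r m) k) (ι-* c Q)) (ℚₚ.*-assoc (ι c) (ι Q) (seq (E D r m) k))))
      (≤ℝ-trans {c · (Q · E D r m)} {c · ⌜ A ⌝} {⌜ c ℕ.* A ⌝} (scale-mono c {Q · E D r m} {⌜ A ⌝} h)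
        (≋⇒≤ {c · ⌜ A ⌝} {⌜ c ℕ.* A ⌝} (λ _ → sym (ι-* c A)))))

    bd-unscale : ∀ c {Q m A} → 0 ℕ.< c → Bd (c ℕ.* Q) m (c ℕ.* A) → Bd Q m A
    bd-unscale c {Q} {m} {A} l (mkBd h) = mkBd (cancel-scale c {Q · E D r m} {⌜ A ⌝} l
      (≤ℝ-trans {c · (Q · E D r m)} {(c ℕ.* Q) · E D r m} {c · ⌜ A ⌝}
        (≋⇒≤ {c · (Q · E D r m)} {(c ℕ.* Q) · E D r m} (λ k → sym (trans (cong (ℚ._* seq (E D r m) k) (ι-* c Q)) (ℚₚ.*-assoc (ι c) (ι Q) (seq (E D r m) k)))))
        (≤ℝ-trans {(c ℕ.* Q) · E D r m} {⌜ c ℕ.* A ⌝} {c · ⌜ A ⌝} h (≋⇒≤ {⌜ c ℕ.* A ⌝} {c · ⌜ A ⌝} (λ _ → ι-* c A)))))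

    -- Comparison of the fractions A / Q and A′ / Q′ by cross-multiplication.
    bd-conv : ∀ {Q Q′ m A A′} → 0 ℕ.< Q → Q′ ℕ.* A ℕ.≤ A′ ℕ.* Q → Bd Q m A → Bd Q′ m A′
    bd-conv {Q} {Q′} {m} {A} {A′} l h b = bd-unscale Q l
      (bd-mono (ℕₚ.≤-trans h (ℕₚ.≤-reflexive (ℕₚ.*-comm A′ Q))) (subst (λ u → Bd u m (Q′ ℕ.* A)) (ℕₚ.*-comm Q′ Q) (bd-scale Q′ b)))

    bd-ret : ∀ {Q r′} → r xor r′ ≡ true → ∀ {A} → Bd Q (ret r′) A
    bd-ret {Q} {r′} e {A} = mkBd (≤ℝ-trans {Q · E D r (ret r′)} {⌜ 0 ⌝} {⌜ A ⌝} (≋⇒≤ {Q · E D r (ret r′)} {⌜ 0 ⌝} zero-value) (⌜⌝-mono ℕ.z≤n))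
      where zero-value : (Q · E D r (ret r′)) ≋ ⌜ 0 ⌝
            zero-value k rewrite e = ℚₚ.*-zeroʳ (ι Q)

    bd-flip : ∀ {Q κ A A′} → Bd Q (κ false) A → Bd Q (κ true) A′ → Bd (2 ℕ.* Q) (flip κ) (A ℕ.+ A′)
    bd-flip {Q} {κ} {A} {A′} (mkBd p) (mkBd q) = mkBd (≤ℝ-trans {(2 ℕ.* Q) · E D r (flip κ)} {(Q · E D r (κ false)) +ℝ (Q · E D r (κ true))} {⌜ A ℕ.+ A′ ⌝}
      (≋⇒≤ {(2 ℕ.* Q) · E D r (flip κ)} {(Q · E D r (κ false)) +ℝ (Q · E D r (κ true))} eq)
      (≤ℝ-trans {(Q · E D r (κ false)) +ℝ (Q · E D r (κ true))} {⌜ A ⌝ +ℝ ⌜ A′ ⌝} {⌜ A ℕ.+ A′ ⌝}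
        (+ℝ-mono {Q · E D r (κ false)} {⌜ A ⌝} {Q · E D r (κ true)} {⌜ A′ ⌝} p q) (≋⇒≤ {⌜ A ⌝ +ℝ ⌜ A′ ⌝} {⌜ A ℕ.+ A′ ⌝} (λ _ → sym (ι-+ A A′)))))
      where
      eq : ((2 ℕ.* Q) · E D r (flip κ)) ≋ ((Q · E D r (κ false)) +ℝ (Q · E D r (κ true)))
      eq k = begin
        ι (2 ℕ.* Q) ℚ.* (½ ℚ.* (x ℚ.+ y))         ≡⟨ cong (ℚ._* (½ ℚ.* (x ℚ.+ y))) (trans (ι-* 2 Q) (ℚₚ.*-comm (ι 2) (ι Q))) ⟩
        ι Q ℚ.* ι 2 ℚ.* (½ ℚ.* (x ℚ.+ y))         ≡⟨ ℚₚ.*-assoc (ι Q) (ι 2) _ ⟩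
        ι Q ℚ.* (ι 2 ℚ.* (½ ℚ.* (x ℚ.+ y)))       ≡⟨ cong (ι Q ℚ.*_) (trans (sym (ℚₚ.*-assoc (ι 2) ½ (x ℚ.+ y))) (ℚₚ.*-identityˡ (x ℚ.+ y))) ⟩
        ι Q ℚ.* (x ℚ.+ y)                         ≡⟨ ℚₚ.*-distribˡ-+ (ι Q) x y ⟩
        ι Q ℚ.* x ℚ.+ ι Q ℚ.* y                   ∎
        where open ≡-Reasoning
              x = seq (E D r (κ false)) k
              y = seq (E D r (κ true)) k

    bd-rand : ∀ k {Q} {κ : Vec Bool k → Comp n} (A : Vec Bool k → ℕ) → (∀ x → Bd Q (κ x) (A x)) → Bd (2 ℕ.^ k ℕ.* Q) (randVec k κ) (sumV k A)
    bd-rand zero    {Q} {κ} A h = subst (λ u → Bd u (κ []) (A [])) (sym (ℕₚ.+-identityʳ Q)) (h [])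
    bd-rand (suc k) {Q} {κ} A h = subst (λ u → Bd u (randVec (suc k) κ) (sumV (suc k) A)) (sym (ℕₚ.*-assoc 2 (2 ℕ.^ k) Q))
      (bd-flip {κ = λ b → randVec k (λ x → κ (b ∷ x))} (bd-rand k (λ x → A (false ∷ x)) (λ x → h (false ∷ x))) (bd-rand k (λ x → A (true ∷ x)) (λ x → h (true ∷ x))))

    bd-rand-const : ∀ k {Q A} {κ : Vec Bool k → Comp n} → (∀ x → Bd Q (κ x) A) → Bd Q (randVec k κ) A
    bd-rand-const k {Q} {A} h = bd-unscale (2 ℕ.^ k) (ℕₚ.m^n>0 2 k) (subst (Bd (2 ℕ.^ k ℕ.* Q) _) (sumV-const k A) (bd-rand k (λ _ → A) h))

    -- The expectation of the bound.
    bd-draw-≤ : ∀ {Q κ} (A : Vec Bool n → ℕ) → (∀ x → Bd Q (κ x) (A x)) → (Q · E D r (draw κ)) ≤ℝ ∑ n (λ x → weight D x *ℝ ⌜ A x ⌝)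
    bd-draw-≤ {Q} {κ} A h = ≤ℝ-trans {Q · E D r (draw κ)} {∑ n (λ x → weight D x *ℝ (Q · E D r (κ x)))} {∑ n (λ x → weight D x *ℝ ⌜ A x ⌝)}
      (≋⇒≤ {Q · E D r (draw κ)} {∑ n (λ x → weight D x *ℝ (Q · E D r (κ x)))}
        (λ k → trans (sym (∑-scale n ⌜ Q ⌝ (λ x → weight D x *ℝ E D r (κ x)) k)) (∑-cong n (λ x k → swap (ι Q) (seq (weight D x) k) (seq (E D r (κ x)) k)) k)))
      (∑-mono n (λ x → *ℝ-monoˡ {weight D x} {Q · E D r (κ x)} {⌜ A x ⌝} (nonNeg D x) (le (h x))))
      where swap : ∀ a b c → a ℚ.* (b ℚ.* c) ≡ b ℚ.* (a ℚ.* c)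
            swap a b c = trans (sym (ℚₚ.*-assoc a b c)) (trans (cong (ℚ._* c) (ℚₚ.*-comm a b)) (ℚₚ.*-assoc b a c))

    bd-draw-const : ∀ {Q κ A} → (∀ x → Bd Q (κ x) A) → Bd Q (draw κ) A
    bd-draw-const {Q} {κ} {A} h = mkBd (≤ℝ-trans {Q · E D r (draw κ)} {∑ n (λ x → weight D x *ℝ ⌜ A ⌝)} {⌜ A ⌝} (bd-draw-≤ (λ _ → A) h) (∑weight≤ A))

    E≤1 : ∀ m → Bd 1 m 1
    E≤1 (ret r′) with r xor r′ in e
    ... | true  = bd-ret e
    ... | false = mkBd (≤-pointwise {1 · E D r (ret r′)} {⌜ 1 ⌝} (λ k → ℚₚ.≤-reflexive (value k)))
      where value : ∀ k → seq (1 · E D r (ret r′)) k ≡ ι 1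
            value k rewrite e = refl
    E≤1 (flip κ) = bd-unscale 2 (ℕ.s≤s ℕ.z≤n) (bd-flip {κ = κ} (E≤1 (κ false)) (E≤1 (κ true)))
    E≤1 (draw κ) = bd-draw-const {κ = κ} (λ x → E≤1 (κ x))

    bd-one : ∀ {Q m A} → Q ℕ.≤ A → Bd Q m A
    bd-one {Q} {m} l = bd-conv (ℕ.s≤s ℕ.z≤n) (ℕₚ.≤-trans (ℕₚ.≤-reflexive (ℕₚ.*-identityʳ Q)) (ℕₚ.≤-trans l (ℕₚ.≤-reflexive (sym (ℕₚ.*-identityʳ _))))) (E≤1 m)

    -- A union bound along a loop, each step failing with probability η / Q.
    bd-iter : ∀ {X : Set} {Q η} (G : ℕ → X → (X → Comp n) → Comp n) (Inv : ℕ → X → Set) →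
              (∀ i x → Inv (suc i) x → ∀ k β → (∀ y → Inv i y → Bd Q (k y) β) → Bd Q (G i x k) (η ℕ.+ β)) →
              ∀ i x → Inv i x → ∀ k β → (∀ y → Inv 0 y → Bd Q (k y) β) → Bd Q (iter G i x k) (i ℕ.* η ℕ.+ β)
    bd-iter G Inv step zero    x v k β h = h x v
    bd-iter {Q = Q} {η} G Inv step (suc i) x v k β h = subst (Bd Q (iter G (suc i) x k)) (sym (ℕₚ.+-assoc η (i ℕ.* η) β))
      (step i x v (λ y → iter G i y k) (i ℕ.* η ℕ.+ β) (λ y v′ → bd-iter G Inv step i y v′ k β h))

  -- Agreement with functions that are far from f.
  agreeing : ∀ {n} → BoolFun n → Vec Bool n → List (BoolFun n) → List (BoolFun n)
  agreeing f x []       = []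
  agreeing f x (g ∷ gs) = if f x xor g x then agreeing f x gs else g ∷ agreeing f x gs

  module _ {n : ℕ} (D : Distribution n) (f : BoolFun n) (ε : ℚ) (a b : ℕ) (a≤b : a ℕ.≤ b) (bε≡a : ι b ℚ.* ε ≡ ι a) where

    private
      one : BoolFun n → Vec Bool n → ℝ
      one g x = if f x xor g x then 0ℝ else weight D x

      two : BoolFun n → Vec Bool n → ℝ
      two g x = if f x xor g x then weight D x else 0ℝ

      agree+differ : ∀ g → (∑ n (one g) +ℝ ∑ n (two g)) ≋ ∑ n (weight D)
      agree+differ g k = trans (sym (∑-+ n (one g) (two g) k)) (∑-cong n (λ x → pt x) k)
        where pt : ∀ x → (one g x +ℝ two g x) ≋ weight D x
              pt x k with f x xor g x
              ... | true  = ℚₚ.+-identityˡ (seq (weight D x) k)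
              ... | false = ℚₚ.+-identityʳ (seq (weight D x) k)

      -- The probabilities of agreeing and of differing add up to the total weight, and b times the
      -- latter is at least b · ε = a.
      agree-≤ : ∀ g → Far ε D f g → (b · ∑ n (one g)) ≤ℝ ⌜ b ℕ.∸ a ⌝
      agree-≤ g (δ , 0<δ , far) = cancel-+ {b · ∑ n (one g)} {⌜ b ℕ.∸ a ⌝} (ι a)
        (≤ℝ-trans {(b · ∑ n (one g)) +ℝ ⌜ a ⌝} {b · ∑ n (weight D)} {⌜ b ℕ.∸ a ⌝ +ℝ ⌜ a ⌝}
          (≤ℝ-trans {(b · ∑ n (one g)) +ℝ ⌜ a ⌝} {(b · ∑ n (one g)) +ℝ (b · ∑ n (two g))} {b · ∑ n (weight D)}
            (+ℝ-mono {b · ∑ n (one g)} {b · ∑ n (one g)} {⌜ a ⌝} {b · ∑ n (two g)} (≤ℝ-refl {b · ∑ n (one g)}) differ)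
            (≋⇒≤ {(b · ∑ n (one g)) +ℝ (b · ∑ n (two g))} {b · ∑ n (weight D)}
              (λ k → trans (sym (ℚₚ.*-distribˡ-+ (ι b) (seq (∑ n (one g)) k) (seq (∑ n (two g)) k))) (cong (ι b ℚ.*_) (agree+differ g k)))))
          (≤ℝ-trans {b · ∑ n (weight D)} {b · 1ℝ} {⌜ b ℕ.∸ a ⌝ +ℝ ⌜ a ⌝} (scale-mono b {∑ n (weight D)} {1ℝ} (proj₁ (total D)))
            (≋⇒≤ {b · 1ℝ} {⌜ b ℕ.∸ a ⌝ +ℝ ⌜ a ⌝} (λ _ → trans (ℚₚ.*-identityʳ (ι b)) (trans (cong ι (sym (ℕₚ.m∸n+n≡m a≤b))) (ι-+ (b ℕ.∸ a) a))))))
        where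
        differ : ⌜ a ⌝ ≤ℝ (b · ∑ n (two g))
        differ = ≤ℝ-trans {⌜ a ⌝} {b · fromℚ ε} {b · ∑ n (two g)} (≋⇒≤ {⌜ a ⌝} {b · fromℚ ε} (λ _ → sym bε≡a))
          (scale-mono b {fromℚ ε} {∑ n (two g)} λ γ 0<γ → proj₁ far , λ k l → ℚₚ.≤-trans
            (ℚₚ.≤-trans (ℚₚ.≤-reflexive (sym (ℚₚ.+-identityʳ ε))) (ℚₚ.+-monoʳ-≤ ε (ℚₚ.<⇒≤ 0<δ)))
            (ℚₚ.≤-trans (proj₂ far k l) (ℚₚ.≤-trans (ℚₚ.≤-reflexive (sym (ℚₚ.+-identityʳ _))) (ℚₚ.+-monoʳ-≤ (seq (∑ n (two g)) k) (ℚₚ.<⇒≤ 0<γ)))))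

      count : ℕ → ℕ → List (BoolFun n) → Vec Bool n → ℕ
      count β c gs x = β ℕ.+ c ℕ.* length (agreeing f x gs)

      -- Linearity of expectation: the number of functions agreeing with f at the example is a sum
      -- of indicators, each with probability at most (b - a) / b.
      sum-≤ : ∀ r β c gs → All (Far ε D f) gs →
              (b · ∑ n (λ x → weight D x *ℝ ⌜ count β c gs x ⌝)) ≤ℝ ⌜ b ℕ.* β ℕ.+ c ℕ.* length gs ℕ.* (b ℕ.∸ a) ⌝
      sum-≤ r β c [] [] = ≤ℝ-trans {b · ∑ n (λ x → weight D x *ℝ ⌜ count β c [] x ⌝)} {b · ∑ n (λ x → weight D x *ℝ ⌜ β ℕ.+ c ℕ.* 0 ⌝)} {⌜ b ℕ.* β ℕ.+ c ℕ.* 0 ℕ.* (b ℕ.∸ a) ⌝}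
        (≋⇒≤ {b · ∑ n (λ x → weight D x *ℝ ⌜ count β c [] x ⌝)} {b · ∑ n (λ x → weight D x *ℝ ⌜ β ℕ.+ c ℕ.* 0 ⌝)}
          (λ k → cong (ι b ℚ.*_) (∑-cong n {λ x → weight D x *ℝ ⌜ count β c [] x ⌝} {λ x → weight D x *ℝ ⌜ β ℕ.+ c ℕ.* 0 ⌝} (λ _ _ → refl) k)))
        (≤ℝ-trans {b · ∑ n (λ x → weight D x *ℝ ⌜ β ℕ.+ c ℕ.* 0 ⌝)} {b · ⌜ β ℕ.+ c ℕ.* 0 ⌝} {⌜ b ℕ.* β ℕ.+ c ℕ.* 0 ℕ.* (b ℕ.∸ a) ⌝}
          (scale-mono b {∑ n (λ x → weight D x *ℝ ⌜ β ℕ.+ c ℕ.* 0 ⌝)} {⌜ β ℕ.+ c ℕ.* 0 ⌝} (Bounds.∑weight≤ D r (β ℕ.+ c ℕ.* 0)))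
          (≋⇒≤ {b · ⌜ β ℕ.+ c ℕ.* 0 ⌝} {⌜ b ℕ.* β ℕ.+ c ℕ.* 0 ℕ.* (b ℕ.∸ a) ⌝} (λ _ → trans (sym (ι-* b (β ℕ.+ c ℕ.* 0))) (cong ι eq))))
        where eq : b ℕ.* (β ℕ.+ c ℕ.* 0) ≡ b ℕ.* β ℕ.+ c ℕ.* 0 ℕ.* (b ℕ.∸ a)
              eq rewrite ℕₚ.*-zeroʳ c | ℕₚ.+-identityʳ β = sym (ℕₚ.+-identityʳ (b ℕ.* β))
      sum-≤ r β c (g ∷ gs) (h ∷ hs) =
        ≤ℝ-trans {b · ∑ n (λ x → weight D x *ℝ ⌜ count β c (g ∷ gs) x ⌝)} {c · (b · ∑ n (one g)) +ℝ (b · ∑ n (λ x → weight D x *ℝ ⌜ count β c gs x ⌝))}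
          {⌜ b ℕ.* β ℕ.+ c ℕ.* suc (length gs) ℕ.* (b ℕ.∸ a) ⌝}
          (≋⇒≤ {b · ∑ n (λ x → weight D x *ℝ ⌜ count β c (g ∷ gs) x ⌝)} {c · (b · ∑ n (one g)) +ℝ (b · ∑ n (λ x → weight D x *ℝ ⌜ count β c gs x ⌝))} split)
          (≤ℝ-trans {c · (b · ∑ n (one g)) +ℝ (b · ∑ n (λ x → weight D x *ℝ ⌜ count β c gs x ⌝))} {(c · ⌜ b ℕ.∸ a ⌝) +ℝ ⌜ b ℕ.* β ℕ.+ c ℕ.* length gs ℕ.* (b ℕ.∸ a) ⌝}
            {⌜ b ℕ.* β ℕ.+ c ℕ.* suc (length gs) ℕ.* (b ℕ.∸ a) ⌝}
            (+ℝ-mono {c · (b · ∑ n (one g))} {c · ⌜ b ℕ.∸ a ⌝} {b · ∑ n (λ x → weight D x *ℝ ⌜ count β c gs x ⌝)} {⌜ b ℕ.* β ℕ.+ c ℕ.* length gs ℕ.* (b ℕ.∸ a) ⌝}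
              (scale-mono c {b · ∑ n (one g)} {⌜ b ℕ.∸ a ⌝} (agree-≤ g h)) (sum-≤ r β c gs hs))
            (≋⇒≤ {(c · ⌜ b ℕ.∸ a ⌝) +ℝ ⌜ b ℕ.* β ℕ.+ c ℕ.* length gs ℕ.* (b ℕ.∸ a) ⌝} {⌜ b ℕ.* β ℕ.+ c ℕ.* suc (length gs) ℕ.* (b ℕ.∸ a) ⌝}
              (λ _ → trans (cong (ℚ._+ ι (b ℕ.* β ℕ.+ c ℕ.* length gs ℕ.* (b ℕ.∸ a))) (sym (ι-* c (b ℕ.∸ a)))) (trans (sym (ι-+ (c ℕ.* (b ℕ.∸ a)) _)) (cong ι arith)))))
        where
        e = b ℕ.∸ a
        arith : c ℕ.* e ℕ.+ (b ℕ.* β ℕ.+ c ℕ.* length gs ℕ.* e) ≡ b ℕ.* β ℕ.+ c ℕ.* suc (length gs) ℕ.* e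
        arith = trans (sym (ℕₚ.+-assoc (c ℕ.* e) (b ℕ.* β) _)) (trans (cong (ℕ._+ c ℕ.* length gs ℕ.* e) (ℕₚ.+-comm (c ℕ.* e) (b ℕ.* β)))
          (trans (ℕₚ.+-assoc (b ℕ.* β) (c ℕ.* e) _) (cong (b ℕ.* β ℕ.+_) (trans (sym (ℕₚ.*-distribʳ-+ e c (c ℕ.* length gs))) (cong (ℕ._* e) (sym (ℕₚ.*-suc c (length gs))))))))
        pt : ∀ x → (weight D x *ℝ ⌜ count β c (g ∷ gs) x ⌝) ≋ ((c · one g x) +ℝ (weight D x *ℝ ⌜ count β c gs x ⌝))
        pt x k with f x xor g x
        ... | true  = trans (sym (ℚₚ.+-identityˡ _)) (cong (ℚ._+ seq (weight D x) k ℚ.* ι (count β c gs x)) (sym (ℚₚ.*-zeroʳ (ι c))))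
        ... | false = trans (cong (seq (weight D x) k ℚ.*_) (trans (cong ι (trans (cong (β ℕ.+_) (ℕₚ.*-suc c _)) (trans (sym (ℕₚ.+-assoc β c _)) (trans (cong (ℕ._+ c ℕ.* length (agreeing f x gs)) (ℕₚ.+-comm β c)) (ℕₚ.+-assoc c β _))))) (ι-+ c (count β c gs x))))
                        (trans (ℚₚ.*-distribˡ-+ (seq (weight D x) k) (ι c) (ι (count β c gs x))) (cong (ℚ._+ seq (weight D x) k ℚ.* ι (count β c gs x)) (ℚₚ.*-comm (seq (weight D x) k) (ι c))))
        split : (b · ∑ n (λ x → weight D x *ℝ ⌜ count β c (g ∷ gs) x ⌝)) ≋ (c · (b · ∑ n (one g)) +ℝ (b · ∑ n (λ x → weight D x *ℝ ⌜ count β c gs x ⌝)))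
        split k = trans (cong (ι b ℚ.*_) (trans (∑-cong n (λ x → pt x) k) (trans (∑-+ n (λ x → c · one g x) (λ x → weight D x *ℝ ⌜ count β c gs x ⌝) k)
                      (cong (ℚ._+ seq (∑ n (λ x → weight D x *ℝ ⌜ count β c gs x ⌝)) k) (∑-scale n ⌜ c ⌝ (one g) k)))))
                  (trans (ℚₚ.*-distribˡ-+ (ι b) (ι c ℚ.* seq (∑ n (one g)) k) (seq (∑ n (λ x → weight D x *ℝ ⌜ count β c gs x ⌝)) k)) (cong (ℚ._+ ι b ℚ.* seq (∑ n (λ x → weight D x *ℝ ⌜ count β c gs x ⌝)) k)
                    (trans (sym (ℚₚ.*-assoc (ι b) (ι c) _)) (trans (cong (ℚ._* seq (∑ n (one g)) k) (ℚₚ.*-comm (ι b) (ι c))) (ℚₚ.*-assoc (ι c) (ι b) _)))))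

    -- Drawing one example keeps each function consistent with probability 1 - ε.
    bd-draw-far : ∀ r {Q κ β c} gs → All (Far ε D f) gs → (∀ x → Bounds.Bd D r Q (κ x) (β ℕ.+ c ℕ.* length (agreeing f x gs))) →
                  Bounds.Bd D r (b ℕ.* Q) (draw κ) (b ℕ.* β ℕ.+ c ℕ.* length gs ℕ.* (b ℕ.∸ a))
    bd-draw-far r {Q} {κ} {β} {c} gs fars h = mkBd (≤ℝ-trans {(b ℕ.* Q) · E D r (draw κ)} {b · (Q · E D r (draw κ))} {⌜ b ℕ.* β ℕ.+ c ℕ.* length gs ℕ.* (b ℕ.∸ a) ⌝}
      (≋⇒≤ {(b ℕ.* Q) · E D r (draw κ)} {b · (Q · E D r (draw κ))} (λ k → trans (cong (ℚ._* seq (E D r (draw κ)) k) (ι-* b Q)) (ℚₚ.*-assoc (ι b) (ι Q) _)))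
      (≤ℝ-trans {b · (Q · E D r (draw κ))} {b · ∑ n (λ x → weight D x *ℝ ⌜ count β c gs x ⌝)} {⌜ b ℕ.* β ℕ.+ c ℕ.* length gs ℕ.* (b ℕ.∸ a) ⌝}
        (scale-mono b {Q · E D r (draw κ)} {∑ n (λ x → weight D x *ℝ ⌜ count β c gs x ⌝)} (bd-draw-≤ {Q} {κ} (count β c gs) h)) (sum-≤ r β c gs fars)))
      where open Bounds D r

  -- Both outputs together have probability 1.
  module _ {n : ℕ} (D : Distribution n) where

    private
      2≤sum : ∀ m → 1ℝ ≤ℝ (E D true m +ℝ E D false m)
      2≤sum (ret true)  = ≤-pointwise {1ℝ} {1ℝ +ℝ 0ℝ} (λ _ → ℚₚ.≤-refl)
      2≤sum (ret false) = ≤-pointwise {1ℝ} {0ℝ +ℝ 1ℝ} (λ _ → ℚₚ.≤-refl)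
      2≤sum (flip κ) = ≤ℝ-trans {1ℝ} {fromℚ ½ *ℝ (1ℝ +ℝ 1ℝ)} {E D true (flip κ) +ℝ E D false (flip κ)} (≤-pointwise {1ℝ} {fromℚ ½ *ℝ (1ℝ +ℝ 1ℝ)} (λ _ → ℚₚ.≤-refl))
        (≤ℝ-trans {fromℚ ½ *ℝ (1ℝ +ℝ 1ℝ)} {fromℚ ½ *ℝ (s₀ +ℝ s₁)} {E D true (flip κ) +ℝ E D false (flip κ)}
          (*ℝ-monoˡ {fromℚ ½} {1ℝ +ℝ 1ℝ} {s₀ +ℝ s₁} (≤-pointwise {0ℝ} {fromℚ ½} (λ _ → ℚₚ.<⇒≤ (ℚₚ.positive⁻¹ ½))) (+ℝ-mono {1ℝ} {s₀} {1ℝ} {s₁} (2≤sum (κ false)) (2≤sum (κ true))))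
          (≋⇒≤ {fromℚ ½ *ℝ (s₀ +ℝ s₁)} {E D true (flip κ) +ℝ E D false (flip κ)}
            (λ k → let a = seq (E D true (κ false)) k
                       b = seq (E D false (κ false)) k
                       c = seq (E D true (κ true)) k
                       d = seq (E D false (κ true)) k in
              trans (cong (½ ℚ.*_) (interchange a b c d)) (ℚₚ.*-distribˡ-+ ½ (a ℚ.+ c) (b ℚ.+ d)))))
        where
        s₀ = E D true (κ false) +ℝ E D false (κ false)
        s₁ = E D true (κ true) +ℝ E D false (κ true)
        interchange : ∀ a b c d → (a ℚ.+ b) ℚ.+ (c ℚ.+ d) ≡ (a ℚ.+ c) ℚ.+ (b ℚ.+ d)
        interchange a b c d = trans (ℚₚ.+-assoc a b (c ℚ.+ d)) (trans (cong (a ℚ.+_) (trans (sym (ℚₚ.+-assoc b c d)) (trans (cong (ℚ._+ d) (ℚₚ.+-comm b c)) (ℚₚ.+-assoc c b d)))) (sym (ℚₚ.+-assoc a c (b ℚ.+ d))))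
      2≤sum (draw κ) = ≤ℝ-trans {1ℝ} {∑ n (weight D)} {E D true (draw κ) +ℝ E D false (draw κ)} (proj₂ (total D))
        (≤ℝ-trans {∑ n (weight D)} {∑ n (λ x → weight D x *ℝ (E D true (κ x) +ℝ E D false (κ x)))} {E D true (draw κ) +ℝ E D false (draw κ)}
          (∑-mono n (λ x → ≤ℝ-trans {weight D x} {weight D x *ℝ 1ℝ} {weight D x *ℝ (E D true (κ x) +ℝ E D false (κ x))}
            (≋⇒≤ {weight D x} {weight D x *ℝ 1ℝ} (λ k → sym (ℚₚ.*-identityʳ _)))
            (*ℝ-monoˡ {weight D x} {1ℝ} {E D true (κ x) +ℝ E D false (κ x)} (nonNeg D x) (2≤sum (κ x)))))
          (≋⇒≤ {∑ n (λ x → weight D x *ℝ (E D true (κ x) +ℝ E D false (κ x)))} {E D true (draw κ) +ℝ E D false (draw κ)}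
            (λ k → trans (∑-cong n {h = λ x → (weight D x *ℝ E D true (κ x)) +ℝ (weight D x *ℝ E D false (κ x))} (λ x k → ℚₚ.*-distribˡ-+ (seq (weight D x) k) _ _) k)
              (∑-+ n (λ x → weight D x *ℝ E D true (κ x)) (λ x → weight D x *ℝ E D false (κ x)) k))))

      sum≥1 : ∀ r m → 1ℝ ≤ℝ (E D r m +ℝ E D (not r) m)
      sum≥1 true  m = 2≤sum m
      sum≥1 false m = ≤ℝ-trans {1ℝ} {E D true m +ℝ E D false m} {E D false m +ℝ E D true m} (2≤sum m)
        (≋⇒≤ {E D true m +ℝ E D false m} {E D false m +ℝ E D true m} (λ k → ℚₚ.+-comm (seq (E D true m) k) _))

    -- The two outputs have total probability at least 1, so it suffices to bound the wrong output
    -- by 1/3. All later estimates can thus be upper bounds.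
    two-thirds : ∀ r m → Bounds.Bd D (not r) 3 m 1 → fromℚ (ℤ.+ 2 ℚ./ 3) ≤ℝ E D r m
    two-thirds r m (Bounds.mkBd h) = cancel-scale 3 {fromℚ (ℤ.+ 2 ℚ./ 3)} {E D r m} (ℕ.s≤s ℕ.z≤n)
      (cancel-+ {3 · fromℚ (ℤ.+ 2 ℚ./ 3)} {3 · E D r m} (ι 1)
        (≤ℝ-trans {(3 · fromℚ (ℤ.+ 2 ℚ./ 3)) +ℝ ⌜ 1 ⌝} {3 · 1ℝ} {(3 · E D r m) +ℝ ⌜ 1 ⌝} (≤-pointwise {(3 · fromℚ (ℤ.+ 2 ℚ./ 3)) +ℝ ⌜ 1 ⌝} {3 · 1ℝ} (λ _ → ℚₚ.≤-refl))
          (≤ℝ-trans {3 · 1ℝ} {3 · (E D r m +ℝ E D (not r) m)} {(3 · E D r m) +ℝ ⌜ 1 ⌝} (scale-mono 3 {1ℝ} {E D r m +ℝ E D (not r) m} (sum≥1 r m))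
            (≤ℝ-trans {3 · (E D r m +ℝ E D (not r) m)} {(3 · E D r m) +ℝ (3 · E D (not r) m)} {(3 · E D r m) +ℝ ⌜ 1 ⌝}
              (≋⇒≤ {3 · (E D r m +ℝ E D (not r) m)} {(3 · E D r m) +ℝ (3 · E D (not r) m)} (λ k → ℚₚ.*-distribˡ-+ (ι 3) (seq (E D r m) k) _))
              (+ℝ-mono {3 · E D r m} {3 · E D r m} {3 · E D (not r) m} {⌜ 1 ⌝} (≤ℝ-refl {3 · E D r m}) h)))))

-- Linearity testing, self-correction and literals

module LinearityTesting where

  open TesterAlgorithm using (_⊕_; _⊗_; zeros)
  open CubeCounting
  open import Data.Bool.Properties using (∧-comm)
  open import Data.Bool.Solver using (module xor-∧-Solver)
  open import Data.Fin using (Fin; zero; suc)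
  open import Data.Nat
  open import Data.Nat.Properties
  open import Data.Nat.Tactic.RingSolver using (solve-∀)
  open import Data.Vec using (lookup)

  module X = xor-∧-Solver

  xor-≤ : ∀ a b → fromBit (a xor b) ≤ fromBit a + fromBit b
  xor-≤ false b     = ≤-refl
  xor-≤ true  false = ≤-refl
  xor-≤ true  true  = z≤n

  xor-false : ∀ {a b} → a xor b ≡ false → a ≡ b
  xor-false {false} {false} e = refl
  xor-false {true}  {true}  e = refl

  bit≤1 : ∀ a → fromBit a ≤ 1
  bit≤1 false = z≤n
  bit≤1 true  = ≤-refl

  IsLiteral : ∀ {n} → (Vec Bool n → Bool) → Set
  IsLiteral {n} h = (Σ (Fin n) λ i → ∀ x → h x ≡ lookup x i) ⊎ (∀ x → h x ≡ false)

  private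
    zeros-⊗ : ∀ {k} (x : Vec Bool k) → zeros ⊗ x ≡ zeros
    zeros-⊗ []      = refl
    zeros-⊗ (_ ∷ x) = cong (false ∷_) (zeros-⊗ x)

    comparison : ∀ t b F .{{_ : NonZero t}} → 13 * t * b ≤ 16 * F → 32 * F < t * (t * t) → 26 * b < t * t
    comparison t b F h few = *-cancelˡ-< t (26 * b) (t * t) (≤-<-trans (begin
      t * (26 * b)       ≡⟨ arith t b ⟩
      2 * (13 * t * b)   ≤⟨ *-monoʳ-≤ 2 h ⟩
      2 * (16 * F)       ≡⟨ arith′ F ⟩
      32 * F             ∎) few)
      where
      open ≤-Reasoning
      arith : ∀ t b → t * (26 * b) ≡ 2 * (13 * t * b)
      arith = solve-∀
      arith′ : ∀ F → 2 * (16 * F) ≡ 32 * F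
      arith′ = solve-∀

    remainder : ∀ t c e → t ≤ c + e → 16 * e ≤ 3 * t → 13 * t * 1 ≤ 16 * c
    remainder t c e cover small = +-cancelʳ-≤ (3 * t) _ _ (begin
      13 * t * 1 + 3 * t   ≡⟨ arith t ⟩
      16 * t               ≤⟨ *-monoʳ-≤ 16 cover ⟩
      16 * (c + e)         ≡⟨ *-distribˡ-+ 16 c e ⟩
      16 * c + 16 * e      ≤⟨ +-monoʳ-≤ (16 * c) small ⟩
      16 * c + 3 * t       ∎)
      where
      open ≤-Reasoning
      arith : ∀ t → 13 * t * 1 + 3 * t ≡ 16 * t
      arith = solve-∀

    sum²-scale : ∀ n c C (φ ψ : Vec Bool n → Vec Bool n → ℕ) → (∀ x y → c * φ x y ≤ C * ψ x y) →
                 c * sumV n (λ x → sumV n (φ x)) ≤ C * sumV n (λ x → sumV n (ψ x))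
    sum²-scale n c C φ ψ h = begin
      c * sumV n (λ x → sumV n (φ x))          ≡⟨ scale c φ ⟩
      sumV n (λ x → sumV n (λ y → c * φ x y))  ≤⟨ sumV-mono n (λ x → sumV-mono n (h x)) ⟩
      sumV n (λ x → sumV n (λ y → C * ψ x y))  ≡⟨ sym (scale C ψ) ⟩
      C * sumV n (λ x → sumV n (ψ x))          ∎
      where
      open ≤-Reasoning
      scale : ∀ c φ → c * sumV n (λ x → sumV n (φ x)) ≡ sumV n (λ x → sumV n (λ y → c * φ x y))
      scale c φ = trans (sym (sumV-* n c (λ x → sumV n (φ x)))) (sumV-cong n (λ x → sym (sumV-* n c (φ x))))

  -- An additive and multiplicative map is a coordinate, or zero.
  homomorphism⇒literal : ∀ {n} (h : Vec Bool n → Bool) → (∀ x y → h (x ⊕ y) ≡ h x xor h y) → (∀ x y → h (x ⊗ y) ≡ h x ∧ h y) → IsLiteral h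
  homomorphism⇒literal {zero} h additive multiplicative = inj₂ λ { [] → self (h []) (additive [] []) }
    where self : ∀ a → a ≡ a xor a → a ≡ false
          self false e = refl
          self true  ()
  homomorphism⇒literal {suc n} h additive multiplicative with h (true ∷ zeros) in e
  -- The first unit vector has product zero with every vector whose first bit is 0. Since h is 1 on
  -- the unit vector, multiplicativity forces h to vanish on those vectors, so h is the first
  -- coordinate.
  ... | true  = inj₁ (zero , λ { (false ∷ x) → low x ; (true ∷ x) →
      trans (cong h (cong (true ∷_) (sym (zeros-⊕ x)))) (trans (additive (true ∷ zeros) (false ∷ x)) (cong₂ _xor_ e (low x))) })
    where
    h0 : h zeros ≡ false
    h0 = trans (cong h (sym (⊕-self zeros))) (trans (additive zeros zeros) (same (h zeros)))
      where same : ∀ a → a xor a ≡ false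
            same false = refl
            same true  = refl
    low : ∀ x → h (false ∷ x) ≡ false
    low x = trans (sym (cong (_∧ h (false ∷ x)) e)) (trans (sym (multiplicative (true ∷ zeros) (false ∷ x))) (trans (cong (λ y → h (false ∷ y)) (zeros-⊗ x)) h0))
  -- Here h ignores the first coordinate by additivity, and the remaining coordinates are handled by
  -- induction.
  ... | false with homomorphism⇒literal (λ x → h (false ∷ x)) (λ x y → additive (false ∷ x) (false ∷ y)) (λ x y → multiplicative (false ∷ x) (false ∷ y))
  ... | inj₁ (i , p) = inj₁ (suc i , λ { (false ∷ x) → p x ; (true ∷ x) → trans (drop x) (p x) })
    where drop : ∀ x → h (true ∷ x) ≡ h (false ∷ x)
          drop x = trans (cong h (cong (true ∷_) (sym (zeros-⊕ x)))) (trans (additive (true ∷ zeros) (false ∷ x)) (cong (_xor h (false ∷ x)) e))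
  ... | inj₂ p = inj₂ λ { (false ∷ x) → p x ; (true ∷ x) → trans (trans (cong h (cong (true ∷_) (sym (zeros-⊕ x)))) (trans (additive (true ∷ zeros) (false ∷ x)) (cong (_xor h (false ∷ x)) e))) (p x) }

  ⊗-distribʳ : ∀ {k} (x y z : Vec Bool k) → (x ⊕ y) ⊗ z ≡ (x ⊗ z) ⊕ (y ⊗ z)
  ⊗-distribʳ []      []      []      = refl
  ⊗-distribʳ (a ∷ x) (b ∷ y) (c ∷ z) = cong₂ _∷_ (X.solve 3 (λ a b c → (a X.:+ b) X.:* c X.:= (a X.:* c) X.:+ (b X.:* c)) refl a b c) (⊗-distribʳ x y z)

  ⊗-comm : ∀ {k} (x y : Vec Bool k) → x ⊗ y ≡ y ⊗ x
  ⊗-comm []      []      = refl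
  ⊗-comm (a ∷ x) (b ∷ y) = cong₂ _∷_ (∧-comm a b) (⊗-comm x y)

  -- The defect of multiplicativity of an additive map is bilinear.
  private
    module Form {n : ℕ} (h : Vec Bool n → Bool) (additive : ∀ x y → h (x ⊕ y) ≡ h x xor h y) where

      B : Vec Bool n → Vec Bool n → Bool
      B x y = h (x ⊗ y) xor (h x ∧ h y)

      bilinearˡ : ∀ x x₀ y → B (x ⊕ x₀) y ≡ B x y xor B x₀ y
      bilinearˡ x x₀ y = trans (cong₂ (λ u v → u xor (v ∧ h y)) (trans (cong h (⊗-distribʳ x x₀ y)) (additive (x ⊗ y) (x₀ ⊗ y))) (additive x x₀))
        (X.solve 5 (λ p q u v w → (p X.:+ q) X.:+ ((u X.:+ v) X.:* w) X.:= (p X.:+ (u X.:* w)) X.:+ (q X.:+ (v X.:* w))) refl (h (x ⊗ y)) (h (x₀ ⊗ y)) (h x) (h x₀) (h y))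

      B-comm : ∀ x y → B x y ≡ B y x
      B-comm x y = cong₂ _xor_ (cong h (⊗-comm x y)) (∧-comm (h x) (h y))

      bilinearʳ : ∀ x y y₀ → B x (y ⊕ y₀) ≡ B x y xor B x y₀
      bilinearʳ x y y₀ = trans (B-comm x (y ⊕ y₀)) (trans (bilinearˡ y y₀ x) (cong₂ _xor_ (B-comm y x) (B-comm y₀ x)))

      -- For uniform x and y each of the four arguments on the right is a uniform pair. A bilinear
      -- form that is nonzero somewhere is thus nonzero on at least a quarter of all pairs.
      polarise : ∀ x₀ y₀ x y → B x₀ y₀ ≡ B x y xor (B (x ⊕ x₀) y xor (B x (y ⊕ y₀) xor B (x ⊕ x₀) (y ⊕ y₀)))
      polarise x₀ y₀ x y = trans
        (X.solve 4 (λ p q r s → s X.:= p X.:+ ((p X.:+ q) X.:+ ((p X.:+ r) X.:+ ((p X.:+ r) X.:+ (q X.:+ s))))) refl (B x y) (B x₀ y) (B x y₀) (B x₀ y₀))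
        (cong (B x y xor_) (cong₂ _xor_ (sym (bilinearˡ x x₀ y)) (cong₂ _xor_ (sym (bilinearʳ x y y₀))
          (sym (trans (bilinearˡ x x₀ (y ⊕ y₀)) (cong₂ _xor_ (bilinearʳ x y y₀) (bilinearʳ x₀ y y₀)))))))

  -- Linearity testing by self-correction (Blum, Luby, Rubinfeld), followed by
  -- the multiplicativity test on the corrected function.
  module SelfCorrection {n : ℕ} (g : Vec Bool n → Bool) where

    a : Vec Bool n → Vec Bool n → Bool
    a z x = g z xor g (z ⊕ x)

    -- Expanded, g(x) + g(x ⊕ y) + g(0) + g(y): the linearity test for a function g that is linear
    -- up to a constant.
    β : Vec Bool n → Vec Bool n → Bool
    β x y = a x y xor a zeros y

    fails : Vec Bool n → Vec Bool n → Vec Bool n → Bool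
    fails x y z = if β x y then true else (a z (x ⊗ y) xor (a z x ∧ a z y))

    2ⁿ failures : ℕ
    2ⁿ       = 2 ^ n
    failures = sumV n λ x → sumV n λ y → cnt n (fails x y)

    0<2ⁿ : 0 < 2ⁿ
    0<2ⁿ = m^n>0 2 n

    instance
      nonZero-2ⁿ : NonZero 2ⁿ
      nonZero-2ⁿ = >-nonZero 0<2ⁿ

    module _ (few : 32 * failures < 2ⁿ * (2ⁿ * 2ⁿ)) where

      private
        Fβ : ℕ
        Fβ = sumV n λ x → cnt n (β x)

        -- A pair failing the linearity test makes the triple fail for every z, so the failing
        -- fraction of pairs is at most that of triples.
        Fβ-small : 32 * Fβ < 2ⁿ * 2ⁿ
        Fβ-small = *-cancelˡ-< 2ⁿ (32 * Fβ) (2ⁿ * 2ⁿ) (≤-<-trans (≤-trans (≤-reflexive (comm 2ⁿ 32 Fβ)) (*-monoʳ-≤ 32 averaged)) few)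
          where
          comm : ∀ x y z → x * (y * z) ≡ y * (x * z)
          comm = solve-∀
          averaged : 2ⁿ * Fβ ≤ failures
          averaged = ≤-trans (≤-reflexive (trans (sym (sumV-* n 2ⁿ _)) (sumV-cong n λ x → sym (sumV-* n 2ⁿ _))))
            (sumV-mono n λ x → sumV-mono n λ y → ≤-trans (≤-reflexive (sym (sumV-const n (fromBit (β x y))))) (sumV-mono n λ z → le x y z))
            where le : ∀ x y z → fromBit (β x y) ≤ fromBit (fails x y z)
                  le x y z with β x y
                  ... | true  = ≤-refl
                  ... | false = z≤n

        ⊕-swap : ∀ (p q x : Vec Bool n) → p ⊕ (q ⊕ x) ≡ q ⊕ (p ⊕ x)
        ⊕-swap p q x = trans (sym (⊕-assoc p q x)) (trans (cong (_⊕ x) (⊕-comm p q)) (⊕-assoc q p x))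

        ⊕-twice : ∀ (p q x : Vec Bool n) → p ⊕ (q ⊕ (p ⊕ x)) ≡ q ⊕ x
        ⊕-twice p q x = trans (⊕-swap p q (p ⊕ x)) (cong (q ⊕_) (trans (sym (⊕-assoc p p x)) (trans (cong (_⊕ x) (⊕-self p)) (zeros-⊕ x))))

        -- Two votes z and w on the value at x differ only if the linearity test fails at one of two
        -- pairs. Each of these pairs is uniform when z and w are, although x is arbitrary.
        collision : ∀ x z w → a z x xor a w x ≡ β z (w ⊕ (z ⊕ x)) xor β w (z ⊕ (w ⊕ x))
        collision x z w rewrite ⊕-twice z w x | ⊕-twice w z x | ⊕-swap z w x | zeros-⊕ (w ⊕ (z ⊕ x)) =
          X.solve 6 (λ gz gzx gw gwx g0 gy → (gz X.:+ gzx) X.:+ (gw X.:+ gwx) X.:= ((gz X.:+ gwx) X.:+ (g0 X.:+ gy)) X.:+ ((gw X.:+ gzx) X.:+ (g0 X.:+ gy)))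
            refl (g z) (g (z ⊕ x)) (g w) (g (w ⊕ x)) (g zeros) (g (w ⊕ (z ⊕ x)))

        collisions≤ : ∀ x → sumV n (λ z → sumV n λ w → fromBit (a z x xor a w x)) ≤ Fβ + Fβ
        collisions≤ x = begin
          sumV n (λ z → sumV n λ w → fromBit (a z x xor a w x))
            ≤⟨ sumV-mono n (λ z → sumV-mono n λ w → ≤-trans (≤-reflexive (cong fromBit (collision x z w))) (xor-≤ (β z (w ⊕ (z ⊕ x))) (β w (z ⊕ (w ⊕ x))))) ⟩
          sumV n (λ z → sumV n λ w → fromBit (β z (w ⊕ (z ⊕ x))) + fromBit (β w (z ⊕ (w ⊕ x))))
            ≡⟨ trans (sumV-cong n λ z → sumV-+ n _ _) (sumV-+ n _ _) ⟩
          sumV n (λ z → sumV n λ w → fromBit (β z (w ⊕ (z ⊕ x)))) + sumV n (λ z → sumV n λ w → fromBit (β w (z ⊕ (w ⊕ x))))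
            ≡⟨ cong₂ _+_ (sumV-cong n λ z → sumV-shift n (z ⊕ x) (λ w → fromBit (β z w)))
                         (trans (sumV-swap n n (λ z w → fromBit (β w (z ⊕ (w ⊕ x))))) (sumV-cong n λ w → sumV-shift n (w ⊕ x) (λ z → fromBit (β w z)))) ⟩
          Fβ + Fβ ∎
          where open ≤-Reasoning

        c₁ c₀ : Vec Bool n → ℕ
        c₁ x = cnt n (λ z → a z x)
        c₀ x = cnt n (λ z → not (a z x))

        collisions≡ : ∀ x → sumV n (λ z → sumV n λ w → fromBit (a z x xor a w x)) ≡ c₁ x * c₀ x + c₁ x * c₀ x
        collisions≡ x = begin
          sumV n (λ z → sumV n λ w → fromBit (a z x xor a w x))  ≡⟨ sumV-cong n row ⟩
          sumV n (λ z → c₀ x * fromBit (a z x) + c₁ x * fromBit (not (a z x))) ≡⟨ trans (sumV-+ n _ _) (cong₂ _+_ (sumV-* n (c₀ x) _) (sumV-* n (c₁ x) _)) ⟩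
          c₀ x * c₁ x + c₁ x * c₀ x                              ≡⟨ cong (_+ c₁ x * c₀ x) (*-comm (c₀ x) (c₁ x)) ⟩
          c₁ x * c₀ x + c₁ x * c₀ x                              ∎
          where
          open ≡-Reasoning
          row : ∀ z → sumV n (λ w → fromBit (a z x xor a w x)) ≡ c₀ x * fromBit (a z x) + c₁ x * fromBit (not (a z x))
          row z with a z x
          ... | true  = trans (sym (*-identityʳ (c₀ x))) (trans (sym (+-identityʳ _)) (cong (c₀ x * 1 +_) (sym (*-zeroʳ (c₁ x)))))
          ... | false = trans (sym (*-identityʳ (c₁ x))) (cong (_+ c₁ x * 1) (sym (*-zeroʳ (c₀ x))))

        -- The ordered pairs of differing votes number twice the product of the two vote counts and
        -- at most twice the failing pairs.
        product-small : ∀ x → 32 * (c₁ x * c₀ x) < 2ⁿ * 2ⁿ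
        product-small x = ≤-<-trans (*-monoʳ-≤ 32 (halve (c₁ x * c₀ x) Fβ (subst (_≤ Fβ + Fβ) (collisions≡ x) (collisions≤ x)))) Fβ-small
          where halve : ∀ p q → p + p ≤ q + q → p ≤ q
                halve p q l with ≤-total p q
                ... | inj₁ k = k
                ... | inj₂ k with m≤n⇒m<n∨m≡n k
                ...   | inj₁ k′ = ⊥-elim (<⇒≱ (+-mono-< k′ k′) l)
                ...   | inj₂ k′ = ≤-reflexive (sym k′)

      -- The self-corrected function: the majority over z of the votes `a z x`.
      h : Vec Bool n → Bool
      h x = c₀ x ≤ᵇ c₁ x

      errors : Vec Bool n → ℕ
      errors x = cnt n (λ z → a z x xor h x)

      private
        minority : ∀ p q → p ≤ q → p + q ≡ 2ⁿ → 32 * (p * q) < 2ⁿ * 2ⁿ → 16 * p < 2ⁿ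
        minority p q l e s = *-cancelʳ-< 2ⁿ (16 * p) 2ⁿ (≤-<-trans (begin
          16 * p * 2ⁿ        ≡⟨ cong (16 * p *_) (sym e) ⟩
          16 * p * (p + q)   ≤⟨ *-monoʳ-≤ (16 * p) (+-monoˡ-≤ q l) ⟩
          16 * p * (q + q)   ≡⟨ arith p q ⟩
          32 * (p * q)       ∎) s)
          where open ≤-Reasoning
                arith : ∀ p q → 16 * p * (q + q) ≡ 32 * (p * q)
                arith = solve-∀

      few-errors : ∀ x → 16 * errors x < 2ⁿ
      few-errors x with c₀ x ≤ᵇ c₁ x in e
      ... | true  = subst (λ u → 16 * u < 2ⁿ) (cnt-≡ n (λ z → flip-true (a z x)))
          (minority (c₀ x) (c₁ x) (≤ᵇ⇒≤ (c₀ x) (c₁ x) (subst T (sym e) _)) (trans (+-comm (c₀ x) (c₁ x)) (cnt-total n _)) (subst (λ u → 32 * u < 2ⁿ * 2ⁿ) (*-comm (c₁ x) (c₀ x)) (product-small x)))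
        where flip-true : ∀ b → not b ≡ b xor true
              flip-true false = refl
              flip-true true  = refl
      ... | false = subst (λ u → 16 * u < 2ⁿ) (cnt-≡ n (λ z → xor-f (a z x)))
          (minority (c₁ x) (c₀ x) (≰⇒≥ (λ l → subst T e (≤⇒≤ᵇ l))) (cnt-total n _) (product-small x))
        where xor-f : ∀ b → b ≡ b xor false
              xor-f false = refl
              xor-f true  = refl

      private
        three : ∀ p q r → 16 * p < 2ⁿ → 16 * q < 2ⁿ → 16 * r < 2ⁿ → 16 * (p + (q + r)) ≤ 3 * 2ⁿ
        three p q r hp hq hr = ≤-trans (≤-reflexive (split p q r)) (+-mono-≤ (<⇒≤ hp) (+-mono-≤ (<⇒≤ hq) (≤-trans (<⇒≤ hr) (≤-reflexive (sym (+-identityʳ 2ⁿ))))))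
          where split : ∀ p q r → 16 * (p + (q + r)) ≡ 16 * p + (16 * q + 16 * r)
                split = solve-∀

        true-or : ∀ b {A : Set} → (b ≡ true → A) → (b ≡ false → A) → A
        true-or true  f g = f refl
        true-or false f g = g refl

      -- A defect of h at (x, y) would need, for every z, one of three votes to be wrong, since the
      -- votes themselves telescope. But the wrong votes make up less than 3/16 in total.
      additive : ∀ x y → h (x ⊕ y) ≡ h x xor h y
      additive x y = true-or (h (x ⊕ y) xor (h x xor h y)) (λ e → ⊥-elim (absurd e)) xor-false
        where
        point : ∀ z → h (x ⊕ y) xor (h x xor h y) ≡ (a z x xor h x) xor ((a (z ⊕ x) y xor h y) xor (a z (x ⊕ y) xor h (x ⊕ y)))
        point z rewrite ⊕-assoc z x y = X.solve 6 (λ hxy hx hy gz gzx gzxy → hxy X.:+ (hx X.:+ hy) X.:=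
          ((gz X.:+ gzx) X.:+ hx) X.:+ (((gzx X.:+ gzxy) X.:+ hy) X.:+ ((gz X.:+ gzxy) X.:+ hxy))) refl (h (x ⊕ y)) (h x) (h y) (g z) (g (z ⊕ x)) (g (z ⊕ (x ⊕ y)))
        absurd : h (x ⊕ y) xor (h x xor h y) ≡ true → ⊥
        absurd e = <⇒≱ (*-monoˡ-< 2ⁿ (≤-trans (s≤s ≤-refl) (m≤m+n 4 12))) (≤-trans (*-monoʳ-≤ 16 cover) (three (errors x) (errors y) (errors (x ⊕ y)) (few-errors x) (few-errors y) (few-errors (x ⊕ y))))
          where
          cover : 2ⁿ ≤ errors x + (errors y + errors (x ⊕ y))
          cover = begin
            2ⁿ           ≡⟨ sym (trans (sumV-const n 1) (*-identityʳ 2ⁿ)) ⟩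
            sumV n (λ _ → 1)
              ≤⟨ sumV-mono n (λ z → ≤-trans (≤-reflexive (cong fromBit (trans (sym e) (point z)))) (≤-trans (xor-≤ (a z x xor h x) _) (+-monoʳ-≤ (fromBit (a z x xor h x)) (xor-≤ (a (z ⊕ x) y xor h y) _)))) ⟩
            sumV n (λ z → fromBit (a z x xor h x) + (fromBit (a (z ⊕ x) y xor h y) + fromBit (a z (x ⊕ y) xor h (x ⊕ y))))
              ≡⟨ trans (sumV-+ n _ _) (cong (errors x +_) (trans (sumV-+ n _ _) (cong (_+ errors (x ⊕ y)) (sumV-shift n x (λ z → fromBit (a z y xor h y)))))) ⟩
            errors x + (errors y + errors (x ⊕ y)) ∎
            where open ≤-Reasoning

      private
        B : Vec Bool n → Vec Bool n → Bool
        B x y = h (x ⊗ y) xor (h x ∧ h y)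

        nB : ℕ
        nB = sumV n λ x → cnt n (B x)

        transfer : ∀ b a₁ a₂ a₃ h₁ h₂ h₃ → fromBit (h₁ xor (h₂ ∧ h₃)) ≤
          fromBit (if b then true else (a₁ xor (a₂ ∧ a₃))) + (fromBit (a₁ xor h₁) + (fromBit (a₂ xor h₂) + fromBit (a₃ xor h₃)))
        transfer true  a₁ a₂ a₃ h₁ h₂ h₃ = ≤-trans (bit≤1 (h₁ xor (h₂ ∧ h₃))) (m≤m+n 1 _)
        transfer false a₁ a₂ a₃ h₁ h₂ h₃ with a₁ xor h₁ in e₁ | a₂ xor h₂ in e₂ | a₃ xor h₃ in e₃
        ... | true  | _     | _    = ≤-trans (bit≤1 (h₁ xor (h₂ ∧ h₃))) (≤-trans (m≤m+n 1 _) (m≤n+m _ (fromBit (a₁ xor (a₂ ∧ a₃)))))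
        ... | false | true  | _    = ≤-trans (bit≤1 (h₁ xor (h₂ ∧ h₃))) (≤-trans (m≤m+n 1 _) (m≤n+m _ (fromBit (a₁ xor (a₂ ∧ a₃)))))
        ... | false | false | true = ≤-trans (bit≤1 (h₁ xor (h₂ ∧ h₃))) (m≤n+m 1 (fromBit (a₁ xor (a₂ ∧ a₃))))
        ... | false | false | false rewrite xor-false {a₁} e₁ | xor-false {a₂} e₂ | xor-false {a₃} e₃ = m≤m+n _ 0

        -- If h is not multiplicative at (x, y), the test fails for every z whose three votes are
        -- right, that is for at least 13/16 of all z.
        nB-pointwise : ∀ x y → 13 * 2ⁿ * fromBit (B x y) ≤ 16 * cnt n (fails x y)
        nB-pointwise x y = true-or (B x y) (λ e → subst (λ u → 13 * 2ⁿ * fromBit u ≤ 16 * cnt n (fails x y)) (sym e) (hit e))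
            (λ e → subst (λ u → 13 * 2ⁿ * fromBit u ≤ 16 * cnt n (fails x y)) (sym e) (≤-trans (≤-reflexive (*-zeroʳ (13 * 2ⁿ))) z≤n))
          where
          hit : B x y ≡ true → 13 * 2ⁿ * 1 ≤ 16 * cnt n (fails x y)
          hit e = remainder 2ⁿ (cnt n (fails x y)) (errors (x ⊗ y) + (errors x + errors y)) cover
            (three (errors (x ⊗ y)) (errors x) (errors y) (few-errors (x ⊗ y)) (few-errors x) (few-errors y))
            where
            open ≤-Reasoning
            cover : 2ⁿ ≤ cnt n (fails x y) + (errors (x ⊗ y) + (errors x + errors y))
            cover = begin
              2ⁿ  ≡⟨ sym (trans (sumV-const n 1) (*-identityʳ 2ⁿ)) ⟩
              sumV n (λ _ → 1)
                ≤⟨ sumV-mono n (λ z → ≤-trans (≤-reflexive (cong fromBit (sym e))) (transfer (β x y) (a z (x ⊗ y)) (a z x) (a z y) (h (x ⊗ y)) (h x) (h y))) ⟩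
              sumV n (λ z → fromBit (fails x y z) + (fromBit (a z (x ⊗ y) xor h (x ⊗ y)) + (fromBit (a z x xor h x) + fromBit (a z y xor h y))))
                ≡⟨ trans (sumV-+ n _ _) (cong (cnt n (fails x y) +_) (trans (sumV-+ n _ _) (cong (errors (x ⊗ y) +_) (sumV-+ n _ _)))) ⟩
              cnt n (fails x y) + (errors (x ⊗ y) + (errors x + errors y)) ∎

        nB-small : 26 * nB < 2ⁿ * 2ⁿ
        nB-small = comparison 2ⁿ nB failures
          (sum²-scale n (13 * 2ⁿ) 16 (λ x y → fromBit (B x y)) (λ x y → cnt n (fails x y)) nB-pointwise) few

      -- By `nB-pointwise` the defect is 1 on fewer than 1/26 of the pairs, while a nonzero bilinear
      -- form is 1 on at least a quarter.
      multiplicative : ∀ x y → h (x ⊗ y) ≡ h x ∧ h y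
      multiplicative x₀ y₀ = true-or (B x₀ y₀) (λ e → ⊥-elim (absurd e)) xor-false
        where
        absurd : B x₀ y₀ ≡ true → ⊥
        absurd e = <⇒≱ (≤-<-trans (*-monoˡ-≤ nB (m≤m+n 4 22)) nB-small) cover
          where
          cover : 2ⁿ * 2ⁿ ≤ 4 * nB
          cover = begin
            2ⁿ * 2ⁿ ≡⟨ sym (trans (sumV-cong n (λ _ → trans (sumV-const n 1) (*-identityʳ 2ⁿ))) (sumV-const n 2ⁿ)) ⟩
            sumV n (λ x → sumV n λ y → 1)
              ≤⟨ sumV-mono n (λ x → sumV-mono n λ y → ≤-trans (≤-reflexive (cong fromBit (trans (sym e) (Form.polarise h additive x₀ y₀ x y))))
                   (≤-trans (xor-≤ (B x y) _) (+-monoʳ-≤ (fromBit (B x y)) (≤-trans (xor-≤ (B (x ⊕ x₀) y) _) (+-monoʳ-≤ (fromBit (B (x ⊕ x₀) y)) (xor-≤ (B x (y ⊕ y₀)) _)))))) ⟩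
            sumV n (λ x → sumV n λ y → fromBit (B x y) + (fromBit (B (x ⊕ x₀) y) + (fromBit (B x (y ⊕ y₀)) + fromBit (B (x ⊕ x₀) (y ⊕ y₀)))))
              ≡⟨ trans (sumV-cong n λ x → trans (sumV-+ n _ _) (cong (cnt n (B x) +_) (trans (sumV-+ n _ _) (cong (cnt n (B (x ⊕ x₀)) +_)
                   (trans (sumV-+ n _ _) (cong₂ _+_ (sumV-shift n y₀ (λ y → fromBit (B x y))) (sumV-shift n y₀ (λ y → fromBit (B (x ⊕ x₀) y)))))))))
                   (trans (sumV-+ n _ _) (cong (nB +_) (trans (sumV-+ n _ _) (cong₂ _+_ (sumV-shift n x₀ (λ x → cnt n (B x))) (trans (sumV-+ n _ _) (cong (nB +_) (sumV-shift n x₀ (λ x → cnt n (B x)))))))))⟩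
            nB + (nB + (nB + nB))  ≡⟨ four nB ⟩
            4 * nB ∎
            where
            open ≤-Reasoning
            four : ∀ b → b + (b + (b + b)) ≡ 4 * b
            four = solve-∀

      is-literal : IsLiteral h
      is-literal = homomorphism⇒literal h additive multiplicative

  abstract
    self-correction : ∀ {n} (g : Vec Bool n → Bool) → 32 * SelfCorrection.failures g < 2 ^ n * (2 ^ n * 2 ^ n) →
                      Σ (Vec Bool n → Bool) λ h → (∀ x → 16 * cnt n (λ z → (g z xor g (z ⊕ x)) xor h x) < 2 ^ n) × IsLiteral h
    self-correction g few = SelfCorrection.h g few , SelfCorrection.few-errors g few , SelfCorrection.is-literal g few

-- The exhaustive search finds a smallest consistent tree

module MinimalTrees where

  open TesterAlgorithm using (module MinSize)
  open import Data.Bool.Properties using (∧-identityʳ; ∧-assoc; xor-same)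
  open import Data.Fin using (Fin; toℕ; fromℕ<)
  open import Data.Fin.Properties using (toℕ<n; toℕ-fromℕ<)
  open import Data.Nat
  open import Data.Nat.Properties

  evalBy : ∀ {κ} → Tree κ → (Fin κ → Bool) → Bool
  evalBy (leaf b)       y = b
  evalBy (node j t₀ t₁) y = if y j then evalBy t₁ y else evalBy t₀ y

  module MinTree (Y : ℕ → ℕ → Bool) (lab : ℕ → Bool) (m κ s : ℕ) where

    open MinSize Y lab m κ s

    Fits : Path → Tree κ → Set
    Fits p τ = ∀ t → t < m → alive true p t ≡ true → evalBy τ (λ j → Y t (toℕ j)) ≡ lab t

    private
      alive-∧ : ∀ a p t → alive a p t ≡ a ∧ alive true p t
      alive-∧ a []            t = sym (∧-identityʳ a)
      alive-∧ a ((j , b) ∷ p) t = trans (alive-∧ (a ∧ not (Y t j xor b)) p t)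
        (trans (∧-assoc a _ _) (cong (a ∧_) (sym (alive-∧ (not (Y t j xor b)) p t))))

      split-∧ : ∀ {a b} → a ∧ b ≡ true → a ≡ true × b ≡ true
      split-∧ {true} e = refl , e

      not-xor : ∀ {a b} → not (a xor b) ≡ true → a ≡ b
      not-xor {false} {false} e = refl
      not-xor {true}  {true}  e = refl

      alive-tail : ∀ {j b p t} → alive true ((j , b) ∷ p) t ≡ true → Y t j ≡ b × alive true p t ≡ true
      alive-tail {j} {b} {p} {t} e with split-∧ {not (Y t j xor b)} (trans (sym (alive-∧ _ p t)) e)
      ... | e₁ , e₂ = not-xor e₁ , e₂

      alive-cons : ∀ {j b p t} → Y t j ≡ b → alive true p t ≡ true → alive true ((j , b) ∷ p) t ≡ true
      alive-cons {j} {b} {p} {t} e e′ = trans (alive-∧ _ p t) (cong₂ _∧_ (trans (cong (λ y → not (y xor b)) e) (cong not (xor-same b))) e′)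

      tally-zero : ∀ b p k → tally b p k ≡ 0 → ∀ t → t < k → alive true p t ∧ not (lab t xor b) ≡ false
      tally-zero b p (suc k) e t l with m≤n⇒m<n∨m≡n (≤-pred l)
      ... | inj₁ l′ = tally-zero b p k (m+n≡0⇒n≡0 _ e) t l′
      ... | inj₂ refl = bit (m+n≡0⇒m≡0 _ e)
        where bit : ∀ {c} → fromBit c ≡ 0 → c ≡ false
              bit {false} _ = refl

      zero-tally : ∀ b p k → (∀ t → t < k → alive true p t ∧ not (lab t xor b) ≡ false) → tally b p k ≡ 0
      zero-tally b p zero    h = refl
      zero-tally b p (suc k) h rewrite h k ≤-refl = zero-tally b p k (λ t l → h t (m<n⇒m<1+n l))

      minOf-≤ : ∀ {x y} → x ≤ y → minOf x y ≡ x
      minOf-≤ {x} {y} l rewrite m≤n⇒m∸n≡0 l = refl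

      minOf-≥ : ∀ {x y} → y ≤ x → minOf x y ≡ y
      minOf-≥ l = m∸[m∸n]≡n l

      minOf≤ʳ : ∀ x y → minOf x y ≤ y
      minOf≤ʳ x y with ≤-total x y
      ... | inj₁ l = ≤-trans (≤-reflexive (minOf-≤ l)) l
      ... | inj₂ l = ≤-reflexive (minOf-≥ l)

      ≡ᵇ-zero : ∀ {x} → (x ≡ᵇ 0) ≡ true → x ≡ 0
      ≡ᵇ-zero {zero} e = refl

      -- A pure path has a constant tree.
      pure-leaf : ∀ p → pure p ≡ true → Σ Bool λ b → Fits p (leaf b)
      pure-leaf p e with ≤-total (tally false p m) (tally true p m)
      ... | inj₁ l = true , λ t t<m al → sym (other (trans (sym (cong (_∧ not (lab t xor false)) al)) (tally-zero false p m (trans (sym (minOf-≤ l)) (≡ᵇ-zero e)) t t<m)))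
        where other : ∀ {c} → not (c xor false) ≡ false → c ≡ true
              other {true} _ = refl
      ... | inj₂ l = false , λ t t<m al → sym (other (trans (sym (cong (_∧ not (lab t xor true)) al)) (tally-zero true p m (trans (sym (minOf-≥ l)) (≡ᵇ-zero e)) t t<m)))
        where other : ∀ {c} → not (c xor true) ≡ false → c ≡ false
              other {false} _ = refl

      leaf-pure : ∀ p b → Fits p (leaf b) → pure p ≡ true
      leaf-pure p b fits = cong (_≡ᵇ 0) (zero-min b (zero-tally (not b) p m none))
        where
        none : ∀ t → t < m → alive true p t ∧ not (lab t xor not b) ≡ false
        none t l with alive true p t in e
        ... | false = refl
        ... | true  = trans (cong (λ c → not (c xor not b)) (sym (fits t l e))) (differ b)
          where differ : ∀ b → not (b xor not b) ≡ false
                differ false = refl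
                differ true  = refl
        zero-min : ∀ b → tally (not b) p m ≡ 0 → minOf (tally false p m) (tally true p m) ≡ 0
        zero-min true  e = n≤0⇒n≡0 (≤-trans (m∸n≤m _ (tally false p m ∸ tally true p m)) (≤-reflexive e))
        zero-min false e = n≤0⇒n≡0 (≤-trans (minOf≤ʳ _ _) (≤-reflexive e))

    Found : ℕ → Path → ℕ → Set
    Found r p v = Σ (Tree κ) λ τ → depth τ ≤ r × size τ ≤ v × Fits p τ

    private
      branch : ∀ {r p j v₀ v₁} (j<κ : j < κ) → Found r ((j , false) ∷ p) v₀ → Found r ((j , true) ∷ p) v₁ → Found (suc r) p (v₀ + v₁)
      branch {r} {p} {j} j<κ (τ₀ , d₀ , s₀ , f₀) (τ₁ , d₁ , s₁ , f₁) = node (fromℕ< j<κ) τ₀ τ₁ , s≤s (⊔-lub d₀ d₁) , +-mono-≤ s₀ s₁ , fits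
        where
        fits : Fits p (node (fromℕ< j<κ) τ₀ τ₁)
        fits t l al rewrite toℕ-fromℕ< j<κ with Y t j in e
        ... | true  = f₁ t l (alive-cons {p = p} e al)
        ... | false = f₀ t l (alive-cons {p = p} e al)

    mutual
      -- A value of at most s cannot be the cap s + 1, so it was reached through pure paths and
      -- branchings, from which the tree is rebuilt.
      found : ∀ r p → minSize r p ≤ s → Found r p (minSize r p)
      found r p l with pure p in e
      ... | true with pure-leaf p e
      ...   | b , fits = leaf b , z≤n , ≤-refl , fits
      found zero    p l | false = ⊥-elim (<⇒≱ ≤-refl l)
      found (suc r) p l | false = found-scan r p κ ≤-refl (suc s) l (λ h → ⊥-elim (<⇒≱ ≤-refl h))

      -- The best value so far is required to come from a tree only if it is at most s, because the
      -- scan starts at s + 1 without one.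
      found-scan : ∀ r p j → j ≤ κ → ∀ best → scan r p j best ≤ s → (best ≤ s → Found (suc r) p best) → Found (suc r) p (scan r p j best)
      found-scan r p zero    h best l k = k l
      found-scan r p (suc j) h best l k = found-scan r p j (<⇒≤ h) _ l next
        where
        v₀ = minSize r ((j , false) ∷ p)
        v₁ = minSize r ((j , true) ∷ p)
        next : minOf best (v₀ + v₁) ≤ s → Found (suc r) p (minOf best (v₀ + v₁))
        next l′ with ≤-total best (v₀ + v₁)
        ... | inj₁ le = subst (Found (suc r) p) (sym (minOf-≤ le)) (k (subst (_≤ s) (minOf-≤ le) l′))
        ... | inj₂ ge = subst (Found (suc r) p) (sym (minOf-≥ ge)) (branch {r} {p} {j} h (found r ((j , false) ∷ p) (≤-trans (m≤m+n v₀ v₁) sum≤)) (found r ((j , true) ∷ p) (≤-trans (m≤n+m v₁ v₀) sum≤)))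
          where sum≤ = subst (_≤ s) (minOf-≥ ge) l′

    private
      scan≤best : ∀ r p j best → scan r p j best ≤ best
      scan≤best r p zero    best = ≤-refl
      scan≤best r p (suc j) best = ≤-trans (scan≤best r p j _) (m∸n≤m best (best ∸ (minSize r ((j , false) ∷ p) + minSize r ((j , true) ∷ p))))

      scan≤ : ∀ r p i best j → j < i → scan r p i best ≤ minSize r ((j , false) ∷ p) + minSize r ((j , true) ∷ p)
      scan≤ r p (suc i) best j l with m≤n⇒m<n∨m≡n (≤-pred l)
      ... | inj₁ l′ = scan≤ r p i _ j l′
      ... | inj₂ refl = ≤-trans (scan≤best r p i _) (minOf≤ʳ best (minSize r ((i , false) ∷ p) + minSize r ((i , true) ∷ p)))

      size>0 : ∀ (τ : Tree κ) → 1 ≤ size τ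
      size>0 (leaf _)       = ≤-refl
      size>0 (node _ τ₀ τ₁) = ≤-trans (size>0 τ₀) (m≤m+n _ _)

    -- Induction on τ: the variable at its root is one of those scanned, and its two subtrees fit
    -- the two extended paths. If τ is a leaf the path is pure and the value is 1.
    minSize-minimal : ∀ r p τ → depth τ ≤ r → Fits p τ → minSize r p ≤ size τ
    minSize-minimal r p τ h fits with pure p in e
    ... | true = size>0 τ
    minSize-minimal r p (leaf b) h fits | false with trans (sym e) (leaf-pure p b fits)
    ... | ()
    minSize-minimal (suc r) p (node j τ₀ τ₁) (s≤s h) fits | false = ≤-trans (scan≤ r p κ (suc s) (toℕ j) (toℕ<n j))
      (+-mono-≤ (minSize-minimal r _ τ₀ (≤-trans (m≤m⊔n (depth τ₀) (depth τ₁)) h) (fits-side false))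
                (minSize-minimal r _ τ₁ (≤-trans (m≤n⊔m (depth τ₀) (depth τ₁)) h) (fits-side true)))
      where
      fits-side : ∀ b → Fits ((toℕ j , b) ∷ p) (if b then τ₁ else τ₀)
      fits-side false t l al with alive-tail {toℕ j} {false} {p} {t} al
      ... | e , al′ = trans (cong (λ y → if y then evalBy τ₁ (λ j → Y t (toℕ j)) else evalBy τ₀ (λ j → Y t (toℕ j))) (sym e)) (fits t l al′)
      fits-side true t l al with alive-tail {toℕ j} {true} {p} {t} al
      ... | e , al′ = trans (cong (λ y → if y then evalBy τ₁ (λ j → Y t (toℕ j)) else evalBy τ₀ (λ j → Y t (toℕ j))) (sym e)) (fits t l al′)

-- Counting the trees over the blocks

module CandidateTrees where

  open OutputBounds using (agreeing)
  open MinimalTrees using (evalBy)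
  open import Data.Fin using (Fin)
  open import Data.List using (_++_; map; concatMap; replicate; allFin)
  open import Data.List.Properties using (length-++; length-map; length-tabulate; length-replicate)
  open import Data.List.Membership.Propositional.Properties using (∈-map⁺; ∈-concatMap⁺; ∈-allFin; ∈-++⁺ˡ; ∈-++⁺ʳ)
  open import Data.List.Relation.Unary.All using (All; []; _∷_)
  import Data.List.Relation.Unary.All.Properties as Allₚ
  open import Data.Nat
  open import Data.Nat.Properties
  open import Data.Vec using (lookup)

  -- A tree is coded by its postfix notation; the coding of trees of size at
  -- most s by words of length 2 s bounds their number.
  module Postfix (κ : ℕ) where

    data Symbol : Set where
      leaf : Bool → Symbol
      node : Fin κ → Symbol

    symbols : List Symbol
    symbols = leaf false ∷ leaf true ∷ map node (allFin κ)

    length-symbols : length symbols ≡ 2 + κ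
    length-symbols = cong (2 +_) (trans (length-map node (allFin κ)) (length-tabulate {n = κ} (λ i → i)))

    symbol∈ : ∀ σ → σ ∈ symbols
    symbol∈ (leaf false) = here refl
    symbol∈ (leaf true)  = there (here refl)
    symbol∈ (node j)     = there (there (∈-map⁺ node (∈-allFin j)))

    words : ℕ → List (List Symbol)
    words zero    = [] ∷ []
    words (suc ℓ) = concatMap (λ σ → map (σ ∷_) (words ℓ)) symbols

    length-concatMap : ∀ {A B : Set} c (g : A → List B) xs → (∀ x → length (g x) ≤ c) → length (concatMap g xs) ≤ length xs * c
    length-concatMap c g []       h = z≤n
    length-concatMap c g (x ∷ xs) h = ≤-trans (≤-reflexive (length-++ (g x))) (+-mono-≤ (h x) (length-concatMap c g xs h))

    length-words : ∀ ℓ → length (words ℓ) ≤ (2 + κ) ^ ℓ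
    length-words zero    = ≤-refl
    length-words (suc ℓ) = ≤-trans (length-concatMap ((2 + κ) ^ ℓ) (λ σ → map (σ ∷_) (words ℓ)) symbols (λ σ → ≤-trans (≤-reflexive (length-map (σ ∷_) (words ℓ))) (length-words ℓ)))
      (≤-reflexive (cong (_* (2 + κ) ^ ℓ) length-symbols))

    word∈ : ∀ w → w ∈ words (length w)
    word∈ []      = here refl
    word∈ (σ ∷ w) = ∈-concatMap⁺ (λ σ → map (σ ∷_) (words (length w))) (at symbols (symbol∈ σ))
      where
      open import Data.List.Relation.Unary.Any using (Any)
      at : ∀ xs → σ ∈ xs → Any (λ σ′ → (σ ∷ w) ∈ map (σ′ ∷_) (words (length w))) xs
      at (_ ∷ xs) (here refl) = here (∈-map⁺ (σ ∷_) (word∈ w))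
      at (_ ∷ xs) (there p)   = there (at xs p)

    -- Total on all words: a node symbol without two operands is skipped. Only surjectivity onto the
    -- small trees matters for the count.
    decode : List Symbol → List (Tree κ) → List (Tree κ)
    decode []           st              = st
    decode (leaf b ∷ w) st              = decode w (leaf b ∷ st)
    decode (node j ∷ w) (t₁ ∷ t₀ ∷ st)  = decode w (node j t₀ t₁ ∷ st)
    decode (node j ∷ w) st              = decode w st

    encode : Tree κ → List Symbol
    encode (leaf b)       = leaf b ∷ []
    encode (node j t₀ t₁) = encode t₀ ++ encode t₁ ++ node j ∷ []

    decode-encode : ∀ t w st → decode (encode t ++ w) st ≡ decode w (t ∷ st)
    decode-encode (leaf b)       w st = refl
    decode-encode (node j t₀ t₁) w st = begin
      decode ((encode t₀ ++ encode t₁ ++ node j ∷ []) ++ w) st  ≡⟨ cong (λ v → decode v st) (trans (++-assoc (encode t₀) _ w) (cong (encode t₀ ++_) (++-assoc (encode t₁) _ w))) ⟩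
      decode (encode t₀ ++ encode t₁ ++ node j ∷ w) st          ≡⟨ decode-encode t₀ _ st ⟩
      decode (encode t₁ ++ node j ∷ w) (t₀ ∷ st)                ≡⟨ decode-encode t₁ _ (t₀ ∷ st) ⟩
      decode w (node j t₀ t₁ ∷ st)                              ∎
      where open ≡-Reasoning
            open import Data.List.Properties using (++-assoc)

    length-encode : ∀ t → length (encode t) < size t + size t
    length-encode (leaf b)       = ≤-refl
    length-encode (node j t₀ t₁) = begin-strict
      length (encode t₀ ++ encode t₁ ++ node j ∷ [])            ≡⟨ trans (length-++ (encode t₀)) (cong (length (encode t₀) +_) (length-++ (encode t₁))) ⟩
      length (encode t₀) + (length (encode t₁) + 1)             ≡⟨ cong (length (encode t₀) +_) (+-comm _ 1) ⟩
      length (encode t₀) + suc (length (encode t₁))             <⟨ +-mono-<-≤ (length-encode t₀) (length-encode t₁) ⟩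
      (size t₀ + size t₀) + (size t₁ + size t₁)                 ≡⟨ arith (size t₀) (size t₁) ⟩
      (size t₀ + size t₁) + (size t₀ + size t₁)                 ∎
      where
      open ≤-Reasoning
      open import Data.Nat.Tactic.RingSolver using (solve-∀)
      arith : ∀ a b → (a + a) + (b + b) ≡ (a + b) + (a + b)
      arith = solve-∀

    padded : ∀ t s → size t ≤ s → Σ (List Symbol) λ w → length w ≡ s + s × Σ (List (Tree κ)) λ st → decode w [] ≡ t ∷ st
    padded t s h = pad ++ encode t , length-w , decoded
      where
      open import Data.List.Properties using (++-identityʳ)
      k = (s + s) ∸ length (encode t)
      pad = replicate k (leaf false)
      length-w : length (pad ++ encode t) ≡ s + s
      length-w = trans (length-++ pad) (trans (cong (_+ length (encode t)) (length-replicate k)) (m∸n+n≡m (<⇒≤ (<-≤-trans (length-encode t) (+-mono-≤ h h)))))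
      skip-pad : ∀ k st → Σ (List (Tree κ)) λ st′ → decode (replicate k (leaf false) ++ encode t) st ≡ decode (encode t) st′
      skip-pad zero    st = st , refl
      skip-pad (suc k) st = skip-pad k (leaf false ∷ st)
      decoded : Σ (List (Tree κ)) λ st → decode (pad ++ encode t) [] ≡ t ∷ st
      decoded with skip-pad k []
      ... | st , e = st , trans e (trans (cong (λ w → decode w st) (sym (++-identityʳ (encode t)))) (decode-encode t [] st))

  -- Replacing block indices by variables of the function, or by zero.
  substitute : ∀ {κ n} → (Fin κ → Maybe (Fin n)) → Tree κ → Tree n
  substitute v (leaf b)       = leaf b
  substitute v (node j t₀ t₁) with v j
  ... | just i  = node i (substitute v t₀) (substitute v t₁)
  ... | nothing = substitute v t₀

  bitOf : ∀ {n} → Maybe (Fin n) → Vec Bool n → Bool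
  bitOf (just i) x = lookup x i
  bitOf nothing  x = false

  module _ {κ n : ℕ} (v : Fin κ → Maybe (Fin n)) where

    substitute-eval : ∀ t x → eval (substitute v t) x ≡ evalBy t (λ j → bitOf (v j) x)
    substitute-eval (leaf b)       x = refl
    substitute-eval (node j t₀ t₁) x with v j
    ... | nothing = substitute-eval t₀ x
    ... | just i with lookup x i
    ...   | true  = substitute-eval t₁ x
    ...   | false = substitute-eval t₀ x

    substitute-depth : ∀ t → depth (substitute v t) ≤ depth t
    substitute-depth (leaf b)       = z≤n
    substitute-depth (node j t₀ t₁) with v j
    ... | just i  = s≤s (⊔-mono-≤ (substitute-depth t₀) (substitute-depth t₁))
    ... | nothing = m≤n⇒m≤1+n (≤-trans (substitute-depth t₀) (m≤m⊔n _ _))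

    substitute-size : ∀ t → size (substitute v t) ≤ size t
    substitute-size (leaf b)       = ≤-refl
    substitute-size (node j t₀ t₁) with v j
    ... | just i  = +-mono-≤ (substitute-size t₀) (substitute-size t₁)
    ... | nothing = ≤-trans (substitute-size t₀) (m≤m+n _ _)

    open Postfix κ

    module Candidates (d s : ℕ) where

      candidate : List (Tree κ) → List (BoolFun n)
      candidate []       = []
      candidate (t ∷ st) with depth t ≤? d | size t ≤? s
      ... | yes _ | yes _ = eval (substitute v t) ∷ []
      ... | _     | _     = []

      candidate-length : ∀ st → length (candidate st) ≤ 1
      candidate-length []       = z≤n
      candidate-length (t ∷ st) with depth t ≤? d | size t ≤? s
      ... | yes _ | yes _ = ≤-refl
      ... | yes _ | no _  = z≤n
      ... | no _  | _     = z≤n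

      candidate-DT : ∀ st → All (DT d s) (candidate st)
      candidate-DT []       = []
      candidate-DT (t ∷ st) with depth t ≤? d | size t ≤? s
      ... | yes h | yes h′ = (substitute v t , ≤-trans (substitute-depth t) h , ≤-trans (substitute-size t) h′ , λ x → refl) ∷ []
      ... | yes _ | no _   = []
      ... | no _  | _      = []

      candidate-∈ : ∀ t st → depth t ≤ d → size t ≤ s → eval (substitute v t) ∈ candidate (t ∷ st)
      candidate-∈ t st h h′ with depth t ≤? d | size t ≤? s
      ... | yes _ | yes _ = here refl
      ... | yes _ | no k  = ⊥-elim (k h′)
      ... | no k  | _     = ⊥-elim (k h)

      of-word : List Symbol → List (BoolFun n)
      of-word w = candidate (decode w [])

      candidates : List (BoolFun n)
      candidates = concatMap of-word (words (s + s))

      candidates-length : length candidates ≤ (2 + κ) ^ (s + s)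
      candidates-length = ≤-trans (length-concatMap 1 of-word (words (s + s)) (λ w → candidate-length (decode w [])))
        (≤-trans (≤-reflexive (*-identityʳ _)) (length-words (s + s)))

      candidates-DT : All (DT d s) candidates
      candidates-DT = go (words (s + s))
        where go : ∀ ws → All (DT d s) (concatMap of-word ws)
              go []       = []
              go (w ∷ ws) = Allₚ.++⁺ (candidate-DT (decode w [])) (go ws)

      candidates-∈ : ∀ t → depth t ≤ d → size t ≤ s → eval (substitute v t) ∈ candidates
      candidates-∈ t h h′ with padded t s h′
      ... | w , e , st , e′ = go (words (s + s)) (subst (λ ℓ → w ∈ words ℓ) e (word∈ w))
        where go : ∀ ws → w ∈ ws → eval (substitute v t) ∈ concatMap of-word ws
              go (_ ∷ ws) (here refl) = ∈-++⁺ˡ (subst (λ st → eval (substitute v t) ∈ candidate st) (sym e′) (candidate-∈ t st h h′))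
              go (w′ ∷ ws) (there p)  = ∈-++⁺ʳ (of-word w′) (go ws p)

  agreeing-∈ : ∀ {n} (f : BoolFun n) x g gs → g ∈ gs → f x xor g x ≡ false → g ∈ agreeing f x gs
  agreeing-∈ f x g (g′ ∷ gs) (here refl) e rewrite e = here refl
  agreeing-∈ f x g (g′ ∷ gs) (there p) e with f x xor g′ x
  ... | true  = agreeing-∈ f x g gs p e
  ... | false = there (agreeing-∈ f x g gs p e)

  agreeing-All : ∀ {n} {P : BoolFun n → Set} (f : BoolFun n) x gs → All P gs → All P (agreeing f x gs)
  agreeing-All f x []       []       = []
  agreeing-All f x (g ∷ gs) (p ∷ ps) with f x xor g x
  ... | true  = agreeing-All f x gs ps
  ... | false = p ∷ agreeing-All f x gs ps

-- Soundness: far functions are rejected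

module SoundnessProof where

  open Compilation using (Comp; ret; iter)
  open Operations using (≡ᵇ-refl; ≡ᵇ-≢)
  open TesterAlgorithm
  open CubeCounting
  open RealOrder using (ι)
  open OutputBounds
  open LinearityTesting
  open MinimalTrees using (evalBy; module MinTree)
  open CandidateTrees
  open import Data.Bool.Properties using (xor-same)
  open import Data.Fin using (Fin; toℕ)
  open import Data.Fin.Properties using (toℕ<n)
  open import Data.List.Relation.Unary.All as All using (All; []; _∷_)
  open import Data.Nat
  open import Data.Nat.Properties
  open import Data.Nat.Tactic.RingSolver using (solve-∀)
  import Data.Rational as ℚ

  private
    passes-few : ∀ P F C → P + F ≡ C → C ≤ 32 * F → 32 * P ≤ 31 * C
    passes-few P F C e h = +-cancelʳ-≤ (32 * F) _ _ (begin
      32 * P + 32 * F   ≡⟨ trans (sym (*-distribˡ-+ 32 P F)) (cong (32 *_) e) ⟩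
      32 * C            ≡⟨ split C ⟩
      31 * C + C        ≤⟨ +-monoʳ-≤ (31 * C) h ⟩
      31 * C + 32 * F   ∎)
      where
      open ≤-Reasoning
      split : ∀ C → 32 * C ≡ 31 * C + C
      split = solve-∀

    rescale : ∀ Q A P T → 32 * P ≤ 31 * (T * (T * T)) → (32 * Q) * (A * P) ≤ (31 * A) * (T * (T * (T * Q)))
    rescale Q A P T h = begin
      (32 * Q) * (A * P)              ≡⟨ left Q A P ⟩
      Q * A * (32 * P)                ≤⟨ *-monoʳ-≤ (Q * A) h ⟩
      Q * A * (31 * (T * (T * T)))    ≡⟨ right Q A T ⟩
      (31 * A) * (T * (T * (T * Q)))  ∎
      where
      open ≤-Reasoning
      left : ∀ Q A P → (32 * Q) * (A * P) ≡ Q * A * (32 * P)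
      left = solve-∀
      right : ∀ Q A T → Q * A * (31 * (T * (T * T))) ≡ (31 * A) * (T * (T * (T * Q)))
      right = solve-∀

    rescale′ : ∀ Q A e T → 16 * e < T → (16 * Q) * (A * e) ≤ A * (T * Q)
    rescale′ Q A e T h = begin
      (16 * Q) * (A * e)  ≡⟨ left Q A e ⟩
      Q * A * (16 * e)    ≤⟨ *-monoʳ-≤ (Q * A) (<⇒≤ h) ⟩
      Q * A * T           ≡⟨ right Q A T ⟩
      A * (T * Q)         ∎
      where
      open ≤-Reasoning
      left : ∀ Q A e → (16 * Q) * (A * e) ≡ Q * A * (16 * e)
      left = solve-∀
      right : ∀ Q A T → Q * A * T ≡ A * (T * Q)
      right = solve-∀

    evalBy-cong : ∀ {κ} (t : Tree κ) {y y′} → (∀ j → y j ≡ y′ j) → evalBy t y ≡ evalBy t y′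
    evalBy-cong (leaf b)       h = refl
    evalBy-cong (node j t₀ t₁) {y} {y′} h rewrite h j with y′ j
    ... | true  = evalBy-cong t₁ h
    ... | false = evalBy-cong t₀ h

  agreeAll : ∀ {n} → BoolFun n → List (Vec Bool n) → List (BoolFun n) → List (BoolFun n)
  agreeAll f []       gs = gs
  agreeAll f (x ∷ xs) gs = agreeing f x (agreeAll f xs gs)

  update-same : ∀ t j v Y → update t j v Y t j ≡ v
  update-same t j v Y rewrite ≡ᵇ-refl t | ≡ᵇ-refl j = refl

  update-row : ∀ t j v Y {t′} j′ → t′ ≢ t → update t j v Y t′ j′ ≡ Y t′ j′
  update-row t j v Y {t′} j′ ne rewrite ≡ᵇ-≢ ne = refl

  update-col : ∀ t j v Y {j′} → j′ ≢ j → update t j v Y t j′ ≡ Y t j′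
  update-col t j v Y {j′} ne rewrite ≡ᵇ-refl t | ≡ᵇ-≢ ne = refl

  module Soundness {n : ℕ} (f : BoolFun n) (s d m R : ℕ) (D : Distribution n) (ε : ℚ.ℚ) (a b : ℕ) (a≤b : a ≤ b) (0<b : 0 < b)
                   (bε≡a : ι b ℚ.* ε ≡ ι a) (far : ∀ g → DT d s g → Far ε D f g)
                   (Q ηL ηT : ℕ) (eval-small : Q ≤ 16 ^ R) (literal-small : Q * 31 ^ R ≤ ηL * 32 ^ R)
                   (trees-small : Q * (2 + s) ^ (s + s) * (b ∸ a) ^ m ≤ ηT * b ^ m) where

    open Tester f s d m R
    open Bounds D true

    view : Vec Bool n → Vec Bool n → Vec Bool n → Bool
    view u δ z = f (u ⊕ z ⊗ δ)

    module SC (u δ : Vec Bool n) = SelfCorrection (view u δ)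

    Few : Vec Bool n → Vec Bool n → Set
    Few u δ = 32 * SC.failures u δ < 2 ^ n * (2 ^ n * 2 ^ n)

    literal-of : ∀ {u δ} → Few u δ → Vec Bool n → Bool
    literal-of {u} {δ} few = proj₁ (self-correction (view u δ) few)

    private
      0<T : 0 < 2 ^ n
      0<T = m^n>0 2 n

      bd-iter₀ : ∀ {X : Set} {q} (G : ℕ → X → (X → Comp n) → Comp n) →
                 (∀ i x k β → (∀ y → Bd q (k y) β) → Bd q (G i x k) β) →
                 ∀ i x k β → (∀ y → Bd q (k y) β) → Bd q (iter G i x k) β
      bd-iter₀ G stage zero    x k β h = h x
      bd-iter₀ G stage (suc i) x k β h = stage i x (λ y → iter G i y k) β (λ y → bd-iter₀ G stage i y k β h)

    -- Blocks failing the literal test often are rejected.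
    module _ (u δ : Vec Bool n) where

      private
        open SelfCorrection (view u δ) using (fails; failures)

        body : (x y z : Vec Bool n) → (⊤ → Comp n) → Comp n
        body x y z k = if A u δ x y xor A u δ zeros y then ret false else
          (if A u δ z (x ⊗ y) xor (A u δ z x ∧ A u δ z y) then ret false else k tt)

        body-bound : ∀ {q A′} k → Bd q (k tt) A′ → ∀ x y z → Bd q (body x y z k) (A′ * fromBit (not (fails x y z)))
        body-bound {q} {A′} k h x y z with A u δ x y xor A u δ zeros y | A u δ z (x ⊗ y) xor (A u δ z x ∧ A u δ z y)
        ... | true  | _     = bd-ret refl
        ... | false | true  = bd-ret refl
        ... | false | false = subst (Bd q (k tt)) (sym (*-identityʳ A′)) h

        passed : ℕ
        passed = sumV n λ x → sumV n λ y → cnt n (λ z → not (fails x y z))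

        passed+failures : passed + failures ≡ 2 ^ n * (2 ^ n * 2 ^ n)
        passed+failures = trans (sym (sumV-+ n _ _)) (trans (sumV-cong n λ x → trans (sym (sumV-+ n _ _)) (trans (sumV-cong n λ y →
          trans (+-comm (cnt n (λ z → not (fails x y z))) _) (cnt-total n (fails x y))) (sumV-const n (2 ^ n)))) (sumV-const n (2 ^ n * 2 ^ n)))

        scaled : ∀ A′ → (sumV n λ x → sumV n λ y → sumV n λ z → A′ * fromBit (not (fails x y z))) ≡ A′ * passed
        scaled A′ = trans (sumV-cong n λ x → trans (sumV-cong n λ y → sumV-* n A′ _) (sumV-* n A′ _)) (sumV-* n A′ _)

      -- Without `Few` at least 1/32 of all triples fail, so whatever follows is reached with
      -- probability at most 31/32.
      literal-step-bad : ¬ Few u δ → ∀ {q A′} i k → 0 < q → Bd q (k tt) A′ → Bd (32 * q) (literalStep u δ i tt k) (31 * A′)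
      literal-step-bad nf {q} {A′} i k 0<q h = bd-conv {2 ^ n * (2 ^ n * (2 ^ n * q))} {32 * q}
        (*-mono-< 0<T (*-mono-< 0<T (*-mono-< 0<T 0<q)))
        (rescale q A′ passed (2 ^ n) (passes-few passed failures _ passed+failures (≮⇒≥ nf)))
        (subst (Bd (2 ^ n * (2 ^ n * (2 ^ n * q))) (literalStep u δ i tt k)) (scaled A′)
          (bd-rand n (λ x → sumV n λ y → sumV n λ z → A′ * fromBit (not (fails x y z))) λ x →
           bd-rand n (λ y → sumV n λ z → A′ * fromBit (not (fails x y z))) λ y →
           bd-rand n (λ z → A′ * fromBit (not (fails x y z))) (body-bound k h x y)))

      literal-loop-bad : ¬ Few u δ → ∀ i k → Bd (32 ^ i) (iter (literalStep u δ) i tt k) (31 ^ i)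
      literal-loop-bad nf zero    k = E≤1 (k tt)
      literal-loop-bad nf (suc i) k = literal-step-bad nf i (λ y → iter (literalStep u δ) i y k) (m^n>0 32 i) (literal-loop-bad nf i k)

      literal-loop : ∀ {q} i k β → Bd q (k tt) β → Bd q (iter (literalStep u δ) i tt k) β
      literal-loop {q} i k β h = bd-iter₀ (literalStep u δ) stage i tt k β (λ _ → h)
        where
        stage : ∀ i x k β → (∀ y → Bd q (k y) β) → Bd q (literalStep u δ i x k) β
        stage i _ k β h = bd-rand-const n λ x → bd-rand-const n λ y → bd-rand-const n λ z → go x y z
          where go : ∀ x y z → Bd q (body x y z k) β
                go x y z with A u δ x y xor A u δ zeros y | A u δ z (x ⊗ y) xor (A u δ z x ∧ A u δ z y)
                ... | true  | _     = bd-ret refl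
                ... | false | true  = bd-ret refl
                ... | false | false = h tt

      -- Either the block is good, and passing the test costs nothing, or it survives R repetitions
      -- with probability at most (31/32)^R, which is charged to ηL.
      test-bound : ∀ k β → (Few u δ → Bd Q (k tt) β) → Bd Q (iter (literalStep u δ) R tt k) (ηL + β)
      test-bound k β h with 32 * SC.failures u δ <? 2 ^ n * (2 ^ n * 2 ^ n)
      ... | yes few = literal-loop R k (ηL + β) (bd-mono (m≤n+m β ηL) (h few))
      ... | no nf   = bd-mono (m≤m+n ηL β) (bd-conv {32 ^ R} {Q} {A = 31 ^ R} {A′ = ηL} (m^n>0 32 R) literal-small (literal-loop-bad nf R k))

      -- The bits of a block that mostly passes are evaluated correctly.
      module _ (few : Few u δ) where
        private
          h : Vec Bool n → Bool
          h = literal-of few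

          true≢ : ∀ {p q : Bool} → p ≢ q → ∀ r → not (r xor p) ≡ r xor q
          true≢ {false} {false} ne r     = ⊥-elim (ne refl)
          true≢ {false} {true}  ne false = refl
          true≢ {false} {true}  ne true  = refl
          true≢ {true}  {false} ne false = refl
          true≢ {true}  {false} ne true  = refl
          true≢ {true}  {true}  ne r     = ⊥-elim (ne refl)

        -- A wrong value y is confirmed only by a z that errs in the same way, and fewer than 1/16
        -- of all z err.
        recheck-bad : ∀ x y → y ≢ literal-of few x → ∀ i k → Bd (16 ^ i) (iter (recheck u δ x y) i tt k) 1
        recheck-bad x y ne zero    k = E≤1 (k tt)
        recheck-bad x y ne (suc i) k = bd-conv {2 ^ n * 16 ^ i} {16 * 16 ^ i} (*-mono-< 0<T (m^n>0 16 i))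
          (rescale′ (16 ^ i) 1 (cnt n (λ z → A u δ z x xor h x)) (2 ^ n) (proj₁ (proj₂ (self-correction (view u δ) few)) x))
          (subst (Bd (2 ^ n * 16 ^ i) _) (sumV-* n 1 (λ z → fromBit (A u δ z x xor h x)))
            (bd-rand n (λ z → 1 * fromBit (A u δ z x xor h x)) point))
          where
          point : ∀ z → Bd (16 ^ i) (if A u δ z x xor y then ret false else iter (recheck u δ x y) i tt k) (1 * fromBit (A u δ z x xor h x))
          point z rewrite sym (true≢ ne (A u δ z x)) with A u δ z x xor y
          ... | true  = bd-ret refl
          ... | false = recheck-bad x y ne i k

        recheck-loop : ∀ {q} x y i k β → Bd q (k tt) β → Bd q (iter (recheck u δ x y) i tt k) β
        recheck-loop {q} x y i k β hk = bd-iter₀ (recheck u δ x y) stage i tt k β (λ _ → hk)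
          where
          stage : ∀ i w k β → (∀ y → Bd q (k y) β) → Bd q (recheck u δ x y i w k) β
          stage i _ k β hk = bd-rand-const n go
            where go : ∀ z → Bd q (if A u δ z x xor y then ret false else k tt) β
                  go z with A u δ z x xor y
                  ... | true  = bd-ret refl
                  ... | false = hk tt

        evalBit-bound : ∀ x k β → Bd Q (k (literal-of few x)) β → Bd Q (evalBit u δ x k) (1 + β)
        evalBit-bound x k β hk = bd-rand-const n go
          where
          go : ∀ z → Bd Q (iter (recheck u δ x (A u δ z x)) R tt λ _ → k (A u δ z x)) (1 + β)
          go z with A u δ z x Data.Bool.≟ h x
          ... | yes e = recheck-loop x (A u δ z x) R (λ _ → k (A u δ z x)) (1 + β) (bd-mono (n≤1+n β) (subst (λ v → Bd Q (k v) β) (sym e) hk))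
          ... | no ne = bd-mono (m≤m+n 1 β) (bd-conv {16 ^ R} {Q} {A = 1} {A′ = 1} (m^n>0 16 R)
                  (≤-trans (≤-reflexive (*-identityʳ Q)) (≤-trans eval-small (≤-reflexive (sym (+-identityʳ _))))) (recheck-bad x (A u δ z x) ne R (λ _ → k (A u δ z x))))

    Good : Blocks → Set
    Good bl = ∀ j → j < κ bl → Few (bu bl j) (bd bl j)

    good-append : ∀ {u δ bl} → Few u δ → Good bl → Good (append u δ bl)
    good-append {u} {δ} {bl} few good j j≤κ = choose Few (j ≡ᵇ κ bl) (λ _ → few)
      (λ e → good j (≤∧≢⇒< (≤-pred j≤κ) (λ q → different (trans (sym e) (subst (λ i → (j ≡ᵇ i) ≡ true) q (≡ᵇ-refl j))))))
      where
      different : false ≢ true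
      different ()
      choose : ∀ {A B : Set} (P : A → B → Set) c {a a′ b b′} → (c ≡ true → P a b) → (c ≡ false → P a′ b′) →
               P (if c then a else a′) (if c then b else b′)
      choose P true  t e = t refl
      choose P false t e = e refl

    -- The outcome of the search is irrelevant here: whatever pair it delivers must still pass the
    -- literal test.
    newBlock-bound : ∀ bl x k β → Good bl → (∀ u δ → Few u δ → Bd Q (k (append u δ bl)) β) → Bd Q (newBlock bl x k) (ηL + β)
    newBlock-bound bl x k β good h = bd-iter₀ searchStep stage R _ (λ y → testBlock bl y k) (ηL + β)
      λ { (u , δ) → test-bound u δ (λ _ → k (append u δ bl)) β (h u δ) }
      where
      stage : ∀ {q} i y k β → (∀ y → Bd q (k y) β) → Bd q (searchStep i y k) β
      stage {q} i (u , δ) k β h = bd-rand-const n go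
        where go : ∀ c → Bd q (if f (u ⊕ c ⊗ δ) xor f u then k (u , c ⊗ δ) else k (u ⊕ c ⊗ δ , δ ⊕ c ⊗ δ)) β
              go c with f (u ⊕ c ⊗ δ) xor f u
              ... | true  = h _
              ... | false = h _

    module Final (bl : Blocks) (good : Good bl) (κ≤s : κ bl ≤ s) where

      bit : ∀ j → j < κ bl → Vec Bool n → Bool
      bit j l = literal-of (good j l)

      variable-of : Fin (κ bl) → Maybe (Fin n)
      variable-of j with proj₂ (proj₂ (self-correction (view (bu bl (toℕ j)) (bd bl (toℕ j))) (good (toℕ j) (toℕ<n j))))
      ... | inj₁ (i , _) = just i
      ... | inj₂ _       = nothing

      variable-of-bit : ∀ j x → bit (toℕ j) (toℕ<n j) x ≡ bitOf (variable-of j) x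
      variable-of-bit j x with proj₂ (proj₂ (self-correction (view (bu bl (toℕ j)) (bd bl (toℕ j))) (good (toℕ j) (toℕ<n j))))
      ... | inj₁ (i , e) = e x
      ... | inj₂ e       = e x

      -- Determined by the blocks alone, hence fixed before the batch is drawn. This independence is
      -- what permits the union bound over them.
      trees : List (BoolFun n)
      trees = Candidates.candidates variable-of d s

      trees-far : All (Far ε D f) trees
      trees-far = All.map (λ {g} → far g) (Candidates.candidates-DT variable-of d s)

      module _ (xs : List (Vec Bool n)) where

        Correct : ℕ → Matrix → Set
        Correct i Y = ∀ t j (l : j < κ bl) → i ≤ t → t < m → Y t j ≡ bit j l (nth xs t)

        CorrectRow : ℕ → ℕ → Matrix → Set
        CorrectRow t i Y = Correct (suc t) Y × (∀ j (l : j < κ bl) → i ≤ j → Y t j ≡ bit j l (nth xs t)) × i ≤ κ bl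

        row-bound : ∀ t → t < m → ∀ Y → Correct (suc t) Y → ∀ k β → (∀ Y′ → Correct t Y′ → Bd Q (k Y′) β) →
                    Bd Q (evalAll bl xs t Y k) (κ bl * 1 + β)
        row-bound t t<m Y c k β h = bd-iter (evalRow bl xs t) (CorrectRow t) stage (κ bl) Y (c , (λ j l l′ → ⊥-elim (<⇒≱ l l′)) , ≤-refl) k β
            (λ Y′ (c′ , r , _) → h Y′ (λ t′ j l le t′<m → case-row Y′ c′ r t′ j l le t′<m))
          where
          case-row : ∀ Y′ → Correct (suc t) Y′ → (∀ j (l : j < κ bl) → 0 ≤ j → Y′ t j ≡ bit j l (nth xs t)) →
                     ∀ t′ j (l : j < κ bl) → t ≤ t′ → t′ < m → Y′ t′ j ≡ bit j l (nth xs t′)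
          case-row Y′ c′ r t′ j l le t′<m = cases (m≤n⇒m<n∨m≡n le)
            where
            cases : t < t′ ⊎ t ≡ t′ → Y′ t′ j ≡ bit j l (nth xs t′)
            cases (inj₁ lt)   = c′ t′ j l lt t′<m
            cases (inj₂ refl) = r j l z≤n
          stage : ∀ j Y → CorrectRow t (suc j) Y → ∀ k β → (∀ Y′ → CorrectRow t j Y′ → Bd Q (k Y′) β) → Bd Q (evalRow bl xs t j Y k) (1 + β)
          stage j Y (c , r , j<κ) k β h = evalBit-bound (bu bl j) (bd bl j) (good j j<κ) (nth xs t) (λ v → k (update t j v Y)) β
            (h _ ((λ t′ j′ l le t′<m → trans (update-row t j _ Y j′ (>⇒≢ le)) (c t′ j′ l le t′<m)) , row , <⇒≤ j<κ))
            where
            row : ∀ j′ (l : j′ < κ bl) → j ≤ j′ → update t j (bit j j<κ (nth xs t)) Y t j′ ≡ bit j′ l (nth xs t)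
            row j′ l le = cases (m≤n⇒m<n∨m≡n le)
              where
              cases : j < j′ ⊎ j ≡ j′ → update t j (bit j j<κ (nth xs t)) Y t j′ ≡ bit j′ l (nth xs t)
              cases (inj₁ lt)   = trans (update-col t j _ Y (>⇒≢ lt)) (r j′ l lt)
              cases (inj₂ refl) = trans (update-same t j _ Y) (cong (λ p → bit j p (nth xs t)) (≤-irrelevant j<κ l))

        agreeAll-∈ : ∀ g ys → g ∈ trees → (∀ i → i < length ys → f (nth ys i) ≡ g (nth ys i)) → g ∈ agreeAll f ys trees
        agreeAll-∈ g []       p h = p
        agreeAll-∈ g (y ∷ ys) p h = agreeing-∈ f y g _ (agreeAll-∈ g ys p (λ i l → h (suc i) (s≤s l))) (trans (cong (_xor g y) (h 0 (s≤s z≤n))) (xor-same (g y)))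

        -- Acceptance produces a tree over the block bits which, after substitution, is a candidate
        -- agreeing with f on all examples. So the indicator of acceptance is at most the number of
        -- survivors.
        decide-bound : length xs ≡ m → ∀ Y → Correct 0 Y → Bd Q (decide bl xs Y) (Q * length (agreeAll f xs trees))
        decide-bound len Y c with MinSize.minSize Y (λ t → f (nth xs t)) m (κ bl) s d [] ≤ᵇ s in e
        ... | false = bd-ret refl
        ... | true with MinTree.found Y (λ t → f (nth xs t)) m (κ bl) s d [] (≤ᵇ⇒≤ _ s (subst T (sym e) tt))
        ...   | τ , dτ , sτ , fits = bd-one (≤-trans (≤-reflexive (sym (*-identityʳ Q))) (*-monoʳ-≤ Q (nonempty
                  (agreeAll-∈ (eval (substitute variable-of τ)) xs
                    (Candidates.candidates-∈ variable-of d s τ dτ (≤-trans sτ (≤ᵇ⇒≤ _ s (subst T (sym e) tt)))) agree))))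
          where
          nonempty : ∀ {A : Set} {g : A} {gs} → g ∈ gs → 1 ≤ length gs
          nonempty (here _)  = s≤s z≤n
          nonempty (there _) = s≤s z≤n
          agree : ∀ i → i < length xs → f (nth xs i) ≡ eval (substitute variable-of τ) (nth xs i)
          agree i l = sym (trans (substitute-eval variable-of τ (nth xs i)) (trans (evalBy-cong τ (λ j → sym (trans (c i (toℕ j) (toℕ<n j) z≤n (subst (i <_) len l)) (variable-of-bit j (nth xs i)))))
            (fits i (subst (i <_) len l) refl)))

        final-bound : length xs ≡ m → Bd Q (final bl xs) (m * (κ bl * 1) + Q * length (agreeAll f xs trees))
        final-bound len = bd-iter (evalAll bl xs) (λ i Y → Correct i Y × i ≤ m)
          (λ t Y (c , t<m) k β h → row-bound t t<m Y c k β (λ Y′ c′ → h Y′ (c′ , <⇒≤ t<m)))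
          m (λ _ _ → false) ((λ t j l le lt → ⊥-elim (<⇒≱ lt le)) , ≤-refl) (decide bl xs) _ (λ Y (c , _) → decide-bound len Y c)

    -- After t further examples, the expected number of surviving trees has
    -- shrunk by (1 - ε) ^ t.
    batch-bound : ∀ gs → All (Far ε D f) gs → ∀ B t xs bad k β → (∀ ys bad → length ys ≡ t + length xs → Bd Q (k (ys , bad)) (β + Q * length (agreeAll f ys gs))) →
                  Bd (b ^ t * Q) (iter (batchStep B) t (xs , bad) k) (b ^ t * β + Q * length (agreeAll f xs gs) * (b ∸ a) ^ t)
    batch-bound gs fars B zero xs bad k β h = subst₂ (λ q c → Bd q (k (xs , bad)) c) (sym (+-identityʳ Q))
      (cong₂ _+_ (sym (+-identityʳ β)) (sym (*-identityʳ _))) (h xs bad refl)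
    batch-bound gs fars B (suc t) xs bad k β h = subst₂ (λ q c → Bd q (iter (batchStep B) (suc t) (xs , bad) k) c) (sym (*-assoc b (b ^ t) Q))
      (arith b (b ^ t) β Q (length (agreeAll f xs gs)) (b ∸ a) ((b ∸ a) ^ t))
      (bd-draw-far D f ε a b a≤b bε≡a true {b ^ t * Q} {λ x → next x} {b ^ t * β} {Q * (b ∸ a) ^ t} (agreeAll f xs gs) (all-far xs) point)
      where
      rest : Batch → Comp n
      rest y = iter (batchStep B) t y k
      next : Vec Bool n → Comp n
      next x = if f x xor f (x ⊗ B) then rest (x ∷ xs , just x) else rest (x ∷ xs , bad)
      all-far : ∀ ys → All (Far ε D f) (agreeAll f ys gs)
      all-far []       = fars
      all-far (y ∷ ys) = agreeing-All f y _ (all-far ys)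
      inner : ∀ x bad → Bd (b ^ t * Q) (rest (x ∷ xs , bad)) (b ^ t * β + Q * (b ∸ a) ^ t * length (agreeing f x (agreeAll f xs gs)))
      inner x bad = subst (λ c → Bd (b ^ t * Q) (rest (x ∷ xs , bad)) (b ^ t * β + c)) (swap Q (length (agreeing f x (agreeAll f xs gs))) ((b ∸ a) ^ t))
        (batch-bound gs fars B t (x ∷ xs) bad k β (λ ys bad e → h ys bad (trans e (+-suc t (length xs)))))
        where swap : ∀ q l c → q * l * c ≡ q * c * l
              swap = solve-∀
      point : ∀ x → Bd (b ^ t * Q) (next x) (b ^ t * β + Q * (b ∸ a) ^ t * length (agreeing f x (agreeAll f xs gs)))
      point x with f x xor f (x ⊗ B)
      ... | true  = inner x (just x)
      ... | false = inner x bad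
      arith : ∀ b bt β Q l e et → b * (bt * β) + Q * et * l * e ≡ b * bt * β + Q * l * (e * et)
      arith = solve-∀

    perRound : ℕ
    perRound = m * s + ηL + ηT

    rounds-bound : ∀ r bl → Good bl → κ bl + r ≡ s → Bd Q (rounds r bl finish) (r * perRound)
    rounds-bound zero    bl good e = bd-ret refl
    -- `batch-bound` carries the factor b^m that clears the denominators of (1 - ε)^m; it is divided
    -- out again. A round may fail by misread bits, by a bad block that passes, or by a surviving
    -- tree, which are the three summands of `perRound`.
    rounds-bound (suc r) bl good e = bd-unscale (b ^ m) 0<bᵐ (bd-mono total-≤
      (batch-bound trees trees-far (mask bl) m [] nothing _ β point))
      where
      0<bᵐ : 0 < b ^ m
      0<bᵐ = m^n>0 b {{>-nonZero 0<b}} m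
      κ≤s : κ bl ≤ s
      κ≤s = subst (κ bl ≤_) e (m≤m+n (κ bl) (suc r))
      open Final bl good κ≤s
      β : ℕ
      β = m * s + (ηL + r * perRound)
      next : Batch → Comp n
      next y = afterBatch bl y (λ o → continue r bl o finish)
      point : ∀ ys bad → length ys ≡ m + 0 → Bd Q (next (ys , bad)) (β + Q * length (agreeAll f ys trees))
      point ys nothing len = bd-mono (+-monoˡ-≤ _ (≤-trans (*-monoʳ-≤ m (≤-trans (≤-reflexive (*-identityʳ (κ bl))) κ≤s)) (m≤m+n (m * s) _)))
        (final-bound ys (trans len (+-identityʳ m)))
      point ys (just x) len = bd-mono (≤-trans (m≤n+m _ (m * s)) (m≤m+n β _))
        (newBlock-bound bl x (λ b′ → rounds r b′ finish) (r * perRound) good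
          (λ u δ few → rounds-bound r (append u δ bl) (good-append {u} {δ} {bl} few good) (trans (sym (+-suc (κ bl) r)) e)))
      total-≤ : b ^ m * β + Q * length trees * (b ∸ a) ^ m ≤ b ^ m * (perRound + r * perRound)
      total-≤ = begin
        b ^ m * β + Q * length trees * (b ∸ a) ^ m
          ≤⟨ +-monoʳ-≤ (b ^ m * β) (*-monoˡ-≤ ((b ∸ a) ^ m) (*-monoʳ-≤ Q (≤-trans (Candidates.candidates-length variable-of d s) (^-monoˡ-≤ (s + s) (+-monoʳ-≤ 2 κ≤s))))) ⟩
        b ^ m * β + Q * (2 + s) ^ (s + s) * (b ∸ a) ^ m   ≤⟨ +-monoʳ-≤ (b ^ m * β) trees-small ⟩
        b ^ m * β + ηT * b ^ m                            ≡⟨ arith (b ^ m) (m * s) ηL ηT (r * perRound) ⟩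
        b ^ m * (perRound + r * perRound)                 ∎
        where
        open ≤-Reasoning
        arith : ∀ B M L T P → B * (M + (L + P)) + T * B ≡ B * (M + L + T + P)
        arith = solve-∀

    tester-bound : Bd Q tester (s * perRound)
    tester-bound = rounds-bound s noBlocks (λ j ()) refl

-- Completeness: functions of small trees are accepted

module CompletenessProof where

  open Compilation using (Comp; ret; iter)
  open Operations using (≡ᵇ-refl; ≡ᵇ-≢)
  open TesterAlgorithm
  open CubeCounting
  open OutputBounds
  open MinimalTrees using (evalBy; module MinTree)
  open import Data.Bool.Properties using (xor-same; ∧-zeroʳ; ∧-identityʳ; xor-identityʳ)
  open import Data.Bool.Solver using (module xor-∧-Solver)
  open import Data.Fin as F using (Fin; toℕ; fromℕ<)
  open import Data.Fin.Properties using (toℕ<n; toℕ-fromℕ<; _≟_)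
  open import Data.List using (_++_)
  open import Data.List.Properties using (length-++)
  open import Data.List.Membership.Propositional.Properties using (∈-++⁺ˡ; ∈-++⁺ʳ)
  open import Data.Nat hiding (_≟_)
  open import Data.Nat.Properties hiding (_≟_)
  open import Data.Nat.Tactic.RingSolver using (solve-∀)
  open import Data.Vec using (lookup)
  open import Data.Vec.Properties using (lookup-zipWith; lookup-replicate)

  module X = xor-∧-Solver

  lookup-⊕ : ∀ {n} (x y : Vec Bool n) i → lookup (x ⊕ y) i ≡ lookup x i xor lookup y i
  lookup-⊕ x y i = lookup-zipWith _xor_ i x y

  lookup-⊗ : ∀ {n} (x y : Vec Bool n) i → lookup (x ⊗ y) i ≡ lookup x i ∧ lookup y i
  lookup-⊗ x y i = lookup-zipWith _∧_ i x y

  variables : ∀ {n} → Tree n → List (Fin n)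
  variables (leaf _)       = []
  variables (node i t₀ t₁) = i ∷ variables t₀ ++ variables t₁

  length-variables : ∀ {n} (t : Tree n) → suc (length (variables t)) ≡ size t
  length-variables (leaf _)       = refl
  length-variables (node i t₀ t₁) = trans (cong (λ l → suc (suc l)) (length-++ (variables t₀)))
    (trans (cong suc (sym (+-suc _ _))) (cong₂ _+_ (length-variables t₀) (length-variables t₁)))

  eval-local : ∀ {n} (t : Tree n) {x y} → (∀ v → v ∈ variables t → lookup x v ≡ lookup y v) → eval t x ≡ eval t y
  eval-local (leaf _)       h = refl
  eval-local (node i t₀ t₁) {x} {y} h rewrite h i (here refl) with lookup y i
  ... | true  = eval-local t₁ (λ v p → h v (there (∈-++⁺ʳ (variables t₀) p)))
  ... | false = eval-local t₀ (λ v p → h v (there (∈-++⁺ˡ p)))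

  sumL : ∀ {A : Set} → List A → (A → ℕ) → ℕ
  sumL []       φ = 0
  sumL (v ∷ vs) φ = φ v + sumL vs φ

  module _ {A : Set} where
    sumL-mono : ∀ (vs : List A) {φ ψ} → (∀ v → φ v ≤ ψ v) → sumL vs φ ≤ sumL vs ψ
    sumL-mono []       h = z≤n
    sumL-mono (v ∷ vs) h = +-mono-≤ (h v) (sumL-mono vs h)

    sumL-< : ∀ (vs : List A) {φ ψ v} → (∀ v → φ v ≤ ψ v) → v ∈ vs → φ v < ψ v → sumL vs φ < sumL vs ψ
    sumL-< (v ∷ vs) h (here refl) l = +-mono-<-≤ l (sumL-mono vs h)
    sumL-< (v ∷ vs) h (there p) l   = +-mono-≤-< (h v) (sumL-< vs h p l)

    sumL-* : ∀ (vs : List A) c φ → sumL vs (λ v → c * φ v) ≡ c * sumL vs φ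
    sumL-* []       c φ = sym (*-zeroʳ c)
    sumL-* (v ∷ vs) c φ = trans (cong (c * φ v +_) (sumL-* vs c φ)) (sym (*-distribˡ-+ c (φ v) _))

    sumL-const≤ : ∀ (vs : List A) {φ c} → (∀ v → φ v ≤ c) → sumL vs φ ≤ length vs * c
    sumL-const≤ []       h = z≤n
    sumL-const≤ (v ∷ vs) h = +-mono-≤ (h v) (sumL-const≤ vs h)

    sumL-zero : ∀ (vs : List A) {φ} → sumL vs φ ≡ 0 → ∀ {v} → v ∈ vs → φ v ≡ 0
    sumL-zero (v ∷ vs) e (here refl) = m+n≡0⇒m≡0 _ e
    sumL-zero (v ∷ vs) e (there p)   = sumL-zero vs (m+n≡0⇒n≡0 _ e) p

    sumV-sumL : ∀ k (vs : List A) (φ : Vec Bool k → A → ℕ) → sumV k (λ c → sumL vs (φ c)) ≡ sumL vs (λ v → sumV k (λ c → φ c v))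
    sumV-sumL k []       φ = trans (sumV-const k 0) (*-zeroʳ (2 ^ k))
    sumV-sumL k (v ∷ vs) φ = trans (sumV-+ k (λ c → φ c v) (λ c → sumL vs (φ c))) (cong (_ +_) (sumV-sumL k vs φ))

  -- Two distinct coordinates of a random vector agree with probability 1/2.
  coordinates-agree : ∀ {k} (v w : Fin k) → v ≢ w → 2 * cnt k (λ c → not (lookup c v xor lookup c w)) ≡ 2 ^ k
  coordinates-agree F.zero F.zero ne = ⊥-elim (ne refl)
  coordinates-agree {suc k} F.zero (F.suc w) ne = cong (2 *_) (trans (cong (cnt k (λ x → not (lookup x w)) +_) (cnt-≡ k (λ x → nn (lookup x w))))
      (trans (+-comm (cnt k (λ x → not (lookup x w))) _) (cnt-total k (λ x → lookup x w))))
    where nn : ∀ b → not (true xor b) ≡ b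
          nn false = refl
          nn true  = refl
  coordinates-agree {suc k} (F.suc v) F.zero ne = trans (cong (2 *_) (cnt-≡ (suc k) (λ c → cong not (comm (lookup c (F.suc v)) (lookup c F.zero))))) (coordinates-agree F.zero (F.suc v) (λ e → ne (sym e)))
    where comm : ∀ a b → a xor b ≡ b xor a
          comm false false = refl
          comm false true  = refl
          comm true  false = refl
          comm true  true  = refl
  coordinates-agree {suc k} (F.suc v) (F.suc w) ne = trans (double (cnt k (λ c → not (lookup c v xor lookup c w))))
      (cong (2 *_) (coordinates-agree v w (λ e → ne (cong F.suc e))))
    where double : ∀ x → 2 * (x + x) ≡ 2 * (2 * x)
          double = solve-∀

  bit≤1 : ∀ b → fromBit b ≤ 1
  bit≤1 false = z≤n
  bit≤1 true  = ≤-refl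

  module Completeness {n : ℕ} (f : BoolFun n) (s d m R : ℕ) (D : Distribution n) (tree : Tree n)
                      (depth≤d : depth tree ≤ d) (size≤s : size tree ≤ s) (computes : ∀ x → eval tree x ≡ f x)
                      (Q : ℕ) (0<Q : 0 < Q) (search-small : s * s * Q ≤ 2 ^ R) where

    open Tester f s d m R
    open Bounds D false

    V : List (Fin n)
    V = variables tree

    private
      bd-iter₀ : ∀ {X : Set} {q} (G : ℕ → X → (X → Comp n) → Comp n) (Inv : ℕ → X → Set) →
                 (∀ i x → Inv (suc i) x → ∀ k β → (∀ y → Inv i y → Bd q (k y) β) → Bd q (G i x k) β) →
                 ∀ i x → Inv i x → ∀ k β → (∀ y → Inv 0 y → Bd q (k y) β) → Bd q (iter G i x k) β
      bd-iter₀ G Inv stage zero    x v k β h = h x v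
      bd-iter₀ G Inv stage (suc i) x v k β h = stage i x v (λ y → iter G i y k) β (λ y v′ → bd-iter₀ G Inv stage i y v′ k β h)

      local : ∀ {x y} → (∀ v → v ∈ V → lookup x v ≡ lookup y v) → f x ≡ f y
      local {x} {y} h = trans (sym (computes x)) (trans (eval-local tree h) (computes y))

      xor-false : ∀ {p q} → p xor q ≡ false → p ≡ q
      xor-false {true}  {true}  e = refl
      xor-false {false} {false} e = refl

    -- The block reads off the variable v.
    Reads : Vec Bool n → Vec Bool n → Fin n → Set
    Reads u δ v = ∀ z x → A u δ z x ≡ lookup x v

    pair : Vec Bool n → Fin n → Fin n → ℕ
    pair δ v w with v ≟ w
    ... | yes _ = 0
    ... | no _  = fromBit (lookup δ v ∧ lookup δ w)

    -- The potential of the search: ordered pairs of occurrences in the tree of distinct variables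
    -- that both lie in δ. It vanishes when δ holds at most one tree variable.
    Φ : Vec Bool n → ℕ
    Φ δ = sumL V λ v → sumL V λ w → pair δ v w

    Sensitive : Vec Bool n → Vec Bool n → Set
    Sensitive u δ = f u xor f (u ⊕ δ) ≡ true

    private
      some-variable : ∀ δ (vs : List (Fin n)) → (Σ (Fin n) λ v → v ∈ vs × lookup δ v ≡ true) ⊎ (∀ v → v ∈ vs → lookup δ v ≡ false)
      some-variable δ [] = inj₂ λ v ()
      some-variable δ (v ∷ vs) with lookup δ v in e
      ... | true = inj₁ (v , here refl , e)
      ... | false with some-variable δ vs
      ...   | inj₁ (w , p , e′) = inj₁ (w , there p , e′)
      ...   | inj₂ h = inj₂ λ { _ (here refl) → e ; w (there p) → h w p }

      unique : ∀ δ → Φ δ ≡ 0 → ∀ {v w} → v ∈ V → w ∈ V → lookup δ v ≡ true → lookup δ w ≡ true → w ≡ v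
      unique δ e {v} {w} pv pw ev ew with sumL-zero V (sumL-zero V e pv) pw
      ... | z with v ≟ w
      ...   | yes eq = sym eq
      ...   | no _ rewrite ev | ew with z
      ...     | ()

    -- Sensitivity forces some tree variable into δ, and the potential allows only one, v. Then f(u
    -- ⊕ z ⊗ δ) depends on z only through its coordinate at v, and in the difference of two such
    -- values both f(u) and z cancel.
    reads : ∀ u δ → Sensitive u δ → Φ δ ≡ 0 → Σ (Fin n) λ v → v ∈ V × lookup δ v ≡ true × Reads u δ v
    reads u δ sens e with some-variable δ V
    ... | inj₂ none = ⊥-elim (absurd (trans (sym sens) (trans (cong (f u xor_) (local (λ v p → trans (lookup-⊕ u δ v) (trans (cong (lookup u v xor_) (none v p)) (xor-identityʳ _))))) (xor-same (f u)))))
      where absurd : true ≢ false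
            absurd ()
    ... | inj₁ (v , pv , ev) = v , pv , ev , λ z x → trans (cong₂ _xor_ (value z) (trans (value (z ⊕ x)) (cong (f u xor_) (lookup-⊕ z x v))))
          (X.solve 3 (λ p z x → (p X.:+ z) X.:+ (p X.:+ (z X.:+ x)) X.:= x) refl (f u) (lookup z v) (lookup x v))
      where
      coordinate : ∀ z w → w ∈ V → lookup (u ⊕ z ⊗ δ) w ≡ lookup (if lookup z v then u ⊕ δ else u) w
      coordinate z w pw rewrite lookup-⊕ u (z ⊗ δ) w | lookup-⊗ z δ w with lookup δ w in ew
      ... | false rewrite ∧-zeroʳ (lookup z w) with lookup z v
      ...   | true rewrite lookup-⊕ u δ w | ew = refl
      ...   | false = xor-identityʳ _
      coordinate z w pw | true rewrite unique δ e pv pw ev ew | ∧-identityʳ (lookup z v) with lookup z v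
      ...   | true rewrite lookup-⊕ u δ v | ev = refl
      ...   | false = xor-identityʳ _
      value : ∀ z → f (u ⊕ z ⊗ δ) ≡ f u xor lookup z v
      value z with lookup z v in ez
      ... | true  = trans (local (λ w p → trans (coordinate z w p) (cong (λ c → lookup (if c then u ⊕ δ else u) w) ez))) (flip-bit (f u) _ sens)
        where flip-bit : ∀ a b → a xor b ≡ true → b ≡ a xor true
              flip-bit true  false e = refl
              flip-bit false true  e = refl
      ... | false = trans (local (λ w p → trans (coordinate z w p) (cong (λ c → lookup (if c then u ⊕ δ else u) w) ez))) (sym (xor-identityʳ (f u)))

    -- Searching halves the number of pairs of variables left in the block.
    private
      pair-≤ : ∀ δ δ′ c v w → (lookup δ′ v ∧ lookup δ′ w ≡ true → (lookup δ v ∧ lookup δ w ≡ true) × lookup c v ≡ lookup c w) →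
               pair δ′ v w ≤ pair δ v w * fromBit (not (lookup c v xor lookup c w))
      pair-≤ δ δ′ c v w h with v ≟ w
      ... | yes _ = z≤n
      ... | no _ with lookup δ′ v ∧ lookup δ′ w
      ...   | false = z≤n
      ...   | true with h refl
      ...     | e , e′ rewrite e | e′ | xor-same (lookup c w) = ≤-refl

      ∧-parts : ∀ {a b} → a ∧ b ≡ true → a ≡ true × b ≡ true
      ∧-parts {true} {true} e = refl , refl

      kept : ∀ (δ c : Vec Bool n) v w → lookup (c ⊗ δ) v ∧ lookup (c ⊗ δ) w ≡ true → (lookup δ v ∧ lookup δ w ≡ true) × lookup c v ≡ lookup c w
      kept δ c v w e rewrite lookup-⊗ c δ v | lookup-⊗ c δ w with ∧-parts {lookup c v ∧ lookup δ v} e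
      ... | e₁ , e₂ with ∧-parts {lookup c v} e₁ | ∧-parts {lookup c w} e₂
      ... | a , b | a′ , b′ = cong₂ _∧_ b b′ , trans a (sym a′)

      removed : ∀ (δ c : Vec Bool n) v w → lookup (δ ⊕ c ⊗ δ) v ∧ lookup (δ ⊕ c ⊗ δ) w ≡ true → (lookup δ v ∧ lookup δ w ≡ true) × lookup c v ≡ lookup c w
      removed δ c v w e rewrite lookup-⊕ δ (c ⊗ δ) v | lookup-⊕ δ (c ⊗ δ) w | lookup-⊗ c δ v | lookup-⊗ c δ w with ∧-parts {lookup δ v xor (lookup c v ∧ lookup δ v)} e
      ... | e₁ , e₂ with parts (lookup δ v) (lookup c v) e₁ | parts (lookup δ w) (lookup c w) e₂
        where parts : ∀ a b → a xor (b ∧ a) ≡ true → a ≡ true × b ≡ false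
              parts true false e = refl , refl
              parts true true  ()
              parts false false ()
              parts false true ()
      ... | a , b | a′ , b′ = cong₂ _∧_ a a′ , trans b (sym b′)

      next-δ : Vec Bool n → Vec Bool n → Vec Bool n → Vec Bool n
      next-δ u δ c = if f (u ⊕ c ⊗ δ) xor f u then c ⊗ δ else δ ⊕ c ⊗ δ

      next-pair : ∀ u δ c v w → pair (next-δ u δ c) v w ≤ pair δ v w * fromBit (not (lookup c v xor lookup c w))
      next-pair u δ c v w with f (u ⊕ c ⊗ δ) xor f u
      ... | true  = pair-≤ δ (c ⊗ δ) c v w (kept δ c v w)
      ... | false = pair-≤ δ (δ ⊕ c ⊗ δ) c v w (removed δ c v w)

      pair-half : ∀ δ v w → 2 * sumV n (λ c → pair δ v w * fromBit (not (lookup c v xor lookup c w))) ≤ 2 ^ n * pair δ v w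
      pair-half δ v w with v ≟ w
      ... | yes _ = ≤-trans (≤-reflexive (cong (2 *_) (trans (sumV-const n 0) (*-zeroʳ (2 ^ n))))) z≤n
      ... | no ne = ≤-reflexive (trans (cong (2 *_) (sumV-* n (fromBit (lookup δ v ∧ lookup δ w)) (λ c → fromBit (not (lookup c v xor lookup c w)))))
          (trans (swap 2 (fromBit (lookup δ v ∧ lookup δ w)) (cnt n (λ c → not (lookup c v xor lookup c w)))) (cong (_* fromBit (lookup δ v ∧ lookup δ w)) (coordinates-agree v w ne))))
        where swap : ∀ a b c → a * (b * c) ≡ a * c * b
              swap = solve-∀

    -- Whichever half is kept, a pair survives only if c gives both variables the same bit, which
    -- happens for exactly half of all c.
    Φ-halves : ∀ u δ → 2 * sumV n (λ c → Φ (next-δ u δ c)) ≤ 2 ^ n * Φ δ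
    Φ-halves u δ = begin
      2 * sumV n (λ c → Φ (next-δ u δ c))
        ≤⟨ *-monoʳ-≤ 2 (sumV-mono n (λ c → sumL-mono V (λ v → sumL-mono V (λ w → next-pair u δ c v w)))) ⟩
      2 * sumV n (λ c → sumL V λ v → sumL V λ w → term c v w)
        ≡⟨ cong (2 *_) (trans (sumV-sumL n V (λ c v → sumL V (term c v))) (sumL-cong V (λ v → sumV-sumL n V (λ c w → term c v w)))) ⟩
      2 * (sumL V λ v → sumL V λ w → sumV n λ c → term c v w)
        ≡⟨ trans (sym (sumL-* V 2 _)) (sumL-cong V (λ v → sym (sumL-* V 2 _))) ⟩
      (sumL V λ v → sumL V λ w → 2 * sumV n λ c → term c v w)
        ≤⟨ sumL-mono V (λ v → sumL-mono V (pair-half δ v)) ⟩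
      (sumL V λ v → sumL V λ w → 2 ^ n * pair δ v w)
        ≡⟨ trans (sumL-cong V (λ v → sumL-* V (2 ^ n) (pair δ v))) (sumL-* V (2 ^ n) _) ⟩
      2 ^ n * Φ δ ∎
      where
      open ≤-Reasoning
      term : Vec Bool n → Fin n → Fin n → ℕ
      term c v w = pair δ v w * fromBit (not (lookup c v xor lookup c w))
      sumL-cong : ∀ (vs : List (Fin n)) {φ ψ : Fin n → ℕ} → (∀ v → φ v ≡ ψ v) → sumL vs φ ≡ sumL vs ψ
      sumL-cong []       h = refl
      sumL-cong (v ∷ vs) h = cong₂ _+_ (h v) (sumL-cong vs h)

    Φ-bound : ∀ δ → Φ δ ≤ s * s
    Φ-bound δ = ≤-trans (sumL-const≤ V (λ v → sumL-const≤ V (λ w → pair≤1 v w))) (*-mono-≤ V≤s (≤-trans (≤-reflexive (*-identityʳ _)) V≤s))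
      where
      V≤s : length V ≤ s
      V≤s = ≤-trans (n≤1+n _) (≤-trans (≤-reflexive (length-variables tree)) size≤s)
      pair≤1 : ∀ v w → pair δ v w ≤ 1
      pair≤1 v w with v ≟ w
      ... | yes _ = z≤n
      ... | no _  = bit≤1 (lookup δ v ∧ lookup δ w)

    Disjoint : Vec Bool n → Vec Bool n → Set
    Disjoint B δ = ∀ i → lookup B i ≡ true → lookup δ i ≡ false

    private
      conversion : ∀ S φ T P Q β → 2 * S ≤ T * φ → (2 * P * Q) * (S * Q + T * (P * β)) ≤ (φ * Q + 2 * P * β) * (T * (P * Q))
      conversion S φ T P Q β h = begin
        (2 * P * Q) * (S * Q + T * (P * β))               ≡⟨ left S T P Q β ⟩
        P * Q * Q * (2 * S) + 2 * P * β * (T * (P * Q))   ≤⟨ +-monoˡ-≤ _ (*-monoʳ-≤ (P * Q * Q) h) ⟩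
        P * Q * Q * (T * φ) + 2 * P * β * (T * (P * Q))   ≡⟨ right φ T P Q β ⟩
        (φ * Q + 2 * P * β) * (T * (P * Q))               ∎
        where
        open ≤-Reasoning
        left : ∀ S T P Q β → (2 * P * Q) * (S * Q + T * (P * β)) ≡ P * Q * Q * (2 * S) + 2 * P * β * (T * (P * Q))
        left = solve-∀
        right : ∀ φ T P Q β → P * Q * Q * (T * φ) + 2 * P * β * (T * (P * Q)) ≡ (φ * Q + 2 * P * β) * (T * (P * Q))
        right = solve-∀

    -- Markov's inequality for the potential: a pair is left after i steps with probability at most
    -- Φ(δ) / 2^i, and otherwise the continuation applies.
    search-bound : ∀ B i u δ k β → Sensitive u δ → Disjoint B δ →
                   (∀ u δ → Sensitive u δ → Disjoint B δ → Φ δ ≡ 0 → Bd Q (k (u , δ)) β) →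
                   Bd (2 ^ i * Q) (iter searchStep i (u , δ) k) (Φ δ * Q + 2 ^ i * β)
    search-bound B zero u δ k β sens dis h with Φ δ in e
    ... | zero  = subst₂ (λ q c → Bd q (k (u , δ)) c) (sym (+-identityʳ Q)) (sym (+-identityʳ β)) (h u δ sens dis e)
    -- If a pair is left at the end, the numerator is already at least Q and the bound is trivial.
    ... | suc φ = bd-one (≤-trans (≤-reflexive (+-identityʳ Q)) (≤-trans (m≤m+n Q (φ * Q)) (m≤m+n _ _)))
    search-bound B (suc i) u δ k β sens dis h = bd-conv {2 ^ n * (2 ^ i * Q)} {2 * 2 ^ i * Q}
      (*-mono-< (m^n>0 2 n) (*-mono-< (m^n>0 2 i) 0<Q))
      (conversion (sumV n (λ c → Φ (next-δ u δ c))) (Φ δ) (2 ^ n) (2 ^ i) Q β (Φ-halves u δ))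
      (subst (Bd (2 ^ n * (2 ^ i * Q)) (searchStep i (u , δ) (λ y → iter searchStep i y k))) total-eq
        (bd-rand n (λ c → Φ (next-δ u δ c) * Q + 2 ^ i * β) point))
      where
      total-eq : sumV n (λ c → Φ (next-δ u δ c) * Q + 2 ^ i * β) ≡ sumV n (λ c → Φ (next-δ u δ c)) * Q + 2 ^ n * (2 ^ i * β)
      total-eq = trans (sumV-+ n _ _) (cong₂ _+_ (trans (sumV-cong n (λ c → *-comm (Φ (next-δ u δ c)) Q)) (trans (sumV-* n Q _) (*-comm Q _))) (sumV-const n (2 ^ i * β)))
      xor-comm′ : ∀ {a b} → a xor b ≡ true → b xor a ≡ true
      xor-comm′ {true}  {false} e = refl
      xor-comm′ {false} {true}  e = refl
      point : ∀ c → Bd (2 ^ i * Q) (if f (u ⊕ c ⊗ δ) xor f u then iter searchStep i (u , c ⊗ δ) k else iter searchStep i (u ⊕ c ⊗ δ , δ ⊕ c ⊗ δ) k)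
                       (Φ (next-δ u δ c) * Q + 2 ^ i * β)
      point c with f (u ⊕ c ⊗ δ) xor f u in e
      ... | true = search-bound B i u (c ⊗ δ) k β (xor-comm′ {f (u ⊕ c ⊗ δ)} e)
          (λ j eb → trans (lookup-⊗ c δ j) (trans (cong (lookup c j ∧_) (dis j eb)) (∧-zeroʳ _))) h
      ... | false = search-bound B i (u ⊕ c ⊗ δ) (δ ⊕ c ⊗ δ) k β (trans (cong₂ _xor_ (xor-false {f (u ⊕ c ⊗ δ)} e) (cong f endpoint)) sens)
          (λ j eb → trans (lookup-⊕ δ (c ⊗ δ) j) (trans (cong₂ _xor_ (dis j eb) (lookup-⊗ c δ j)) (trans (cong (lookup c j ∧_) (dis j eb)) (∧-zeroʳ _)))) h
        where
        endpoint : (u ⊕ c ⊗ δ) ⊕ (δ ⊕ c ⊗ δ) ≡ u ⊕ δ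
        endpoint = trans (⊕-assoc u (c ⊗ δ) (δ ⊕ c ⊗ δ)) (cong (u ⊕_) (trans (⊕-comm (c ⊗ δ) (δ ⊕ c ⊗ δ)) (⊕-cancel δ (c ⊗ δ))))

    literal-loop : ∀ {u δ v} → Reads u δ v → ∀ {q} i k β → Bd q (k tt) β → Bd q (iter (literalStep u δ) i tt k) β
    literal-loop {u} {δ} {v} rd {q} i k β h = bd-iter₀ (literalStep u δ) (λ _ _ → ⊤) stage i tt tt k β (λ _ _ → h)
      where
      stage : ∀ i x → ⊤ → ∀ k β → (∀ y → ⊤ → Bd q (k y) β) → Bd q (literalStep u δ i x k) β
      stage i _ _ k β h = bd-rand-const n λ x → bd-rand-const n λ y → bd-rand-const n λ z → go x y z
        where
        go : ∀ x y z → Bd q (if A u δ x y xor A u δ zeros y then ret false else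
                            (if A u δ z (x ⊗ y) xor (A u δ z x ∧ A u δ z y) then ret false else k tt)) β
        go x y z rewrite rd x y | rd zeros y | rd z (x ⊗ y) | rd z x | rd z y | xor-same (lookup y v) | lookup-⊗ x y v | xor-same (lookup x v ∧ lookup y v) = h tt tt

    -- Progress measure of the rounds: occurrences of tree variables not yet covered. Every new
    -- block contains an uncovered tree variable and so lowers it.
    remaining : Vec Bool n → ℕ
    remaining B = sumL V λ v → fromBit (not (lookup B v))

    record Valid (bl : Blocks) : Set where
      field
        literal : ∀ j → j < κ bl → Σ (Fin n) λ v → Reads (bu bl j) (bd bl j) v
        covered : ∀ v → v ∈ V → lookup (mask bl) v ≡ true → Σ ℕ λ j → j < κ bl × Reads (bu bl j) (bd bl j) v
    open Valid

    valid-append : ∀ {u δ bl v} → Valid bl → (∀ w → w ∈ V → lookup δ w ≡ true → w ≡ v) → Reads u δ v → Valid (append u δ bl)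
    valid-append {u} {δ} {bl} {v} val only rd = record { literal = lit′ ; covered = cov′ }
      where
      new : Reads (bu (append u δ bl) (κ bl)) (bd (append u δ bl) (κ bl)) v
      new rewrite ≡ᵇ-refl (κ bl) = rd
      old : ∀ {j w} → j < κ bl → Reads (bu bl j) (bd bl j) w → Reads (bu (append u δ bl) j) (bd (append u δ bl) j) w
      old l r rewrite ≡ᵇ-≢ (<⇒≢ l) = r
      lit′ : ∀ j → j < suc (κ bl) → Σ (Fin n) λ w → Reads (bu (append u δ bl) j) (bd (append u δ bl) j) w
      lit′ j l with m≤n⇒m<n∨m≡n (≤-pred l)
      ... | inj₂ refl = v , new
      ... | inj₁ l′ with literal val j l′
      ...   | w , r = w , old {j} {w} l′ r
      cov′ : ∀ w → w ∈ V → lookup (mask bl ⊕ δ) w ≡ true → Σ ℕ λ j → j < suc (κ bl) × Reads (bu (append u δ bl) j) (bd (append u δ bl) j) w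
      cov′ w p e with lookup (mask bl) w in em | trans (sym (lookup-⊕ (mask bl) δ w)) e
      ... | false | eδ = κ bl , ≤-refl , subst (Reads (bu (append u δ bl) (κ bl)) (bd (append u δ bl) (κ bl))) (sym (only w p eδ)) new
      ... | true  | _ with covered val w p em
      ...   | j , l , r = j , m<n⇒m<1+n l , old {j} {w} l r

    remaining-< : ∀ B δ v → Disjoint B δ → v ∈ V → lookup δ v ≡ true → remaining (B ⊕ δ) < remaining B
    remaining-< B δ v dis p e = sumL-< V all-≤ p strict
      where
      at : ∀ w → fromBit (not (lookup (B ⊕ δ) w)) ≡ fromBit (not (lookup B w xor lookup δ w))
      at w = cong (λ b → fromBit (not b)) (lookup-⊕ B δ w)
      all-≤ : ∀ w → fromBit (not (lookup (B ⊕ δ) w)) ≤ fromBit (not (lookup B w))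
      all-≤ w rewrite at w with lookup B w in eB
      ... | true rewrite dis w eB = z≤n
      ... | false = bit≤1 _
      strict : fromBit (not (lookup (B ⊕ δ) v)) < fromBit (not (lookup B v))
      strict rewrite at v with lookup B v in eB
      ... | false rewrite e = ≤-refl
      ... | true with trans (sym e) (dis v eB)
      ...   | ()

    newBlock-bound : ∀ bl x k β → Valid bl → f x xor f (x ⊗ mask bl) ≡ true →
                     (∀ u δ → Valid (append u δ bl) → remaining (mask bl ⊕ δ) < remaining (mask bl) → Bd Q (k (append u δ bl)) β) →
                     Bd Q (newBlock bl x k) (1 + β)
    newBlock-bound bl x k β val bad h = bd-unscale (2 ^ R) (m^n>0 2 R) (bd-mono total-≤
      (search-bound (mask bl) R x (x ⊕ x ⊗ mask bl) (λ y → testBlock bl y k) β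
        (trans (cong (λ y → f x xor f y) (trans (sym (⊕-assoc x x (x ⊗ mask bl))) (trans (cong (_⊕ (x ⊗ mask bl)) (⊕-self x)) (zeros-⊕ _)))) bad)
        (λ i e → trans (lookup-⊕ x (x ⊗ mask bl) i) (trans (cong (lookup x i xor_) (trans (lookup-⊗ x (mask bl) i) (trans (cong (lookup x i ∧_) e) (∧-identityʳ _)))) (xor-same (lookup x i))))
        after))
      where
      after : ∀ u δ → Sensitive u δ → Disjoint (mask bl) δ → Φ δ ≡ 0 → Bd Q (testBlock bl (u , δ) k) β
      after u δ sens dis e with reads u δ sens e
      ... | v , p , ev , rd = literal-loop {u} {δ} {v} rd R (λ _ → k (append u δ bl)) β
        (h u δ (valid-append {u} {δ} {bl} {v} val (λ w pw ew → unique δ e p pw ev ew) rd) (remaining-< (mask bl) δ v dis p ev))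
      total-≤ : Φ (x ⊕ x ⊗ mask bl) * Q + 2 ^ R * β ≤ 2 ^ R * (1 + β)
      total-≤ = ≤-trans (+-monoˡ-≤ (2 ^ R * β) (≤-trans (*-monoˡ-≤ Q (Φ-bound (x ⊕ x ⊗ mask bl))) search-small))
        (≤-reflexive (sym (*-suc (2 ^ R) β)))

    -- The tree restricted to the variables found, over the blocks.
    restrict : ∀ bl (t : Tree n) → (∀ v → v ∈ variables t → lookup (mask bl) v ≡ true → Σ ℕ λ j → j < κ bl × Reads (bu bl j) (bd bl j) v) →
               Σ (Tree (κ bl)) λ τ → depth τ ≤ depth t × size τ ≤ size t ×
                 (∀ x y → (∀ j → y j ≡ A (bu bl (toℕ j)) (bd bl (toℕ j)) zeros x) → evalBy τ y ≡ eval t (x ⊗ mask bl))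
    restrict bl (leaf b) cov = leaf b , z≤n , ≤-refl , λ _ _ _ → refl
    restrict bl (node i t₀ t₁) cov with restrict bl t₀ (λ v p → cov v (there (∈-++⁺ˡ p))) | lookup (mask bl) i in e
    ... | τ₀ , d₀ , s₀ , h₀ | false = τ₀ , m≤n⇒m≤1+n (≤-trans d₀ (m≤m⊔n _ _)) , ≤-trans s₀ (m≤m+n _ _) , λ x y hy → trans (h₀ x y hy) (sym (drop x))
      where
      drop : ∀ x → eval (node i t₀ t₁) (x ⊗ mask bl) ≡ eval t₀ (x ⊗ mask bl)
      drop x rewrite lookup-⊗ x (mask bl) i | e | ∧-zeroʳ (lookup x i) = refl
    ... | τ₀ , d₀ , s₀ , h₀ | true with restrict bl t₁ (λ v p → cov v (there (∈-++⁺ʳ (variables t₀) p))) | cov i (here refl) e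
    ...   | τ₁ , d₁ , s₁ , h₁ | j , l , rd = node (fromℕ< l) τ₀ τ₁ , s≤s (⊔-mono-≤ d₀ d₁) , +-mono-≤ s₀ s₁ , agree
      where
      agree : ∀ x y → (∀ j → y j ≡ A (bu bl (toℕ j)) (bd bl (toℕ j)) zeros x) → evalBy (node (fromℕ< l) τ₀ τ₁) y ≡ eval (node i t₀ t₁) (x ⊗ mask bl)
      agree x y hy = trans (cong₂ (λ c₁ c₂ → if y (fromℕ< l) then c₁ else c₂) (h₁ x y hy) (h₀ x y hy))
        (cong (λ c → if c then eval t₁ (x ⊗ mask bl) else eval t₀ (x ⊗ mask bl)) bit)
        where
        bit : y (fromℕ< l) ≡ lookup (x ⊗ mask bl) i
        bit = trans (hy (fromℕ< l)) (trans (cong (λ j → A (bu bl j) (bd bl j) zeros x) (toℕ-fromℕ< l))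
          (trans (rd zeros x) (sym (trans (lookup-⊗ x (mask bl) i) (trans (cong (lookup x i ∧_) e) (∧-identityʳ _))))))

    module _ (bl : Blocks) (val : Valid bl) where

      evalBit-bound : ∀ j → j < κ bl → ∀ x {q} k β → Bd q (k (A (bu bl j) (bd bl j) zeros x)) β → Bd q (evalBit (bu bl j) (bd bl j) x k) β
      evalBit-bound j l x {q} k β h with literal val j l
      ... | v , rd = bd-rand-const n go
        where
        u = bu bl j
        δ = bd bl j
        same : ∀ z → A u δ z x ≡ A u δ zeros x
        same z = trans (rd z x) (sym (rd zeros x))
        go : ∀ z → Bd q (iter (recheck u δ x (A u δ z x)) R tt λ _ → k (A u δ z x)) β
        go z = bd-iter₀ (recheck u δ x (A u δ z x)) (λ _ _ → ⊤) stage R tt tt (λ _ → k (A u δ z x)) β (λ _ _ → subst (λ y → Bd q (k y) β) (sym (same z)) h)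
          where
          stage : ∀ i w → ⊤ → ∀ k β → (∀ y → ⊤ → Bd q (k y) β) → Bd q (recheck u δ x (A u δ z x) i w k) β
          stage i _ _ k β h = bd-rand-const n λ z′ → step′ z′
            where
            step′ : ∀ z′ → Bd q (if A u δ z′ x xor A u δ z x then ret false else k tt) β
            step′ z′ rewrite trans (same z′) (sym (same z)) | xor-same (A u δ z x) = h tt tt

      module _ (xs : List (Vec Bool n)) where

        value : ℕ → ℕ → Bool
        value t j = A (bu bl j) (bd bl j) zeros (nth xs t)

        Correct : ℕ → Matrix → Set
        Correct i Y = ∀ t j → j < κ bl → i ≤ t → t < m → Y t j ≡ value t j

        CorrectRow : ℕ → ℕ → Matrix → Set
        CorrectRow t i Y = Correct (suc t) Y × (∀ j → j < κ bl → i ≤ j → Y t j ≡ value t j) × i ≤ κ bl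

        private
          update-same : ∀ t j v Y → update t j v Y t j ≡ v
          update-same t j v Y rewrite ≡ᵇ-refl t | ≡ᵇ-refl j = refl

          update-row : ∀ t j v Y {t′} j′ → t′ ≢ t → update t j v Y t′ j′ ≡ Y t′ j′
          update-row t j v Y {t′} j′ ne rewrite ≡ᵇ-≢ ne = refl

          update-col : ∀ t j v Y {j′} → j′ ≢ j → update t j v Y t j′ ≡ Y t j′
          update-col t j v Y {j′} ne rewrite ≡ᵇ-refl t | ≡ᵇ-≢ ne = refl

        row-bound : ∀ t → t < m → ∀ Y → Correct (suc t) Y → ∀ {q} k β → (∀ Y′ → Correct t Y′ → Bd q (k Y′) β) → Bd q (evalAll bl xs t Y k) β
        row-bound t t<m Y c {q} k β h = bd-iter₀ (evalRow bl xs t) (CorrectRow t) stage (κ bl) Y (c , (λ j l l′ → ⊥-elim (<⇒≱ l l′)) , ≤-refl) k β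
            (λ Y′ (c′ , r , _) → h Y′ (λ t′ j l le t′<m → case-row Y′ c′ r t′ j l le t′<m))
          where
          case-row : ∀ Y′ → Correct (suc t) Y′ → (∀ j → j < κ bl → 0 ≤ j → Y′ t j ≡ value t j) → ∀ t′ j → j < κ bl → t ≤ t′ → t′ < m → Y′ t′ j ≡ value t′ j
          case-row Y′ c′ r t′ j l le t′<m with m≤n⇒m<n∨m≡n le
          ... | inj₁ lt   = c′ t′ j l lt t′<m
          ... | inj₂ refl = r j l z≤n
          stage : ∀ j Y → CorrectRow t (suc j) Y → ∀ k β → (∀ Y′ → CorrectRow t j Y′ → Bd q (k Y′) β) → Bd q (evalRow bl xs t j Y k) β
          stage j Y (c , r , j<κ) k β h = evalBit-bound j j<κ (nth xs t) (λ v → k (update t j v Y)) β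
            (h _ ((λ t′ j′ l le t′<m → trans (update-row t j _ Y j′ (>⇒≢ le)) (c t′ j′ l le t′<m)) , row , <⇒≤ j<κ))
            where
            row : ∀ j′ → j′ < κ bl → j ≤ j′ → update t j (value t j) Y t j′ ≡ value t j′
            row j′ l le with m≤n⇒m<n∨m≡n le
            ... | inj₁ lt   = trans (update-col t j _ Y (>⇒≢ lt)) (r j′ l lt)
            ... | inj₂ refl = update-same t j _ Y

        -- The tree with uncovered variables set to 0, rewritten over the blocks, computes f(x ⊗
        -- `mask`), which equals the label on a batch without a witness.
        decide-accepts : (∀ t → t < m → f (nth xs t) ≡ f (nth xs t ⊗ mask bl)) → ∀ Y → Correct 0 Y →
                         MinSize.minSize Y (λ t → f (nth xs t)) m (κ bl) s d [] ≤ s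
        decide-accepts agree Y c with restrict bl tree (covered val)
        ... | τ , dτ , sτ , h = ≤-trans (MinTree.minSize-minimal Y (λ t → f (nth xs t)) m (κ bl) s d [] τ (≤-trans dτ depth≤d)
              (λ t t<m _ → trans (h (nth xs t) _ (λ j → c t (toℕ j) (toℕ<n j) z≤n t<m)) (trans (computes _) (sym (agree t t<m))))) (≤-trans sτ size≤s)

        final-bound : (∀ t → t < m → f (nth xs t) ≡ f (nth xs t ⊗ mask bl)) → ∀ {q β} → Bd q (final bl xs) β
        final-bound agree {q} {β} = bd-iter₀ (evalAll bl xs) (λ i Y → Correct i Y × i ≤ m)
          (λ t Y (c , t<m) k β h → row-bound t t<m Y c k β (λ Y′ c′ → h Y′ (c′ , <⇒≤ t<m)))
          m (λ _ _ → false) ((λ t j l le lt → ⊥-elim (<⇒≱ lt le)) , ≤-refl) (decide bl xs) β (λ Y (c , _) → accept Y c)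
          where
          accept : ∀ Y → Correct 0 Y → Bd q (decide bl xs Y) β
          accept Y c with MinSize.minSize Y (λ t → f (nth xs t)) m (κ bl) s d [] ≤ᵇ s in e
          ... | true  = bd-ret refl
          ... | false = ⊥-elim (subst T e (≤⇒≤ᵇ (decide-accepts agree Y c)))

    BatchOK : Vec Bool n → ℕ → Batch → Set
    BatchOK B t (xs , nothing) = ∀ i → i < length xs → f (nth xs i) ≡ f (nth xs i ⊗ B)
    BatchOK B t (xs , just x)  = f x xor f (x ⊗ B) ≡ true

    BatchInv : Vec Bool n → ℕ → Batch → Set
    BatchInv B t y = BatchOK B t y × t + length (proj₁ y) ≡ m

    batch-stage : ∀ {q} B t y → BatchInv B (suc t) y → ∀ k β → (∀ y′ → BatchInv B t y′ → Bd q (k y′) β) → Bd q (batchStep B t y k) β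
    batch-stage {q} B t (xs , bad) (ok , len) k β h = bd-draw-const go
      where
      len′ : t + suc (length xs) ≡ m
      len′ = trans (+-suc t (length xs)) len
      keep-ok : ∀ x bad → f x ≡ f (x ⊗ B) → BatchOK B (suc t) (xs , bad) → BatchOK B t (x ∷ xs , bad)
      keep-ok x nothing  e ok zero    l = e
      keep-ok x nothing  e ok (suc i) (s≤s l) = ok i l
      keep-ok x (just _) e ok = ok
      go : ∀ x → Bd q (if f x xor f (x ⊗ B) then k (x ∷ xs , just x) else k (x ∷ xs , bad)) β
      go x with f x xor f (x ⊗ B) in e
      ... | true  = h (x ∷ xs , just x) (e , len′)
      ... | false = h (x ∷ xs , bad) (keep-ok x bad (xor-false e) ok , len′)

    rounds-bound : ∀ r bl → Valid bl → remaining (mask bl) < r → Bd Q (rounds r bl finish) (r * 1)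
    rounds-bound zero    bl val ()
    rounds-bound (suc r) bl val rem = bd-iter₀ (batchStep (mask bl)) (BatchInv (mask bl)) (batch-stage (mask bl)) m ([] , nothing) ((λ i ()) , +-identityʳ m)
      (λ y → afterBatch bl y (λ o → continue r bl o finish)) (suc r * 1) point
      where
      point : ∀ y → BatchInv (mask bl) 0 y → Bd Q (afterBatch bl y (λ o → continue r bl o finish)) (suc r * 1)
      point (xs , nothing) (ok , len) = final-bound bl val xs (λ t t<m → ok t (subst (t <_) (sym len) t<m))
      point (xs , just x) (bad , _) = newBlock-bound bl x (λ b′ → rounds r b′ finish) (r * 1) val bad
        (λ u δ val′ less → rounds-bound r (append u δ bl) val′ (<-≤-trans less (≤-pred rem)))

    -- A tree has one internal node fewer than leaves, so fewer than s occurrences remain at the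
    -- start. This strict inequality leaves one round for the final batch without a witness.
    tester-bound : Bd Q tester (s * 1)
    tester-bound = rounds-bound s noBlocks (record { literal = λ j () ; covered = λ v p e → ⊥-elim (none v e) })
      (≤-trans (s≤s (≤-trans (sumL-const≤ V (λ v → bit≤1 _)) (≤-reflexive (*-identityʳ _)))) (≤-trans (≤-reflexive (length-variables tree)) size≤s))
      where
      none : ∀ v → lookup (zeros {n}) v ≢ true
      none v e with trans (sym e) (lookup-replicate v false)
      ... | ()

-- Estimates for the parameters

module ParameterEstimates where

  open TesterCode using (bits; module Parameters; searchTime)
  open import Data.Nat
  open import Data.Nat.DivMod using (_/_; _%_; m/n*n≤m; m%n<n; m≡m%n+[m/n]*n; m≥n⇒m/n>0)
  open import Data.Nat.Logarithm using (⌈log₂_⌉; ⌈log₂⌉-mono-≤; ⌈log₂2*n⌉≡1+⌈log₂n⌉; ⌈log₂2^n⌉≡n)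
  open import Data.Nat.Properties
  open import Data.Nat.Tactic.RingSolver using (solve-∀)
  import Relation.Nullary

  ^-pos : ∀ x k → 0 < x → 0 < x ^ k
  ^-pos x k l = m^n>0 x {{>-nonZero l}} k

  -- (1 - 1/N)^N ≤ 1/2.
  private
    bernoulli : ∀ x k → x ^ suc k + suc k * x ^ k ≤ suc x ^ suc k
    bernoulli x zero    = ≤-reflexive (arith x)
      where arith : ∀ x → x * 1 + 1 * 1 ≡ 1 * 1 + x * 1
            arith = solve-∀
    bernoulli x (suc k) = begin
      x * x ^ suc k + suc (suc k) * x ^ suc k               ≡⟨ left x (x ^ suc k) k ⟩
      x * x ^ suc k + x ^ suc k + suc k * x ^ suc k         ≡⟨ cong (λ u → x * x ^ suc k + x ^ suc k + u) (right x (x ^ k) k) ⟩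
      x * x ^ suc k + x ^ suc k + x * (suc k * x ^ k)       ≤⟨ m≤m+n _ (suc k * x ^ k) ⟩
      x * x ^ suc k + x ^ suc k + x * (suc k * x ^ k) + suc k * x ^ k ≡⟨ factor x (x ^ suc k) (suc k * x ^ k) ⟩
      suc x * (x ^ suc k + suc k * x ^ k)                   ≤⟨ *-monoʳ-≤ (suc x) (bernoulli x k) ⟩
      suc x * suc x ^ suc k                                 ∎
      where
      open ≤-Reasoning
      left : ∀ x p k → x * p + suc (suc k) * p ≡ x * p + p + suc k * p
      left = solve-∀
      right : ∀ x p k → suc k * (x * p) ≡ x * (suc k * p)
      right = solve-∀
      factor : ∀ x p r → x * p + p + x * r + r ≡ suc x * (p + r)
      factor = solve-∀

  halving : ∀ x → 2 * x ^ suc x ≤ suc x ^ suc x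
  halving x = ≤-trans (≤-trans (≤-reflexive (cong (x ^ suc x +_) (+-identityʳ _))) (+-monoʳ-≤ (x ^ suc x) (*-monoˡ-≤ (x ^ x) (n≤1+n x)))) (bernoulli x x)

  ^-distrib : ∀ x y k → (x * y) ^ k ≡ x ^ k * y ^ k
  ^-distrib x y zero    = refl
  ^-distrib x y (suc k) = trans (cong (x * y *_) (^-distrib x y k)) (arith x y (x ^ k) (y ^ k))
    where arith : ∀ x y p q → x * y * (p * q) ≡ x * p * (y * q)
          arith = solve-∀

  -- If 2 x^e ≤ y^e then 2^k x^(e k) ≤ y^(e k).
  amplify : ∀ x y e k → 2 * x ^ e ≤ y ^ e → 2 ^ k * x ^ (e * k) ≤ y ^ (e * k)
  amplify x y e k h = begin
    2 ^ k * x ^ (e * k)     ≡⟨ cong (2 ^ k *_) (sym (^-*-assoc x e k)) ⟩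
    2 ^ k * (x ^ e) ^ k     ≡⟨ sym (^-distrib 2 (x ^ e) k) ⟩
    (2 * x ^ e) ^ k         ≤⟨ ^-monoˡ-≤ k h ⟩
    (y ^ e) ^ k             ≡⟨ ^-*-assoc y e k ⟩
    y ^ (e * k)             ∎
    where open ≤-Reasoning

  bits-lower : ∀ g x → x ≤ g → x < 2 ^ bits g x
  bits-lower zero    zero    l = ≤-refl
  bits-lower (suc g) zero    l = ≤-refl
  bits-lower (suc g) (suc x) (s≤s l) = begin-strict
    suc x                                 ≡⟨ m≡m%n+[m/n]*n (suc x) 2 ⟩
    suc x % 2 + suc x / 2 * 2             <⟨ +-monoˡ-< _ (m%n<n (suc x) 2) ⟩
    2 + suc x / 2 * 2                     ≡⟨ *-comm (suc (suc x / 2)) 2 ⟩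
    2 * suc (suc x / 2)                   ≤⟨ *-monoʳ-≤ 2 (bits-lower g (suc x / 2) (half≤ x g l)) ⟩
    2 * 2 ^ bits g (suc x / 2)            ∎
    where
    open ≤-Reasoning
    half≤ : ∀ x g → x ≤ g → suc x / 2 ≤ g
    half≤ x g l = ≤-trans (≤-pred (m/n<m′ x)) l
      where open import Data.Nat.DivMod using (m/n<m)
            m/n<m′ : ∀ x → suc x / 2 < suc x
            m/n<m′ x = m/n<m (suc x) 2 ≤-refl

  bits-upper : ∀ g x → 0 < x → 2 ^ bits g x ≤ 2 * x
  bits-upper zero    x       l = ≤-trans l (m≤n*m x 2)
  bits-upper (suc g) (suc x) l with suc x / 2 in e
  ... | zero  = ≤-trans (≤-reflexive (cong (2 *_) (one g))) (*-monoʳ-≤ 2 (s≤s z≤n))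
    where one : ∀ g → 2 ^ bits g 0 ≡ 1
          one zero    = refl
          one (suc g) = refl
  ... | suc h = *-monoʳ-≤ 2 (≤-trans (bits-upper g (suc h) (s≤s z≤n)) (subst (λ u → 2 * u ≤ suc x) e (≤-trans (≤-reflexive (*-comm 2 (suc x / 2))) (m/n*n≤m (suc x) 2))))

  bits≤ : ∀ g x → bits g x ≤ g
  bits≤ zero    x       = z≤n
  bits≤ (suc g) zero    = z≤n
  bits≤ (suc g) (suc x) = s≤s (bits≤ g (quotient (suc x) 2))

  2^≥ : ∀ k → k ≤ 2 ^ k
  2^≥ k = <⇒≤ (n<2^n k)
    where n<2^n : ∀ k → k < 2 ^ k
          n<2^n zero    = ≤-refl
          n<2^n (suc k) = ≤-trans (+-mono-≤ (m^n>0 2 k) (n<2^n k)) (≤-reflexive (cong (2 ^ k +_) (sym (+-identityʳ (2 ^ k)))))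

  module Bounds {s a b : ℕ} (1≤s : 1 ≤ s) (0<a : 0 < a) (a<b : a < b) where

    open Parameters s a b

    -- The integer part of 1/ε. Error estimates use N = k₀ + 1, which is at least 1/ε, while
    -- resource bounds use k₀, which is at most 1/ε; the two differ by at most a factor 2.
    k₀ : ℕ
    k₀ = quotient b a

    private
      quotient-≡ : ∀ b a .{{_ : NonZero a}} → quotient b a ≡ b / a
      quotient-≡ b (suc a) = refl

      instance
        nza : NonZero a
        nza = >-nonZero 0<a

    k₀a≤b : k₀ * a ≤ b
    k₀a≤b = ≤-trans (≤-reflexive (cong (_* a) (quotient-≡ b a))) (m/n*n≤m b a)

    1≤k₀ : 1 ≤ k₀
    1≤k₀ = subst (1 ≤_) (sym (quotient-≡ b a)) (m≥n⇒m/n>0 {b} {a} (<⇒≤ a<b))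

    k₀≤b : k₀ ≤ b
    k₀≤b = ≤-trans (m≤m*n k₀ a) k₀a≤b

    b≤Na : b ≤ N * a
    b≤Na = begin
      b                     ≡⟨ m≡m%n+[m/n]*n b a ⟩
      b % a + b / a * a     ≤⟨ +-monoˡ-≤ _ (<⇒≤ (m%n<n b a)) ⟩
      a + b / a * a         ≡⟨ cong (λ u → a + u * a) (sym (quotient-≡ b a)) ⟩
      N * a                 ∎
      where open ≤-Reasoning

    N≤2k₀ : N ≤ 2 * k₀
    N≤2k₀ = ≤-trans (+-monoˡ-≤ k₀ 1≤k₀) (≤-reflexive (cong (k₀ +_) (sym (+-identityʳ k₀))))

    2≤N : 2 ≤ N
    2≤N = s≤s 1≤k₀

    -- The power of two with q < P ≤ 2q, against which all polynomial quantities are measured.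
    -- Powers of 2 with exponents linear in λ₀ become powers of P.
    P : ℕ
    P = 2 ^ λ₀

    q<P : q < P
    q<P = bits-lower q q ≤-refl

    1≤s² : 1 ≤ s * s
    1≤s² = *-mono-≤ 1≤s 1≤s

    N≤q : N ≤ q
    N≤q = m≤n*m N (s * s) {{>-nonZero 1≤s²}}

    s≤s² : s ≤ s * s
    s≤s² = m≤m*n s s {{>-nonZero 1≤s}}

    s≤q : s ≤ q
    s≤q = ≤-trans s≤s² (m≤m*n (s * s) N)

    1≤q : 1 ≤ q
    1≤q = ≤-trans 1≤s s≤q

    P≤2q : P ≤ 2 * q
    P≤2q = bits-upper q q 1≤q

    s≤P : s ≤ P
    s≤P = ≤-trans s≤q (<⇒≤ q<P)

    λ≤P : λ₀ ≤ P
    λ≤P = 2^≥ λ₀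

    2≤λ : 2 ≤ λ₀
    2≤λ with 2 ≤? λ₀
    ... | Relation.Nullary.yes h = h
    ... | Relation.Nullary.no h = ⊥-elim (<⇒≱ (≤-<-trans (≤-trans 2≤N N≤q) q<P) (^-monoʳ-≤ 2 (≤-pred (≰⇒> h))))

    1≤λ : 1 ≤ λ₀
    1≤λ = ≤-trans (n≤1+n 1) 2≤λ

    4≤P : 4 ≤ P
    4≤P = ^-monoʳ-≤ 2 2≤λ

    ms≡ : m * s ≡ 7 * λ₀ * q
    ms≡ = arith λ₀ s N
      where arith : ∀ l s N → l * 7 * s * N * s ≡ 7 * l * (s * s * N)
            arith = solve-∀

    1≤ms : 1 ≤ m * s
    1≤ms = subst (1 ≤_) (sym ms≡) (*-mono-≤ {1} {7 * λ₀} (≤-trans 1≤λ (m≤n*m λ₀ 7)) 1≤q)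

    private
      P-sum : ∀ i j → P ^ i * P ^ j ≡ P ^ (i + j)
      P-sum i j = sym (^-distribˡ-+-* P i j)

      16≤P² : 16 ≤ P ^ 2
      16≤P² = ^-monoˡ-≤ 2 4≤P

    ms≤ : m * s ≤ P ^ 4
    ms≤ = begin
      m * s              ≡⟨ ms≡ ⟩
      7 * λ₀ * q         ≤⟨ *-mono-≤ (*-mono-≤ (≤-trans (m≤m+n 7 9) 16≤P²) λ≤P) (<⇒≤ q<P) ⟩
      P ^ 2 * P * P      ≡⟨ arith P ⟩
      P ^ 4              ∎
      where open ≤-Reasoning
            arith : ∀ P → P * (P * 1) * P * P ≡ P * (P * (P * (P * 1)))
            arith = solve-∀

    9s≤ : 9 * s ≤ P ^ 3
    9s≤ = ≤-trans (*-mono-≤ (≤-trans (m≤m+n 9 7) 16≤P²) s≤P) (≤-reflexive (arith P))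
      where arith : ∀ P → P * (P * 1) * P ≡ P * (P * (P * 1))
            arith = solve-∀

    R≡ : R ≡ λ₀ * 96
    R≡ = sym (*-distribˡ-+ λ₀ 48 48)

    P^≤2^R : ∀ i → i ≤ 96 → P ^ i ≤ 2 ^ R
    P^≤2^R i l = ≤-trans (≤-reflexive (^-*-assoc 2 λ₀ i)) (^-monoʳ-≤ 2 (≤-trans (*-monoʳ-≤ λ₀ l) (≤-reflexive (sym R≡))))

    -- Soundness loses 3 · m · s in each of s rounds, relative to Q; this choice makes the total
    -- exactly 1/3.
    Q : ℕ
    Q = 9 * s * (m * s)

    eval-small : Q ≤ 16 ^ R
    eval-small = ≤-trans (*-mono-≤ 9s≤ ms≤) (≤-trans (≤-reflexive (P-sum 3 4)) (≤-trans (P^≤2^R 7 (m≤m+n 7 89)) (^-monoˡ-≤ R (m≤m+n 2 14))))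

    search-small : s * s * (3 * s) ≤ 2 ^ R
    search-small = ≤-trans (*-mono-≤ (*-mono-≤ s≤P s≤P) (*-mono-≤ (≤-trans (m≤m+n 3 1) 4≤P) s≤P)) (≤-trans (≤-reflexive (arith P)) (P^≤2^R 4 (m≤m+n 4 92)))
      where arith : ∀ P → P * P * (P * P) ≡ P * (P * (P * (P * 1)))
            arith = solve-∀

    -- Since (31/32)^32 ≤ 1/2 and R = 32 · 3 λ₀, a bad block passes with probability at most 1/P³,
    -- and 9s ≤ P³.
    literal-small : Q * 31 ^ R ≤ m * s * 32 ^ R
    literal-small = begin
      9 * s * (m * s) * 31 ^ R         ≡⟨ arith (9 * s) (m * s) (31 ^ R) ⟩
      m * s * (9 * s * 31 ^ R)         ≤⟨ *-monoʳ-≤ (m * s) (≤-trans (*-monoˡ-≤ (31 ^ R) (≤-trans 9s≤ (≤-reflexive (^-*-assoc 2 λ₀ 3)))) amplified) ⟩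
      m * s * 32 ^ R                   ∎
      where
      open ≤-Reasoning
      arith : ∀ x y z → x * y * z ≡ y * (x * z)
      arith = solve-∀
      R≡′ : R ≡ 32 * (λ₀ * 3)
      R≡′ = trans R≡ (arith′ λ₀)
        where arith′ : ∀ l → l * 96 ≡ 32 * (l * 3)
              arith′ = solve-∀
      amplified : 2 ^ (λ₀ * 3) * 31 ^ R ≤ 32 ^ R
      amplified = subst (λ r → 2 ^ (λ₀ * 3) * 31 ^ r ≤ 32 ^ r) (sym R≡′) (amplify 31 32 32 (λ₀ * 3) (halving 31))

    M : ℕ
    M = λ₀ * 7 * s

    private
      -- As N · ε ≥ 1, the ratio 1 - ε is at most k₀ / (k₀ + 1), whose power N is at most 1/2 by
      -- `halving`.
      shrink : 2 * (b ∸ a) ^ N ≤ b ^ N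
      shrink = *-cancelʳ-≤ _ _ (N ^ N) {{>-nonZero (^-pos N N (s≤s z≤n))}} (begin
        2 * (b ∸ a) ^ N * N ^ N       ≡⟨ trans (*-assoc 2 ((b ∸ a) ^ N) (N ^ N)) (cong (2 *_) (sym (^-distrib (b ∸ a) N N))) ⟩
        2 * ((b ∸ a) * N) ^ N         ≤⟨ *-monoʳ-≤ 2 (^-monoˡ-≤ N le) ⟩
        2 * (k₀ * b) ^ N              ≡⟨ trans (cong (2 *_) (^-distrib k₀ b N)) (sym (*-assoc 2 (k₀ ^ N) (b ^ N))) ⟩
        2 * k₀ ^ N * b ^ N            ≤⟨ *-monoˡ-≤ (b ^ N) (halving k₀) ⟩
        N ^ N * b ^ N                 ≡⟨ *-comm (N ^ N) (b ^ N) ⟩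
        b ^ N * N ^ N                 ∎)
        where
        open ≤-Reasoning
        le : (b ∸ a) * N ≤ k₀ * b
        le = begin
          (b ∸ a) * N          ≡⟨ *-comm (b ∸ a) N ⟩
          N * (b ∸ a)          ≡⟨ *-distribˡ-∸ N b a ⟩
          N * b ∸ N * a        ≤⟨ ∸-monoʳ-≤ (N * b) b≤Na ⟩
          b + k₀ * b ∸ b       ≡⟨ m+n∸m≡n b (k₀ * b) ⟩
          k₀ * b               ∎

    -- The batch has m = N · M examples with M = 7 λ₀ s, so each tree survives with probability at
    -- most 2^(-M) = P^(-7s). Of these seven powers, three pay for 9s and four for the (2 + s)^(2s)
    -- trees.
    trees-small : Q * (2 + s) ^ (s + s) * (b ∸ a) ^ m ≤ m * s * b ^ m
    trees-small = begin
      9 * s * (m * s) * (2 + s) ^ (s + s) * (b ∸ a) ^ m    ≡⟨ arith (9 * s) (m * s) ((2 + s) ^ (s + s)) ((b ∸ a) ^ m) ⟩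
      m * s * (9 * s * (2 + s) ^ (s + s) * (b ∸ a) ^ m)    ≤⟨ *-monoʳ-≤ (m * s) (≤-trans (*-monoˡ-≤ ((b ∸ a) ^ m) number) shrunk) ⟩
      m * s * b ^ m                                        ∎
      where
      open ≤-Reasoning
      arith : ∀ x y z w → x * y * z * w ≡ y * (x * z * w)
      arith = solve-∀
      m≡ : m ≡ N * M
      m≡ = *-comm M N
      shrunk : 2 ^ M * (b ∸ a) ^ m ≤ b ^ m
      shrunk = subst (λ e → 2 ^ M * (b ∸ a) ^ e ≤ b ^ e) (sym m≡) (amplify (b ∸ a) b N M shrink)
      2+s≤ : 2 + s ≤ P ^ 2
      2+s≤ = ≤-trans (+-mono-≤ (≤-trans (m≤m+n 2 2) 4≤P) s≤P) (≤-trans (≤-reflexive (double P)) (≤-trans (*-monoˡ-≤ P (≤-trans (m≤m+n 2 2) 4≤P)) (≤-reflexive (square P))))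
        where double : ∀ P → P + P ≡ 2 * P
              double = solve-∀
              square : ∀ P → P * P ≡ P * (P * 1)
              square = solve-∀
      number : 9 * s * (2 + s) ^ (s + s) ≤ 2 ^ M
      number = begin
        9 * s * (2 + s) ^ (s + s)       ≤⟨ *-mono-≤ (≤-trans 9s≤ (^-monoʳ-≤ P {{>-nonZero (≤-trans (s≤s z≤n) 4≤P)}} (m≤m*n 3 s {{>-nonZero 1≤s}}))) (≤-trans (^-monoˡ-≤ (s + s) 2+s≤) (≤-reflexive (^-*-assoc P 2 (s + s)))) ⟩
        P ^ (3 * s) * P ^ (2 * (s + s)) ≡⟨ P-sum (3 * s) (2 * (s + s)) ⟩
        P ^ (3 * s + 2 * (s + s))       ≡⟨ trans (^-*-assoc 2 λ₀ _) (cong (2 ^_) (exponent λ₀ s)) ⟩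
        2 ^ M                           ∎
        where exponent : ∀ l s → l * (3 * s + 2 * (s + s)) ≡ l * 7 * s
              exponent = solve-∀

    -- The time of the search for a tree, with s - 1 blocks.
    private
      search-≤ : ∀ k M′ r l → 1 ≤ M′ → searchTime M′ k r l ≤ 656 * M′ * (1 + l) * (suc k ^ 3) ^ r
      search-≤ k M′ zero    l h = ≤-trans (bound M′ l h) (≤-reflexive (sym (*-identityʳ _)))
        where
        bound : ∀ M′ l → 1 ≤ M′ → 3 + (51 + ((1 + M′ * (148 + l * 111)) + 150)) ≤ 656 * M′ * (1 + l)
        bound M′ l h = begin
          3 + (51 + ((1 + M′ * (148 + l * 111)) + 150))  ≡⟨ e₁ M′ l ⟩
          205 * 1 + M′ * (148 + l * 111)                 ≤⟨ +-monoˡ-≤ _ (*-monoʳ-≤ 205 h) ⟩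
          205 * M′ + M′ * (148 + l * 111)                ≤⟨ m≤m+n _ (M′ * (303 + l * 545)) ⟩
          205 * M′ + M′ * (148 + l * 111) + M′ * (303 + l * 545) ≡⟨ e₂ M′ l ⟩
          656 * M′ * (1 + l)                             ∎
          where open ≤-Reasoning
                e₁ : ∀ M l → 3 + (51 + ((1 + M * (148 + l * 111)) + 150)) ≡ 205 * 1 + M * (148 + l * 111)
                e₁ = solve-∀
                e₂ : ∀ M l → 205 * M + M * (148 + l * 111) + M * (303 + l * 545) ≡ 656 * M * (1 + l)
                e₂ = solve-∀
      search-≤ k M′ (suc r) l h = begin
        3 + (51 + ((1 + M′ * (148 + l * 111)) + 150)) + (suc k * 303 + k * (t + (303 + t)))
          ≡⟨ e₁ M′ l k t ⟩
        (205 + 303 + 606 * k) * 1 + M′ * (148 + l * 111) + 2 * k * t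
          ≤⟨ +-mono-≤ (+-monoˡ-≤ _ (*-monoʳ-≤ (205 + 303 + 606 * k) h)) (*-monoʳ-≤ (2 * k) (≤-trans (search-≤ k M′ r (suc l) h) (*-monoˡ-≤ p (*-monoʳ-≤ (656 * M′) 2+l≤)))) ⟩
        (205 + 303 + 606 * k) * M′ + M′ * (148 + l * 111) + 2 * k * (656 * M′ * (2 * (1 + l)) * p)
          ≤⟨ m≤m+n _ (M′ * (50 * k + l * (545 + 656 * k))) ⟩
        (205 + 303 + 606 * k) * M′ + M′ * (148 + l * 111) + 2 * k * (656 * M′ * (2 * (1 + l)) * p) + M′ * (50 * k + l * (545 + 656 * k))
          ≡⟨ e₂ M′ l k p ⟩
        656 * M′ * (1 + l) * ((1 + k) * 1 + 4 * k * p)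
          ≤⟨ *-monoʳ-≤ (656 * M′ * (1 + l)) (+-monoˡ-≤ (4 * k * p) (*-monoʳ-≤ (1 + k) (^-pos (suc k ^ 3) r (^-pos (suc k) 3 (s≤s z≤n))))) ⟩
        656 * M′ * (1 + l) * ((1 + k) * p + 4 * k * p)
          ≡⟨ cong (656 * M′ * (1 + l) *_) (e₃ k p) ⟩
        656 * M′ * (1 + l) * ((1 + 5 * k) * p)
          ≤⟨ *-monoʳ-≤ (656 * M′ * (1 + l)) (*-monoˡ-≤ p (cube k)) ⟩
        656 * M′ * (1 + l) * (suc k ^ 3 * p) ∎
        where
        open ≤-Reasoning
        t = searchTime M′ k r (suc l)
        p = (suc k ^ 3) ^ r
        2+l≤ : 1 + suc l ≤ 2 * (1 + l)
        2+l≤ = ≤-trans (m≤m+n (1 + suc l) l) (≤-reflexive (arith l))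
          where arith : ∀ l → 1 + suc l + l ≡ 2 * (1 + l)
                arith = solve-∀
        cube : ∀ k → 1 + 5 * k ≤ suc k ^ 3
        cube zero    = ≤-refl
        cube (suc k) = ≤-trans (m≤m+n _ (k * k * k + 6 * k * k + 7 * k + 2)) (≤-reflexive (arith k))
          where arith : ∀ k → 1 + 5 * suc k + (k * k * k + 6 * k * k + 7 * k + 2) ≡ suc (suc k) * (suc (suc k) * (suc (suc k) * 1))
                arith = solve-∀
        e₁ : ∀ M l k t → 3 + (51 + ((1 + M * (148 + l * 111)) + 150)) + (suc k * 303 + k * (t + (303 + t))) ≡ (205 + 303 + 606 * k) * 1 + M * (148 + l * 111) + 2 * k * t
        e₁ = solve-∀
        e₂ : ∀ M l k p → (205 + 303 + 606 * k) * M + M * (148 + l * 111) + 2 * k * (656 * M * (2 * (1 + l)) * p) + M * (50 * k + l * (545 + 656 * k)) ≡ 656 * M * (1 + l) * ((1 + k) * 1 + 4 * k * p)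
        e₂ = solve-∀
        e₃ : ∀ k p → (1 + k) * p + 4 * k * p ≡ (1 + 5 * k) * p
        e₃ = solve-∀

    -- The common unit of all query and time bounds, λ₀² s² N.
    U : ℕ
    U = λ₀ * λ₀ * q

    λq≤U : λ₀ * q ≤ U
    λq≤U = *-monoˡ-≤ q (m≤m*n λ₀ λ₀ {{>-nonZero 1≤λ}})

    q≤U : q ≤ U
    q≤U = ≤-trans (m≤n*m q λ₀ {{>-nonZero 1≤λ}}) λq≤U

    1≤m : 1 ≤ m
    1≤m = *-mono-≤ {1} {λ₀ * 7 * s} (*-mono-≤ {1} {λ₀ * 7} (*-mono-≤ {1} {λ₀} {1} {7} 1≤λ (s≤s z≤n)) 1≤s) (s≤s z≤n)

    private
      product≤squares : ∀ x y → x * y ≤ x * x + y * y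
      product≤squares x y with ≤-total x y
      ... | inj₁ l = ≤-trans (*-monoˡ-≤ y l) (m≤n+m (y * y) (x * x))
      ... | inj₂ l = ≤-trans (*-monoʳ-≤ x l) (m≤m+n (x * x) (y * y))

    -- The factor λ₀ in m must not multiply s^O(d) / ε, so λ₀ · X is split into λ₀² + X²: the first
    -- part joins the unit U, the second raises s^(3d) to s^(6d). The leftover factor s is absorbed
    -- into s^d if d is positive; for d = 0 there is no power to split, and U alone suffices.
    search-time : ∀ d → searchTime m (s ∸ 1) d 0 ≤ U * 4592 + s ^ (7 * d) * k₀ * 9184
    search-time d = ≤-trans (search-≤ (s ∸ 1) m d 0 1≤m) (begin
      656 * m * 1 * (suc (s ∸ 1) ^ 3) ^ d   ≡⟨ cong₂ _*_ (*-identityʳ (656 * m)) (trans (cong (λ u → (u ^ 3) ^ d) (m+[n∸m]≡n 1≤s)) (^-*-assoc s 3 d)) ⟩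
      656 * m * s ^ (3 * d)                 ≡⟨ e₀ λ₀ s N (s ^ (3 * d)) ⟩
      s * N * (λ₀ * s ^ (3 * d)) * 4592     ≤⟨ *-monoˡ-≤ 4592 (main d) ⟩
      (U + 2 * (s ^ (7 * d) * k₀)) * 4592   ≡⟨ e₁ U (s ^ (7 * d) * k₀) ⟩
      U * 4592 + s ^ (7 * d) * k₀ * 9184    ∎)
      where
      open ≤-Reasoning
      e₀ : ∀ l s N x → 656 * (l * 7 * s * N) * x ≡ s * N * (l * x) * 4592
      e₀ = solve-∀
      e₁ : ∀ U x → (U + 2 * x) * 4592 ≡ U * 4592 + x * 9184
      e₁ = solve-∀
      sN≤q : s * N ≤ q
      sN≤q = *-monoˡ-≤ N s≤s²
      main : ∀ d → s * N * (λ₀ * s ^ (3 * d)) ≤ U + 2 * (s ^ (7 * d) * k₀)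
      main zero    = ≤-trans (≤-trans (*-mono-≤ sN≤q (≤-reflexive (*-identityʳ λ₀))) (≤-trans (≤-reflexive (*-comm q λ₀)) λq≤U)) (m≤m+n U _)
      main (suc d) = begin
        s * N * (λ₀ * X)                     ≤⟨ *-monoʳ-≤ (s * N) (product≤squares λ₀ X) ⟩
        s * N * (λ₀ * λ₀ + X * X)            ≡⟨ *-distribˡ-+ (s * N) (λ₀ * λ₀) (X * X) ⟩
        s * N * (λ₀ * λ₀) + s * N * (X * X)  ≤⟨ +-mono-≤ (≤-trans (*-monoˡ-≤ (λ₀ * λ₀) sN≤q) (≤-reflexive (*-comm q (λ₀ * λ₀)))) second ⟩
        U + 2 * (s ^ (7 * suc d) * k₀)       ∎
        where
        X = s ^ (3 * suc d)
        second : s * N * (X * X) ≤ 2 * (s ^ (7 * suc d) * k₀)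
        second = begin
          s * N * (X * X)                        ≤⟨ *-mono-≤ (*-mono-≤ (≤-trans (≤-reflexive (sym (*-identityʳ s))) (*-monoʳ-≤ s (^-pos s d 1≤s))) N≤2k₀) ≤-refl ⟩
          s ^ suc d * (2 * k₀) * (X * X)         ≡⟨ e₂ (s ^ suc d) k₀ (X * X) ⟩
          2 * (s ^ suc d * (X * X) * k₀)         ≡⟨ cong (λ u → 2 * (u * k₀)) (trans (cong (s ^ suc d *_) (sym (^-distribˡ-+-* s (3 * suc d) (3 * suc d)))) (trans (sym (^-distribˡ-+-* s (suc d) _)) (cong (s ^_) (e₃ d)))) ⟩
          2 * (s ^ (7 * suc d) * k₀)             ∎
          where e₂ : ∀ x k y → x * (2 * k) * y ≡ 2 * (x * y * k)
                e₂ = solve-∀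
                e₃ : ∀ d → suc d + (3 * suc d + 3 * suc d) ≡ 7 * suc d
                e₃ = solve-∀

    q≤2s²k₀ : q ≤ 2 * (s ^ 2 * k₀)
    q≤2s²k₀ = ≤-trans (*-monoʳ-≤ (s * s) N≤2k₀) (≤-reflexive (arith s k₀))
      where arith : ∀ s k → s * s * (2 * k) ≡ 2 * (s * (s * 1) * k)
            arith = solve-∀

    -- U is Õ(s²/ε).
    U-soft : ∀ g → s ^ 2 * k₀ ≤ g → U ≤ 8 * (g * suc ⌈log₂ g ⌉ ^ 2)
    U-soft g h = begin
      λ₀ * λ₀ * q              ≤⟨ *-mono-≤ (*-mono-≤ λ≤ λ≤) q≤ ⟩
      2 * ℓ * (2 * ℓ) * (2 * g) ≡⟨ arith ℓ g ⟩
      8 * (g * ℓ ^ 2)          ∎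
      where
      open ≤-Reasoning
      ℓ = suc ⌈log₂ g ⌉
      q≤ : q ≤ 2 * g
      q≤ = ≤-trans q≤2s²k₀ (*-monoʳ-≤ 2 h)
      1≤g : 1 ≤ g
      1≤g = ≤-trans (*-mono-≤ {1} {s ^ 2} (^-pos s 2 1≤s) 1≤k₀) h
      arith : ∀ l g → 2 * l * (2 * l) * (2 * g) ≡ 8 * (g * (l * (l * 1)))
      arith = solve-∀
      λ≤ : λ₀ ≤ 2 * ℓ
      λ≤ = begin
        λ₀                     ≡⟨ sym (⌈log₂2^n⌉≡n λ₀) ⟩
        ⌈log₂ P ⌉              ≤⟨ ⌈log₂⌉-mono-≤ (≤-trans P≤2q (*-monoʳ-≤ 2 q≤)) ⟩
        ⌈log₂ 2 * (2 * g) ⌉    ≡⟨ ⌈log₂2*n⌉≡1+⌈log₂n⌉ (2 * g) {{>-nonZero (≤-trans 1≤g (m≤n*m g 2))}} ⟩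
        suc ⌈log₂ 2 * g ⌉      ≡⟨ cong suc (⌈log₂2*n⌉≡1+⌈log₂n⌉ g {{>-nonZero 1≤g}}) ⟩
        suc ℓ                  ≤⟨ s≤s (m≤m+n ℓ _) ⟩
        suc (ℓ + ⌈log₂ g ⌉)    ≡⟨ trans (sym (+-suc ℓ ⌈log₂ g ⌉)) (cong (ℓ +_) (sym (+-identityʳ ℓ))) ⟩
        2 * ℓ                  ∎

    soft : ∀ C c g → s ^ 2 * k₀ ≤ g → 2 ≤ C → 8 * c ≤ C → c * U ≤ softO C g
    soft C c g h 2≤C le = begin
      c * U                              ≤⟨ *-monoʳ-≤ c (U-soft g h) ⟩
      c * (8 * (g * ℓ ^ 2))              ≡⟨ arith c (g * ℓ ^ 2) ⟩
      8 * c * (g * ℓ ^ 2)                ≤⟨ *-mono-≤ le (*-monoʳ-≤ g (^-monoʳ-≤ ℓ 2≤C)) ⟩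
      C * (g * ℓ ^ C)                    ∎
      where
      open ≤-Reasoning
      ℓ = suc ⌈log₂ g ⌉
      arith : ∀ c x → c * (8 * x) ≡ 8 * c * x
      arith = solve-∀

-- Query, time and word bounds

module ResourceBounds where

  open Compilation
  open RealOrder using (ι; ι-*; ι-≤; ι-pos)
  open OutputBounds using (module Bounds)
  open TesterCode
  open import Data.Integer as ℤ using (ℤ; +_; -[1+_])
  import Data.Integer.DivMod as ℤ-DivMod
  import Data.Integer.Properties as ℤₚ
  open import Data.Nat
  open import Data.Nat.Properties
  open import Data.Nat.Tactic.RingSolver using (solve-∀)
  open import Data.Rational as ℚ using (ℚ; mkℚ; 0ℚ; 1ℚ; Positive)
  import Data.Rational.Properties as ℚₚ
  import Data.Rational.Unnormalised as ℚᵘ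
  import Data.Rational.Unnormalised.Properties as ℚᵘₚ

  denominator*ε : ∀ ε .{{_ : Positive ε}} → ι (ℚ.↧ₙ ε) ℚ.* ε ≡ ι ℤ.∣ ℚ.↥ ε ∣
  denominator*ε ε@(mkℚ (+ a) b-1 _) = ℚₚ.toℚᵘ-injective (ℚᵘₚ.≃-trans (ℚₚ.toℚᵘ-homo-* (ι (suc b-1)) ε)
    (ℚᵘ.*≡* (trans (ℤₚ.*-identityʳ _) (trans (ℤₚ.*-comm (+ suc b-1) (+ a)) (cong (λ u → + a ℤ.* + u) (sym (*-identityˡ (suc b-1))))))))

  1≤numerator : ∀ ε .{{_ : Positive ε}} → 1 ≤ ℤ.∣ ℚ.↥ ε ∣
  1≤numerator (mkℚ (+ suc a) _ _) = s≤s z≤n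

  numerator<denominator : ∀ ε .{{_ : Positive ε}} → ε ℚ.< 1ℚ → ℤ.∣ ℚ.↥ ε ∣ < ℚ.↧ₙ ε
  numerator<denominator (mkℚ (+ a) b-1 _) (ℚ.*<* l) = ℤₚ.drop‿+<+ (subst₂ ℤ._<_ (ℤₚ.*-identityʳ (+ a)) (ℤₚ.*-identityˡ (+ suc b-1)) l)

  floor≤ : ∀ p → ℚ.floor p ℤ.* ℚ.↧ p ℤ.≤ ℚ.↥ p
  floor≤ p@(mkℚ i j _) = ℤ-DivMod.[n/d]*d≤n i (+ suc j)

  -- The ceiling is the negated floor of the negation, so the claim is turned into an upper bound on
  -- that floor.
  ≤ceiling : ∀ z p → ι z ℚ.≤ p → z ≤ ℤ.∣ ℚ.ceiling p ∣
  ≤ceiling z p@(mkℚ pn pd c) (ℚ.*≤* l) = magnitude (subst (ℤ._≤ ℚ.ceiling p) (ℤₚ.neg-involutive (+ z)) (ℤₚ.neg-mono-≤ below))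
    where
    magnitude : ∀ {i} → + z ℤ.≤ i → z ≤ ℤ.∣ i ∣
    magnitude (ℤ.+≤+ h) = h
    below : ℚ.floor (ℚ.- p) ℤ.≤ ℤ.- (+ z)
    below = ℤₚ.*-cancelʳ-≤-pos _ _ (ℚ.↧ (ℚ.- p)) (begin
      ℚ.floor (ℚ.- p) ℤ.* ℚ.↧ (ℚ.- p)     ≤⟨ floor≤ (ℚ.- p) ⟩
      ℚ.↥ (ℚ.- p)                         ≡⟨ ℚₚ.↥-neg p ⟩
      ℤ.- pn                              ≤⟨ ℤₚ.neg-mono-≤ (subst (+ z ℤ.* ℚ.↧ p ℤ.≤_) (ℤₚ.*-identityʳ pn) l) ⟩
      ℤ.- (+ z ℤ.* ℚ.↧ p)                 ≡⟨ ℤₚ.neg-distribˡ-* (+ z) (ℚ.↧ p) ⟩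
      ℤ.- (+ z) ℤ.* ℚ.↧ p                 ≡⟨ cong (ℤ.- (+ z) ℤ.*_) (sym (ℚₚ.↧-neg p)) ⟩
      ℤ.- (+ z) ℤ.* ℚ.↧ (ℚ.- p)           ∎)
      where open ℤₚ.≤-Reasoning

  ≤⌈÷⌉ : ∀ A k ε .{{_ : Positive ε}} → k * ℤ.∣ ℚ.↥ ε ∣ ≤ ℚ.↧ₙ ε → A * k ≤ ⌈ A ÷ ε ⌉
  ≤⌈÷⌉ A k ε h = ≤ceiling (A * k) p (ℚₚ.*-cancelʳ-≤-pos ε (ℚₚ.≤-trans scaled (ℚₚ.≤-reflexive (sym inverse))))
    where
    instance
      ε≢0 = ℚₚ.pos⇒nonZero ε
    a b : ℕ
    a = ℤ.∣ ℚ.↥ ε ∣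
    b = ℚ.↧ₙ ε
    p : ℚ
    p = (+ A ℚ./ 1) ℚ.* (ℚ.1/ ε)
    A/1 : + A ℚ./ 1 ≡ ι A
    A/1 = ℚₚ.↥p/↧p≡p (ι A)
    inverse : p ℚ.* ε ≡ ι A
    inverse = trans (ℚₚ.*-assoc (+ A ℚ./ 1) (ℚ.1/ ε) ε) (trans (cong ((+ A ℚ./ 1) ℚ.*_) (ℚₚ.*-inverseˡ ε)) (trans (ℚₚ.*-identityʳ _) A/1))
    scaled : ι (A * k) ℚ.* ε ℚ.≤ ι A
    scaled = ℚₚ.*-cancelˡ-≤-pos (ι b) {{ι-pos (s≤s z≤n)}} (begin
      ι b ℚ.* (ι (A * k) ℚ.* ε)      ≡⟨ trans (sym (ℚₚ.*-assoc (ι b) (ι (A * k)) ε)) (trans (cong (ℚ._* ε) (ℚₚ.*-comm (ι b) (ι (A * k)))) (ℚₚ.*-assoc (ι (A * k)) (ι b) ε)) ⟩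
      ι (A * k) ℚ.* (ι b ℚ.* ε)      ≡⟨ trans (cong (ι (A * k) ℚ.*_) (denominator*ε ε)) (sym (ι-* (A * k) a)) ⟩
      ι (A * k * a)                  ≤⟨ ι-≤ (≤-trans (≤-reflexive (*-assoc A k a)) (≤-trans (*-monoʳ-≤ A h) (≤-reflexive (*-comm A b)))) ⟩
      ι (b * A)                      ≡⟨ ι-* b A ⟩
      ι b ℚ.* ι A                    ∎)
      where open ℚₚ.≤-Reasoning

  abstract
    -- Eight times 833924, the largest coefficient of U, where the eight comes from `U-soft`. Sealed
    -- so that powers with exponent C are never evaluated.
    C : ℕ
    C = 6671392

    C-large : 6671392 ≤ C
    C-large = ≤-refl

  module _ {s a b : ℕ} (1≤s : 1 ≤ s) (0<a : 0 < a) (a<b : a < b) where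

    open Parameters s a b
    open ParameterEstimates.Bounds {s} {a} {b} 1≤s 0<a a<b
    open ≤-Reasoning

    private
      Rs : R * s ≤ U * 96
      Rs = ≤-trans (≤-reflexive (trans (cong (_* s) R≡) (arith λ₀ s))) (*-monoˡ-≤ 96 (≤-trans (*-monoʳ-≤ λ₀ s≤q) λq≤U))
        where arith : ∀ l s → l * 96 * s ≡ l * s * 96
              arith = solve-∀

      ms≤7U : m * s ≤ U * 7
      ms≤7U = ≤-trans (≤-reflexive (trans ms≡ (trans (*-assoc 7 λ₀ q) (*-comm 7 (λ₀ * q))))) (*-monoˡ-≤ 7 λq≤U)

      Rms : R * (m * s) ≤ U * 672
      Rms = ≤-reflexive (trans (cong₂ _*_ R≡ ms≡) (arith λ₀ q))
        where arith : ∀ l q → l * 96 * (7 * l * q) ≡ l * l * q * 672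
              arith = solve-∀

      1≤U : 1 ≤ U
      1≤U = ≤-trans 1≤q q≤U

      s≤U : s ≤ U
      s≤U = ≤-trans s≤q q≤U

      m≤7U : m ≤ U * 7
      m≤7U = ≤-trans (m≤m*n m s {{>-nonZero 1≤s}}) ms≤7U

    queries-≤ : s * (m * 2 + (R * 2 + R * 10)) + m * (s * (2 + R * 2)) ≤ U * 2524
    queries-≤ = begin
      s * (m * 2 + (R * 2 + R * 10)) + m * (s * (2 + R * 2))    ≡⟨ e₁ s m R ⟩
      m * s * 4 + R * s * 12 + R * (m * s) * 2                  ≤⟨ +-mono-≤ (+-mono-≤ (*-monoˡ-≤ 4 ms≤7U) (*-monoˡ-≤ 12 Rs)) (*-monoˡ-≤ 2 Rms) ⟩
      U * 7 * 4 + U * 96 * 12 + U * 672 * 2                     ≡⟨ e₂ U ⟩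
      U * 2524                                                  ∎
      where
      e₁ : ∀ s m R → s * (m * 2 + (R * 2 + R * 10)) + m * (s * (2 + R * 2)) ≡ m * s * 4 + R * s * 12 + R * (m * s) * 2
      e₁ = solve-∀
      e₂ : ∀ U → U * 7 * 4 + U * 96 * 12 + U * 672 * 2 ≡ U * 2524
      e₂ = solve-∀

    private
      fixed-≤ : 291 + q * 27 + s * 3 ≤ U * 321
      fixed-≤ = ≤-trans (+-mono-≤ (+-mono-≤ (≤-trans (≤-reflexive (sym (*-identityˡ 291))) (*-monoˡ-≤ 291 1≤U)) (*-monoˡ-≤ 27 q≤U)) (*-monoˡ-≤ 3 s≤U)) (≤-reflexive (e U))
        where e : ∀ U → U * 291 + U * 27 + U * 3 ≡ U * 321
              e = solve-∀

      per-vector-≤ : 3 + s * 19 + m * 6 + m * s * 27 + R * s * 63 + R * (m * s) * 13 ≤ U * 15037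
      per-vector-≤ = ≤-trans (+-mono-≤ (+-mono-≤ (+-mono-≤ (+-mono-≤ (+-mono-≤ (*-monoˡ-≤ 3 1≤U) (*-monoˡ-≤ 19 s≤U)) (*-monoˡ-≤ 6 m≤7U)) (*-monoˡ-≤ 27 ms≤7U)) (*-monoˡ-≤ 63 Rs)) (*-monoˡ-≤ 13 Rms)) (≤-reflexive (e U))
        where e : ∀ U → U * 3 + U * 19 + U * 7 * 6 + U * 7 * 27 + U * 96 * 63 + U * 672 * 13 ≡ U * 15037
              e = solve-∀

    time-≤ : ∀ V t → 1 ≤ V →
      3 + (5 + (72 + ((1 + q * 27) + (132 + ((1 + s * (3 + (3 + ((1 + m * 11) + (1 + (4 + ((1 + R * 12) + (5 + ((1 + R * 51) + 3))))))) * V)) +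
        (3 + (2 * V + ((1 + m * (1 + (3 + (1 + s * (16 + R * 13) + 1)))) * V + ((36 + (t + 22)) + (12 + 4)))))))))) ≤ U * V * 15358 + t
    time-≤ V t 1≤V = begin
      _ ≡⟨ e₁ q s m R V t ⟩
      291 + q * 27 + s * 3 + (3 + s * 19 + m * 6 + m * s * 27 + R * s * 63 + R * (m * s) * 13) * V + t
        ≤⟨ +-monoˡ-≤ t (+-mono-≤ (≤-trans fixed-≤ (*-monoˡ-≤ 321 (m≤m*n U V {{>-nonZero 1≤V}}))) (*-monoˡ-≤ V per-vector-≤)) ⟩
      U * V * 321 + U * 15037 * V + t      ≡⟨ cong (λ u → u + t) (e₂ U V) ⟩
      U * V * 15358 + t                    ∎
      where
      e₁ : ∀ q s m R V t →
        3 + (5 + (72 + ((1 + q * 27) + (132 + ((1 + s * (3 + (3 + ((1 + m * 11) + (1 + (4 + ((1 + R * 12) + (5 + ((1 + R * 51) + 3))))))) * V)) +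
        (3 + (2 * V + ((1 + m * (1 + (3 + (1 + s * (16 + R * 13) + 1)))) * V + ((36 + (t + 22)) + (12 + 4)))))))))) ≡
        291 + q * 27 + s * 3 + (3 + s * 19 + m * 6 + m * s * 27 + R * s * 63 + R * (m * s) * 13) * V + t
      e₁ = solve-∀
      e₂ : ∀ U V → U * V * 321 + U * 15037 * V ≡ U * V * 15358
      e₂ = solve-∀

    total-time-≤ : ∀ {n} d → 0 < n → U * (40 + n * 14) * 15358 + searchTime m (s ∸ 1) d 0 ≤ n * (U * 833924) + s ^ (7 * d) * k₀ * 9184
    total-time-≤ {n} d 0<n = begin
      U * (40 + n * 14) * 15358 + searchTime m (s ∸ 1) d 0
        ≤⟨ +-mono-≤ (*-monoˡ-≤ 15358 (*-monoʳ-≤ U (+-monoˡ-≤ (n * 14) (*-monoʳ-≤ 40 0<n)))) (search-time d) ⟩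
      U * (40 * n + n * 14) * 15358 + (U * 4592 + X * 9184)
        ≤⟨ +-monoʳ-≤ (U * (40 * n + n * 14) * 15358) (+-monoˡ-≤ (X * 9184) (*-monoˡ-≤ 4592 (m≤n*m U n {{>-nonZero 0<n}}))) ⟩
      U * (40 * n + n * 14) * 15358 + (n * U * 4592 + X * 9184)
        ≡⟨ e n U X ⟩
      n * (U * 833924) + X * 9184 ∎
      where
      X = s ^ (7 * d) * k₀
      e : ∀ n U X → U * (40 * n + n * 14) * 15358 + (n * U * 4592 + X * 9184) ≡ n * (U * 833924) + X * 9184
      e = solve-∀

    private
      soft≤ : ∀ c {g} → s ^ 2 * k₀ ≤ g → 8 * c ≤ 6671392 → U * c ≤ softO C g
      soft≤ c {g} l h = ≤-trans (≤-reflexive (*-comm U c)) (soft C c g l (≤-trans (m≤m+n 2 6671390) C-large) (≤-trans h C-large))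

    -- Constants stand on the right: a literal factor on the left would be unfolded.
    time-bound : ∀ {n g h V} d → 0 < n → V ≡ 40 + n * 14 → s ^ 2 * k₀ ≤ g → s ^ (7 * d) * k₀ ≤ h →
      3 + (5 + (72 + ((1 + q * 27) + (132 + ((1 + s * (3 + (3 + ((1 + m * 11) + (1 + (4 + ((1 + R * 12) + (5 + ((1 + R * 51) + 3))))))) * V)) +
        (3 + (2 * V + ((1 + m * (1 + (3 + (1 + s * (16 + R * 13) + 1)))) * V + ((36 + (searchTime m (s ∸ 1) d 0 + 22)) + (12 + 4)))))))))) ≤ C * h + n * softO C g
    time-bound {n} {g} {h} d 0<n refl l₁ l₂ = begin
      _                                                           ≤⟨ time-≤ (40 + n * 14) (searchTime m (s ∸ 1) d 0) (s≤s z≤n) ⟩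
      U * (40 + n * 14) * 15358 + searchTime m (s ∸ 1) d 0        ≤⟨ total-time-≤ {n} d 0<n ⟩
      n * (U * 833924) + s ^ (7 * d) * k₀ * 9184                  ≤⟨ +-mono-≤ (*-monoʳ-≤ n (soft≤ 833924 l₁ ≤-refl)) (*-mono-≤ l₂ (≤-trans (m≤m+n 9184 6662208) C-large)) ⟩
      n * softO C g + h * C                                       ≡⟨ trans (+-comm (n * softO C g) (h * C)) (cong (λ u → u + n * softO C g) (*-comm h C)) ⟩
      C * h + n * softO C g                                       ∎

    queries-bound : ∀ {g} → s ^ 2 * k₀ ≤ g → s * (m * 2 + (R * 2 + R * 10)) + m * (s * (2 + R * 2)) ≤ softO C g
    queries-bound {g} l = ≤-trans queries-≤ (soft≤ 2524 l (m≤m+n (8 * 2524) 6651200))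

    -- All numbers in memory are polynomial in K, a linear bound on the inputs.
    module Words (n d K : ℕ) (6≤K : 6 ≤ K) (w≤K : n + s + 4 ≤ K) (1+s≤K : 1 + s ≤ K) (1+b≤K : 1 + b ≤ K) where

      -- The computed quantities are at most K^8, the largest of them being m with at most K^7; one
      -- further factor K makes the bound strict.
      I : ℕ
      I = K ^ 9

      instance
        K≢0 : NonZero K
        K≢0 = >-nonZero (≤-trans (s≤s z≤n) 6≤K)

      <I : ∀ {x} i j → x ≤ K ^ i → i + j ≡ 8 → x < I
      <I {x} i j l e = ≤-<-trans (≤-trans l (^-monoʳ-≤ K {i} {8} (≤-trans (m≤m+n i j) (≤-reflexive e)))) (^-monoʳ-< K (≤-trans (s≤s (s≤s z≤n)) 6≤K) {8} {9} ≤-refl)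

      ≤K : ∀ {x} → x ≤ K → x ≤ K ^ 1
      ≤K l = ≤-trans l (≤-reflexive (sym (*-identityʳ K)))

      times : ∀ {x y} i j → x ≤ K ^ i → y ≤ K ^ j → x * y ≤ K ^ (i + j)
      times i j l h = ≤-trans (*-mono-≤ l h) (≤-reflexive (sym (^-distribˡ-+-* K i j)))

      s≤K : s ≤ K ^ 1
      s≤K = ≤K (≤-trans (n≤1+n s) 1+s≤K)

      N≤K : N ≤ K ^ 1
      N≤K = ≤K (≤-trans (s≤s k₀≤b) 1+b≤K)

      s²≤ : s * s ≤ K ^ 2
      s²≤ = times 1 1 s≤K s≤K

      q≤ : q ≤ K ^ 3
      q≤ = times 2 1 s²≤ N≤K

      λ≤ : λ₀ ≤ K ^ 3
      λ≤ = ≤-trans (bits≤q) q≤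
        where bits≤q = ParameterEstimates.bits≤ q q

      R≤ : R ≤ K ^ 6
      R≤ = ≤-trans (≤-reflexive R≡) (times 3 3 λ≤ (≤-trans (m≤m+n 96 120) (^-monoˡ-≤ 3 6≤K)))

      7≤K² : 7 ≤ K ^ 2
      7≤K² = ≤-trans (m≤m+n 7 29) (^-monoˡ-≤ 2 6≤K)

      λ7s≤ : λ₀ * 7 * s ≤ K ^ 6
      λ7s≤ = times 5 1 (times 3 2 λ≤ 7≤K²) s≤K

      m≤ : m ≤ K ^ 7
      m≤ = times 6 1 λ7s≤ N≤K

      2s≤ : suc s + suc s ≤ K ^ 2
      2s≤ = ≤-trans (≤-reflexive (cong (λ u → suc s + u) (sym (+-identityʳ (suc s))))) (times 1 1 (≤K (≤-trans (s≤s (s≤s z≤n)) 6≤K)) (≤K 1+s≤K))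

      ^≤W : ∀ i j → i + j ≡ 6671392 → K ^ i ≤ K ^ C
      ^≤W i j e = ^-monoʳ-≤ K (≤-trans (≤-trans (m≤m+n i j) (≤-reflexive e)) C-large)

      64<W : 64 < K ^ C
      64<W = ≤-trans (≤-trans (m≤m+n 65 151) (^-monoˡ-≤ 3 6≤K)) (^≤W 3 6671389 refl)

      space : 64 + 18 * I * (n + s + 4) ≤ K ^ C
      space = begin
        64 + 18 * I * (n + s + 4)   ≤⟨ +-mono-≤ (≤-trans (≤-trans (m≤m+n 64 152) (^-monoˡ-≤ 3 6≤K)) (^-monoʳ-≤ K {3} {12} (m≤m+n 3 9))) (times 11 1 (times 2 9 (≤-trans (m≤m+n 18 18) (^-monoˡ-≤ 2 6≤K)) ≤-refl) (≤K w≤K)) ⟩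
        K ^ 12 + K ^ 12             ≡⟨ cong (λ u → K ^ 12 + u) (sym (+-identityʳ (K ^ 12))) ⟩
        2 * K ^ 12                  ≤⟨ *-monoˡ-≤ (K ^ 12) (≤-trans (s≤s (s≤s z≤n)) 6≤K) ⟩
        K ^ 13                      ≤⟨ ^≤W 13 6671379 refl ⟩
        K ^ C                       ∎

-- Assembling the program, the probabilities and the resource bounds

module Conclusion where

  open Compilation
  open RealOrder using (≋⇒≤; ≤ℝ-trans)
  open OutputBounds using (two-thirds; module Bounds)
  open SoundnessProof using (module Soundness)
  open CompletenessProof using (module Completeness)
  open TesterCode
  open ResourceBounds
  open TesterAlgorithm using (module Tester)
  open import Data.Bool.Properties using (xor-same)
  open import Data.Integer as ℤ using (+_)
  open import Data.Nat
  open import Data.Nat.Properties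
  open import Data.Nat.Tactic.RingSolver using (solve-∀)
  open import Data.Rational as ℚ using (ℚ; 0ℚ; 1ℚ; Positive)
  import Data.Rational.Properties as ℚₚ

  module Correctness (s d : ℕ) (ε : ℚ) .{{ε⁺ : Positive ε}} (1≤s : 1 ≤ s) (ε<1 : ε ℚ.< 1ℚ) where

    a b : ℕ
    a = ℤ.∣ ℚ.↥ ε ∣
    b = ℚ.↧ₙ ε

    0<a : 0 < a
    0<a = 1≤numerator ε

    a<b : a < b
    a<b = numerator<denominator ε ε<1

    open Parameters s a b
    module B = ParameterEstimates.Bounds {s} {a} {b} 1≤s 0<a a<b

    private
      s^-mono : ∀ {i j} → i ≤ j → s ^ i ≤ s ^ j
      s^-mono = ^-monoʳ-≤ s {{>-nonZero 1≤s}}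

      7≤C : 7 ≤ C
      7≤C = ≤-trans (m≤m+n 7 6671385) C-large

    search≤ : s ^ (7 * d) * B.k₀ ≤ ⌈ s ^ (C * d) ÷ ε ⌉
    search≤ = ≤-trans (*-monoˡ-≤ B.k₀ (s^-mono (*-monoˡ-≤ d 7≤C))) (≤⌈÷⌉ (s ^ (C * d)) B.k₀ ε B.k₀a≤b)

    dominated : s ^ 2 * B.k₀ ≤ ⌈ s ^ 2 ÷ ε ⌉
    dominated = ≤⌈÷⌉ (s ^ 2) B.k₀ ε B.k₀a≤b

    private
      positive-time : ∀ n → 4 ≤ timeBound C n s d ε
      positive-time n = ≤-trans (≤-trans (m≤m+n 4 3) 7≤C)
        (≤-trans (m≤m*n C ⌈ s ^ (C * d) ÷ ε ⌉ {{>-nonZero (≤-trans (*-mono-≤ (ParameterEstimates.^-pos s (7 * d) 1≤s) B.1≤k₀) search≤)}}) (m≤m+n _ _))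

    module _ (n K : ℕ) (6≤K : 6 ≤ K) (w≤K : n + s + 4 ≤ K) (1+s≤K : 1 + s ≤ K) (1+b≤K : 1 + b ≤ K) (d≤K : d ≤ K) (0<n : 0 < n) (f : BoolFun n) where

      open Simulation f (K ^ C)

      private
        open Words 1≤s 0<a a<b n d K 6≤K w≤K 1+s≤K 1+b≤K

        module WP = WholeProgram f s d a b (K ^ C) I 0<n 1≤s 64<W space
          (<I 1 7 (≤K w≤K) refl) (<I 1 7 (≤K d≤K) refl) (<I 2 6 2s≤ refl)
          (<I 1 7 (≤K (≤-trans (<⇒≤ a<b) (≤-trans (n≤1+n b) 1+b≤K))) refl) (<I 1 7 (≤K (≤-trans (n≤1+n b) 1+b≤K)) refl)
          (<I 1 7 N≤K refl) (<I 2 6 s²≤ refl) (<I 3 5 q≤ refl) (<I 6 2 R≤ refl) (<I 6 2 λ7s≤ refl) (<I 7 1 m≤ refl)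

        time≤ : WP.wholeTime ≤ timeBound C n s d ε
        time≤ = time-bound 1≤s 0<a a<b d 0<n WP.V-def dominated search≤

        queries≤ : WP.mainQueries ≤ queryBound C s ε
        queries≤ = queries-bound 1≤s 0<a a<b dominated

      run-tester : ∀ {M} → M 0 ≡ n → M 1 ≡ s → M 2 ≡ d → M 3 ≡ a → M 4 ≡ b → (∀ c → 5 ≤ c → M c ≡ 0) → Bnd M →
                   Sim (compile testerCode 0) (timeBound C n s d ε) (queryBound C s ε) ⟨ 0 , M ⟩ (Tester.tester f s d m R)
      run-tester e₀ e₁ e₂ e₃ e₄ e₅ bnd = sim-weaken time≤ queries≤ (sim-program testerCode bnd (WP.whole-frag e₀ e₁ e₂ e₃ e₄ e₅))

    module _ (n : ℕ) where

      K : ℕ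
      K = 2 + n + s + d + b

      n≤K : n ≤ K
      n≤K = ≤-trans (≤-trans (m≤n+m n 2) (m≤m+n (2 + n) s)) (≤-trans (m≤m+n _ d) (m≤m+n _ b))

      1+s≤K : 1 + s ≤ K
      1+s≤K = ≤-trans (+-mono-≤ {1} {2 + n} (s≤s z≤n) (≤-refl {s})) (≤-trans (m≤m+n (2 + n + s) d) (m≤m+n _ b))

      d≤K : d ≤ K
      d≤K = ≤-trans (m≤n+m d (2 + n + s)) (m≤m+n _ b)

      1+b≤K : 1 + b ≤ K
      1+b≤K = +-monoˡ-≤ b {1} {2 + n + s + d} (s≤s z≤n)

      w≤K : n + s + 4 ≤ K
      w≤K = ≤-trans (+-monoʳ-≤ (n + s) (+-monoʳ-≤ 2 (≤-trans (s≤s 0<a) a<b))) (≤-trans (m≤m+n _ d) (≤-reflexive (arith n s d b)))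
        where arith : ∀ n s d b → n + s + (2 + b) + d ≡ 2 + n + s + d + b
              arith = solve-∀

      small : ∀ {x} → x ≤ K → x < wordBound C n s d ε
      small l = ≤-<-trans l (<-≤-trans (subst (_< K ^ 2) (*-identityʳ K) (^-monoʳ-< K (s≤s (s≤s z≤n)) {1} {2} ≤-refl)) (^-monoʳ-≤ K {2} (≤-trans (m≤m+n 2 5) 7≤C)))

      initial-small : ∀ c → mem (initial n s d ε) c < wordBound C n s d ε
      initial-small 0 = small n≤K
      initial-small 1 = small (≤-trans (n≤1+n s) 1+s≤K)
      initial-small 2 = small d≤K
      initial-small 3 = small (≤-trans (<⇒≤ a<b) (≤-trans (n≤1+n b) 1+b≤K))
      initial-small 4 = small (≤-trans (n≤1+n b) 1+b≤K)
      initial-small (suc (suc (suc (suc (suc _))))) = small z≤n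

      module _ (f : BoolFun n) where

        open Simulation f (wordBound C n s d ε)

        Correct : Comp n → Set
        Correct c = Sim (compile testerCode 0) (timeBound C n s d ε) (queryBound C s ε) (initial n s d ε) c
          × (∀ D → (DT d s f → fromℚ (+ 2 ℚ./ 3) ≤ℝ E D true c)
                 × ((∀ g → DT d s g → Far ε D f g) → fromℚ (+ 2 ℚ./ 3) ≤ℝ E D false c))

    -- Without variables f is constant and equals a single leaf, so acceptance is right. The
    -- hypothesis of the rejecting case is contradictory, as it would make f far from itself.
    no-variables : ∀ f → Correct 0 f (ret true)
    no-variables f = sim-weaken (positive-time 0) z≤n
        (sim-program testerCode {F = λ _ → ret true} (initial-small 0) (m-ifz (λ x M ()) (λ _ → m-halt {t = 0}) (λ h → ⊥-elim (h refl))))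
      , λ D → (λ _ → two-thirds D true (ret true) (Bounds.bd-ret D false refl))
            , (λ far → ⊥-elim (not-far D (far f (leaf (f []) , z≤n , 1≤s , λ { [] → refl }))))
      where
      open Simulation f (wordBound C 0 s d ε)
      not-far : ∀ D → Far ε D f f → ⊥
      not-far D (δ , 0<δ , M , h) = ℚₚ.<-irrefl refl (ℚₚ.<-≤-trans (ℚₚ.+-mono-< (ℚₚ.positive⁻¹ ε) 0<δ) (subst (ε ℚ.+ δ ℚ.≤_) zero-distance (h M ≤-refl)))
        where
        zero-distance : seq (Pr[ f ≠ f ] D) M ≡ 0ℚ
        zero-distance = cong (λ r → seq (if r then weight D [] else 0ℝ) M) (xor-same (f []))

    some-variables : ∀ n → 0 < n → ∀ f → Correct n f (Tester.tester f s d m R)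
    some-variables n 0<n f = run-tester n (K n) 6≤K (w≤K n) (1+s≤K n) (1+b≤K n) (d≤K n) 0<n f refl refl refl refl refl beyond (initial-small n)
      , λ D → (λ { (t , p , q , e) → two-thirds D true _ (Bounds.bd-conv D false {3 * s} {3} 0<3s (≤-reflexive (arith₁ s))
                    (Completeness.tester-bound f s d m R D t p q e (3 * s) 0<3s B.search-small)) })
            , (λ far → two-thirds D false _ (Bounds.bd-conv D true {B.Q} {3} 0<Q (≤-reflexive (arith₂ s (m * s)))
                    (Soundness.tester-bound f s d m R D ε a b (<⇒≤ a<b) (≤-trans 0<a (<⇒≤ a<b)) (denominator*ε ε) far B.Q (m * s) (m * s)
                       B.eval-small B.literal-small B.trees-small)))
      where
      open Simulation f (wordBound C n s d ε)

      0<3s : 0 < 3 * s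
      0<3s = *-mono-≤ {1} {3} (s≤s z≤n) 1≤s

      0<Q : 0 < B.Q
      0<Q = *-mono-≤ {1} {9 * s} (*-mono-≤ {1} {9} (s≤s z≤n) 1≤s) B.1≤ms

      arith₁ : ∀ s → 3 * (s * 1) ≡ 1 * (3 * s)
      arith₁ = solve-∀

      arith₂ : ∀ s x → 3 * (s * (x + x + x)) ≡ 1 * (9 * s * x)
      arith₂ = solve-∀

      beyond : ∀ c → 5 ≤ c → mem (initial n s d ε) c ≡ 0
      beyond _ (s≤s (s≤s (s≤s (s≤s (s≤s _))))) = refl

      6≤K : 6 ≤ K n
      6≤K = ≤-trans (+-monoˡ-≤ 4 (+-mono-≤ 0<n 1≤s)) (w≤K n)

    correct : ∀ n f → Σ (Comp n) (Correct n f)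
    correct zero    f = _ , no-variables f
    correct (suc n) f = _ , some-variables (suc n) (s≤s z≤n) f

  -- Carries the bounds for the computation tree over to the machine, whose output probabilities
  -- within the time bound have the same approximating sequences.
  realise : ∀ {n s d ε} {f : BoolFun n} {W t q P c m} → Simulation.Sim f W P t q c m →
    (∀ D → (DT d s f → fromℚ (+ 2 ℚ./ 3) ≤ℝ E D true m) × ((∀ g → DT d s g → Far ε D f g) → fromℚ (+ 2 ℚ./ 3) ≤ℝ E D false m)) →
    Runs P f W t q c ×
    (∀ D → (DT d s f → fromℚ (+ 2 ℚ./ 3) ≤ℝ Pr-output P f D true t c) × ((∀ g → DT d s g → Far ε D f g) → fromℚ (+ 2 ℚ./ 3) ≤ℝ Pr-output P f D false t c))
  realise {f = f} {W} {t} {P = P} {c} {m} sim prob = S.runs sim , λ D →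
      (λ accepting → transfer D true (proj₁ (prob D) accepting)) , (λ rejecting → transfer D false (proj₂ (prob D) rejecting))
    where
    module S = Simulation f W
    transfer : ∀ D r → fromℚ (+ 2 ℚ./ 3) ≤ℝ E D r m → fromℚ (+ 2 ℚ./ 3) ≤ℝ Pr-output P f D r t c
    transfer D r h = ≤ℝ-trans {fromℚ (+ 2 ℚ./ 3)} {E D r m} {Pr-output P f D r t c} h
      (≋⇒≤ {E D r m} {Pr-output P f D r t c} (λ k → sym (S.out sim D r ≤-refl k)))

open import Data.Nat using (ℕ; _≤_)
open import Data.Rational using (ℚ; 1ℚ; Positive; _<_; _/_)
open import Data.Integer using (+_)
open Compilation using (compile)
open TesterCode using (testerCode)
open ResourceBounds using (C)
open Conclusion using (realise; module Correctness)

mainTheorem11 : Σ Program λ P → Σ ℕ λ C →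
    ∀ (n s d : ℕ) (ε : ℚ) .{{_ : Positive ε}} → 1 ≤ s → ε < 1ℚ →
    ∀ (f : BoolFun n) →
    Runs P f (wordBound C n s d ε) (timeBound C n s d ε) (queryBound C s ε)
    (initial n s d ε)
    × (∀ (D : Distribution n) →
    (DT d s f →
    fromℚ (+ 2 / 3)
    ≤ℝ Pr-output P f D true (timeBound C n s d ε) (initial n s d ε))
    × ((∀ (g : BoolFun n) → DT d s g → Far ε D f g) →
    fromℚ (+ 2 / 3)
    ≤ℝ Pr-output P f D false (timeBound C n s d ε) (initial n s d ε)))
mainTheorem11 = compile testerCode 0 , C , λ n s d ε 1≤s ε<1 f →
  realise {ε = ε} {W = wordBound C n s d ε} (proj₁ (proj₂ (Correctness.correct s d ε 1≤s ε<1 n f))) (proj₂ (proj₂ (Correctness.correct s d ε 1≤s ε<1 n f)))
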